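{- $G\in\mathcal{B}_3$ if and only if $G\cong P_5$ or $G\cong P_5\times\mathbb{Z}_2$ or $G\cong D_{10}$, where $P_5$ is a $5$-group of exponent $5$.
   Context: All groups are finite, and $G$ denotes a group. For a group $G$ and a subset $S\subseteq G$ with $1_G\notin S=S^{ -1}$, $\mathrm{Cay}(G,S)$ is the undirected graph with vertex set $G$ in which $g,h$ are adjacent if and only if $hg^{ -1}\in S$. A graph $\Gamma$ is $2$-integral if $[\mathbb{SF}(\Gamma):\mathbb{Q}]=2$, where $\mathbb{SF}(\Gamma)$ is the smallest field extension of $\mathbb{Q}$ containing all eigenvalues of the adjacency matrix of $\Gamma$. For an integer $k\geq 2$, $\mathcal{B}_k$ is the set of all groups $G$ such that $\mathrm{Cay}(G,S)$ is $2$-integral whenever $S\subset G$ satisfies $1_G\notin S=S^{ -1}$ and $2\leq|S|\leq k$. $\mathbb{Z}_2$ is the cyclic group of order $2$ and $D_{10}$ is the dihedral group of order $10$.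
   Formalization: "Exponent 5" is read as x^5 = 1 for all x, so P_5 may be trivial: the trivial group and Z_2 lie in B_3 vacuously (no S with |S| ≥ 2) and would contradict the claim if the exponent had to be exactly 5. -}

module Defs where

open import Algebra.Apartness.Bundles using (HeytingField)
open import Algebra.Bundles using (Group; CommutativeRing; Semiring)
import Algebra.Construct.DirectProduct as DirectProduct
import Algebra.Definitions.RawMonoid as RawMonoidDefs
import Algebra.Definitions.RawSemiring as RawSemiringDefs
open import Algebra.Morphism.Structures
  using (module GroupMorphisms; module RingMorphisms)
import Algebra.Properties.Group as GroupProperties
open import Algebra.Structures using (IsGroup)
open import Data.Bool.Base using (if_then_else_)
open import Data.Fin.Base using (Fin; zero; toℕ)
import Data.Fin.Properties as Fin
open import Data.Fin.Subset using (Subset; _∈_; ∣_∣)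
open import Data.Fin.Subset.Properties using (_∈?_)
open import Data.Nat.Base as ℕ using (ℕ; suc; _∸_; _≤_)
open import Data.Nat.DivMod using (_mod_)
open import Data.Parity.Base using (Parity; 0ℙ; 1ℙ) renaming (_+_ to _+ℙ_)
import Data.Parity.Properties as Parity
open import Data.Product.Base using (_×_; _,_; proj₁; proj₂; ∃-syntax; Σ-syntax)
open import Data.Product.Properties using (≡-dec)
open import Data.Rational.Base as ℚ using (ℚ; 0ℚ)
open import Data.Vec.Functional using (Vector)
open import Function.Bundles using (Inverse; _⇔_; Equivalence)
open import Level using (Level; _⊔_; 0ℓ) renaming (suc to lsuc)
open import Relation.Binary.Bundles using (Setoid)
open import Relation.Binary.Core using (Rel)
open import Relation.Binary.Definitions
  using (Decidable; Irreflexive; Symmetric; _Respects₂_)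
open import Relation.Binary.PropositionalEquality as ≡ using (_≡_)
open import Relation.Binary.PropositionalEquality.Algebra using (isMagma)
open import Relation.Nullary.Decidable using (Dec; does; map′; toWitness; _×-dec_)
open import Relation.Nullary.Negation using (¬_)
open import Relation.Unary using (Pred)

private
  variable
    a b c ℓ ℓ₁ ℓ₂ p v e : Level

record Finite (A : Setoid a ℓ) : Set (a ⊔ ℓ) where
  field
    size        : ℕ
    enumeration : Inverse A (≡.setoid (Fin size))

  open Inverse enumeration public
    using () renaming (to to index; from to element; to-cong to index-cong)

------------------------------------------------------------------------
-- Groups

record FiniteGroup a ℓ : Set (lsuc (a ⊔ ℓ)) where
  field
    group  : Group a ℓ
    finite : Finite (Group.setoid group)

  open Group group public
  open Finite finite public renaming (size to order)

  infix 4 _∈ᴳ_ _∈ᴳ?_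

  -- Subsets of the group are given through the enumeration of its elements,
  -- so that ∣ S ∣ is the library's cardinality.
  _∈ᴳ_ : Carrier → Subset order → Set
  g ∈ᴳ S = index g ∈ S

  _∈ᴳ?_ : ∀ g S → Dec (g ∈ᴳ S)
  g ∈ᴳ? S = index g ∈? S

  ∈ᴳ-resp-≈ : ∀ S {g h} → g ≈ h → g ∈ᴳ S → h ∈ᴳ S
  ∈ᴳ-resp-≈ S g≈h = ≡.subst (_∈ S) (index-cong g≈h)

infix 4 _≅_
_≅_ : Group a ℓ₁ → Group b ℓ₂ → Set (a ⊔ b ⊔ ℓ₁ ⊔ ℓ₂)
G ≅ H = ∃[ f ] IsGroupIsomorphism f
  where open GroupMorphisms (Group.rawGroup G) (Group.rawGroup H)

IsPGroup : ℕ → FiniteGroup a ℓ → Set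
IsPGroup q G = ∃[ m ] FiniteGroup.order G ≡ q ℕ.^ m

-- "Exponent n" in the sense of the identity xⁿ = 1, so that the trivial group
-- has exponent 5.  This matters: the trivial group and ℤ₂ have no inverse-closed
-- subset S with 1 ∉ S and 2 ≤ |S|, hence belong to every 𝓑 k, and they are
-- P and P × ℤ₂ for P trivial.
HasExponent : ℕ → FiniteGroup a ℓ → Set (a ⊔ ℓ)
HasExponent n G = ∀ x → power n x ≈ ε
  where
  open FiniteGroup G
  open RawMonoidDefs rawMonoid renaming (_×_ to power)

infixr 7 _×ᴳ_
_×ᴳ_ : Group a ℓ₁ → Group b ℓ₂ → Group (a ⊔ b) (ℓ₁ ⊔ ℓ₂)
_×ᴳ_ = DirectProduct.group

ℤ₂ : Group 0ℓ 0ℓ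
ℤ₂ = Parity.+-0-group

-- The pair (i , s) stands for rⁱ fˢ, where r⁵ = f² = 1 and f r f⁻¹ = r⁻¹.
module D₁₀ where

  Carrier : Set
  Carrier = Fin 5 × Parity

  _+₅_ : Fin 5 → Fin 5 → Fin 5
  i +₅ j = (toℕ i ℕ.+ toℕ j) mod 5

  -₅_ : Fin 5 → Fin 5
  -₅ i = (5 ∸ toℕ i) mod 5

  act : Parity → Fin 5 → Fin 5
  act 0ℙ i = i
  act 1ℙ i = -₅ i

  _∙_ : Carrier → Carrier → Carrier
  (i , s) ∙ (j , t) = i +₅ act s j , s +ℙ t

  ε : Carrier
  ε = zero , 0ℙ

  _⁻¹ : Carrier → Carrier
  (i , s) ⁻¹ = act s (-₅ i) , s

  private
    all? : ∀ {P : Carrier → Set} → (∀ x → Dec (P x)) → Dec (∀ x → P x)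
    all? P? = map′
      (λ h → λ { (i , 0ℙ) → proj₁ (h i) ; (i , 1ℙ) → proj₂ (h i) })
      (λ h i → h (i , 0ℙ) , h (i , 1ℙ))
      (Fin.all? (λ i → P? (i , 0ℙ) ×-dec P? (i , 1ℙ)))

    _≟_ : ∀ (x y : Carrier) → Dec (x ≡ y)
    _≟_ = ≡-dec Fin._≟_ Parity._≟_

  abstract
    isGroup : IsGroup _≡_ _∙_ ε _⁻¹
    isGroup = record
      { isMonoid = record
        { isSemigroup = record
          { isMagma = isMagma _∙_
          ; assoc   = toWitness {a? = all? λ x → all? λ y → all? λ z →
                        ((x ∙ y) ∙ z) ≟ (x ∙ (y ∙ z))} _
          }
        ; identity = toWitness {a? = all? λ x → (ε ∙ x) ≟ x} _
                   , toWitness {a? = all? λ x → (x ∙ ε) ≟ x} _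
        }
      ; inverse = toWitness {a? = all? λ x → ((x ⁻¹) ∙ x) ≟ ε} _
                , toWitness {a? = all? λ x → (x ∙ (x ⁻¹)) ≟ ε} _
      ; ⁻¹-cong = ≡.cong _⁻¹
      }

D₁₀ : Group 0ℓ 0ℓ
D₁₀ = record { isGroup = D₁₀.isGroup }

------------------------------------------------------------------------
-- Cayley graphs

record Graph v ℓ e : Set (lsuc (v ⊔ ℓ ⊔ e)) where
  infix 4 _∼_
  field
    vertices : Setoid v ℓ
    finite   : Finite vertices

  open Setoid vertices public using (_≈_) renaming (Carrier to Vertex)
  open Finite finite public

  field
    _∼_      : Rel Vertex e
    ∼-resp-≈ : _∼_ Respects₂ _≈_
    ∼-irrefl : Irreflexive _≈_ _∼_
    ∼-sym    : Symmetric _∼_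
    _∼?_     : Decidable _∼_

module _ (G : FiniteGroup a ℓ) where
  open FiniteGroup G
  open GroupProperties group using (⁻¹-anti-homo-∙; ⁻¹-involutive)

  record IsConnectionSet (S : Subset order) : Set (a ⊔ ℓ) where
    field
      ε∉S   : ¬ ε ∈ᴳ S
      S≡S⁻¹ : ∀ g → g ∈ᴳ S ⇔ g ⁻¹ ∈ᴳ S

  Cay : (S : Subset order) → IsConnectionSet S → Graph a ℓ 0ℓ
  Cay S conn = record
    { vertices = setoid
    ; finite   = finite
    ; _∼_      = λ g h → h ∙ g ⁻¹ ∈ᴳ S
    ; ∼-resp-≈ = (λ h≈k → ∈ᴳ-resp-≈ S (∙-congʳ h≈k))
               , (λ g≈k → ∈ᴳ-resp-≈ S (∙-congˡ (⁻¹-cong g≈k)))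
    ; ∼-irrefl = λ {g} {h} g≈h h∙g⁻¹∈S → ε∉S
        (∈ᴳ-resp-≈ S (trans (∙-congʳ (sym g≈h)) (inverseʳ g)) h∙g⁻¹∈S)
    ; ∼-sym    = λ {g} {h} h∙g⁻¹∈S →
        ∈ᴳ-resp-≈ S
          (trans (⁻¹-anti-homo-∙ h (g ⁻¹)) (∙-congʳ (⁻¹-involutive g)))
          (Equivalence.to (S≡S⁻¹ (h ∙ g ⁻¹)) h∙g⁻¹∈S)
    ; _∼?_     = λ g h → (h ∙ g ⁻¹) ∈ᴳ? S
    }
    where open IsConnectionSet conn

------------------------------------------------------------------------
-- The field in which eigenvalues live

-- An algebraically closed field of characteristic 0, abstracting ℂ, which the
-- library lacks.  The homomorphism ι is unique, and it exists exactly when the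
-- characteristic is 0.  As usual constructively, x # 0# expresses that x is
-- nonzero; classically it is the negation of x ≈ 0#.
record AlgebraicallyClosedField c ℓ₁ ℓ₂ : Set (lsuc (c ⊔ ℓ₁ ⊔ ℓ₂)) where
  field
    heytingField : HeytingField c ℓ₁ ℓ₂

  open HeytingField heytingField public

  commutativeRing : CommutativeRing c ℓ₁
  commutativeRing = record { isCommutativeRing = isCommutativeRing }

  open CommutativeRing commutativeRing using (rawRing; semiring)
  open RawSemiringDefs (Semiring.rawSemiring semiring) public using (sum; _^_)
  open RingMorphisms ℚ.+-*-rawRing rawRing using (IsRingHomomorphism)

  field
    ι                  : ℚ → Carrier
    isRingHomomorphism : IsRingHomomorphism ι
    hasRoot            : ∀ n (coeff : Vector Carrier (suc n)) →
      ∃[ x ] x ^ suc n + sum (λ i → coeff i * x ^ toℕ i) ≈ 0#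

module _ (Ω : AlgebraicallyClosedField c ℓ₁ ℓ₂) where
  open AlgebraicallyClosedField Ω

  -- The smallest subfield of Ω containing X.
  data Generated (X : Pred Carrier p) : Pred Carrier (c ⊔ ℓ₁ ⊔ p) where
    gen  : ∀ {x} → X x → Generated X x
    resp : ∀ {x y} → x ≈ y → Generated X x → Generated X y
    0∈   : Generated X 0#
    1∈   : Generated X 1#
    +∈   : ∀ {x y} → Generated X x → Generated X y → Generated X (x + y)
    -∈   : ∀ {x} → Generated X x → Generated X (- x)
    *∈   : ∀ {x y} → Generated X x → Generated X y → Generated X (x * y)
    ⁻¹∈  : ∀ {x y} → x * y ≈ 1# → Generated X x → Generated X y

  -- [ F : ℚ ] = d: a basis of F with d elements over ℚ.
  record HasDegree (F : Pred Carrier p) (d : ℕ) : Set (c ⊔ ℓ₁ ⊔ p) where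
    field
      basis       : Vector Carrier d
      basis∈F     : ∀ i → F (basis i)
      spanning    : ∀ {x} → F x →
        Σ[ q ∈ Vector ℚ d ] x ≈ sum (λ i → ι (q i) * basis i)
      independent : ∀ (q : Vector ℚ d) → sum (λ i → ι (q i) * basis i) ≈ 0# →
        ∀ i → q i ≡ 0ℚ

  module _ (Γ : Graph v ℓ e) where
    open Graph Γ using (size; element; _∼?_)

    adjacencyMatrix : Fin size → Fin size → Carrier
    adjacencyMatrix i j = if does (element i ∼? element j) then 1# else 0#

    IsEigenvalue : Pred Carrier (c ⊔ ℓ₁ ⊔ ℓ₂)
    IsEigenvalue μ = Σ[ x ∈ Vector Carrier size ] (∃[ i ] x i # 0#) ×
      (∀ i → sum (λ j → adjacencyMatrix i j * x j) ≈ μ * x i)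

    SF : Pred Carrier (c ⊔ ℓ₁ ⊔ ℓ₂)
    SF = Generated IsEigenvalue

    Is2Integral : Set (c ⊔ ℓ₁ ⊔ ℓ₂)
    Is2Integral = HasDegree SF 2

  𝓑 : ℕ → FiniteGroup a ℓ → Set (c ⊔ ℓ₁ ⊔ ℓ₂ ⊔ a ⊔ ℓ)
  𝓑 k G = ∀ S (conn : IsConnectionSet G S) → 2 ≤ ∣ S ∣ → ∣ S ∣ ≤ k →
    Is2Integral (Cay G S conn)

{-# OPTIONS --safe #-}
module Submission where

-- Suppose G ∈ 𝓑 3.  The graphs for {x, x⁻¹} with x of order 3 or 4, and for two
-- commuting involutions, have rational spectrum, hence degree 1, so neither exists
-- in G.  If x has order n, then 2cos(2π/n) is an eigenvalue for {x, x⁻¹}.  Were it in a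
-- quadratic field for a prime n ≥ 7 or n = 25, the coordinates of 2cos(2πk/n) would be
-- rational sequences in k that satisfy a quadratic recurrence in s + s⁻¹, s the
-- shift, and are annihilated by a cyclotomic polynomial, modulo p a power of s − 1;
-- a p-adic descent shows that such sequences vanish.  So x¹⁰ = 1 for all x.
--
-- If G has an involution a, the sign of translation by g, acting on the pairs
-- {h, ha}, is a homomorphism whose kernel P has exponent 5 and omits a.  If a is
-- central, G = P × ⟨a⟩.  Otherwise a inverts some x of order 5.  If a commutes with
-- some y ≠ 1 in P, then counting involutions modulo 5 one may assume that x commutes
-- with y, and for u = xy the set {u, u⁻¹, a} has an eigenvalue μ with
-- (μ − 2)(μ − φ) = 1, φ² + φ = 1, so that 9 − 5φ is a square in ℚ(√5).  If there is
-- no such y, then a inverts P, which is abelian, and if y ∈ P lies outside ⟨x⟩ the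
-- set {a, ax, ay} has the eigenvalue √(5 + 2φ).  The norms 101 and 11 of 9 − 5φ and
-- 5 + 2φ are not squares, so P = ⟨x⟩ and G is D₁₀.  In all cases |P| is a power of 5
-- by McKay's count of the solutions of g^q = 1.
--
-- Conversely, each connection set commutes with C = y + y⁻¹ for some y of order 5.
-- The eigenvalues of C are 2, φ and −1 − φ, and on each eigenspace of C the adjacency
-- operator satisfies a quadratic equation with roots in ℚ(√5).

open import Defs
open import Data.Product using (_×_; Σ-syntax)
open import Data.Sum using (_⊎_)
open import Function.Bundles using (_⇔_)
open import Level using (Level; 0ℓ)

import Algebra.Apartness.Properties.HeytingCommutativeRing as HeytingProperties
open import Algebra.Bundles using (CommutativeRing; Group)
open import Algebra.Morphism.Structures using (module GroupMorphisms; module RingMorphisms)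
import Algebra.Properties.CommutativeMonoid.Sum as MonoidSum
import Algebra.Properties.Group as GroupProperties
import Algebra.Properties.Ring as RingProperties
import Algebra.Solver.Ring as RingSolver
import Algebra.Solver.Ring.AlmostCommutativeRing as ACR
open import Algebra.Structures using (IsGroup)
open import Data.Bool.Base using (Bool; true; false; not; _∧_; _xor_; if_then_else_)
import Data.Bool.Properties as Bool
import Data.Empty
open import Data.Fin.Base as Fin using (Fin; zero; suc; toℕ; fromℕ<; combine; remQuot)
open import Data.Fin.Permutation using (Permutation; permutation)
import Data.Fin.Properties as Fin
open import Data.Fin.Subset as Subset using (Subset)
import Data.Fin.Subset.Properties as Subset
open import Data.Integer.Base as ℤ using (ℤ; 0ℤ; 1ℤ)
import Data.Integer.Properties as ℤ
import Data.Integer.Solver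
open import Data.List.Base as List using (List; []; _∷_; _++_; length; map; lookup)
open import Data.List.Membership.Propositional using (_∈_; _∉_)
open import Data.List.Membership.Propositional.Properties using (∈-map⁺; ∈-map⁻; ∈-lookup)
open import Data.List.Membership.Propositional.Properties.WithK using (unique∧set⇒bag)
import Data.List.Properties as List
open import Data.List.Relation.Binary.BagAndSetEquality using (∼bag⇒↭)
open import Data.List.Relation.Binary.Permutation.Propositional as ↭ using (_↭_; ↭-refl; ↭-sym)
open import Data.List.Relation.Binary.Permutation.Propositional.Properties using (↭-length)
open import Data.List.Relation.Unary.All as All using (All; []; _∷_)
import Data.List.Relation.Unary.All.Properties as All
open import Data.List.Relation.Unary.AllPairs using ([]; _∷_)
open import Data.List.Relation.Unary.Any as Any using (here; there)
open import Data.List.Relation.Unary.Any.Properties using (lookup-index)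
open import Data.List.Relation.Unary.Unique.Propositional using (Unique)
import Data.List.Relation.Unary.Unique.Propositional.Properties as Unique
open import Data.Maybe.Base using (Maybe; just; nothing)
open import Data.Nat.Base as ℕ using (ℕ; zero; suc; parity)
open import Data.Nat.Coprimality as Coprime using (Coprime; coprime-Bézout; prime⇒coprime)
open import Data.Nat.Divisibility as ℕ∣ using ()
open import Data.Nat.DivMod using (_%_; _/_; m≡m%n+[m/n]*n; m%n<n)
open import Data.Nat.GCD using (module Bézout)
open import Data.Nat.Induction using (<-wellFounded)
open import Data.Nat.ListAction using (product)
open import Data.Nat.ListAction.Properties using (∈⇒∣product)
open import Data.Nat.Primality using
  (Prime; prime?; prime[2]; prime⇒nonZero; prime⇒nonTrivial; prime⇒irreducible; euclidsLemma; ¬prime[0]; ¬prime[1])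
open import Data.Nat.Primality.Factorisation using (factorise; module PrimeFactorisation)
import Data.Nat.Properties as ℕ
import Data.Nat.Solver
open import Data.Parity.Base using (Parity; 0ℙ; 1ℙ) renaming (_+_ to _+ℙ_)
import Data.Parity.Properties as Parity
open import Data.Product.Base using (_,_; proj₁; proj₂; ∃; ∃-syntax)
open import Data.Rational.Base as ℚ using (ℚ; 0ℚ; 1ℚ)
import Data.Rational.Properties as ℚ
import Data.Rational.Solver
import Data.Rational.Unnormalised.Base as ℚᵘ
import Data.Rational.Unnormalised.Properties as ℚᵘ
open import Data.Sum.Base using (inj₁; inj₂; [_,_]′)
open import Data.Vec.Base as Vec using (Vec; []; _∷_; _∷ʳ_)
open import Data.Vec.Functional using (Vector)
import Data.Vec.Properties as Vec
open import Function.Base using (_∘_; case_of_)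
open import Function.Bundles using (Inverse; mk⇔; Equivalence)
open import Induction.WellFounded using (Acc; acc)
open import Level as Level using (_⊔_)
open import Relation.Binary.Definitions using (tri<; tri≈; tri>)
open import Relation.Binary.PropositionalEquality as ≡
  using (_≡_; _≢_; refl; sym; trans; cong; cong₂; subst; module ≡-Reasoning)
import Relation.Binary.Reasoning.Setoid as SetoidReasoning
open import Relation.Nullary.Decidable
  using (Dec; yes; no; does; from-yes; from-no; dec-true; dec-false; decidable-stable; _×-dec_; _⊎-dec_; ¬?)
open import Relation.Nullary.Negation using (¬_; contradiction)
open import Relation.Unary using (Pred)

-- The descent is ramification in disguise. Let ζ be a primitive n-th root of unity. At the prime
-- above p the number ζ - 1 has valuation 1, so that η = ζ + ζ⁻¹ - 2 = ζ⁻¹(ζ - 1)² has valuation 2,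
-- while p has as valuation the ramification index, p - 1 or, for n = 25, 20, in any case at least
-- 6. In B₀ + B₁η + B₂η² with rational coefficients the nonzero terms then have valuations in the
-- distinct classes 0, 2, 4 modulo that index and cannot cancel. The sequences carry this out
-- without number fields and without irreducibility of cyclotomic polynomials.
--
-- Equality in Ω is not decidable, which shapes all arguments on spectra. Given a nonzero w with (A
-- - p)(A - q)w = 0 and p # q, cotransitivity shows only that one of p and q is an eigenvalue, so
-- the argument that follows must cope with either. In the converse direction an eigenfunction is
-- split into components in the eigenspaces of C, at least one of which is apart from zero, and this
-- component decides where the eigenvalue lies.

private
  module ℕSolver = Data.Nat.Solver.+-*-Solver
  module ℤSolver = Data.Integer.Solver.+-*-Solver
  module ℚSolver = Data.Rational.Solver.+-*-Solver

-- Orbits of maps of prime order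

module Counting where
  open import Data.Nat.Base
  open import Data.Nat.Divisibility using (_∣_; m∣m*n; ∣m⇒∣m*n; ∣m+n∣m⇒∣n; >⇒∤)
  open import Data.List.Base using ([_])
  open MonoidSum ℕ.+-0-commutativeMonoid using (sum; sum-cong-≗; ∑-comm; ∑-distrib-+; sum-permute)

  module _ {a} {A : Set a} where

    iter : (A → A) → ℕ → A → A
    iter σ zero    x = x
    iter σ (suc k) x = σ (iter σ k x)

    iter-+ : ∀ σ m n x → iter σ (m + n) x ≡ iter σ m (iter σ n x)
    iter-+ σ zero    n x = refl
    iter-+ σ (suc m) n x = cong σ (iter-+ σ m n x)

    iter-comm : ∀ σ m n x → iter σ m (iter σ n x) ≡ iter σ n (iter σ m x)
    iter-comm σ m n x = begin
      iter σ m (iter σ n x) ≡⟨ iter-+ σ m n x ⟨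
      iter σ (m + n) x      ≡⟨ cong (λ k → iter σ k x) (ℕ.+-comm m n) ⟩
      iter σ (n + m) x      ≡⟨ iter-+ σ n m x ⟩
      iter σ n (iter σ m x) ∎
      where open ≡-Reasoning

    iter-fixed : ∀ {σ x} → σ x ≡ x → ∀ k → iter σ k x ≡ x
    iter-fixed         eq zero    = refl
    iter-fixed {σ = σ} eq (suc k) = trans (cong σ (iter-fixed eq k)) eq

    iter-* : ∀ {σ d x} → iter σ d x ≡ x → ∀ k → iter σ (k * d) x ≡ x
    iter-*             eq zero    = refl
    iter-* {σ} {d} {x} eq (suc k) = trans (iter-+ σ d (k * d) x) (trans (cong (iter σ d) (iter-* eq k)) eq)

    -- Bézout gives 1 + v n = u m, or the same with m and n exchanged, and both multiples are
    -- periods of `x`.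
    iter-coprime : ∀ {σ m n x} → Coprime m n → iter σ m x ≡ x → iter σ n x ≡ x → σ x ≡ x
    iter-coprime {σ} {m} {n} {x} cop σᵐx σⁿx with coprime-Bézout cop
    ... | Bézout.+- u v eq = trans (cong σ (sym (iter-* σⁿx v)))
            (trans (cong (λ k → iter σ k x) eq) (iter-* σᵐx u))
    ... | Bézout.-+ u v eq = trans (cong σ (sym (iter-* σᵐx u)))
            (trans (cong (λ k → iter σ k x) eq) (iter-* σⁿx v))

  iter-cong : ∀ {a b} {A : Set a} {B : Set b} {σ : A → A} {ρ : B → B} (f : A → B) →
    (∀ x → f (σ x) ≡ ρ (f x)) → ∀ k x → f (iter σ k x) ≡ iter ρ k (f x)
  iter-cong         f eq zero    x = refl
  iter-cong {ρ = ρ} f eq (suc k) x = trans (eq _) (cong ρ (iter-cong f eq k x))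

  sum-const : ∀ n k → sum {n} (λ _ → k) ≡ n * k
  sum-const zero    k = refl
  sum-const (suc n) k = cong (k +_) (sum-const n k)

  sum-zero : ∀ {n} {f : Vector ℕ n} → (∀ i → f i ≡ 0) → sum f ≡ 0
  sum-zero {n} {f} f≡0 = trans (sum-cong-≗ f≡0) (trans (sum-const n 0) (ℕ.*-zeroʳ n))

  sum-single : ∀ {n} (f : Vector ℕ n) i₀ → (∀ i → i ≢ i₀ → f i ≡ 0) → sum f ≡ f i₀
  sum-single f zero    f≡0 = trans (cong (f zero +_) (sum-zero λ i → f≡0 (suc i) λ ())) (ℕ.+-identityʳ _)
  sum-single f (suc i₀) f≡0 = cong₂ _+_ (f≡0 zero λ ())
    (sum-single (f ∘ suc) i₀ λ i i≢i₀ → f≡0 (suc i) (i≢i₀ ∘ Fin.suc-injective))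

  [_]·_ : ∀ {p} {P : Set p} → Dec P → ℕ → ℕ
  [ d ]· k = if does d then k else 0

  [yes]· : ∀ {p} {P : Set p} (d : Dec P) k → P → [ d ]· k ≡ k
  [yes]· d k p rewrite dec-true d p = refl

  [no]· : ∀ {p} {P : Set p} (d : Dec P) k → ¬ P → [ d ]· k ≡ 0
  [no]· d k ¬p rewrite dec-false d ¬p = refl

  argmin : ∀ {N} n (g : Fin (suc n) → Fin N) → ∃[ i ] ∀ j → toℕ (g i) ≤ toℕ (g j)
  argmin zero    g = zero , λ { zero → ℕ.≤-refl }
  argmin (suc n) g with argmin n (g ∘ suc)
  ... | i , least with ℕ.≤-total (toℕ (g zero)) (toℕ (g (suc i)))
  ...   | inj₁ g₀≤gᵢ = zero , λ { zero → ℕ.≤-refl ; (suc j) → ℕ.≤-trans g₀≤gᵢ (least j) }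
  ...   | inj₂ gᵢ≤g₀ = suc i , λ { zero → gᵢ≤g₀ ; (suc j) → least j }

  module Orbits {N r} (q-prime : Prime (suc r)) (σ : Fin N → Fin N) (σ^q : ∀ x → iter σ (suc r) x ≡ x) where

    private
      q : ℕ
      q = suc r

    -- Applying q - i further steps to both sides makes j - i a period of `x`; being positive and
    -- less than q, it is coprime to q.
    iter-< : ∀ {i j x} → i < j → j < q → iter σ i x ≡ iter σ j x → σ x ≡ x
    iter-< {i} {j} {x} i<j j<q eq = iter-coprime
      (prime⇒coprime q-prime {{>-nonZero (ℕ.m<n⇒0<n∸m i<j)}} (ℕ.≤-<-trans (ℕ.m∸n≤m j i) j<q))
      (σ^q x) (begin
        iter σ (j ∸ i) x                             ≡⟨ σ^q _ ⟨
        iter σ q (iter σ (j ∸ i) x)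
          ≡⟨ cong (λ k → iter σ k (iter σ (j ∸ i) x)) (ℕ.m∸n+n≡m i≤q) ⟨
        iter σ (q ∸ i + i) (iter σ (j ∸ i) x)        ≡⟨ iter-+ σ (q ∸ i) i _ ⟩
        iter σ (q ∸ i) (iter σ i (iter σ (j ∸ i) x)) ≡⟨ cong (iter σ (q ∸ i)) (iter-+ σ i (j ∸ i) x) ⟨
        iter σ (q ∸ i) (iter σ (i + (j ∸ i)) x)
          ≡⟨ cong (λ k → iter σ (q ∸ i) (iter σ k x)) (ℕ.m+[n∸m]≡n (ℕ.<⇒≤ i<j)) ⟩
        iter σ (q ∸ i) (iter σ j x)                  ≡⟨ cong (iter σ (q ∸ i)) eq ⟨
        iter σ (q ∸ i) (iter σ i x)                  ≡⟨ iter-+ σ (q ∸ i) i x ⟨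
        iter σ (q ∸ i + i) x                         ≡⟨ cong (λ k → iter σ k x) (ℕ.m∸n+n≡m i≤q) ⟩
        iter σ q x                                   ≡⟨ σ^q x ⟩
        x                                            ∎)
      where
      open ≡-Reasoning
      i≤q : i ≤ q
      i≤q = ℕ.<⇒≤ (ℕ.<-trans i<j j<q)

    iter-injective : ∀ {x} → σ x ≢ x → ∀ (i j : Fin q) → iter σ (toℕ i) x ≡ iter σ (toℕ j) x → i ≡ j
    iter-injective σx≢x i j eq with ℕ.<-cmp (toℕ i) (toℕ j)
    ... | tri< i<j _ _ = contradiction (iter-< i<j (Fin.toℕ<n j) eq) σx≢x
    ... | tri≈ _ i≡j _ = Fin.toℕ-injective i≡j
    ... | tri> _ _ j<i = contradiction (iter-< j<i (Fin.toℕ<n i) (sym eq)) σx≢x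

    iter-connect : ∀ (i j : Fin q) x → ∃[ k ] iter σ (toℕ {q} k) (iter σ (toℕ i) x) ≡ iter σ (toℕ j) x
    iter-connect i j x with ℕ.≤-<-connex (toℕ i) (toℕ j)
    ... | inj₁ i≤j = fromℕ< j∸i<q , trans (cong (λ k → iter σ k (iter σ (toℕ i) x)) (Fin.toℕ-fromℕ< j∸i<q))
            (trans (sym (iter-+ σ (toℕ j ∸ toℕ i) (toℕ i) x)) (cong (λ k → iter σ k x) (ℕ.m∸n+n≡m i≤j)))
      where
      j∸i<q : toℕ j ∸ toℕ i < q
      j∸i<q = ℕ.≤-<-trans (ℕ.m∸n≤m (toℕ j) (toℕ i)) (Fin.toℕ<n j)
    ... | inj₂ j<i = fromℕ< k<q , trans (cong (λ k → iter σ k (iter σ (toℕ i) x)) (Fin.toℕ-fromℕ< k<q)) (begin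
        iter σ (q ∸ toℕ i + toℕ j) (iter σ (toℕ i) x)          ≡⟨ iter-+ σ (q ∸ toℕ i + toℕ j) (toℕ i) x ⟨
        iter σ (q ∸ toℕ i + toℕ j + toℕ i) x
          ≡⟨ cong (λ k → iter σ k x) (ℕ.+-assoc (q ∸ toℕ i) (toℕ j) (toℕ i)) ⟩
        iter σ (q ∸ toℕ i + (toℕ j + toℕ i)) x
          ≡⟨ cong (λ k → iter σ (q ∸ toℕ i + k) x) (ℕ.+-comm (toℕ j) (toℕ i)) ⟩
        iter σ (q ∸ toℕ i + (toℕ i + toℕ j)) x
          ≡⟨ cong (λ k → iter σ k x) (ℕ.+-assoc (q ∸ toℕ i) (toℕ i) (toℕ j)) ⟨
        iter σ (q ∸ toℕ i + toℕ i + toℕ j) x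
          ≡⟨ cong (λ k → iter σ (k + toℕ j) x) (ℕ.m∸n+n≡m (ℕ.<⇒≤ (Fin.toℕ<n i))) ⟩
        iter σ (q + toℕ j) x                                   ≡⟨ iter-+ σ q (toℕ j) x ⟩
        iter σ q (iter σ (toℕ j) x)                            ≡⟨ σ^q _ ⟩
        iter σ (toℕ j) x                                       ∎)
      where
      open ≡-Reasoning
      k<q : q ∸ toℕ i + toℕ j < q
      k<q = ℕ.<-≤-trans (ℕ.+-monoʳ-< (q ∸ toℕ i) j<i) (ℕ.≤-reflexive (ℕ.m∸n+n≡m (ℕ.<⇒≤ (Fin.toℕ<n i))))

    Leader : Fin N → Set
    Leader y = σ y ≢ y × (∀ (j : Fin q) → toℕ y ≤ toℕ (iter σ (toℕ j) y))

    leader? : ∀ y → Dec (Leader y)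
    leader? y = ¬? (σ y Fin.≟ y) ×-dec Fin.all? λ j → toℕ y ℕ.≤? toℕ (iter σ (toℕ j) y)

    -- Each free orbit is counted at its least element only.
    module Count (f : Fin N → ℕ) (f-inv : ∀ x → f (σ x) ≡ f x) where

      led : Fin N → ℕ
      led y = [ leader? y ]· f y

      f-inv-iter : ∀ i x → f (iter σ i x) ≡ f x
      f-inv-iter zero    x = refl
      f-inv-iter (suc i) x = trans (f-inv _) (f-inv-iter i x)

      -- A fixed point leads no orbit and is accounted for by the first summand. On a free orbit
      -- exactly one of the q iterates is the leader, and `f` has the same value there as at `x`.
      -- The equation is pointwise, so that no set of orbits has to be formed.
      orbit-sum : ∀ x → f x ≡ [ σ x Fin.≟ x ]· f x + sum {q} (λ i → led (iter σ (toℕ i) x))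
      orbit-sum x = go (σ x Fin.≟ x)
        where
        go : (d : Dec (σ x ≡ x)) → f x ≡ [ d ]· f x + sum {q} (λ i → led (iter σ (toℕ i) x))
        go (yes σx≡x) =
          sym (trans (cong (f x +_) (sum-zero {q} λ i → trans (cong led (iter-fixed {σ = σ} σx≡x (toℕ i)))
            ([no]· (leader? x) _ λ ℓ → proj₁ ℓ σx≡x))) (ℕ.+-identityʳ _))
        go (no σx≢x) = sym (trans (sum-single _ i₀ others)
              (trans ([yes]· (leader? (iter σ (toℕ i₀) x)) _ i₀-leads) (f-inv-iter (toℕ i₀) x)))
          where
          i₀ : Fin q
          i₀ = proj₁ (argmin r (λ i → iter σ (toℕ i) x))
          least : ∀ j → toℕ (iter σ (toℕ i₀) x) ≤ toℕ (iter σ (toℕ j) x)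
          least = proj₂ (argmin r (λ i → iter σ (toℕ i) x))
          reach : ∀ (i j : Fin q) → ∃[ l ] iter σ (toℕ {q} l) (iter σ (toℕ i) x) ≡ iter σ (toℕ j) x
          reach i j = iter-connect i j x
          moves : ∀ (i : Fin q) → σ (iter σ (toℕ i) x) ≢ iter σ (toℕ i) x
          moves i eq with iter-connect i zero x
          ... | l , σˡσⁱx≡x = σx≢x (subst (λ y → σ y ≡ y) σˡσⁱx≡x
                  (trans (sym (iter-comm σ (toℕ l) 1 _)) (cong (iter σ (toℕ l)) eq)))
          i₀-leads : Leader (iter σ (toℕ i₀) x)
          i₀-leads = moves i₀ , λ j → subst (λ y → toℕ (iter σ (toℕ i₀) x) ≤ toℕ y)
            (sym (proj₂ (wrap j))) (least (proj₁ (wrap j)))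
            where
            wrap : ∀ (j : Fin q) → ∃[ l ] iter σ (toℕ j) (iter σ (toℕ i₀) x) ≡ iter σ (toℕ {q} l) x
            wrap j with (toℕ j + toℕ i₀) ℕ.<? q
            ... | yes j+i₀<q = fromℕ< j+i₀<q , trans (sym (iter-+ σ (toℕ j) (toℕ i₀) x))
                    (cong (λ k → iter σ k x) (sym (Fin.toℕ-fromℕ< j+i₀<q)))
            ... | no  j+i₀≮q = fromℕ< l<q , (begin
                iter σ (toℕ j) (iter σ (toℕ i₀) x)      ≡⟨ iter-+ σ (toℕ j) (toℕ i₀) x ⟨
                iter σ (toℕ j + toℕ i₀) x               ≡⟨ cong (λ k → iter σ k x) (ℕ.m+[n∸m]≡n q≤) ⟨
                iter σ (q + (toℕ j + toℕ i₀ ∸ q)) x     ≡⟨ iter-+ σ q _ x ⟩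
                iter σ q (iter σ (toℕ j + toℕ i₀ ∸ q) x) ≡⟨ σ^q _ ⟩
                iter σ (toℕ j + toℕ i₀ ∸ q) x           ≡⟨ cong (λ k → iter σ k x) (Fin.toℕ-fromℕ< l<q) ⟨
                iter σ (toℕ (fromℕ< l<q)) x             ∎)
              where
              open ≡-Reasoning
              q≤ : q ≤ toℕ j + toℕ i₀
              q≤ = ℕ.≮⇒≥ j+i₀≮q
              l<q : toℕ j + toℕ i₀ ∸ q < q
              l<q = ℕ.+-cancelʳ-< q _ _ (subst (_< q + q) (sym (ℕ.m∸n+n≡m q≤))
                (ℕ.+-mono-< (Fin.toℕ<n j) (Fin.toℕ<n i₀)))
          others : ∀ i → i ≢ i₀ → led (iter σ (toℕ i) x) ≡ 0
          others i i≢i₀ =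
            [no]· (leader? _) _ λ ℓ → i≢i₀ (iter-injective σx≢x i i₀ (Fin.toℕ-injective (ℕ.≤-antisym
            (subst (λ y → toℕ (iter σ (toℕ i) x) ≤ toℕ y) (proj₂ (reach i i₀)) (proj₂ ℓ (proj₁ (reach i i₀))))
            (least i))))

      -- After summing `orbit-sum` over all x and exchanging the two sums, each of the q inner sums
      -- is the same, because every iterate of `σ` is a permutation.
      orbit-count : ∃[ m ] sum f ≡ sum (λ x → [ σ x Fin.≟ x ]· f x) + q * m
      orbit-count = sum led , (begin
        sum f
          ≡⟨ sum-cong-≗ orbit-sum ⟩
        sum (λ x → [ σ x Fin.≟ x ]· f x + sum {q} (λ i → led (iter σ (toℕ i) x)))
          ≡⟨ ∑-distrib-+ (λ x → [ σ x Fin.≟ x ]· f x) _ ⟩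
        fixed + sum (λ x → sum {q} (λ i → led (iter σ (toℕ i) x)))
          ≡⟨ cong (fixed +_) (∑-comm λ x (i : Fin q) → led (iter σ (toℕ i) x)) ⟩
        fixed + sum {q} (λ i → sum (λ x → led (iter σ (toℕ i) x)))
          ≡⟨ cong (fixed +_) (sum-cong-≗ {q} λ i → sym (sum-permute led (shift i))) ⟩
        fixed + sum {q} (λ i → sum led)
          ≡⟨ cong (fixed +_) (sum-const q (sum led)) ⟩
        fixed + q * sum led ∎)
        where
        open ≡-Reasoning
        fixed = sum (λ x → [ σ x Fin.≟ x ]· f x)
        shift : Fin q → _
        shift i = permutation (iter σ (toℕ i)) (iter σ (q ∸ toℕ i))
          (λ x → trans (iter-comm σ (toℕ i) (q ∸ toℕ i) x) (back x)) back
          where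
          back : ∀ x → iter σ (q ∸ toℕ i) (iter σ (toℕ i) x) ≡ x
          back x = trans (sym (iter-+ σ (q ∸ toℕ i) (toℕ i) x))
            (trans (cong (λ k → iter σ k x) (ℕ.m∸n+n≡m (ℕ.<⇒≤ (Fin.toℕ<n i)))) (σ^q x))

  -- Groups on the elements of `Fin n`

  record FinGroup : Set where
    infixl 7 _∙_
    infix  8 _⁻¹
    field
      order   : ℕ
      _∙_     : Fin order → Fin order → Fin order
      ε       : Fin order
      _⁻¹     : Fin order → Fin order
      isGroup : IsGroup _≡_ _∙_ ε _⁻¹

    El : Set
    El = Fin order

    open IsGroup isGroup public using (assoc; identityˡ; identityʳ; inverseˡ; inverseʳ)

    group : Group 0ℓ 0ℓ
    group = record { isGroup = isGroup }

    open GroupProperties group public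
      using (∙-cancelˡ; ∙-cancelʳ; ⁻¹-involutive; ⁻¹-anti-homo-∙; ⁻¹-injective; ε⁻¹≈ε; inverseˡ-unique; inverseʳ-unique)

    infixr 9 _**_
    _**_ : El → ℕ → El
    x ** k = iter (x ∙_) k ε

    prod : List El → El
    prod = List.foldr _∙_ ε

  -- Tuples with product 1 and McKay's count

  finVec : ∀ {n k} → Vec (Fin n) k → Fin (n ^ k)
  finVec []      = zero
  finVec (x ∷ v) = combine x (finVec v)

  vecFin : ∀ {n} k → Fin (n ^ k) → Vec (Fin n) k
  vecFin     zero    _ = []
  vecFin {n} (suc k) i = proj₁ (remQuot {n} (n ^ k) i) ∷ vecFin k (proj₂ (remQuot {n} (n ^ k) i))

  vecFin-finVec : ∀ {n k} (v : Vec (Fin n) k) → vecFin k (finVec v) ≡ v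
  vecFin-finVec     []      = refl
  vecFin-finVec {n} (x ∷ v) = cong₂ _∷_ (cong proj₁ (Fin.remQuot-combine x (finVec v)))
    (trans (cong (vecFin _ ∘ proj₂) (Fin.remQuot-combine x (finVec v))) (vecFin-finVec v))

  finVec-vecFin : ∀ {n} k (i : Fin (n ^ k)) → finVec (vecFin k i) ≡ i
  finVec-vecFin     zero    zero = refl
  finVec-vecFin {n} (suc k) i    = trans
    (cong (combine (proj₁ (remQuot {n} (n ^ k) i))) (finVec-vecFin k _))
    (Fin.combine-remQuot {n} (n ^ k) i)

  rotate : ∀ {a} {A : Set a} → List A → List A
  rotate []       = []
  rotate (x ∷ xs) = xs ++ [ x ]

  rotate-++ : ∀ {a} {A : Set a} (xs ys : List A) → iter rotate (length xs) (xs ++ ys) ≡ ys ++ xs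
  rotate-++ []       ys = sym (List.++-identityʳ ys)
  rotate-++ (x ∷ xs) ys = begin
    rotate (iter rotate (length xs) (x ∷ xs ++ ys)) ≡⟨ iter-comm rotate 1 (length xs) _ ⟩
    iter rotate (length xs) ((xs ++ ys) ++ [ x ])
      ≡⟨ cong (iter rotate (length xs)) (List.++-assoc xs ys [ x ]) ⟩
    iter rotate (length xs) (xs ++ ys ++ [ x ])     ≡⟨ rotate-++ xs (ys ++ [ x ]) ⟩
    (ys ++ [ x ]) ++ xs                             ≡⟨ List.++-assoc ys [ x ] xs ⟩
    ys ++ x ∷ xs                                    ∎
    where open ≡-Reasoning

  rotate-length : ∀ {a} {A : Set a} (xs : List A) → iter rotate (length xs) xs ≡ xs
  rotate-length xs = trans (cong (iter rotate (length xs)) (sym (List.++-identityʳ xs))) (rotate-++ xs [])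

  rotate-fixed : ∀ {a} {A : Set a} {x : A} xs → xs ++ [ x ] ≡ x ∷ xs → xs ≡ List.replicate (length xs) x
  rotate-fixed []       eq = refl
  rotate-fixed (y ∷ xs) eq with List.∷-injective eq
  ... | refl , eq′ = cong (y ∷_) (rotate-fixed xs eq′)

  -- McKay's count: rotating the q-tuples with product 1 fixes only the constant
  -- tuples, that is, the solutions of x^q = 1.
  module McKay (G : FinGroup) where
    open FinGroup G

    prod-∷ʳ : ∀ xs z → prod (xs ++ [ z ]) ≡ prod xs ∙ z
    prod-∷ʳ []       z = trans (identityʳ z) (sym (identityˡ z))
    prod-∷ʳ (x ∷ xs) z = trans (cong (x ∙_) (prod-∷ʳ xs z)) (sym (assoc x _ z))

    prod-replicate : ∀ k x → prod (List.replicate k x) ≡ x ** k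
    prod-replicate zero    x = refl
    prod-replicate (suc k) x = cong (x ∙_) (prod-replicate k x)

    -- A tuple with product 1 is determined by all entries but the last. These tuples are therefore
    -- encoded by arbitrary vectors one entry shorter, and `turn` is the rotation read in this
    -- encoding.
    full : ∀ {k} → Vec El k → List El
    full v = Vec.toList v ++ [ prod (Vec.toList v) ⁻¹ ]

    turn : ∀ {k} → Vec El (suc k) → Vec El (suc k)
    turn (x ∷ v) = v ∷ʳ (prod (Vec.toList (x ∷ v)) ⁻¹)

    full-turn : ∀ {k} (v : Vec El (suc k)) → full (turn v) ≡ rotate (full v)
    full-turn (x ∷ v) = cong₂ (λ xs z → xs ++ [ z ]) (Vec.toList-∷ʳ _ v) (begin
      prod (Vec.toList (v ∷ʳ (x ∙ p) ⁻¹)) ⁻¹   ≡⟨ cong (λ xs → prod xs ⁻¹) (Vec.toList-∷ʳ _ v) ⟩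
      prod (Vec.toList v ++ [ (x ∙ p) ⁻¹ ]) ⁻¹ ≡⟨ cong _⁻¹ (prod-∷ʳ (Vec.toList v) _) ⟩
      (p ∙ (x ∙ p) ⁻¹) ⁻¹                      ≡⟨ ⁻¹-anti-homo-∙ _ _ ⟩
      (x ∙ p) ⁻¹ ⁻¹ ∙ p ⁻¹                     ≡⟨ cong (_∙ p ⁻¹) (⁻¹-involutive _) ⟩
      x ∙ p ∙ p ⁻¹                             ≡⟨ assoc x p (p ⁻¹) ⟩
      x ∙ (p ∙ p ⁻¹)                           ≡⟨ cong (x ∙_) (inverseʳ p) ⟩
      x ∙ ε                                    ≡⟨ identityʳ x ⟩
      x                                        ∎)
      where
      open ≡-Reasoning
      p = prod (Vec.toList v)

    full-injective : ∀ {k} (v w : Vec El k) → full v ≡ full w → v ≡ w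
    full-injective v w eq = trans (sym (Vec.cast-is-id refl v))
      (Vec.toList-injective refl v w (List.∷ʳ-injectiveˡ (Vec.toList v) (Vec.toList w) eq))

    length-full : ∀ {k} (v : Vec El k) → length (full v) ≡ suc k
    length-full {k} v = trans (List.length-++ (Vec.toList v))
      (trans (ℕ.+-comm _ 1) (cong suc (Vec.length-toList v)))

    turn-period : ∀ {k} (v : Vec El (suc k)) → iter turn (2 + k) v ≡ v
    turn-period {k} v = full-injective _ v (begin
      full (iter turn (2 + k) v)            ≡⟨ iter-cong {ρ = rotate} full full-turn (2 + k) v ⟩
      iter rotate (2 + k) (full v)          ≡⟨ cong (λ m → iter rotate m (full v)) (length-full v) ⟨
      iter rotate (length (full v)) (full v) ≡⟨ rotate-length (full v) ⟩
      full v                                ∎)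
      where open ≡-Reasoning

    ones : ∀ k → Vec El k
    ones k = Vec.replicate k ε

    prod-ones : ∀ k → prod (Vec.toList (ones k)) ≡ ε
    prod-ones zero    = refl
    prod-ones (suc k) = trans (identityˡ _) (prod-ones k)

    ones-∷ʳ : ∀ k → ones k ∷ʳ ε ≡ ones (suc k)
    ones-∷ʳ zero    = refl
    ones-∷ʳ (suc k) = cong (ε ∷_) (ones-∷ʳ k)

    turn-ones : ∀ k → turn (ones (suc k)) ≡ ones (suc k)
    turn-ones k = trans (cong (ones k ∷ʳ_) (trans (cong _⁻¹ (prod-ones (suc k))) ε⁻¹≈ε)) (ones-∷ʳ k)

    all-ones : ∀ {k} (v : Vec El k) m → Vec.toList v ≡ List.replicate m ε → v ≡ ones k
    all-ones []      m       eq = refl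
    all-ones (x ∷ v) (suc m) eq = cong₂ _∷_ (List.∷-injectiveˡ eq) (all-ones v m (List.∷-injectiveʳ eq))

    -- A tuple equal to its rotation is constant, and for a constant tuple the condition on the
    -- product is a power equation in its entry.
    turn-fixed : ∀ {k} → (∀ x → x ** (2 + k) ≡ ε → x ≡ ε) → (v : Vec El (suc k)) → turn v ≡ v → v ≡ ones
      (suc k)
    turn-fixed {k} torsion-free (x ∷ v) eq = all-ones (x ∷ v) (suc k)
      (trans (cong (x ∷_) (List.++-cancelʳ _ _ _ [v]≡)) (cong (λ y → List.replicate (suc k) y) x≡ε))
      where
      z = prod (Vec.toList (x ∷ v)) ⁻¹
      fixed : (Vec.toList v ++ [ z ]) ++ [ x ] ≡ x ∷ (Vec.toList v ++ [ z ])
      fixed = trans (sym (full-turn (x ∷ v))) (cong full eq)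
      const : Vec.toList v ++ [ z ] ≡ List.replicate (suc k) x
      const = trans (rotate-fixed _ fixed) (cong (λ m → List.replicate m x)
        (ℕ.suc-injective (length-full (x ∷ v))))
      x≡ε : x ≡ ε
      x≡ε = torsion-free x (begin
        x ** (2 + k)                              ≡⟨ prod-replicate (2 + k) x ⟨
        prod (x ∷ List.replicate (suc k) x)       ≡⟨ cong (prod ∘ (x ∷_)) const ⟨
        prod (full (x ∷ v))                       ≡⟨ prod-∷ʳ (Vec.toList (x ∷ v)) z ⟩
        prod (Vec.toList (x ∷ v)) ∙ z             ≡⟨ inverseʳ _ ⟩
        ε                                         ∎)
        where open ≡-Reasoning
      replicate-∷ʳ : ∀ m → List.replicate (suc m) x ≡ List.replicate m x ++ [ x ]
      replicate-∷ʳ zero    = refl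
      replicate-∷ʳ (suc m) = cong (x ∷_) (replicate-∷ʳ m)
      [v]≡ : Vec.toList v ++ [ x ] ≡ List.replicate k x ++ [ x ]
      [v]≡ = trans (cong (λ y → Vec.toList v ++ [ y ]) (sym z≡x)) (trans const (replicate-∷ʳ k))
        where
        z≡x : z ≡ x
        z≡x = List.∷ʳ-injectiveʳ (Vec.toList v) (List.replicate k x) (trans const (replicate-∷ʳ k))

    -- There are n^(q-1) tuples, n the order, and rotation fixes exactly one of them, so that
    -- n^(q-1) ≡ 1 modulo q.
    prime-∤-order : ∀ {q} → Prime q → (∀ x → x ** q ≡ ε → x ≡ ε) → ¬ q ∣ order
    prime-∤-order {0}           q-prime _ _ = contradiction q-prime ¬prime[0]
    prime-∤-order {1}           q-prime _ _ = contradiction q-prime ¬prime[1]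
    prime-∤-order {suc (suc k)} q-prime torsion-free q∣n = contradiction
      (∣m+n∣m⇒∣n (subst (q ∣_) (trans count (ℕ.+-comm 1 (q * m))) (∣m⇒∣m*n (order ^ k) q∣n)) (m∣m*n m))
      (>⇒∤ (s≤s (s≤s z≤n)))
      where
      q N : ℕ
      q = suc (suc k)
      N = order ^ suc k
      σ : Fin N → Fin N
      σ = finVec ∘ turn ∘ vecFin (suc k)
      vec-σ : ∀ x → vecFin (suc k) (σ x) ≡ turn (vecFin (suc k) x)
      vec-σ x = vecFin-finVec (turn (vecFin (suc k) x))
      σ^q : ∀ x → iter σ q x ≡ x
      σ^q x = begin
        iter σ q x                              ≡⟨ finVec-vecFin {order} (suc k) _ ⟨
        finVec {order} (vecFin (suc k) (iter σ q x))
          ≡⟨ cong (finVec {order}) (iter-cong {ρ = turn} (vecFin (suc k)) vec-σ q x) ⟩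
        finVec (iter turn q (vecFin (suc k) x)) ≡⟨ cong (finVec {order}) (turn-period (vecFin (suc k) x)) ⟩
        finVec {order} (vecFin (suc k) x)               ≡⟨ finVec-vecFin {order} (suc k) x ⟩
        x                                       ∎
        where open ≡-Reasoning
      open Orbits q-prime σ σ^q
      open Count (λ _ → 1) (λ _ → refl)
      x₀ : Fin N
      x₀ = finVec (ones (suc k))
      σx₀ : σ x₀ ≡ x₀
      σx₀ = cong (finVec {order}) (trans (cong turn (vecFin-finVec (ones (suc k)))) (turn-ones k))
      only-x₀ : ∀ x → x ≢ x₀ → ¬ σ x ≡ x
      only-x₀ x x≢x₀ σx≡x = x≢x₀ (trans (sym (finVec-vecFin {order} (suc k) x)) (cong finVec
        (turn-fixed torsion-free (vecFin (suc k) x) (trans (sym (vec-σ x)) (cong (vecFin (suc k)) σx≡x)))))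
      m : ℕ
      m = proj₁ orbit-count
      count : N ≡ 1 + q * m
      count = begin
        N                                                  ≡⟨ ℕ.*-identityʳ N ⟨
        N * 1                                              ≡⟨ sum-const N 1 ⟨
        sum {N} (λ _ → 1)                                  ≡⟨ proj₂ orbit-count ⟩
        sum (λ x → [ σ x Fin.≟ x ]· 1) + q * m
          ≡⟨ cong (_+ q * m) (sum-single _ x₀ λ x x≢x₀ → [no]· (σ x Fin.≟ x) 1 (only-x₀ x x≢x₀)) ⟩
        [ σ x₀ Fin.≟ x₀ ]· 1 + q * m                       ≡⟨ cong (_+ q * m) ([yes]· (σ x₀ Fin.≟ x₀) 1 σx₀) ⟩
        1 + q * m                                          ∎
        where open ≡-Reasoning

  power-of-prime : ∀ {p} n .{{_ : NonZero n}} → (∀ {q} → Prime q → q ≢ p → ¬ q ∣ n) → ∃[ m ] n ≡ p ^ m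
  power-of-prime {p} n only-p = length factors , trans isFactorisation
    (all-p factorsPrime (λ q∈ → subst (_ ∣_) (sym isFactorisation) (∈⇒∣product q∈)))
    where
    open PrimeFactorisation (factorise n)
    all-p : ∀ {as} → All Prime as → (∀ {a} → a ∈ as → a ∣ n) → product as ≡ p ^ length as
    all-p []        _    = refl
    all-p {a ∷ as} (pa ∷ ps) as∣n with a ℕ.≟ p
    ... | yes refl = cong (a *_) (all-p ps (as∣n ∘ there))
    ... | no  a≢p  = contradiction (as∣n (here refl)) (only-p pa a≢p)

open Counting

-- Identities in free groups by reflection

infixl 7 _⊙_
data Word (n : ℕ) : Set where
  var : Fin n → Word n
  𝟏 : Word n
  _⊙_ : Word n → Word n → Word n
  inv : Word n → Word n

module FreeReduction {a ℓ} (G : Group a ℓ) where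
  open Group G hiding (setoid) renaming (refl to ≈-refl; sym to ≈-sym; trans to ≈-trans)
  open GroupProperties G using (⁻¹-involutive; ⁻¹-anti-homo-∙; ε⁻¹≈ε)
  open import Relation.Binary.Reasoning.Setoid (Group.setoid G)

  ⟦_⟧ : ∀ {n} → Word n → Vec Carrier n → Carrier
  ⟦ var i ⟧ ρ = Vec.lookup ρ i
  ⟦ 𝟏   ⟧ ρ = ε
  ⟦ u ⊙ v ⟧ ρ = ⟦ u ⟧ ρ ∙ ⟦ v ⟧ ρ
  ⟦ inv u ⟧ ρ = ⟦ u ⟧ ρ ⁻¹

  Letters : ℕ → Set
  Letters n = List (Bool × Fin n)

  power : Bool → Carrier → Carrier
  power true  x = x
  power false x = x ⁻¹

  ⟦_⟧ᴸ : ∀ {n} → Letters n → Vec Carrier n → Carrier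
  ⟦ []          ⟧ᴸ ρ = ε
  ⟦ (b , i) ∷ w ⟧ᴸ ρ = power b (Vec.lookup ρ i) ∙ ⟦ w ⟧ᴸ ρ

  push : ∀ {n} → Bool → Fin n → Letters n → Letters n
  push b i []            = (b , i) ∷ []
  push b i ((c , j) ∷ w) with i Fin.≟ j
  push true  i ((true  , j) ∷ w) | yes _ = (true , i) ∷ (true , j) ∷ w
  push true  i ((false , j) ∷ w) | yes _ = w
  push false i ((true  , j) ∷ w) | yes _ = w
  push false i ((false , j) ∷ w) | yes _ = (false , i) ∷ (false , j) ∷ w
  push b     i ((c     , j) ∷ w) | no _  = (b , i) ∷ (c , j) ∷ w

  push-sound : ∀ {n} b (i : Fin n) w ρ → ⟦ push b i w ⟧ᴸ ρ ≈ power b (Vec.lookup ρ i) ∙ ⟦ w ⟧ᴸ ρ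
  push-sound b i []            ρ = ≈-refl
  push-sound b i ((c , j) ∷ w) ρ with i Fin.≟ j
  push-sound true  i ((true  , j) ∷ w) ρ | yes _ = ≈-refl
  push-sound true  i ((false , i) ∷ w) ρ | yes refl =
    ≈-trans (≈-sym (identityˡ _)) (≈-trans (∙-congʳ (≈-sym (inverseʳ _))) (assoc _ _ _))
  push-sound false i ((true  , i) ∷ w) ρ | yes refl =
    ≈-trans (≈-sym (identityˡ _)) (≈-trans (∙-congʳ (≈-sym (inverseˡ _))) (assoc _ _ _))
  push-sound false i ((false , j) ∷ w) ρ | yes _ = ≈-refl
  push-sound b     i ((c     , j) ∷ w) ρ | no _  = ≈-refl

  -- The flag carries a pending inversion, so that inverses of products are distributed while the
  -- word is being read.
  reduce : ∀ {n} → Bool → Word n → Letters n → Letters n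
  reduce b     (var i) w = push b i w
  reduce b     𝟏     w = w
  reduce true  (u ⊙ v) w = reduce true u (reduce true v w)
  reduce false (u ⊙ v) w = reduce false v (reduce false u w)
  reduce b     (inv u) w = reduce (not b) u w

  reduce-sound : ∀ {n} b (u : Word n) w ρ → ⟦ reduce b u w ⟧ᴸ ρ ≈ power b (⟦ u ⟧ ρ) ∙ ⟦ w ⟧ᴸ ρ
  reduce-sound b     (var i) w ρ = push-sound b i w ρ
  reduce-sound true  𝟏     w ρ = ≈-sym (identityˡ _)
  reduce-sound false 𝟏     w ρ = ≈-sym (≈-trans (∙-congʳ ε⁻¹≈ε) (identityˡ _))
  reduce-sound true  (u ⊙ v) w ρ = begin
    _                                  ≈⟨ reduce-sound true u _ ρ ⟩
    ⟦ u ⟧ ρ ∙ ⟦ reduce true v w ⟧ᴸ ρ   ≈⟨ ∙-congˡ (reduce-sound true v w ρ) ⟩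
    ⟦ u ⟧ ρ ∙ (⟦ v ⟧ ρ ∙ ⟦ w ⟧ᴸ ρ)     ≈⟨ assoc _ _ _ ⟨
    ⟦ u ⟧ ρ ∙ ⟦ v ⟧ ρ ∙ ⟦ w ⟧ᴸ ρ       ∎
  reduce-sound false (u ⊙ v) w ρ = begin
    _                                       ≈⟨ reduce-sound false v _ ρ ⟩
    ⟦ v ⟧ ρ ⁻¹ ∙ ⟦ reduce false u w ⟧ᴸ ρ    ≈⟨ ∙-congˡ (reduce-sound false u w ρ) ⟩
    ⟦ v ⟧ ρ ⁻¹ ∙ (⟦ u ⟧ ρ ⁻¹ ∙ ⟦ w ⟧ᴸ ρ)    ≈⟨ assoc _ _ _ ⟨
    ⟦ v ⟧ ρ ⁻¹ ∙ ⟦ u ⟧ ρ ⁻¹ ∙ ⟦ w ⟧ᴸ ρ      ≈⟨ ∙-congʳ (⁻¹-anti-homo-∙ _ _) ⟨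
    (⟦ u ⟧ ρ ∙ ⟦ v ⟧ ρ) ⁻¹ ∙ ⟦ w ⟧ᴸ ρ       ∎
  reduce-sound true  (inv u) w ρ = reduce-sound false u w ρ
  reduce-sound false (inv u) w ρ = ≈-trans (reduce-sound true u w ρ) (∙-congʳ (≈-sym (⁻¹-involutive _)))

  -- Two words with the same reduced form agree in every group, so `refl` proves any identity that
  -- rests on associativity, units and cancellation alone. Relations special to a group enter
  -- separately, often through `insert`.
  free : ∀ {n} (u v : Word n) (ρ : Vec Carrier n) → reduce true u [] ≡ reduce true v [] → ⟦ u ⟧ ρ ≈ ⟦ v ⟧ ρ
  free u v ρ eq = begin
    ⟦ u ⟧ ρ                   ≈⟨ identityʳ _ ⟨
    ⟦ u ⟧ ρ ∙ ε               ≈⟨ reduce-sound true u [] ρ ⟨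
    ⟦ reduce true u [] ⟧ᴸ ρ   ≡⟨ cong (λ w → ⟦ w ⟧ᴸ ρ) eq ⟩
    ⟦ reduce true v [] ⟧ᴸ ρ   ≈⟨ reduce-sound true v [] ρ ⟩
    ⟦ v ⟧ ρ ∙ ε               ≈⟨ identityʳ _ ⟩
    ⟦ v ⟧ ρ                   ∎

infixr 9 _**ʷ_
_**ʷ_ : ∀ {n} → Word n → ℕ → Word n
u **ʷ k = iter (u ⊙_) k 𝟏

pattern ♯₀ = var zero
pattern ♯₁ = var (suc zero)
pattern ♯₂ = var (suc (suc zero))
pattern ♯₃ = var (suc (suc (suc zero)))

⟦_⟧ᴮ : Bool → ℕ
⟦ true  ⟧ᴮ = 1
⟦ false ⟧ᴮ = 0

-- Involutions, elements of order five and the transfer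

module GroupLemmas (G : FinGroup) where
  open import Data.Nat.Base using (_+_; _*_)
  open MonoidSum ℕ.+-0-commutativeMonoid using (sum; sum-cong-≗; ∑-comm; ∑-distrib-+; sum-permute)
  open FinGroup G
  open FreeReduction group public using (free)

  -- Complements `free`: a word is first rewritten with a conjugate of a relator in front, which
  -- this lemma then removes.
  insert : ∀ c v {r} → r ≡ ε → c ∙ r ∙ c ⁻¹ ∙ v ≡ v
  insert c v refl = free (♯₀ ⊙ 𝟏 ⊙ inv ♯₀ ⊙ ♯₁) ♯₁ (c ∷ v ∷ []) refl

  Involution : El → Set
  Involution a = a ≢ ε × a ∙ a ≡ ε

  involution? : ∀ a → Dec (Involution a)
  involution? a = ¬? (a Fin.≟ ε) ×-dec (a ∙ a Fin.≟ ε)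

  involution-⁻¹ : ∀ {a} → a ∙ a ≡ ε → a ⁻¹ ≡ a
  involution-⁻¹ {a} a² = sym (inverseʳ-unique a a a²)

  invert-power : ∀ {a x} k → a ∙ a ≡ ε → a ∙ x ∙ a ≡ x ⁻¹ → a ∙ (x ** k) ∙ a ≡ (x ** k) ⁻¹
  invert-power {a} {x} zero    a² axa = trans (cong (_∙ a) (identityʳ a)) (trans a² (sym ε⁻¹≈ε))
  invert-power {a} {x} (suc k) a² axa = begin
    a ∙ (x ∙ x ** k) ∙ a               ≡⟨ cong (λ z → a ∙ z ∙ a) (power-comm k) ⟩
    a ∙ (x ** k ∙ x) ∙ a
      ≡⟨ free (♯₀ ⊙ (♯₂ ⊙ ♯₁) ⊙ ♯₀) (♯₀ ⊙ ♯₂ ⊙ inv ♯₀ ⊙ (♯₀ ⊙ ♯₁ ⊙ ♯₀)) (a ∷ x ∷ x ** k ∷ []) refl ⟩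
    a ∙ x ** k ∙ a ⁻¹ ∙ (a ∙ x ∙ a)    ≡⟨ cong₂ (λ b y → a ∙ x ** k ∙ b ∙ y) (involution-⁻¹ a²) axa ⟩
    a ∙ x ** k ∙ a ∙ x ⁻¹              ≡⟨ cong (_∙ x ⁻¹) (invert-power k a² axa) ⟩
    (x ** k) ⁻¹ ∙ x ⁻¹                 ≡⟨ ⁻¹-anti-homo-∙ x (x ** k) ⟨
    (x ∙ x ** k) ⁻¹                    ∎
    where
    open ≡-Reasoning
    power-comm : ∀ k → x ∙ x ** k ≡ x ** k ∙ x
    power-comm zero    = trans (identityʳ x) (sym (identityˡ x))
    power-comm (suc k) = trans (cong (x ∙_) (power-comm k)) (sym (assoc x _ x))

  square-of-power : ∀ x → x ** 10 ≡ ε → x ** 5 ∙ x ** 5 ≡ ε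
  square-of-power x x¹⁰ = trans (free (♯₀ **ʷ 5 ⊙ ♯₀ **ʷ 5) (♯₀ **ʷ 10) (x ∷ []) refl) x¹⁰

  no-order-4 : ∀ {x} → x ** 10 ≡ ε → x ** 4 ≡ ε → x ** 2 ≡ ε
  no-order-4 {x} x¹⁰ x⁴ = begin
    x ** 2                           ≡⟨ insert ε (x ** 2) x⁴ ⟨
    ε ∙ x ** 4 ∙ ε ⁻¹ ∙ x ** 2       ≡⟨ insert ε _ x⁴ ⟨
    ε ∙ x ** 4 ∙ ε ⁻¹ ∙ (ε ∙ x ** 4 ∙ ε ⁻¹ ∙ x ** 2)
      ≡⟨ free (𝟏 ⊙ ♯₀ **ʷ 4 ⊙ inv 𝟏 ⊙ (𝟏 ⊙ ♯₀ **ʷ 4 ⊙ inv 𝟏 ⊙ ♯₀ **ʷ 2)) (♯₀ **ʷ 10) (x ∷ []) refl ⟩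
    x ** 10                          ≡⟨ x¹⁰ ⟩
    ε                                ∎
    where open ≡-Reasoning

  order-2-and-5 : ∀ {x} → x ∙ x ≡ ε → x ** 5 ≡ ε → x ≡ ε
  order-2-and-5 {x} x² x⁵ =
    trans (sym (trans (free (♯₀ **ʷ 5) (𝟏 ⊙ (♯₀ ⊙ ♯₀) ⊙ inv 𝟏 ⊙ (𝟏 ⊙ (♯₀ ⊙ ♯₀) ⊙ inv 𝟏 ⊙ ♯₀)) (x ∷ []) refl)
    (trans (insert ε _ x²) (insert ε x x²)))) x⁵

  -- Sorting G into pairs {g, ga}: χ selects one element of each pair.
  module Sign (a : El) (a-inv : Involution a) where
    private
      a² : a ∙ a ≡ ε
      a² = proj₂ a-inv

    _<ᵇ_ : El → El → Bool
    x <ᵇ y = does (toℕ x ℕ.<? toℕ y)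

    χ : El → Bool
    χ g = g <ᵇ (g ∙ a)

    ∙a∙a : ∀ g → g ∙ a ∙ a ≡ g
    ∙a∙a g = trans (assoc g a a) (trans (cong (g ∙_) a²) (identityʳ g))

    χ-a : ∀ g → χ (g ∙ a) ≡ not (χ g)
    χ-a g rewrite ∙a∙a g with ℕ.<-cmp (toℕ g) (toℕ (g ∙ a))
    ... | tri< lt _ ≯ rewrite dec-true (toℕ g ℕ.<? toℕ (g ∙ a)) lt | dec-false (toℕ (g ∙ a) ℕ.<? toℕ g) ≯ =
      refl
    ... | tri> ≮ _ gt rewrite dec-false (toℕ g ℕ.<? toℕ (g ∙ a)) ≮ | dec-true (toℕ (g ∙ a) ℕ.<? toℕ g) gt =
      refl
    ... | tri≈ _ eq _ = contradiction
      (∙-cancelˡ g a ε (trans (sym (Fin.toℕ-injective eq)) (sym (identityʳ g)))) (proj₁ a-inv)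

    ∑ : (El → Bool) → ℕ
    ∑ φ = sum (λ g → ⟦ φ g ⟧ᴮ)

    ∑-shiftˡ : ∀ k (f : El → ℕ) → sum (λ g → f (k ∙ g)) ≡ sum f
    ∑-shiftˡ k f = sym (sum-permute f (permutation (k ∙_) (k ⁻¹ ∙_)
      (λ g → free (♯₀ ⊙ (inv ♯₀ ⊙ ♯₁)) ♯₁ (k ∷ g ∷ []) refl)
      (λ g → free (inv ♯₀ ⊙ (♯₀ ⊙ ♯₁)) ♯₁ (k ∷ g ∷ []) refl)))

    ∑-shiftʳ : ∀ (f : El → ℕ) → sum (λ g → f (g ∙ a)) ≡ sum f
    ∑-shiftʳ f = sym (sum-permute f (permutation (_∙ a) (_∙ a) ∙a∙a ∙a∙a))

    half : ∀ φ → (∀ g → φ (g ∙ a) ≡ φ g) → ∑ φ ≡ 2 * ∑ (λ g → χ g ∧ φ g)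
    half φ φ-a = begin
      ∑ φ                                                        ≡⟨ sum-cong-≗ split ⟩
      sum (λ g → ⟦ χ g ∧ φ g ⟧ᴮ + ⟦ χ (g ∙ a) ∧ φ (g ∙ a) ⟧ᴮ)    ≡⟨ ∑-distrib-+ {order} _ _ ⟩
      H + sum (λ g → ⟦ χ (g ∙ a) ∧ φ (g ∙ a) ⟧ᴮ)
        ≡⟨ cong (H +_) (∑-shiftʳ (λ g → ⟦ χ g ∧ φ g ⟧ᴮ)) ⟩
      H + H                                                      ≡⟨ cong (H +_) (ℕ.+-identityʳ H) ⟨
      2 * H                                                      ∎
      where
      open ≡-Reasoning
      H = ∑ (λ g → χ g ∧ φ g)
      split : ∀ g → ⟦ φ g ⟧ᴮ ≡ ⟦ χ g ∧ φ g ⟧ᴮ + ⟦ χ (g ∙ a) ∧ φ (g ∙ a) ⟧ᴮ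
      split g rewrite χ-a g | φ-a g with χ g | φ g
      ... | true  | true  = refl
      ... | true  | false = refl
      ... | false | true  = refl
      ... | false | false = refl

    -- The pairs are the left cosets of ⟨a⟩, and `χ` marks a representative in each. `flips h g`
    -- tells whether h, acting from the left, exchanges marked and unmarked elements on the coset of
    -- g. Multiplied over all cosets this is the transfer from the group into ⟨a⟩.
    flips : El → El → Bool
    flips h g = χ g xor χ (h ∙ g)

    flips-a : ∀ h g → flips h (g ∙ a) ≡ flips h g
    flips-a h g rewrite sym (assoc h g a) | χ-a g | χ-a (h ∙ g) with χ g | χ (h ∙ g)
    ... | true  | true  = refl
    ... | true  | false = refl
    ... | false | true  = refl
    ... | false | false = refl

    count : El → ℕ
    count h = ∑ (λ g → χ g ∧ flips h g)

    -- The permutation induced by h on the pairs {g, ga} lifts to G with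
    -- count h sign changes.
    sign : El → Parity
    sign h = parity (count h)

    -- A flip of h ∙ k at g is the exclusive or of a flip of k at g and one of h at k ∙ g, which
    -- fails to be their sum by twice the places where both occur. The sums run over the whole group
    -- and are halved afterwards, because translation by k does not respect the marking.
    count-∙ : ∀ h k → ∃[ m ] count (h ∙ k) + 2 * m ≡ count h + count k
    count-∙ h k = M , ℕ.*-cancelˡ-≡ _ _ 2 (begin
      2 * (count (h ∙ k) + 2 * M)
        ≡⟨ solve 2 (λ x y → con 2 :* (x :+ con 2 :* y) := con 2 :* x :+ con 2 :* (con 2 :* y)) refl
        (count (h ∙ k)) M ⟩
      2 * count (h ∙ k) + 2 * (2 * M)
        ≡⟨ cong₂ (λ x y → x + 2 * y) (half (flips (h ∙ k)) (flips-a (h ∙ k))) (half both both-a) ⟨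
      ∑ (flips (h ∙ k)) + 2 * ∑ both
        ≡⟨ cong (∑ (flips (h ∙ k)) +_) (cong (∑ both +_) (ℕ.+-identityʳ (∑ both))) ⟩
      ∑ (flips (h ∙ k)) + (∑ both + ∑ both)   ≡⟨ cong (∑ (flips (h ∙ k)) +_) (∑-distrib-+ {order} _ _) ⟨
      ∑ (flips (h ∙ k)) + sum (λ g → ⟦ both g ⟧ᴮ + ⟦ both g ⟧ᴮ) ≡⟨ ∑-distrib-+ {order} _ _ ⟨
      sum (λ g → ⟦ flips (h ∙ k) g ⟧ᴮ + (⟦ both g ⟧ᴮ + ⟦ both g ⟧ᴮ)) ≡⟨ sum-cong-≗ pointwise ⟩
      sum (λ g → ⟦ flips h (k ∙ g) ⟧ᴮ + ⟦ flips k g ⟧ᴮ)         ≡⟨ ∑-distrib-+ {order} _ _ ⟩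
      sum (λ g → ⟦ flips h (k ∙ g) ⟧ᴮ) + ∑ (flips k)
        ≡⟨ cong (_+ ∑ (flips k)) (∑-shiftˡ k (λ g → ⟦ flips h g ⟧ᴮ)) ⟩
      ∑ (flips h) + ∑ (flips k)
        ≡⟨ cong₂ _+_ (half (flips h) (flips-a h)) (half (flips k) (flips-a k)) ⟩
      2 * count h + 2 * count k               ≡⟨ ℕ.*-distribˡ-+ 2 (count h) (count k) ⟨
      2 * (count h + count k)                 ∎)
      where
      open ≡-Reasoning
      open ℕSolver
      both : El → Bool
      both g = flips h (k ∙ g) ∧ flips k g
      both-a : ∀ g → both (g ∙ a) ≡ both g
      both-a g = cong₂ _∧_ (trans (cong (flips h) (sym (assoc k g a))) (flips-a h (k ∙ g))) (flips-a k g)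
      M = ∑ (λ g → χ g ∧ both g)
      pointwise : ∀ g → ⟦ flips (h ∙ k) g ⟧ᴮ + (⟦ both g ⟧ᴮ + ⟦ both g ⟧ᴮ) ≡ ⟦ flips h (k ∙ g)
        ⟧ᴮ + ⟦ flips k g ⟧ᴮ
      pointwise g rewrite assoc h k g with χ g | χ (k ∙ g) | χ (h ∙ (k ∙ g))
      ... | true  | true  | true  = refl
      ... | true  | true  | false = refl
      ... | true  | false | true  = refl
      ... | true  | false | false = refl
      ... | false | true  | true  = refl
      ... | false | true  | false = refl
      ... | false | false | true  = refl
      ... | false | false | false = refl

    parity-+2* : ∀ n m → parity (n + 2 * m) ≡ parity n
    parity-+2* n m = begin
      parity (n + 2 * m)                   ≡⟨ Parity.+-homo-+ n (2 * m) ⟩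
      parity n +ℙ parity (2 * m)           ≡⟨ cong (parity n +ℙ_) (Parity.*-homo-* 2 m) ⟩
      parity n +ℙ 0ℙ                       ≡⟨ Parity.+-identityʳ (parity n) ⟩
      parity n                             ∎
      where open ≡-Reasoning

    sign-∙ : ∀ h k → sign (h ∙ k) ≡ sign h +ℙ sign k
    sign-∙ h k with count-∙ h k
    ... | m , eq = trans (sym (parity-+2* (count (h ∙ k)) m))
      (trans (cong parity eq) (Parity.+-homo-+ (count h) (count k)))

    commutes? : ∀ g → Dec (a ∙ g ∙ a ≡ g)
    commutes? g = a ∙ g ∙ a Fin.≟ g

    commutes⇒ : ∀ {g} → a ∙ g ∙ a ≡ g → a ∙ g ≡ g ∙ a
    commutes⇒ {g} aga = trans (sym (∙a∙a (a ∙ g))) (cong (_∙ a) aga)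

    module _ (no-4 : ∀ x → x ** 4 ≡ ε → x ** 2 ≡ ε)
             (unique : ∀ b → Involution b → a ∙ b ≡ b ∙ a → b ≡ a) where

      conj-a : El → El
      conj-a g = a ∙ g ∙ a

      conj-a² : ∀ g → iter conj-a 2 g ≡ g
      conj-a² g = trans (free (♯₀ ⊙ (♯₀ ⊙ ♯₁ ⊙ ♯₀) ⊙ ♯₀) ((♯₀ ⊙ ♯₀) ⊙ ♯₁ ⊙ (♯₀ ⊙ ♯₀)) (a ∷ g ∷ []) refl)
        (trans (cong₂ (λ x y → x ∙ g ∙ y) a² a²) (trans (identityʳ _) (identityˡ g)))

      weight : El → ℕ
      weight g = ⟦ χ g ∧ flips a g ⟧ᴮ

      weight-conj : ∀ g → weight (conj-a g) ≡ weight g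
      weight-conj g rewrite assoc a g a | sym (assoc a a (g ∙ a)) | a² | identityˡ (g ∙ a)
        | sym (assoc a g a) | χ-a (a ∙ g) | χ-a g with χ g | χ (a ∙ g)
      ... | true  | true  = refl
      ... | true  | false = refl
      ... | false | true  = refl
      ... | false | false = refl

      central : El → ℕ
      central g = [ commutes? g ]· ⟦ χ g ⟧ᴮ

      weight-central : ∀ g → [ commutes? g ]· weight g ≡ central g
      weight-central g with commutes? g
      ... | no _   = refl
      ... | yes ag rewrite commutes⇒ ag | χ-a g with χ g
      ...   | true  = refl
      ...   | false = refl

      Selected : El → Set
      Selected g = a ∙ g ∙ a ≡ g × χ g ≡ true

      selected? : ∀ g → Dec (Selected g)
      selected? g = commutes? g ×-dec (χ g Bool.≟ true)

      -- Inversion on the pairs inside the centralizer of a, returned to the marked element of the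
      -- pair.
      flip : El → El
      flip g = if χ (g ⁻¹) then g ⁻¹ else g ⁻¹ ∙ a

      ⁻¹-commutes : ∀ {g} → a ∙ g ∙ a ≡ g → a ∙ g ⁻¹ ∙ a ≡ g ⁻¹
      ⁻¹-commutes {g} aga = begin
        a ∙ g ⁻¹ ∙ a          ≡⟨ cong (λ b → b ∙ g ⁻¹ ∙ b) (involution-⁻¹ a²) ⟨
        a ⁻¹ ∙ g ⁻¹ ∙ a ⁻¹    ≡⟨ free (inv ♯₀ ⊙ inv ♯₁ ⊙ inv ♯₀) (inv (♯₀ ⊙ ♯₁ ⊙ ♯₀)) (a ∷ g ∷ []) refl ⟩
        (a ∙ g ∙ a) ⁻¹        ≡⟨ cong _⁻¹ aga ⟩
        g ⁻¹                  ∎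
        where open ≡-Reasoning

      flip-selected : ∀ {g} → Selected g → Selected (flip g)
      flip-selected {g} (aga , χg) with χ (g ⁻¹) in eq
      ... | true  = ⁻¹-commutes aga , eq
      ... | false = trans (cong (_∙ a) (trans (sym (assoc a (g ⁻¹) a)) (⁻¹-commutes aga))) refl
                  , trans (χ-a (g ⁻¹)) (cong not eq)

      flip-flip : ∀ {g} → Selected g → flip (flip g) ≡ g
      flip-flip {g} (aga , χg) with χ (g ⁻¹) in eq
      ... | true  rewrite ⁻¹-involutive g | χg = refl
      ... | false = trans (cong (λ h → if χ h then h else h ∙ a) inverse)
            (trans (cong (λ b → if b then g ∙ a else g ∙ a ∙ a) (trans (χ-a g) (cong not χg))) (∙a∙a g))
        where
        inverse : (g ⁻¹ ∙ a) ⁻¹ ≡ g ∙ a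
        inverse = trans (⁻¹-anti-homo-∙ (g ⁻¹) a)
          (trans (cong₂ _∙_ (involution-⁻¹ a²) (⁻¹-involutive g)) (commutes⇒ aga))

      -- Extension of `flip` by the identity to an involution of all of G, the form in which the
      -- orbit count applies.
      ι : El → El
      ι g = if does (selected? g) then flip g else g

      ι-selected : ∀ {g} → Selected g → ι g ≡ flip g
      ι-selected {g} s rewrite dec-true (selected? g) s = refl

      ι-unselected : ∀ {g} → ¬ Selected g → ι g ≡ g
      ι-unselected {g} ¬s rewrite dec-false (selected? g) ¬s = refl

      ι² : ∀ g → iter ι 2 g ≡ g
      ι² g = go (selected? g)
        where
        go : Dec (Selected g) → ι (ι g) ≡ g
        go (yes s) = trans (cong ι (ι-selected s)) (trans (ι-selected (flip-selected s)) (flip-flip s))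
        go (no ¬s) = trans (cong ι (ι-unselected ¬s)) (ι-unselected ¬s)

      indicator : El → ℕ
      indicator g = [ selected? g ]· 1

      central-indicator : ∀ g → central g ≡ indicator g
      central-indicator g with commutes? g
      ... | no _  = refl
      ... | yes _ with χ g
      ...   | true  = refl
      ...   | false = refl

      indicator-ι : ∀ g → indicator (ι g) ≡ indicator g
      indicator-ι g = go (selected? g)
        where
        go : Dec (Selected g) → indicator (ι g) ≡ indicator g
        go (yes s) =
          trans (trans (cong indicator (ι-selected s)) ([yes]· (selected? (flip g)) 1 (flip-selected s)))
          (sym ([yes]· (selected? g) 1 s))
        go (no ¬s) = cong indicator (ι-unselected ¬s)

      -- The marked element of the pair {1, a}.
      g₀ : El
      g₀ = if χ ε then ε else a

      χ-g₀ : χ g₀ ≡ true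
      χ-g₀ with χ ε in eq
      ... | true  = eq
      ... | false = trans (cong χ (sym (identityˡ a))) (trans (χ-a ε) (cong not eq))

      g₀²-commutes : g₀ ∙ g₀ ≡ ε × a ∙ g₀ ∙ a ≡ g₀
      g₀²-commutes with χ ε
      ... | true  = identityˡ ε , trans (cong (_∙ a) (identityʳ a)) a²
      ... | false = a² , ∙a∙a a

      g₀-fixed : ι g₀ ≡ g₀
      g₀-fixed = trans (ι-selected (proj₂ g₀²-commutes , χ-g₀))
        (trans (cong (λ h → if χ h then h else h ∙ a) (involution-⁻¹ (proj₁ g₀²-commutes)))
          (cong (λ b → if b then g₀ else g₀ ∙ a) χ-g₀))

      fixed⇒g₀ : ∀ {g} → Selected g → flip g ≡ g → g ≡ g₀
      fixed⇒g₀ {g} (aga , χg) eq with χ (g ⁻¹)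
      ... | true = select (g Fin.≟ ε)
        where
        g² : g ∙ g ≡ ε
        g² = trans (cong (_∙ g) (sym eq)) (inverseˡ g)
        select : Dec (g ≡ ε) → g ≡ g₀
        select (yes refl) = sym (cong (λ b → if b then ε else a) χg)
        select (no g≢ε) with unique g (g≢ε , g²) (commutes⇒ aga)
        ... | refl = sym (cong (λ b → if b then ε else a)
                (trans (cong χ (sym a²)) (trans (χ-a a) (cong not χg))))
      ... | false = contradiction (trans (sym g²) g²≡ε) (proj₁ a-inv)
        where
        g² : g ∙ g ≡ a
        g² = trans (cong (g ∙_) (sym eq)) (free (♯₀ ⊙ (inv ♯₀ ⊙ ♯₁)) ♯₁ (g ∷ a ∷ []) refl)
        g²≡ε : g ∙ g ≡ ε
        g²≡ε = trans (free (♯₀ ⊙ ♯₀) (♯₀ **ʷ 2) (g ∷ []) refl) (no-4 g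
          (trans (free (♯₀ **ʷ 4) ((♯₀ ⊙ ♯₀) ⊙ (♯₀ ⊙ ♯₀)) (g ∷ []) refl) (trans (cong₂ _∙_ g² g²) a²)))

      -- Two orbit counts modulo 2. Conjugation by a preserves `weight`, which leaves the marked
      -- elements commuting with a, each of weight 1. On their pairs inversion acts, and a fixed
      -- pair has g² = a or g² = 1. The former would make g of order 4; the latter leaves only the
      -- pair {1, a}, as a is the only involution commuting with a. One fixed pair makes the parity
      -- odd.
      sign-a : sign a ≡ 1ℙ
      sign-a = begin
        parity (sum weight)                         ≡⟨ cong parity (proj₂ first) ⟩
        parity (sum (λ g → [ conj-a g Fin.≟ g ]· weight g) + 2 * m₁)
          ≡⟨ parity-+2* (sum (λ g → [ conj-a g Fin.≟ g ]· weight g)) m₁ ⟩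
        parity (sum (λ g → [ commutes? g ]· weight g))
          ≡⟨ cong parity (sum-cong-≗ λ g → trans (weight-central g) (central-indicator g)) ⟩
        parity (sum indicator)                      ≡⟨ cong parity (proj₂ second) ⟩
        parity (sum (λ g → [ ι g Fin.≟ g ]· indicator g) + 2 * m₂)
          ≡⟨ parity-+2* (sum (λ g → [ ι g Fin.≟ g ]· indicator g)) m₂ ⟩
        parity (sum (λ g → [ ι g Fin.≟ g ]· indicator g)) ≡⟨ cong parity (sum-single _ g₀ others) ⟩
        parity ([ ι g₀ Fin.≟ g₀ ]· indicator g₀)
          ≡⟨ cong parity (trans ([yes]· (ι g₀ Fin.≟ g₀) _ g₀-fixed)
          ([yes]· (selected? g₀) 1 (proj₂ g₀²-commutes , χ-g₀))) ⟩
        1ℙ                                          ∎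
        where
        open ≡-Reasoning
        first = Orbits.Count.orbit-count prime[2] conj-a conj-a² weight weight-conj
        second = Orbits.Count.orbit-count prime[2] ι ι² indicator indicator-ι
        m₁ = proj₁ first
        m₂ = proj₁ second
        others : ∀ g → g ≢ g₀ → [ ι g Fin.≟ g ]· indicator g ≡ 0
        others g g≢g₀ = go (ι g Fin.≟ g) (selected? g)
          where
          go : (d : Dec (ι g ≡ g)) (e : Dec (Selected g)) → [ d ]· ([ e ]· 1) ≡ 0
          go (no _)   _       = refl
          go (yes _)  (no _)  = refl
          go (yes ιg) (yes s) = contradiction (fixed⇒g₀ s (trans (sym (ι-selected s)) ιg)) g≢g₀

-- What the small Cayley graphs of a group in 𝓑 3 say about the group.
record Restricted (G : FinGroup) : Set where
  open FinGroup G
  open GroupLemmas G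
  field
    exponent-10       : ∀ x → x ** 10 ≡ ε
    involution-unique : ∀ {a b} → Involution a → Involution b → a ∙ b ≡ b ∙ a → a ≡ b
    no-mixed-plane    : ∀ {a x y} → Involution a → x ≢ ε → x ** 5 ≡ ε → y ≢ ε → y ** 5 ≡ ε →
      a ∙ x ∙ a ≡ x ⁻¹ → a ∙ y ≡ y ∙ a → ¬ x ∙ y ≡ y ∙ x
    no-inverted-plane : ∀ {a x y} → Involution a → x ≢ ε → x ** 5 ≡ ε → y ** 5 ≡ ε →
      (∀ (i : Fin 5) → y ≢ x ** toℕ i) → a ∙ x ∙ a ≡ x ⁻¹ → a ∙ y ∙ a ≡ y ⁻¹ → ¬ x ∙ y ≡ y ∙ x

-- The internal form of P × ℤ₂: `sgn` is the projection to the second factor, and P will be its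
-- kernel.
record CentralInvolution (G : FinGroup) : Set where
  open FinGroup G
  field
    e          : El
    e²         : e ∙ e ≡ ε
    e-central  : ∀ g → e ∙ g ≡ g ∙ e
    sgn        : El → Parity
    sgn-∙      : ∀ g h → sgn (g ∙ h) ≡ sgn g +ℙ sgn h
    sgn-e      : sgn e ≡ 1ℙ
    exponent-5 : ∀ g → sgn g ≡ 0ℙ → g ** 5 ≡ ε

[_]ᴾ : Parity → ℕ
[ 0ℙ ]ᴾ = 0
[ 1ℙ ]ᴾ = 1

record Dihedral (G : FinGroup) : Set where
  open FinGroup G
  field
    r f     : El
    r≢ε     : r ≢ ε
    r⁵      : r ** 5 ≡ ε
    f≢ε     : f ≢ ε
    f²      : f ∙ f ≡ ε
    frf     : f ∙ r ∙ f ≡ r ⁻¹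
    covered : ∀ g → Σ[ i ∈ Fin 5 ] Σ[ s ∈ Parity ] g ≡ r ** toℕ i ∙ f ** [ s ]ᴾ

-- The trichotomy for groups obeying the restrictions

module _ (G : FinGroup) (restricted : Restricted G) where
  open import Data.Nat.Base using (_+_; _*_)
  open import Data.Nat.Divisibility using (_∣_; ∣m+n∣m⇒∣n; m∣m*n; divides)
  open MonoidSum ℕ.+-0-commutativeMonoid using (sum)
  open FinGroup G
  open GroupLemmas G
  open Restricted restricted

  power-5-involution : ∀ x → x ** 5 ≡ ε ⊎ Involution (x ** 5)
  power-5-involution x with x ** 5 Fin.≟ ε
  ... | yes x⁵ = inj₁ x⁵
  ... | no ¬x⁵ = inj₂ (¬x⁵ , square-of-power x (exponent-10 x))

  inverted-by-involution : ∀ {a b} → a ∙ a ≡ ε → b ∙ b ≡ ε → a ∙ (a ∙ b) ∙ a ≡ (a ∙ b) ⁻¹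
  inverted-by-involution {a} {b} a² b² = begin
    a ∙ (a ∙ b) ∙ a     ≡⟨ free (♯₀ ⊙ (♯₀ ⊙ ♯₁) ⊙ ♯₀) (𝟏 ⊙ (♯₀ ⊙ ♯₀) ⊙ inv 𝟏 ⊙ (♯₁ ⊙ ♯₀)) (a ∷ b ∷ []) refl ⟩
    ε ∙ (a ∙ a) ∙ ε ⁻¹ ∙ (b ∙ a) ≡⟨ insert ε (b ∙ a) a² ⟩
    b ∙ a               ≡⟨ cong₂ _∙_ (involution-⁻¹ b²) (involution-⁻¹ a²) ⟨
    b ⁻¹ ∙ a ⁻¹         ≡⟨ ⁻¹-anti-homo-∙ a b ⟨
    (a ∙ b) ⁻¹          ∎
    where open ≡-Reasoning

  self-inverse-commutes : ∀ {a x} → a ∙ a ≡ ε → x ∙ x ≡ ε → a ∙ x ∙ a ≡ x ⁻¹ → a ∙ x ≡ x ∙ a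
  self-inverse-commutes {a} {x} a² x² axa = begin
    a ∙ x              ≡⟨ free (♯₀ ⊙ ♯₁) (♯₀ ⊙ ♯₁ ⊙ ♯₀ ⊙ inv ♯₀) (a ∷ x ∷ []) refl ⟩
    a ∙ x ∙ a ∙ a ⁻¹   ≡⟨ cong₂ _∙_ (trans axa (involution-⁻¹ x²)) (involution-⁻¹ a²) ⟩
    x ∙ a              ∎
    where open ≡-Reasoning

  -- Both a and b invert x = ab and hence c = x⁵. If c ≠ 1, then c is an involution, for which being
  -- inverted means to commute; so a = c = b by uniqueness, and x is trivial after all.
  product-of-involutions : ∀ {a b} → Involution a → Involution b → (a ∙ b) ** 5 ≡ ε
  product-of-involutions {a} {b} a-inv@(_ , a²) b-inv@(_ , b²) with power-5-involution (a ∙ b)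
  ... | inj₁ x⁵ = x⁵
  ... | inj₂ c-inv@(_ , c²) =
    trans (cong (_** 5) (trans (cong (_∙ b) (trans a≡c c≡b)) b²)) (free (𝟏 {0} **ʷ 5) 𝟏 [] refl)
    where
    x c : El
    x = a ∙ b
    c = x ** 5
    bxb : b ∙ x ∙ b ≡ x ⁻¹
    bxb = begin
      b ∙ (a ∙ b) ∙ b     ≡⟨ free (♯₁ ⊙ (♯₀ ⊙ ♯₁) ⊙ ♯₁) (♯₁ ⊙ ♯₀ ⊙ (♯₁ ⊙ ♯₁)) (a ∷ b ∷ []) refl ⟩
      b ∙ a ∙ (b ∙ b)     ≡⟨ trans (cong (b ∙ a ∙_) b²) (identityʳ _) ⟩
      b ∙ a               ≡⟨ cong₂ _∙_ (involution-⁻¹ b²) (involution-⁻¹ a²) ⟨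
      b ⁻¹ ∙ a ⁻¹         ≡⟨ ⁻¹-anti-homo-∙ a b ⟨
      (a ∙ b) ⁻¹          ∎
      where open ≡-Reasoning
    a≡c : a ≡ c
    a≡c = involution-unique a-inv c-inv
      (self-inverse-commutes a² c² (invert-power {x = x} 5 a² (inverted-by-involution a² b²)))
    c≡b : c ≡ b
    c≡b = sym (involution-unique b-inv c-inv (self-inverse-commutes b² c² (invert-power {x = x} 5 b² bxb)))

  conjugate-involution : ∀ {a} → Involution a → ∀ g → Involution (g ∙ a ∙ g ⁻¹)
  conjugate-involution {a} (a≢ε , a²) g = (λ eq → a≢ε (begin
      a                          ≡⟨ free ♯₀ (inv ♯₁ ⊙ (♯₁ ⊙ ♯₀ ⊙ inv ♯₁) ⊙ ♯₁) (a ∷ g ∷ []) refl ⟩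
      g ⁻¹ ∙ (g ∙ a ∙ g ⁻¹) ∙ g  ≡⟨ cong (λ z → g ⁻¹ ∙ z ∙ g) eq ⟩
      g ⁻¹ ∙ ε ∙ g               ≡⟨ free (inv ♯₀ ⊙ 𝟏 ⊙ ♯₀) 𝟏 (g ∷ []) refl ⟩
      ε                          ∎))
    , (begin
      g ∙ a ∙ g ⁻¹ ∙ (g ∙ a ∙ g ⁻¹)
        ≡⟨ free (♯₁ ⊙ ♯₀ ⊙ inv ♯₁ ⊙ (♯₁ ⊙ ♯₀ ⊙ inv ♯₁)) (♯₁ ⊙ (♯₀ ⊙ ♯₀) ⊙ inv ♯₁ ⊙ 𝟏) (a ∷ g ∷ []) refl ⟩
      g ∙ (a ∙ a) ∙ g ⁻¹ ∙ ε        ≡⟨ insert g ε a² ⟩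
      ε                             ∎)
    where open ≡-Reasoning

  module WithInvolution (a : El) (a-inv : Involution a)
    (sign : El → Parity) (sign-∙ : ∀ g h → sign (g ∙ h) ≡ sign g +ℙ sign h) (sgn-a : sign a ≡ 1ℙ) where

    a² : a ∙ a ≡ ε
    a² = proj₂ a-inv

    p+p : ∀ p → p +ℙ p ≡ 0ℙ
    p+p 0ℙ = refl
    p+p 1ℙ = refl

    sign-ε : sign ε ≡ 0ℙ
    sign-ε = trans (cong sign (sym a²)) (trans (sign-∙ a a) (p+p (sign a)))

    sign-⁵ : ∀ x → sign (x ** 5) ≡ sign x
    sign-⁵ x = begin
      sign (x ** 5)                                 ≡⟨ step 4 ⟩
      p +ℙ sign (x ** 4)                            ≡⟨ cong (p +ℙ_) (step 3) ⟩
      p +ℙ (p +ℙ sign (x ** 3))                     ≡⟨ cong (λ t → p +ℙ (p +ℙ t)) (step 2) ⟩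
      p +ℙ (p +ℙ (p +ℙ sign (x ** 2)))              ≡⟨ cong (λ t → p +ℙ (p +ℙ (p +ℙ t))) (step 1) ⟩
      p +ℙ (p +ℙ (p +ℙ (p +ℙ sign (x ** 1))))
        ≡⟨ cong (λ t → p +ℙ (p +ℙ (p +ℙ (p +ℙ t)))) (cong sign (identityʳ x)) ⟩
      p +ℙ (p +ℙ (p +ℙ (p +ℙ p)))                   ≡⟨ five p ⟩
      p                                             ∎
      where
      open ≡-Reasoning
      p : Parity
      p = sign x
      step : ∀ k → sign (x ** suc k) ≡ p +ℙ sign (x ** k)
      step k = sign-∙ x (x ** k)
      five : ∀ p → p +ℙ (p +ℙ (p +ℙ (p +ℙ p))) ≡ p
      five 0ℙ = refl
      five 1ℙ = refl

    sign-of-order-5 : ∀ {x} → x ** 5 ≡ ε → sign x ≡ 0ℙ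
    sign-of-order-5 {x} x⁵ = trans (sym (sign-⁵ x)) (trans (cong sign x⁵) sign-ε)

    sum-0 : ∀ {p q} → p +ℙ q ≡ 0ℙ → p ≡ 1ℙ → q ≡ 1ℙ
    sum-0 {1ℙ} {1ℙ} _ _ = refl

    -- The product ab has order dividing 5, hence sign 0, so that b has the same sign as a.
    sign-of-involution : ∀ {b} → Involution b → sign b ≡ 1ℙ
    sign-of-involution {b} b-inv = sum-0
      (trans (sym (sign-∙ a b)) (sign-of-order-5 (product-of-involutions a-inv b-inv))) sgn-a

    kernel-exponent : ∀ x → sign x ≡ 0ℙ → x ** 5 ≡ ε
    kernel-exponent x sx with power-5-involution x
    ... | inj₁ x⁵ = x⁵
    ... | inj₂ x⁵-inv with trans (sym (trans (sign-⁵ x) sx)) (sign-of-involution x⁵-inv)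
    ...   | ()

    central-case : (∀ g → a ∙ g ≡ g ∙ a) → CentralInvolution G
    central-case central = record
      { e = a ; e² = a² ; e-central = central ; sgn = sign ; sgn-∙ = sign-∙ ; sgn-e = sgn-a ; exponent-5 =
        kernel-exponent }

    module Noncentral (b : El) (b-inv : Involution b) (b≢a : b ≢ a) where

      x : El
      x = a ∙ b

      x⁵ : x ** 5 ≡ ε
      x⁵ = product-of-involutions a-inv b-inv

      x≢ε : x ≢ ε
      x≢ε eq = b≢a (∙-cancelˡ a b a (trans eq (sym a²)))

      axa : a ∙ x ∙ a ≡ x ⁻¹
      axa = inverted-by-involution a² (proj₂ b-inv)

      x²≢ε : x ∙ x ≢ ε
      x²≢ε x² = x≢ε (order-2-and-5 x² x⁵)

      conj : El → El → El
      conj y c = y ∙ c ∙ y ⁻¹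

      conj⁵ : ∀ {y} → y ** 5 ≡ ε → ∀ c → iter (conj y) 5 c ≡ c
      conj⁵ {y} y⁵ c = begin
        iter (conj y) 5 c ≡⟨ free
          (♯₀ ⊙ (♯₀ ⊙ (♯₀ ⊙ (♯₀ ⊙ (♯₀ ⊙ ♯₁ ⊙ inv ♯₀) ⊙ inv ♯₀) ⊙ inv ♯₀) ⊙ inv ♯₀) ⊙ inv ♯₀)
          (♯₀ **ʷ 5 ⊙ ♯₁ ⊙ inv (♯₀ **ʷ 5)) (y ∷ c ∷ []) refl ⟩
        y ** 5 ∙ c ∙ (y ** 5) ⁻¹ ≡⟨ cong (λ z → z ∙ c ∙ z ⁻¹) y⁵ ⟩
        ε ∙ c ∙ ε ⁻¹             ≡⟨ free (𝟏 ⊙ ♯₀ ⊙ inv 𝟏) ♯₀ (c ∷ []) refl ⟩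
        c                        ∎
        where open ≡-Reasoning

      fixed⇒commutes : ∀ {y c} → conj y c ≡ c → y ∙ c ≡ c ∙ y
      fixed⇒commutes {y} {c} eq =
        trans (free (♯₀ ⊙ ♯₁) (♯₀ ⊙ ♯₁ ⊙ inv ♯₀ ⊙ ♯₀) (y ∷ c ∷ []) refl) (cong (_∙ y) eq)

      commutes⇒fixed : ∀ {y c} → y ∙ c ≡ c ∙ y → conj y c ≡ c
      commutes⇒fixed {y} {c} eq = trans (cong (_∙ y ⁻¹) eq) (free (♯₁ ⊙ ♯₀ ⊙ inv ♯₀) ♯₁ (y ∷ c ∷ []) refl)

      -- The plane is spanned by ac and y: a inverts ac, while y commutes with a and with c, hence
      -- with ac.
      commuting⇒mixed-plane : ∀ {y} → y ≢ ε → y ** 5 ≡ ε → a ∙ y ≡ y ∙ a →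
        ∀ {c} → Involution c → c ≢ a → y ∙ c ≡ c ∙ y → Data.Empty.⊥
      commuting⇒mixed-plane {y} y≢ε y⁵ ay {c} c-inv c≢a yc = no-mixed-plane a-inv
        (λ ac≡ε → c≢a (∙-cancelˡ a c a (trans ac≡ε (sym a²))))
        (product-of-involutions a-inv c-inv) y≢ε y⁵ (inverted-by-involution a² (proj₂ c-inv)) ay
        (begin
          a ∙ c ∙ y     ≡⟨ assoc a c y ⟩
          a ∙ (c ∙ y)   ≡⟨ cong (a ∙_) yc ⟨
          a ∙ (y ∙ c)   ≡⟨ assoc a y c ⟨
          a ∙ y ∙ c     ≡⟨ cong (_∙ c) ay ⟩
          y ∙ a ∙ c     ≡⟨ assoc y a c ⟩
          y ∙ (a ∙ c)   ∎)
        where open ≡-Reasoning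

      involutions : El → ℕ
      involutions c = [ involution? c ]· 1

      involutions-conj : ∀ y c → involutions (conj y c) ≡ involutions c
      involutions-conj y c = go (involution? c)
        where
        go : Dec (Involution c) → involutions (conj y c) ≡ involutions c
        go (yes c-inv) = trans ([yes]· (involution? (conj y c)) 1 (conjugate-involution c-inv y))
          (sym ([yes]· (involution? c) 1 c-inv))
        go (no ¬c-inv) = trans ([no]· (involution? (conj y c)) 1 λ inv′ → ¬c-inv (subst Involution
            (free (inv ♯₀ ⊙ (♯₀ ⊙ ♯₁ ⊙ inv ♯₀) ⊙ inv (inv ♯₀)) ♯₁ (y ∷ c ∷ []) refl)
              (conjugate-involution inv′ (y ⁻¹))))
          (sym ([no]· (involution? c) 1 ¬c-inv))

      -- If c commutes with x, conjugation by u = ca inverts x. As u⁵ = 1, the fifth iterate of this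
      -- conjugation is the identity, yet it still inverts x.
      no-involution-commutes-with-x : ∀ {c} → Involution c → ¬ x ∙ c ≡ c ∙ x
      no-involution-commutes-with-x {c} c-inv@(_ , c²) xc = x²≢ε (trans (cong (x ∙_) x≡x⁻¹) (inverseʳ x))
        where
        u : El
        u = c ∙ a
        u⁵ : u ** 5 ≡ ε
        u⁵ = product-of-involutions c-inv a-inv
        flip-u : conj u x ≡ x ⁻¹
        flip-u = begin
          c ∙ a ∙ x ∙ (c ∙ a) ⁻¹
            ≡⟨ free (♯₀ ⊙ ♯₁ ⊙ ♯₂ ⊙ inv (♯₀ ⊙ ♯₁)) (♯₀ ⊙ (♯₁ ⊙ ♯₂ ⊙ inv ♯₁) ⊙ inv ♯₀) (c ∷ a ∷ x ∷ []) refl ⟩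
          c ∙ (a ∙ x ∙ a ⁻¹) ∙ c ⁻¹   ≡⟨ cong (λ z → c ∙ (a ∙ x ∙ z) ∙ c ⁻¹) (involution-⁻¹ a²) ⟩
          c ∙ (a ∙ x ∙ a) ∙ c ⁻¹      ≡⟨ cong (λ z → c ∙ z ∙ c ⁻¹) axa ⟩
          c ∙ x ⁻¹ ∙ c ⁻¹
            ≡⟨ free (♯₀ ⊙ inv ♯₁ ⊙ inv ♯₀) (inv (♯₀ ⊙ ♯₁ ⊙ inv ♯₀)) (c ∷ x ∷ []) refl ⟩
          (c ∙ x ∙ c ⁻¹) ⁻¹           ≡⟨ cong _⁻¹ (commutes⇒fixed (sym xc)) ⟩
          x ⁻¹                        ∎
          where open ≡-Reasoning
        flip-u′ : conj u (x ⁻¹) ≡ x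
        flip-u′ = trans (free (♯₀ ⊙ inv ♯₁ ⊙ inv ♯₀) (inv (♯₀ ⊙ ♯₁ ⊙ inv ♯₀)) (u ∷ x ∷ []) refl)
          (trans (cong _⁻¹ flip-u) (⁻¹-involutive x))
        x≡x⁻¹ : x ≡ x ⁻¹
        x≡x⁻¹ = trans (sym (conj⁵ u⁵ x)) (trans (cong (iter (conj u) 4) flip-u)
          (trans (cong (iter (conj u) 3) flip-u′)
          (trans (cong (iter (conj u) 2) flip-u) (trans (cong (conj u) flip-u′) flip-u))))

      -- Conjugation by x fixes no involution, so 5 divides their number, and
      -- hence the number of those commuting with y.
      no-fixed-points : ∀ {y} → y ≢ ε → y ** 5 ≡ ε → ¬ a ∙ y ≡ y ∙ a
      no-fixed-points {y} y≢ε y⁵ ay with Fin.any?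
        (λ c → ¬? (c Fin.≟ a) ×-dec (involution? c ×-dec (y ∙ c Fin.≟ c ∙ y)))
      ... | yes (c , c≢a , c-inv , yc) = commuting⇒mixed-plane y≢ε y⁵ ay c-inv c≢a yc
      ... | no only-a = contradiction 5∣1 λ { (divides 0 ()) ; (divides (suc _) ()) }
        where
        open ≡-Reasoning
        5-prime : Prime 5
        5-prime = from-yes (prime? 5)
        countˣ = Orbits.Count.orbit-count 5-prime (conj x) (conj⁵ x⁵) involutions (involutions-conj x)
        countʸ = Orbits.Count.orbit-count 5-prime (conj y) (conj⁵ y⁵) involutions (involutions-conj y)
        fixedˣ : sum (λ c → [ conj x c Fin.≟ c ]· involutions c) ≡ 0
        fixedˣ = sum-zero λ c → go (conj x c Fin.≟ c) (involution? c)
          where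
          go : ∀ {c} (d : Dec (conj x c ≡ c)) (e : Dec (Involution c)) → [ d ]· ([ e ]· 1) ≡ 0
          go (no _)   _           = refl
          go (yes _)  (no _)      = refl
          go (yes eq) (yes c-inv) = contradiction (fixed⇒commutes eq) (no-involution-commutes-with-x c-inv)
        fixedʸ : sum (λ c → [ conj y c Fin.≟ c ]· involutions c) ≡ 1
        fixedʸ = trans (sum-single _ a λ c c≢a → go c≢a (conj y c Fin.≟ c) (involution? c))
          (trans ([yes]· (conj y a Fin.≟ a) _ (commutes⇒fixed (sym ay))) ([yes]· (involution? a) 1 a-inv))
          where
          go : ∀ {c} → c ≢ a → (d : Dec (conj y c ≡ c)) (e : Dec (Involution c)) → [ d ]· ([ e ]· 1) ≡ 0
          go c≢a (no _)   _           = refl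
          go c≢a (yes _)  (no _)      = refl
          go c≢a (yes eq) (yes c-inv) = contradiction (_ , c≢a , c-inv , fixed⇒commutes eq) only-a
        m n : ℕ
        m = proj₁ countʸ
        n = proj₁ countˣ
        total : 5 * m + 1 ≡ 5 * n
        total = begin
          5 * m + 1                 ≡⟨ ℕ.+-comm (5 * m) 1 ⟩
          1 + 5 * m                 ≡⟨ cong (_+ 5 * m) fixedʸ ⟨
          _                         ≡⟨ proj₂ countʸ ⟨
          sum involutions           ≡⟨ proj₂ countˣ ⟩
          _                         ≡⟨ cong (_+ 5 * n) fixedˣ ⟩
          5 * n                     ∎
        5∣1 : 5 ∣ 1
        5∣1 = ∣m+n∣m⇒∣n (subst (5 ∣_) (sym total) (m∣m*n n)) (m∣m*n m)

      -- Besides y, an element w inverted by a conjugates a to c = y⁻¹ay. With z = ac it is w = z³,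
      -- the square root of z in ⟨z⟩: w⁻¹aw = aw² = az = c. Then v = yw⁻¹ commutes with a and lies
      -- in the kernel, so v = 1 by `no-fixed-points`.
      kernel-inverted : ∀ y → sign y ≡ 0ℙ → a ∙ y ∙ a ≡ y ⁻¹
      kernel-inverted y sy = subst (λ t → a ∙ t ∙ a ≡ t ⁻¹) (sym y≡w) awa
        where
        open ≡-Reasoning
        c z w v : El
        c = y ⁻¹ ∙ a ∙ y ⁻¹ ⁻¹
        c-inv : Involution c
        c-inv = conjugate-involution a-inv (y ⁻¹)
        z = a ∙ c
        z⁵ : z ** 5 ≡ ε
        z⁵ = product-of-involutions a-inv c-inv
        w = z ** 3
        awa : a ∙ w ∙ a ≡ w ⁻¹
        awa = invert-power 3 a² (inverted-by-involution a² (proj₂ c-inv))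
        w⁻¹aw : w ⁻¹ ∙ a ∙ w ≡ c
        w⁻¹aw = begin
          w ⁻¹ ∙ a ∙ w                    ≡⟨ cong (λ t → t ∙ a ∙ w) awa ⟨
          a ∙ w ∙ a ∙ a ∙ w
            ≡⟨ free (♯₀ ⊙ ♯₁ **ʷ 3 ⊙ ♯₀ ⊙ ♯₀ ⊙ ♯₁ **ʷ 3) (♯₀ ⊙ ♯₁ **ʷ 3 ⊙ (♯₀ ⊙ ♯₀) ⊙ ♯₁ **ʷ 3)
            (a ∷ z ∷ []) refl ⟩
          a ∙ w ∙ (a ∙ a) ∙ w             ≡⟨ cong (λ t → a ∙ w ∙ t ∙ w) a² ⟩
          a ∙ w ∙ ε ∙ w
            ≡⟨ free (♯₀ ⊙ ♯₁ **ʷ 3 ⊙ 𝟏 ⊙ ♯₁ **ʷ 3) (♯₀ ⊙ ♯₁ **ʷ 5 ⊙ ♯₁) (a ∷ z ∷ []) refl ⟩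
          a ∙ z ** 5 ∙ z                  ≡⟨ cong (λ t → a ∙ t ∙ z) z⁵ ⟩
          a ∙ ε ∙ (a ∙ c)
            ≡⟨ free (♯₀ ⊙ 𝟏 ⊙ (♯₀ ⊙ ♯₁)) (𝟏 ⊙ (♯₀ ⊙ ♯₀) ⊙ inv 𝟏 ⊙ ♯₁) (a ∷ c ∷ []) refl ⟩
          ε ∙ (a ∙ a) ∙ ε ⁻¹ ∙ c          ≡⟨ insert ε c a² ⟩
          c                               ∎
        v = y ∙ w ⁻¹
        av : a ∙ v ≡ v ∙ a
        av = begin
          a ∙ (y ∙ w ⁻¹)
            ≡⟨ free (♯₀ ⊙ (♯₁ ⊙ inv ♯₂)) (♯₁ ⊙ (inv ♯₁ ⊙ ♯₀ ⊙ inv (inv ♯₁)) ⊙ inv ♯₂) (a ∷ y ∷ w ∷ []) refl ⟩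
          y ∙ c ∙ w ⁻¹                           ≡⟨ cong (λ t → y ∙ t ∙ w ⁻¹) w⁻¹aw ⟨
          y ∙ (w ⁻¹ ∙ a ∙ w) ∙ w ⁻¹
            ≡⟨ free (♯₁ ⊙ (inv ♯₂ ⊙ ♯₀ ⊙ ♯₂) ⊙ inv ♯₂) (♯₁ ⊙ inv ♯₂ ⊙ ♯₀) (a ∷ y ∷ w ∷ []) refl ⟩
          y ∙ w ⁻¹ ∙ a                           ∎
        w⁵ : w ** 5 ≡ ε
        w⁵ = begin
          w ** 5              ≡⟨ free ((♯₀ **ʷ 3) **ʷ 5) ((♯₀ **ʷ 5) **ʷ 3) (z ∷ []) refl ⟩
          (z ** 5) ** 3       ≡⟨ cong (_** 3) z⁵ ⟩
          ε ** 3              ≡⟨ free (𝟏 {0} **ʷ 3) 𝟏 [] refl ⟩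
          ε                   ∎
        w⁻¹⁵ : (w ⁻¹) ** 5 ≡ ε
        w⁻¹⁵ = trans (free (inv ♯₀ **ʷ 5) (inv (♯₀ **ʷ 5)) (w ∷ []) refl) (trans (cong _⁻¹ w⁵) ε⁻¹≈ε)
        sv : sign v ≡ 0ℙ
        sv = trans (sign-∙ y (w ⁻¹)) (cong₂ _+ℙ_ sy (sign-of-order-5 w⁻¹⁵))
        v≡ε : v ≡ ε
        v≡ε = decidable-stable (v Fin.≟ ε) λ v≢ε → no-fixed-points v≢ε (kernel-exponent v sv) av
        y≡w : y ≡ w
        y≡w = trans (free ♯₀ (♯₀ ⊙ inv ♯₁ ⊙ ♯₁) (y ∷ w ∷ []) refl) (trans (cong (_∙ w) v≡ε) (identityˡ w))

      -- Conjugation by a inverts x, y and xy, so that (xy)⁻¹ = x⁻¹y⁻¹.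
      x-y-commute : ∀ y → sign y ≡ 0ℙ → x ∙ y ≡ y ∙ x
      x-y-commute y sy = ⁻¹-injective (begin
        (x ∙ y) ⁻¹
          ≡⟨ kernel-inverted (x ∙ y) (trans (sign-∙ x y) (cong₂ _+ℙ_ (sign-of-order-5 x⁵) sy)) ⟨
        a ∙ (x ∙ y) ∙ a
          ≡⟨ free (♯₀ ⊙ (♯₁ ⊙ ♯₂) ⊙ ♯₀) (♯₀ ⊙ ♯₁ ⊙ inv ♯₀ ⊙ (♯₀ ⊙ ♯₂ ⊙ ♯₀)) (a ∷ x ∷ y ∷ []) refl ⟩
        a ∙ x ∙ a ⁻¹ ∙ (a ∙ y ∙ a) ≡⟨ cong (λ t → a ∙ x ∙ t ∙ (a ∙ y ∙ a)) (involution-⁻¹ a²) ⟩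
        a ∙ x ∙ a ∙ (a ∙ y ∙ a)    ≡⟨ cong₂ _∙_ axa (kernel-inverted y sy) ⟩
        x ⁻¹ ∙ y ⁻¹                ≡⟨ ⁻¹-anti-homo-∙ y x ⟨
        (y ∙ x) ⁻¹                 ∎)
        where open ≡-Reasoning

      kernel-cyclic : ∀ y → sign y ≡ 0ℙ → Σ[ i ∈ Fin 5 ] y ≡ x ** toℕ i
      kernel-cyclic y sy = decidable-stable (Fin.any? λ i → y Fin.≟ x ** toℕ i) λ outside →
        no-inverted-plane a-inv x≢ε x⁵ (kernel-exponent y sy) (λ i eq → outside (i , eq)) axa
          (kernel-inverted y sy) (x-y-commute y sy)

      dihedral : Dihedral G
      dihedral = record
        { r = x ; f = a ; r≢ε = x≢ε ; r⁵ = x⁵ ; f≢ε = proj₁ a-inv ; f² = a² ; frf = axa ; covered = λ g →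
          cover g (sign g) refl }
        where
        cover : ∀ g s → sign g ≡ s → Σ[ i ∈ Fin 5 ] Σ[ s ∈ Parity ] g ≡ x ** toℕ i ∙ a ** [ s ]ᴾ
        cover g 0ℙ sg with kernel-cyclic g sg
        ... | i , eq = i , 0ℙ , trans eq (sym (identityʳ _))
        cover g 1ℙ sg with kernel-cyclic (g ∙ a) (trans (sign-∙ g a) (cong₂ _+ℙ_ sg sgn-a))
        ... | i , eq = i , 1ℙ , (begin
          g                ≡⟨ trans (assoc g a a) (trans (cong (g ∙_) a²) (identityʳ g)) ⟨
          g ∙ a ∙ a        ≡⟨ cong₂ _∙_ eq (sym (identityʳ a)) ⟩
          x ** toℕ i ∙ (a ∙ ε) ∎)
          where open ≡-Reasoning

  trichotomy : (∀ x → x ** 5 ≡ ε) ⊎ CentralInvolution G ⊎ Dihedral G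
  trichotomy with Fin.any? involution?
  ... | no none =
    inj₁ λ x → [ (λ x⁵ → x⁵) , (λ x⁵-inv → contradiction (_ , x⁵-inv) none) ]′ (power-5-involution x)
  ... | yes (a , a-inv) = inj₂ (split (Fin.any? (λ g → ¬? (a ∙ g Fin.≟ g ∙ a))))
    where
    open Sign a a-inv
    open WithInvolution a a-inv sign sign-∙
      (sign-a (λ x → no-order-4 (exponent-10 x)) λ b b-inv ab≡ba → sym (involution-unique a-inv b-inv ab≡ba))
    split : Dec (∃[ g ] a ∙ g ≢ g ∙ a) → CentralInvolution G ⊎ Dihedral G
    split (no central) =
      inj₁ (central-case λ g → decidable-stable (a ∙ g Fin.≟ g ∙ a) λ ag → central (g , ag))
    split (yes (g , ag)) = inj₂ (Noncentral.dihedral (g ∙ a ∙ g ⁻¹) (conjugate-involution a-inv g) λ gag⁻¹≡a →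
      ag (trans (cong (_∙ g) (sym gag⁻¹≡a)) (free (♯₁ ⊙ ♯₀ ⊙ inv ♯₁ ⊙ ♯₁) (♯₁ ⊙ ♯₀) (a ∷ g ∷ []) refl)))

-- Rational numbers and squares

2ℚ 3ℚ 4ℚ 5ℚ -1ℚ : ℚ
2ℚ  = ℤ.+ 2 ℚ./ 1
3ℚ  = ℤ.+ 3 ℚ./ 1
4ℚ  = ℤ.+ 4 ℚ./ 1
5ℚ  = ℤ.+ 5 ℚ./ 1
-1ℚ = ℚ.- 1ℚ

square≢prime : ∀ {p} → Prime p → ∀ (q r : ℚ) → ℚ.↥ r ≡ ℤ.+ p → ℚ.↧ₙ r ≡ 1 → q ℚ.* q ≢ r
square≢prime {p} p-prime q@(ℚ.mkℚ n d-1 cop) r@(ℚ.mkℚ _ _ _) ↥r ↧r q²≡r =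
  contradiction p-prime (subst (¬_ ∘ Prime) (sym (recompute-coprime (p∣∣n∣ , p∣d))) ¬prime[1])
  where
  open import Data.Nat.Divisibility using (_∣_; divides; m∣m*n)
  d : ℕ
  d = suc d-1
  -- The coprimality stored in `ℚ.mkℚ` is irrelevant and has to be recomputed before it can be used.
  recompute-coprime : ∀ {i} → i ∣ ℤ.∣ n ∣ × i ∣ d → i ≡ 1
  recompute-coprime = Coprime.recompute cop
  instance
    p≢0 : ℕ.NonZero p
    p≢0 = prime⇒nonZero p-prime
  cross : ℤ.∣ n ∣ ℕ.* ℤ.∣ n ∣ ≡ p ℕ.* (d ℕ.* d)
  cross with ℚᵘ.≃-trans (ℚᵘ.≃-sym (ℚ.toℚᵘ-homo-* q q)) (ℚᵘ.≃-reflexive (cong ℚ.toℚᵘ q²≡r))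
  ... | ℚᵘ.*≡* eq = begin
    ℤ.∣ n ∣ ℕ.* ℤ.∣ n ∣               ≡⟨ ℤ.abs-* n n ⟨
    ℤ.∣ n ℤ.* n ∣                     ≡⟨ cong ℤ.∣_∣ (ℤ.*-identityʳ (n ℤ.* n)) ⟨
    ℤ.∣ n ℤ.* n ℤ.* ℤ.1ℤ ∣            ≡⟨ cong (λ e → ℤ.∣ n ℤ.* n ℤ.* ℤ.+ e ∣) ↧r ⟨
    ℤ.∣ n ℤ.* n ℤ.* ℚ.↧ r ∣           ≡⟨ cong ℤ.∣_∣ eq ⟩
    ℤ.∣ ℚ.↥ r ℤ.* (ℤ.+ d ℤ.* ℤ.+ d) ∣     ≡⟨ cong (λ e → ℤ.∣ e ℤ.* (ℤ.+ d ℤ.* ℤ.+ d) ∣) ↥r ⟩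
    ℤ.∣ ℤ.+ p ℤ.* (ℤ.+ d ℤ.* ℤ.+ d) ∣       ≡⟨ ℤ.abs-* (ℤ.+ p) (ℤ.+ d ℤ.* ℤ.+ d) ⟩
    p ℕ.* ℤ.∣ ℤ.+ d ℤ.* ℤ.+ d ∣           ≡⟨ cong (p ℕ.*_) (ℤ.abs-* (ℤ.+ d) (ℤ.+ d)) ⟩
    p ℕ.* (d ℕ.* d)                   ∎
    where open ≡-Reasoning
  square-divisor : ∀ m → p ∣ m ℕ.* m → p ∣ m
  square-divisor m p∣m² with euclidsLemma m m p-prime p∣m²
  ... | inj₁ p∣m = p∣m
  ... | inj₂ p∣m = p∣m
  p∣∣n∣ : p ∣ ℤ.∣ n ∣
  p∣∣n∣ = square-divisor ℤ.∣ n ∣ (subst (p ∣_) (sym cross) (m∣m*n (d ℕ.* d)))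
  p∣d : p ∣ d
  p∣d with p∣∣n∣
  ... | divides k eq = square-divisor d (divides (k ℕ.* k) (ℕ.*-cancelˡ-≡ _ _ p (begin
      p ℕ.* (d ℕ.* d)                 ≡⟨ cross ⟨
      ℤ.∣ n ∣ ℕ.* ℤ.∣ n ∣             ≡⟨ cong₂ ℕ._*_ eq eq ⟩
      k ℕ.* p ℕ.* (k ℕ.* p)
        ≡⟨ ℕSolver.solve 2 (λ k p → k ℕSolver.:* p ℕSolver.:* (k ℕSolver.:* p) ℕSolver.:= p ℕSolver.:*
        (k ℕSolver.:* k ℕSolver.:* p)) refl k p ⟩
      p ℕ.* (k ℕ.* k ℕ.* p)           ∎)))
    where open ≡-Reasoning

-- Arithmetic in Ω and its subfields of degree two

module Field {c ℓ₁ ℓ₂ : Level} (Ω : AlgebraicallyClosedField c ℓ₁ ℓ₂) where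

  open AlgebraicallyClosedField Ω public
    hiding (refl; sym; trans; zero; setoid; isRingHomomorphism; commutativeRing)
    renaming (Carrier to K; sum to sumK; _^_ to _^ᴷ_)
  open AlgebraicallyClosedField Ω public
    using () renaming
      (refl to ≈-refl; sym to ≈-sym; trans to ≈-trans; isRingHomomorphism to ι-isRingHomomorphism; commutativeRing to ringK)
  open HeytingProperties heytingCommutativeRing public using (1#0; #-congʳ; #-congˡ; x#0y#0→xy#0; x-0≈x)
  open RingMorphisms ℚ.+-*-rawRing (CommutativeRing.rawRing ringK)
  open IsRingHomomorphism ι-isRingHomomorphism public
    using () renaming
      (+-homo to ι-+; *-homo to ι-*; -‿homo to ι--; 0#-homo to ι-0; 1#-homo to ι-1; ⟦⟧-cong to ι-cong)
  open RingProperties (CommutativeRing.ring ringK) public using (-0#≈0#)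

  module ≈-Reasoning = SetoidReasoning (CommutativeRing.setoid ringK)

  -- Chosen so that the solver's constants 0 and 1 are 0# and 1# themselves.
  ⟦_⟧ᶜ : ℚ → K
  ⟦ q ⟧ᶜ with q ℚ.≟ 0ℚ | q ℚ.≟ 1ℚ
  ... | yes _ | _     = 0#
  ... | no _  | yes _ = 1#
  ... | no _  | no _  = ι q

  ⟦⟧ᶜ≈ι : ∀ q → ⟦ q ⟧ᶜ ≈ ι q
  ⟦⟧ᶜ≈ι q with q ℚ.≟ 0ℚ | q ℚ.≟ 1ℚ
  ... | yes refl | _        = ≈-sym ι-0
  ... | no _     | yes refl = ≈-sym ι-1
  ... | no _     | no _     = ≈-refl

  private
    almost : ACR.AlmostCommutativeRing c ℓ₁
    almost = ACR.fromCommutativeRing ringK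

    morphism : ℚ.+-*-rawRing ACR.-Raw-AlmostCommutative⟶ almost
    morphism = record
      { ⟦_⟧    = ⟦_⟧ᶜ
      ; +-homo = λ p q → ≈-trans (⟦⟧ᶜ≈ι _) (≈-trans (ι-+ p q) (+-cong (≈-sym (⟦⟧ᶜ≈ι p)) (≈-sym (⟦⟧ᶜ≈ι q))))
      ; *-homo = λ p q → ≈-trans (⟦⟧ᶜ≈ι _) (≈-trans (ι-* p q) (*-cong (≈-sym (⟦⟧ᶜ≈ι p)) (≈-sym (⟦⟧ᶜ≈ι q))))
      ; -‿homo = λ p → ≈-trans (⟦⟧ᶜ≈ι _) (≈-trans (ι-- p) (-‿cong (≈-sym (⟦⟧ᶜ≈ι p))))
      ; 0-homo = ≈-refl
      ; 1-homo = ≈-refl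
      }

    ⟦⟧ᶜ-≟ : ∀ p q → Maybe (⟦ p ⟧ᶜ ≈ ⟦ q ⟧ᶜ)
    ⟦⟧ᶜ-≟ p q with p ℚ.≟ q
    ... | yes refl = just ≈-refl
    ... | no _     = nothing

  open RingSolver ℚ.+-*-rawRing almost morphism ⟦⟧ᶜ-≟ public
    using (solve; _:=_; _:+_; _:*_; _:-_; :-_; con; Polynomial)

  inverse : ∀ {x} → x # 0# → ∃[ y ] x * y ≈ 1#
  inverse x#0 with #⇒invertible x#0
  ... | y , _ , eq = y , ≈-trans (*-congʳ (≈-sym (x-0≈x _))) eq

  invertible⇒#0 : ∀ {x y} → x * y ≈ 1# → x # 0#
  invertible⇒#0 {x} {y} eq = invertible⇒# (y , ≈-trans (*-comm _ _) eq′ , eq′)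
    where
    eq′ : (x - 0#) * y ≈ 1#
    eq′ = ≈-trans (*-congʳ (x-0≈x x)) eq

  *-factorˡ-# : ∀ {x y} → x * y # 0# → x # 0#
  *-factorˡ-# xy#0 with inverse xy#0
  ... | z , eq = invertible⇒#0 (≈-trans (≈-sym (*-assoc _ _ z)) eq)

  *-factorʳ-# : ∀ {x y} → x * y # 0# → y # 0#
  *-factorʳ-# xy#0 = *-factorˡ-# (#-congʳ (*-comm _ _) xy#0)

  *-cancel-# : ∀ {x y} → x # 0# → x * y ≈ 0# → y ≈ 0#
  *-cancel-# {x} {y} x#0 xy≈0 with inverse x#0
  ... | z , xz≈1 = begin
    y           ≈⟨ *-identityˡ y ⟨
    1# * y      ≈⟨ *-congʳ xz≈1 ⟨
    x * z * y   ≈⟨ solve 3 (λ x y z → x :* z :* y := z :* (x :* y)) ≈-refl x y z ⟩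
    z * (x * y) ≈⟨ *-congˡ xy≈0 ⟩
    z * 0#      ≈⟨ zeroʳ z ⟩
    0#          ∎
    where open ≈-Reasoning

  #⇒-#0 : ∀ {x y} → x # y → x - y # 0#
  #⇒-#0 x#y with #⇒invertible x#y
  ... | z , _ , eq = invertible⇒#0 eq

  -#0⇒# : ∀ {x y} → x - y # 0# → x # y
  -#0⇒# x-y#0 with inverse x-y#0
  ... | z , eq = invertible⇒# (z , ≈-trans (*-comm _ _) eq , eq)

  -- Cotransitivity replaces the decision which summand vanishes. This is how a nonzero vector is
  -- shown to have a nonzero component in some eigenspace.
  +-split-# : ∀ {x y} → x + y # 0# → x # 0# ⊎ y # 0#
  +-split-# {x} {y} x+y#0 with #-cotrans x+y#0 y
  ... | inj₁ x+y#y = inj₁ (#-congʳ (solve 2 (λ x y → x :+ y :- y := x) ≈-refl x y) (#⇒-#0 x+y#y))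
  ... | inj₂ y#0   = inj₂ y#0

  #0⇒≉0 : ∀ {x} → x # 0# → ¬ x ≈ 0#
  #0⇒≉0 x#0 x≈0 = #-irrefl ≈-refl (#-congʳ x≈0 x#0)

  1≉0 : ¬ 1# ≈ 0#
  1≉0 = #0⇒≉0 1#0

  -≈0⇒≈ : ∀ {x y} → x - y ≈ 0# → x ≈ y
  -≈0⇒≈ {x} {y} eq =
    ≈-trans (solve 2 (λ x y → x := x :- y :+ y) ≈-refl x y) (≈-trans (+-congʳ eq) (+-identityˡ y))

  ≈⇒-≈0 : ∀ {x y} → x ≈ y → x - y ≈ 0#
  ≈⇒-≈0 {x} {y} eq = ≈-trans (+-congʳ eq) (-‿inverseʳ y)

  -- As x cannot be compared with p and q by a decision, cotransitivity of p # q supplies one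
  -- invertible factor, which is cancelled.
  roots : ∀ {p q x} → p # q → (x - p) * (x - q) ≈ 0# → x ≈ p ⊎ x ≈ q
  roots {p} {q} {x} p#q eq with #-cotrans p#q x
  ... | inj₁ p#x = inj₂ (-≈0⇒≈ (*-cancel-# (#⇒-#0 (#-sym p#x)) eq))
  ... | inj₂ x#q = inj₁ (-≈0⇒≈ (*-cancel-# (#⇒-#0 x#q) (≈-trans (*-comm _ _) eq)))

  ι-#0 : ∀ {q} → q ≢ 0ℚ → ι q # 0#
  ι-#0 {q} q≢0 = invertible⇒#0 (≈-trans (≈-sym (ι-* q _)) (≈-trans (ι-cong (ℚ.*-inverseʳ q)) ι-1))
    where instance
      q-nonZero : ℚ.NonZero q
      q-nonZero = ℚ.≢-nonZero q≢0

  ι-zero : ∀ {q} → ι q ≈ 0# → q ≡ 0ℚ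
  ι-zero {q} ιq≈0 = decidable-stable (q ℚ.≟ 0ℚ) λ q≢0 → #0⇒≉0 (ι-#0 q≢0) ιq≈0

  ι-injective : ∀ {p q} → ι p ≈ ι q → p ≡ q
  ι-injective {p} {q} eq = begin
    p                  ≡⟨ ℚSolver.solve 2 (λ p q → p ℚSolver.:= p ℚSolver.:- q ℚSolver.:+ q) refl p q ⟩
    p ℚ.- q ℚ.+ q
      ≡⟨ cong (ℚ._+ q) (ι-zero (≈-trans (ι-+ p (ℚ.- q)) (≈-trans (+-congˡ (ι-- q)) (≈⇒-≈0 eq)))) ⟩
    0ℚ ℚ.+ q           ≡⟨ ℚ.+-identityˡ q ⟩
    q                  ∎
    where open ≡-Reasoning

  module _ {p} {X : Pred K p} where

    F : Pred K (c ⊔ ℓ₁ ⊔ p)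
    F = Generated Ω X

    -- For rational b₀ = q₀ and b₁ = q₁ the relation q₁b₀ - q₀b₁ = 0 forces q₁ = 0. Then b₁ = 0,
    -- against independence.
    rational-degree≢2 : (∀ {x} → F x → ∃[ q ] x ≈ ι q) → ¬ HasDegree Ω F 2
    rational-degree≢2 rational deg = 1≉0 (≈-trans (≈-sym ι-1) (≈-trans (ι-cong 1≡0) ι-0))
      where
      open HasDegree deg
      b₀ b₁ : K
      b₀ = basis zero
      b₁ = basis (suc zero)
      q₀ q₁ : ℚ
      q₀ = proj₁ (rational (basis∈F zero))
      q₁ = proj₁ (rational (basis∈F (suc zero)))
      pair : ℚ → ℚ → Fin 2 → ℚ
      pair x y zero       = x
      pair x y (suc zero) = y
      q₁≡0 : q₁ ≡ 0ℚ
      q₁≡0 = independent (pair q₁ (ℚ.- q₀)) (begin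
        ι q₁ * b₀ + (ι (ℚ.- q₀) * b₁ + 0#)
          ≈⟨ +-cong (*-congˡ (proj₂ (rational (basis∈F zero))))
          (+-congʳ (*-cong (ι-- q₀) (proj₂ (rational (basis∈F (suc zero)))))) ⟩
        ι q₁ * ι q₀ + (- ι q₀ * ι q₁ + 0#)
          ≈⟨ solve 2 (λ x y → y :* x :+ (:- x :* y :+ con 0ℚ) := con 0ℚ) ≈-refl (ι q₀) (ι q₁) ⟩
        0#                                 ∎) zero
        where open ≈-Reasoning
      1≡0 : 1ℚ ≡ 0ℚ
      1≡0 = independent (pair 0ℚ 1ℚ) (begin
        ι 0ℚ * b₀ + (ι 1ℚ * b₁ + 0#)
          ≈⟨ +-cong (*-congʳ ι-0) (+-congʳ (*-congˡ
          (≈-trans (proj₂ (rational (basis∈F (suc zero)))) (≈-trans (ι-cong q₁≡0) ι-0)))) ⟩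
        0# * b₀ + (ι 1ℚ * 0# + 0#)
          ≈⟨ solve 2 (λ x y → con 0ℚ :* x :+ (y :* con 0ℚ :+ con 0ℚ) := con 0ℚ) ≈-refl b₀ (ι 1ℚ) ⟩
        0#                           ∎) (suc zero)
        where open ≈-Reasoning

    record Dependence (u v w : K) : Set ℓ₁ where
      field
        B₀ B₁ B₂ : ℚ
        nonzero  : ¬ (B₀ ≡ 0ℚ × B₁ ≡ 0ℚ × B₂ ≡ 0ℚ)
        relation : ι B₀ * u + ι B₁ * v + ι B₂ * w ≈ 0#

    -- Three vectors in ℚ² satisfy the relation whose coefficients are the 2 × 2 minors of their
    -- coordinates. When the minor of u and v is zero these two are already dependent, and a nonzero
    -- coordinate of u, or the vanishing of u, gives the relation.
    dependence : HasDegree Ω F 2 → ∀ {u v w} → F u → F v → F w → Dependence u v w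
    dependence deg {u} {v} {w} u∈ v∈ w∈ = search
      where
      open HasDegree deg
      b₀ b₁ : K
      b₀ = basis zero
      b₁ = basis (suc zero)
      module _ {x} (x∈ : F x) where
        coord₀ coord₁ : ℚ
        coord₀ = proj₁ (spanning x∈) zero
        coord₁ = proj₁ (spanning x∈) (suc zero)
        coords : x ≈ ι coord₀ * b₀ + ι coord₁ * b₁
        coords = ≈-trans (proj₂ (spanning x∈)) (+-congˡ (+-identityʳ _))
      u₀ = coord₀ u∈
      u₁ = coord₁ u∈
      v₀ = coord₀ v∈
      v₁ = coord₁ v∈
      w₀ = coord₀ w∈
      w₁ = coord₁ w∈
      vanishing : ∀ B₀ B₁ B₂ → B₀ ℚ.* u₀ ℚ.+ B₁ ℚ.* v₀ ℚ.+ B₂ ℚ.* w₀ ≡ 0ℚ →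
        B₀ ℚ.* u₁ ℚ.+ B₁ ℚ.* v₁ ℚ.+ B₂ ℚ.* w₁ ≡ 0ℚ → ι B₀ * u + ι B₁ * v + ι B₂ * w ≈ 0#
      vanishing B₀ B₁ B₂ eq₀ eq₁ = begin
        ι B₀ * u + ι B₁ * v + ι B₂ * w
          ≈⟨ +-cong (+-cong (*-congˡ (coords u∈)) (*-congˡ (coords v∈))) (*-congˡ (coords w∈)) ⟩
        _ ≈⟨ solve 11 (λ B₀ B₁ B₂ u₀ v₀ w₀ u₁ v₁ w₁ b₀ b₁ →
               B₀ :* (u₀ :* b₀ :+ u₁ :* b₁) :+ B₁ :* (v₀ :* b₀ :+ v₁ :* b₁) :+ B₂ :* (w₀ :* b₀ :+ w₁ :* b₁)
               := (B₀ :* u₀ :+ B₁ :* v₀ :+ B₂ :* w₀) :* b₀ :+ (B₀ :* u₁ :+ B₁ :* v₁ :+ B₂ :* w₁) :* b₁)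
               ≈-refl (ι B₀) (ι B₁) (ι B₂) (ι u₀) (ι v₀) (ι w₀) (ι u₁) (ι v₁) (ι w₁) b₀ b₁ ⟩
        (ι B₀ * ι u₀ + ι B₁ * ι v₀ + ι B₂ * ι w₀) * b₀ + (ι B₀ * ι u₁ + ι B₁ * ι v₁ + ι B₂ * ι w₁) * b₁
          ≈⟨ +-cong (*-congʳ (collect _ _ _ _ _ _ eq₀)) (*-congʳ (collect _ _ _ _ _ _ eq₁)) ⟩
        0# * b₀ + 0# * b₁
          ≈⟨ solve 2 (λ x y → con 0ℚ :* x :+ con 0ℚ :* y := con 0ℚ) ≈-refl b₀ b₁ ⟩
        0# ∎
        where
        open ≈-Reasoning
        collect : ∀ a b c x y z → a ℚ.* x ℚ.+ b ℚ.* y ℚ.+ c ℚ.* z ≡ 0ℚ →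
          ι a * ι x + ι b * ι y + ι c * ι z ≈ 0#
        collect a b c x y z eq =
          ≈-trans (+-cong (+-cong (≈-sym (ι-* a x)) (≈-sym (ι-* b y))) (≈-sym (ι-* c z)))
          (≈-trans (+-congʳ (≈-sym (ι-+ _ _))) (≈-trans (≈-sym (ι-+ _ _)) (≈-trans (ι-cong eq) ι-0)))
      open ℚSolver using () renaming
        (solve to solveℚ; _:=_ to _≔_; _:+_ to _⊕_; _:*_ to _⊗_; _:-_ to _⊖_; :-_ to ⊖_; con to conℚ)
      m₀ m₁ m₂ : ℚ
      m₀ = v₀ ℚ.* w₁ ℚ.- v₁ ℚ.* w₀
      m₁ = w₀ ℚ.* u₁ ℚ.- w₁ ℚ.* u₀
      m₂ = u₀ ℚ.* v₁ ℚ.- u₁ ℚ.* v₀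
      cross₀ : m₀ ℚ.* u₀ ℚ.+ m₁ ℚ.* v₀ ℚ.+ m₂ ℚ.* w₀ ≡ 0ℚ
      cross₀ = solveℚ 6 (λ u₀ u₁ v₀ v₁ w₀ w₁ → (v₀ ⊗ w₁ ⊖ v₁ ⊗ w₀) ⊗ u₀ ⊕ (w₀ ⊗ u₁ ⊖ w₁ ⊗ u₀) ⊗ v₀ ⊕
        (u₀ ⊗ v₁ ⊖ u₁ ⊗ v₀) ⊗ w₀ ≔ conℚ 0ℚ)
        refl u₀ u₁ v₀ v₁ w₀ w₁
      cross₁ : m₀ ℚ.* u₁ ℚ.+ m₁ ℚ.* v₁ ℚ.+ m₂ ℚ.* w₁ ≡ 0ℚ
      cross₁ = solveℚ 6 (λ u₀ u₁ v₀ v₁ w₀ w₁ → (v₀ ⊗ w₁ ⊖ v₁ ⊗ w₀) ⊗ u₁ ⊕ (w₀ ⊗ u₁ ⊖ w₁ ⊗ u₀) ⊗ v₁ ⊕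
        (u₀ ⊗ v₁ ⊖ u₁ ⊗ v₀) ⊗ w₁ ≔ conℚ 0ℚ)
        refl u₀ u₁ v₀ v₁ w₀ w₁
      swap₀ : ∀ x y w → ℚ.- x ℚ.* y ℚ.+ y ℚ.* x ℚ.+ 0ℚ ℚ.* w ≡ 0ℚ
      swap₀ = solveℚ 3 (λ x y w → ⊖ x ⊗ y ⊕ y ⊗ x ⊕ conℚ 0ℚ ⊗ w ≔ conℚ 0ℚ) refl
      swap₁ : m₂ ≡ 0ℚ → ℚ.- v₀ ℚ.* u₁ ℚ.+ u₀ ℚ.* v₁ ℚ.+ 0ℚ ℚ.* w₁ ≡ 0ℚ
      swap₁ eq = trans (solveℚ 5 (λ u₀ u₁ v₀ v₁ w → ⊖ v₀ ⊗ u₁ ⊕ u₀ ⊗ v₁ ⊕ conℚ 0ℚ ⊗ w ≔ u₀ ⊗ v₁ ⊖ u₁ ⊗ v₀)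
        refl u₀ u₁ v₀ v₁ w₁) eq
      only-u : ∀ {x} y z → x ≡ 0ℚ → 1ℚ ℚ.* x ℚ.+ 0ℚ ℚ.* y ℚ.+ 0ℚ ℚ.* z ≡ 0ℚ
      only-u y z refl = solveℚ 2 (λ y z → conℚ 1ℚ ⊗ conℚ 0ℚ ⊕ conℚ 0ℚ ⊗ y ⊕ conℚ 0ℚ ⊗ z ≔ conℚ 0ℚ) refl y z
      mixed : u₀ ≡ 0ℚ → ℚ.- v₁ ℚ.* u₀ ℚ.+ u₁ ℚ.* v₀ ℚ.+ 0ℚ ℚ.* w₀ ≡ u₁ ℚ.* v₀
      mixed eq = trans (cong (λ x → ℚ.- v₁ ℚ.* x ℚ.+ u₁ ℚ.* v₀ ℚ.+ 0ℚ ℚ.* w₀) eq)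
        (solveℚ 4 (λ u v v′ w → ⊖ v′ ⊗ conℚ 0ℚ ⊕ u ⊗ v ⊕ conℚ 0ℚ ⊗ w ≔ u ⊗ v) refl u₁ v₀ v₁ w₀)
      search : Dependence u v w
      search with m₂ ℚ.≟ 0ℚ
      ... | no m₂≢0 = record { B₀ = m₀ ; B₁ = m₁ ; B₂ = m₂ ; nonzero = λ (_ , _ , eq) → m₂≢0 eq
        ; relation = vanishing _ _ _ cross₀ cross₁ }
      ... | yes m₂≡0 with u₀ ℚ.≟ 0ℚ | u₁ ℚ.≟ 0ℚ
      ... | no u₀≢0 | _ = record { B₀ = ℚ.- v₀ ; B₁ = u₀ ; B₂ = 0ℚ ; nonzero = λ (_ , eq , _) → u₀≢0 eq
        ; relation = vanishing _ _ _ (swap₀ v₀ u₀ w₀) (swap₁ m₂≡0) }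
      ...   | yes u₀≡0 | yes u₁≡0 = record { B₀ = 1ℚ ; B₁ = 0ℚ ; B₂ = 0ℚ ; nonzero = λ ()
        ; relation = vanishing _ _ _ (only-u v₀ w₀ u₀≡0) (only-u v₁ w₁ u₁≡0) }
      ... | yes u₀≡0 | no u₁≢0 = record { B₀ = ℚ.- v₁ ; B₁ = u₁ ; B₂ = 0ℚ ; nonzero = λ (_ , eq , _) → u₁≢0 eq
        ; relation = vanishing _ _ _ (trans (mixed u₀≡0) u₁v₀) (swap₀ v₁ u₁ w₁) }
        where
        u₁v₀ : u₁ ℚ.* v₀ ≡ 0ℚ
        u₁v₀ = trans (solveℚ 3 (λ u₁ v₀ v₁ → u₁ ⊗ v₀ ≔ ⊖ (conℚ 0ℚ ⊗ v₁ ⊖ u₁ ⊗ v₀)) refl u₁ v₀ v₁)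
          (cong ℚ.-_ (trans (cong (λ x → x ℚ.* v₁ ℚ.- u₁ ℚ.* v₀) (sym u₀≡0)) m₂≡0))

  -- The field ℚ(√5), generated by the roots of t² + t = 1

  Golden : K → Set ℓ₁
  Golden φ = φ * φ + φ ≈ 1#

  golden-exists : ∃[ φ ] Golden φ
  golden-exists with hasRoot 1 (λ { zero → - 1# ; (suc _) → 1# })
  ... | φ , eq = φ , -≈0⇒≈ (≈-trans (solve 1 (λ x → x :* x :+ x :- con 1ℚ :=
    x :* (x :* con 1ℚ) :+ (:- con 1ℚ :* con 1ℚ :+ (con 1ℚ :* (x :* con 1ℚ) :+ con 0ℚ))) ≈-refl φ) eq)

  conjugate : K → K
  conjugate φ = - 1# - φ

  golden-conjugate : ∀ {φ} → Golden φ → Golden (conjugate φ)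
  golden-conjugate {φ} eq = ≈-trans (solve 1 (λ x → (:- con 1ℚ :- x) :* (:- con 1ℚ :- x) :+
    (:- con 1ℚ :- x) := x :* x :+ x) ≈-refl φ) eq

  record InSpan (φ x : K) : Set ℓ₁ where
    constructor span
    field
      a b  : ℚ
      span-eq : x ≈ ι a + ι b * φ

  span-resp : ∀ {φ x y} → x ≈ y → InSpan φ x → InSpan φ y
  span-resp x≈y (span a b eq) = span a b (≈-trans (≈-sym x≈y) eq)

  module _ {φ} (golden : Golden φ) where

    golden² : φ * φ ≈ 1# - φ
    golden² = ≈-trans (solve 1 (λ x → x :* x := x :* x :+ x :- x) ≈-refl φ) (+-congʳ golden)

    -- (2φ + 1)² = 4(φ² + φ) + 1 = 5.
    irrational : ∀ q → ¬ φ ≈ ι q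
    irrational q φ≈ιq = square≢prime (from-yes (prime? 5)) (2ℚ ℚ.* q ℚ.+ 1ℚ) 5ℚ refl refl (begin
      (2ℚ ℚ.* q ℚ.+ 1ℚ) ℚ.* (2ℚ ℚ.* q ℚ.+ 1ℚ)
        ≡⟨ ℚSolver.solve 1 (λ q → (ℚSolver.con 2ℚ ℚSolver.:* q ℚSolver.:+ ℚSolver.con 1ℚ) ℚSolver.:*
        (ℚSolver.con 2ℚ ℚSolver.:* q ℚSolver.:+ ℚSolver.con 1ℚ)
          ℚSolver.:= ℚSolver.con 4ℚ ℚSolver.:* (q ℚSolver.:* q ℚSolver.:+ q) ℚSolver.:+ ℚSolver.con 1ℚ)
            refl q ⟩
      4ℚ ℚ.* (q ℚ.* q ℚ.+ q) ℚ.+ 1ℚ            ≡⟨ cong (λ t → 4ℚ ℚ.* t ℚ.+ 1ℚ) q²+q≡1 ⟩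
      5ℚ                                       ∎)
      where
      open ≡-Reasoning
      q²+q≡1 : q ℚ.* q ℚ.+ q ≡ 1ℚ
      q²+q≡1 = ι-injective (≈-trans (ι-+ _ q) (≈-trans (+-congʳ (ι-* q q))
        (≈-trans (+-cong (*-cong (≈-sym φ≈ιq) (≈-sym φ≈ιq)) (≈-sym φ≈ιq)) (≈-trans golden (≈-sym ι-1)))))

    independent-1-φ : ∀ {a b} → ι a + ι b * φ ≈ 0# → a ≡ 0ℚ × b ≡ 0ℚ
    independent-1-φ {a} {b} eq = a≡0 , b≡0
      where
      b≡0 : b ≡ 0ℚ
      b≡0 = decidable-stable (b ℚ.≟ 0ℚ) λ b≢0 → let instance b-nz = ℚ.≢-nonZero b≢0 in irrational (ℚ.- (ℚ.1/ b ℚ.* a)) (begin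
        φ                                     ≈⟨ *-identityˡ φ ⟨
        1# * φ
          ≈⟨ *-congʳ (≈-trans (≈-sym ι-1) (≈-trans (ι-cong (sym (ℚ.*-inverseˡ b))) (ι-* (ℚ.1/ b) b))) ⟩
        ι (ℚ.1/ b) * ι b * φ
          ≈⟨ solve 4 (λ c a b x → c :* b :* x := c :* (a :+ b :* x) :- c :* a) ≈-refl (ι (ℚ.1/ b)) (ι a)
          (ι b) φ ⟩
        ι (ℚ.1/ b) * (ι a + ι b * φ) - ι (ℚ.1/ b) * ι a ≈⟨ +-congʳ (≈-trans (*-congˡ eq) (zeroʳ _)) ⟩
        0# - ι (ℚ.1/ b) * ι a                 ≈⟨ +-identityˡ _ ⟩
        - (ι (ℚ.1/ b) * ι a)                  ≈⟨ -‿cong (ι-* (ℚ.1/ b) a) ⟨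
        - ι (ℚ.1/ b ℚ.* a)                    ≈⟨ ι-- _ ⟨
        ι (ℚ.- (ℚ.1/ b ℚ.* a))                ∎)
        where open ≈-Reasoning
      a≡0 : a ≡ 0ℚ
      a≡0 = ι-zero (begin
        ι a              ≈⟨ solve 2 (λ a x → a := a :+ con 0ℚ :* x) ≈-refl (ι a) φ ⟩
        ι a + 0# * φ     ≈⟨ +-congˡ (*-congʳ (≈-trans (ι-cong b≡0) ι-0)) ⟨
        ι a + ι b * φ    ≈⟨ eq ⟩
        0#               ∎)
        where open ≈-Reasoning

    coefficients : ∀ {a b c d} → ι a + ι b * φ ≈ ι c + ι d * φ → a ≡ c × b ≡ d
    coefficients {a} {b} {c} {d} eq = from-zero (proj₁ zeros) , from-zero (proj₂ zeros)
      where
      zeros : a ℚ.- c ≡ 0ℚ × b ℚ.- d ≡ 0ℚ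
      zeros = independent-1-φ (begin
        ι (a ℚ.- c) + ι (b ℚ.- d) * φ
          ≈⟨ +-cong (≈-trans (ι-+ a _) (+-congˡ (ι-- c))) (*-congʳ (≈-trans (ι-+ b _) (+-congˡ (ι-- d)))) ⟩
        (ι a - ι c) + (ι b - ι d) * φ
          ≈⟨ solve 5 (λ a b c d x → (a :- c) :+ (b :- d) :* x := a :+ b :* x :- (c :+ d :* x)) ≈-refl (ι a)
          (ι b) (ι c) (ι d) φ ⟩
        ι a + ι b * φ - (ι c + ι d * φ)            ≈⟨ ≈⇒-≈0 eq ⟩
        0#                                         ∎)
        where open ≈-Reasoning
      from-zero : ∀ {p q} → p ℚ.- q ≡ 0ℚ → p ≡ q
      from-zero {p} {q} eq =
        trans (ℚSolver.solve 2 (λ p q → p ℚSolver.:= p ℚSolver.:- q ℚSolver.:+ q) refl p q)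
        (trans (cong (ℚ._+ q) eq) (ℚ.+-identityˡ q))

    -- The norm of a + bφ is a² − ab − b².
    nonsquare : ∀ {p x} P Q r → Prime p → ℚ.↥ r ≡ ℤ.+ p → ℚ.↧ₙ r ≡ 1 → P ℚ.* P ℚ.- P ℚ.* Q ℚ.- Q ℚ.* Q ≡ r →
      InSpan φ x → ¬ x * x ≈ ι P + ι Q * φ
    nonsquare {p} {x} P Q r p-prime ↥r ↧r norm (span a b x≈) x² = square≢prime p-prime N r ↥r ↧r (begin
      N ℚ.* N
        ≡⟨ S.solve 2 (λ a b → (a S.:* a S.:- a S.:* b S.:- b S.:* b) S.:*
        (a S.:* a S.:- a S.:* b S.:- b S.:* b) S.:=
          (a S.:* a S.:+ b S.:* b) S.:* (a S.:* a S.:+ b S.:* b)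
          S.:- (a S.:* a S.:+ b S.:* b) S.:* (a S.:* b S.:+ a S.:* b S.:- b S.:* b)
          S.:- (a S.:* b S.:+ a S.:* b S.:- b S.:* b) S.:* (a S.:* b S.:+ a S.:* b S.:- b S.:* b)) refl a b ⟩
      P′ ℚ.* P′ ℚ.- P′ ℚ.* Q′ ℚ.- Q′ ℚ.* Q′
        ≡⟨ cong₂ (λ P Q → P ℚ.* P ℚ.- P ℚ.* Q ℚ.- Q ℚ.* Q) (proj₁ PQ) (proj₂ PQ) ⟩
      P ℚ.* P ℚ.- P ℚ.* Q ℚ.- Q ℚ.* Q           ≡⟨ norm ⟩
      r                                         ∎)
      where
      module S = ℚSolver
      open ≡-Reasoning
      N P′ Q′ : ℚ
      N  = a ℚ.* a ℚ.- a ℚ.* b ℚ.- b ℚ.* b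
      P′ = a ℚ.* a ℚ.+ b ℚ.* b
      Q′ = a ℚ.* b ℚ.+ a ℚ.* b ℚ.- b ℚ.* b
      ab : ι (a ℚ.* b) ≈ ι a * ι b
      ab = ι-* a b
      PQ : P′ ≡ P × Q′ ≡ Q
      PQ = coefficients (≈R.begin
        ι P′ + ι Q′ * φ
          ≈R.≈⟨ +-cong (≈-trans (ι-+ _ _) (+-cong (ι-* a a) (ι-* b b)))
             (*-congʳ (≈-trans (ι-+ _ _) (+-cong (≈-trans (ι-+ _ _) (+-cong ab ab))
               (≈-trans (ι-- _) (-‿cong (ι-* b b)))))) ⟩
        (ι a * ι a + ι b * ι b) + (ι a * ι b + ι a * ι b - ι b * ι b) * φ
          ≈R.≈⟨ solve 3 (λ a b x → (a :* a :+ b :* b) :+ (a :* b :+ a :* b :- b :* b) :* x :=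
             a :* a :+ (a :* b :+ a :* b) :* x :+ b :* b :* (con 1ℚ :- x)) ≈-refl (ι a) (ι b) φ ⟩
        ι a * ι a + (ι a * ι b + ι a * ι b) * φ + ι b * ι b * (1# - φ) ≈R.≈⟨ +-congˡ (*-congˡ golden²) ⟨
        ι a * ι a + (ι a * ι b + ι a * ι b) * φ + ι b * ι b * (φ * φ)
          ≈R.≈⟨ solve 3 (λ a b x → a :* a :+ (a :* b :+ a :* b) :* x :+ b :* b :* (x :* x) := (a :+ b :* x)
          :* (a :+ b :* x)) ≈-refl (ι a) (ι b) φ ⟩
        (ι a + ι b * φ) * (ι a + ι b * φ)                ≈R.≈⟨ *-cong x≈ x≈ ⟨
        x * x                                            ≈R.≈⟨ x² ⟩
        ι P + ι Q * φ                                    ≈R.∎)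
        where module ≈R = ≈-Reasoning

    module _ {p} {X : Pred K p} where

      -- In a field of degree 2 the numbers x, 1 and φ are dependent. The coefficient of x cannot be
      -- zero, as 1 and φ are independent, and so x can be solved for.
      degree-2-span : HasDegree Ω (Generated Ω X) 2 → Generated Ω X φ → ∀ {x} → Generated Ω X x → InSpan φ x
      degree-2-span deg φ∈ {x} x∈ = span (ℚ.- (ℚ.1/ B₀ ℚ.* B₁)) (ℚ.- (ℚ.1/ B₀ ℚ.* B₂)) (begin
          x                                   ≈⟨ *-identityˡ x ⟨
          1# * x
            ≈⟨ *-congʳ (≈-trans (≈-sym ι-1) (≈-trans (ι-cong (sym (ℚ.*-inverseˡ B₀))) (ι-* (ℚ.1/ B₀) B₀))) ⟩
          ι (ℚ.1/ B₀) * ι B₀ * x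
            ≈⟨ solve 6 (λ i B₀ B₁ B₂ x y → i :* B₀ :* x := i :* (B₀ :* x :+ B₁ :* con 1ℚ :+ B₂ :* y) :+
            (:- (i :* B₁) :+ :- (i :* B₂) :* y))
              ≈-refl (ι (ℚ.1/ B₀)) (ι B₀) (ι B₁) (ι B₂) x φ ⟩
          ι (ℚ.1/ B₀) * (ι B₀ * x + ι B₁ * 1# + ι B₂ * φ) +
            (- (ι (ℚ.1/ B₀) * ι B₁) + - (ι (ℚ.1/ B₀) * ι B₂) * φ)
            ≈⟨ +-cong (≈-trans (*-congˡ relation) (zeroʳ _)) (+-cong (neg B₁) (*-congʳ (neg B₂))) ⟩
          0# + (ι (ℚ.- (ℚ.1/ B₀ ℚ.* B₁)) + ι (ℚ.- (ℚ.1/ B₀ ℚ.* B₂)) * φ) ≈⟨ +-identityˡ _ ⟩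
          ι (ℚ.- (ℚ.1/ B₀ ℚ.* B₁)) + ι (ℚ.- (ℚ.1/ B₀ ℚ.* B₂)) * φ ∎)
        where
        open ≈-Reasoning
        open Dependence (dependence deg x∈ 1∈ φ∈)
        B₀≢0 : B₀ ≢ 0ℚ
        B₀≢0 eq = nonzero (eq , independent-1-φ (begin
          ι B₁ + ι B₂ * φ
            ≈⟨ solve 4 (λ B₁ B₂ x y → B₁ :+ B₂ :* y := con 0ℚ :* x :+ B₁ :* con 1ℚ :+ B₂ :* y) ≈-refl
            (ι B₁) (ι B₂) x φ ⟩
          0# * x + ι B₁ * 1# + ι B₂ * φ      ≈⟨ +-congʳ (+-congʳ (*-congʳ (≈-trans (ι-cong eq) ι-0))) ⟨
          ι B₀ * x + ι B₁ * 1# + ι B₂ * φ    ≈⟨ relation ⟩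
          0#                                 ∎))
        instance
          B₀-nonZero : ℚ.NonZero B₀
          B₀-nonZero = ℚ.≢-nonZero B₀≢0
        neg : ∀ B → - (ι (ℚ.1/ B₀) * ι B) ≈ ι (ℚ.- (ℚ.1/ B₀ ℚ.* B))
        neg B = ≈-trans (-‿cong (≈-sym (ι-* _ B))) (≈-sym (ι-- _))

      -- The point is closure of ℚ + ℚφ under inverses: 1/x is the conjugate of x over the norm N.
      -- Were N = 0, the conjugate of the invertible x would vanish, hence both coefficients and x
      -- itself.
      generated-span : (∀ {x} → X x → InSpan φ x) → ∀ {x} → Generated Ω X x → InSpan φ x
      generated-span gens (gen x∈) = gens x∈
      generated-span gens (resp x≈y x∈) = span-resp x≈y (generated-span gens x∈)
      generated-span gens 0∈ = span 0ℚ 0ℚ (≈-trans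
        (solve 1 (λ x → con 0ℚ := con 0ℚ :+ con 0ℚ :* x) ≈-refl φ) (≈-sym (+-cong ι-0 (*-congʳ ι-0))))
      generated-span gens 1∈ = span 1ℚ 0ℚ (≈-trans
        (solve 1 (λ x → con 1ℚ := con 1ℚ :+ con 0ℚ :* x) ≈-refl φ) (≈-sym (+-cong ι-1 (*-congʳ ι-0))))
      generated-span gens (+∈ x∈ y∈) with generated-span gens x∈ | generated-span gens y∈
      ... | span a b eq | span a′ b′ eq′ = span (a ℚ.+ a′) (b ℚ.+ b′) (≈-trans (+-cong eq eq′)
        (≈-trans (solve 5 (λ a b c d x → a :+ b :* x :+ (c :+ d :* x) := (a :+ c) :+ (b :+ d) :* x) ≈-refl
          (ι a) (ι b) (ι a′) (ι b′) φ)
          (≈-sym (+-cong (ι-+ a a′) (*-congʳ (ι-+ b b′))))))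
      generated-span gens (-∈ x∈) with generated-span gens x∈
      ... | span a b eq = span (ℚ.- a) (ℚ.- b) (≈-trans (-‿cong eq)
        (≈-trans (solve 3 (λ a b x → :- (a :+ b :* x) := :- a :+ :- b :* x) ≈-refl (ι a) (ι b) φ)
          (≈-sym (+-cong (ι-- a) (*-congʳ (ι-- b))))))
      generated-span gens (*∈ x∈ y∈) with generated-span gens x∈ | generated-span gens y∈
      ... | span a b eq | span c d eq′ = span (a ℚ.* c ℚ.+ b ℚ.* d) (a ℚ.* d ℚ.+ b ℚ.* c ℚ.- b ℚ.* d) (begin
        _                                             ≈⟨ *-cong eq eq′ ⟩
        (ι a + ι b * φ) * (ι c + ι d * φ)
          ≈⟨ solve 5 (λ a b c d x → (a :+ b :* x) :* (c :+ d :* x) := a :* c :+ (a :* d :+ b :* c)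
          :* x :+ b :* d :* (x :* x)) ≈-refl (ι a) (ι b) (ι c) (ι d) φ ⟩
        ι a * ι c + (ι a * ι d + ι b * ι c) * φ + ι b * ι d * (φ * φ) ≈⟨ +-congˡ (*-congˡ golden²) ⟩
        ι a * ι c + (ι a * ι d + ι b * ι c) * φ + ι b * ι d * (1# - φ)
          ≈⟨ solve 5 (λ a b c d x → a :* c :+ (a :* d :+ b :* c) :* x :+ b :* d :* (con 1ℚ :- x) :=
          (a :* c :+ b :* d) :+ (a :* d :+ b :* c :- b :* d) :* x) ≈-refl (ι a) (ι b) (ι c) (ι d) φ ⟩
        (ι a * ι c + ι b * ι d) + (ι a * ι d + ι b * ι c - ι b * ι d) * φ
          ≈⟨ +-cong (≈-trans (ι-+ _ _) (+-cong (ι-* a c) (ι-* b d)))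
            (*-congʳ (≈-trans (ι-+ _ _) (+-cong (≈-trans (ι-+ _ _) (+-cong (ι-* a d) (ι-* b c)))
              (≈-trans (ι-- _) (-‿cong (ι-* b d)))))) ⟨
        ι (a ℚ.* c ℚ.+ b ℚ.* d) + ι (a ℚ.* d ℚ.+ b ℚ.* c ℚ.- b ℚ.* d) * φ ∎)
        where open ≈-Reasoning
      generated-span gens {y} (⁻¹∈ {x} xy≈1 x∈) with generated-span gens x∈
      ... | span a b eq = span (ℚ.1/ N ℚ.* (a ℚ.- b)) (ℚ.- (ℚ.1/ N ℚ.* b)) (begin
        y                                   ≈⟨ *-identityˡ y ⟨
        1# * y
          ≈⟨ *-congʳ (≈-trans (≈-sym ι-1) (≈-trans (ι-cong (sym (ℚ.*-inverseˡ N))) (ι-* (ℚ.1/ N) N))) ⟩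
        ι (ℚ.1/ N) * ι N * y                ≈⟨ *-congʳ (*-congˡ xx̄≈N) ⟨
        ι (ℚ.1/ N) * (x * x̄) * y
          ≈⟨ solve 4 (λ i x x̄ y → i :* (x :* x̄) :* y := i :* x̄ :* (x :* y)) ≈-refl (ι (ℚ.1/ N)) x x̄ y ⟩
        ι (ℚ.1/ N) * x̄ * (x * y)            ≈⟨ *-congˡ xy≈1 ⟩
        ι (ℚ.1/ N) * x̄ * 1#
          ≈⟨ solve 4 (λ i a b x → i :* (a :- b :- b :* x) :* con 1ℚ := i :* (a :- b) :+ :- (i :* b) :* x)
          ≈-refl (ι (ℚ.1/ N)) (ι a) (ι b) φ ⟩
        ι (ℚ.1/ N) * (ι a - ι b) + - (ι (ℚ.1/ N) * ι b) * φ
          ≈⟨ +-cong (≈-trans (ι-* _ _) (*-congˡ (≈-trans (ι-+ _ _) (+-congˡ (ι-- b)))))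
            (*-congʳ (≈-trans (ι-- _) (-‿cong (ι-* _ b)))) ⟨
        ι (ℚ.1/ N ℚ.* (a ℚ.- b)) + ι (ℚ.- (ℚ.1/ N ℚ.* b)) * φ ∎)
        where
        open ≈-Reasoning
        N : ℚ
        N = a ℚ.* a ℚ.- a ℚ.* b ℚ.- b ℚ.* b
        x̄ : K
        -- The conjugate a + bφ′, where φ′ = -1 - φ is the other root of t² + t = 1.
        x̄ = ι a - ι b - ι b * φ
        xx̄≈N : x * x̄ ≈ ι N
        xx̄≈N = begin
          x * x̄                                  ≈⟨ *-congʳ eq ⟩
          (ι a + ι b * φ) * x̄
            ≈⟨ solve 3 (λ a b x → (a :+ b :* x) :* (a :- b :- b :* x) := a :* a :- a :* b :- b :* b :*
            (x :* x :+ x)) ≈-refl (ι a) (ι b) φ ⟩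
          ι a * ι a - ι a * ι b - ι b * ι b * (φ * φ + φ)
            ≈⟨ +-congˡ (-‿cong (≈-trans (*-congˡ golden) (*-identityʳ _))) ⟩
          ι a * ι a - ι a * ι b - ι b * ι b
            ≈⟨ ≈-trans (ι-+ _ _) (+-cong (≈-trans (ι-+ _ _)
            (+-cong (ι-* a a) (≈-trans (ι-- _) (-‿cong (ι-* a b))))) (≈-trans (ι-- _) (-‿cong (ι-* b b)))) ⟨
          ι N                                    ∎
        N≢0 : N ≢ 0ℚ
        N≢0 N≡0 = 1≉0 (≈-trans (≈-sym xy≈1) (≈-trans (*-congʳ x≈0) (zeroˡ y)))
          where
          x̄≈0 : x̄ ≈ 0#
          x̄≈0 = *-cancel-# (invertible⇒#0 xy≈1) (≈-trans xx̄≈N (≈-trans (ι-cong N≡0) ι-0))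
          zeros : a ℚ.- b ≡ 0ℚ × ℚ.- b ≡ 0ℚ
          zeros = independent-1-φ (≈-trans (+-cong (≈-trans (ι-+ _ _) (+-congˡ (ι-- b))) (*-congʳ (ι-- b)))
            (≈-trans (solve 3 (λ a b x → (a :- b) :+ :- b :* x := a :- b :- b :* x) ≈-refl (ι a) (ι b) φ)
              x̄≈0))
          b≡0 : b ≡ 0ℚ
          b≡0 = ℚ.neg-injective (proj₂ zeros)
          a≡0 : a ≡ 0ℚ
          a≡0 = trans (ℚSolver.solve 2 (λ p q → p ℚSolver.:= p ℚSolver.:- q ℚSolver.:+ q) refl a b)
            (cong₂ ℚ._+_ (proj₁ zeros) b≡0)
          x≈0 : x ≈ 0#
          x≈0 = ≈-trans eq (≈-trans (+-cong (≈-trans (ι-cong a≡0) ι-0) (*-congʳ (≈-trans (ι-cong b≡0) ι-0)))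
            (solve 1 (λ x → con 0ℚ :+ con 0ℚ :* x := con 0ℚ) ≈-refl φ))
        instance
          N-nonZero : ℚ.NonZero N
          N-nonZero = ℚ.≢-nonZero N≢0

      golden-degree : (∀ {x} → X x → InSpan φ x) → Generated Ω X φ → HasDegree Ω (Generated Ω X) 2
      golden-degree gens φ∈ = record
        { basis       = basis
        ; basis∈F     = λ { zero → 1∈ ; (suc zero) → φ∈ }
        ; spanning    = λ x∈ → coords (generated-span gens x∈)
        ; independent = λ q eq → λ { zero → proj₁ (zeros q eq) ; (suc zero) → proj₂ (zeros q eq) }
        }
        where
        basis : Fin 2 → K
        basis zero       = 1#
        basis (suc zero) = φ
        sum-basis : ∀ (q : Fin 2 → ℚ) → sumK (λ i → ι (q i) * basis i) ≈ ι (q zero) + ι (q (suc zero)) * φ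
        sum-basis q = +-cong (*-identityʳ _) (+-identityʳ _)
        coords : ∀ {x} → InSpan φ x → Σ[ q ∈ (Fin 2 → ℚ) ] x ≈ sumK (λ i → ι (q i) * basis i)
        coords (span a b eq) = q , ≈-trans eq (≈-sym (sum-basis q))
          where
          q : Fin 2 → ℚ
          q zero       = a
          q (suc zero) = b
        zeros : ∀ q → sumK (λ i → ι (q i) * basis i) ≈ 0# → q zero ≡ 0ℚ × q (suc zero) ≡ 0ℚ
        zeros q eq = independent-1-φ (≈-trans (≈-sym (sum-basis q)) eq)

-- A p-adic descent for integer sequences

module IntegerSequences where
  open import Data.Integer.Base using (+_; _+_; _*_; _-_; -_) renaming (∣_∣ to abs)
  open import Data.Integer.Divisibility.Signed
    using (_∣_; divides; _∣?_; ∣ᵤ⇒∣; ∣⇒∣ᵤ; ∣m∣n⇒∣m+n; ∣m∣n⇒∣m-n; ∣m+n∣m⇒∣n; ∣m⇒∣m*n; ∣n⇒∣m*n; ∣-refl)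

  open ℤSolver using (_:=_; _:+_; _:*_; _:-_; :-_; con)

  Seq : Set
  Seq = ℕ → ℤ

  -- Abstract, since the normal form of an iterated difference grows exponentially.
  abstract
    Δ : Seq → Seq
    Δ u k = u (suc k) - u k

    Δ-def : ∀ u k → Δ u k ≡ u (suc k) - u k
    Δ-def u k = refl

  Δ-cong : ∀ {u v} → (∀ k → u k ≡ v k) → ∀ m k → iter Δ m u k ≡ iter Δ m v k
  Δ-cong eq zero    k = eq k
  Δ-cong eq (suc m) k =
    trans (Δ-def _ k) (trans (cong₂ _-_ (Δ-cong eq m (suc k)) (Δ-cong eq m k)) (sym (Δ-def _ k)))

  Triple : Set
  Triple = ℤ × ℤ × ℤ

  -- For s the shift and B₀ + B₁η + B₂η² = 0 a relation of η = s + s⁻¹ − 2 = s⁻¹Δ²,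
  -- multiplied by s².
  Rel : Triple → Seq → Seq
  Rel (B₀ , B₁ , B₂) u k = B₀ * u (2 ℕ.+ k) + B₁ * iter Δ 2 u (1 ℕ.+ k) + B₂ * iter Δ 4 u k

  infix 4 _∣ˢ_
  _∣ˢ_ : ℤ → Seq → Set
  p ∣ˢ u = ∀ k → p ∣ u k

  ∣ˢ-Δ : ∀ {p u} → p ∣ˢ u → p ∣ˢ Δ u
  ∣ˢ-Δ {u = u} p∣u k = subst (_ ∣_) (sym (Δ-def u k)) (∣m∣n⇒∣m-n (p∣u (suc k)) (p∣u k))

  euclid : ∀ {p} → Prime p → ∀ a b → ¬ + p ∣ a → + p ∣ a * b → + p ∣ b
  euclid {p} p-prime a b p∤a p∣ab with euclidsLemma (abs a) (abs b) p-prime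
    (subst (p ℕ∣.∣_) (ℤ.abs-* a b) (∣⇒∣ᵤ p∣ab))
  ... | inj₁ p∣a = contradiction (∣ᵤ⇒∣ p∣a) p∤a
  ... | inj₂ p∣b = ∣ᵤ⇒∣ p∣b

  -- Ψ is the operator of the p-power cyclotomic polynomial of order n; modulo p
  -- that polynomial is a power of s − 1.
  record Cyclotomic (p n : ℕ) : Set where
    field
      p-prime  : Prime p
      Ψ        : Seq → Seq
      Ψ-cong   : ∀ {u v} → (∀ k → u k ≡ v k) → ∀ k → Ψ u k ≡ Ψ v k
      Ψ-affine : ∀ c g k → Ψ (λ j → c + + p * g j) k ≡ + p * (c + Ψ g k)
      Ψ-Δ      : ∀ u k → Ψ (Δ u) k ≡ Ψ u (suc k) - Ψ u k
      t        : ℕ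
      Ψ-mod    : ∀ u k → + p ∣ Ψ u k - iter Δ 6 (iter Δ (t ℕ.* 2) u) k

  module Descent {p n′} (cyclotomic : Cyclotomic p (suc n′)) where
    open Cyclotomic cyclotomic

    n : ℕ
    n = suc n′

    P : ℤ
    P = + p

    instance
      p≢0 : ℕ.NonZero p
      p≢0 = prime⇒nonZero p-prime

    Periodic : Seq → Set
    Periodic u = ∀ k → u (n ℕ.+ k) ≡ u k

    Unit : Triple → Set
    Unit (B₀ , B₁ , B₂) = ¬ (P ∣ B₀ × P ∣ B₁ × P ∣ B₂)

    record Solution (B : Triple) (u : Seq) : Set where
      field
        periodic : Periodic u
        relation : ∀ k → Rel B u k ≡ 0ℤ
        kernel   : ∀ k → Ψ u k ≡ 0ℤ

    Δ-periodic : ∀ {u} → Periodic u → Periodic (Δ u)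
    Δ-periodic {u} per k = trans (Δ-def u (n ℕ.+ k))
      (trans (cong₂ _-_ (trans (cong u (sym (ℕ.+-suc n k))) (per (suc k))) (per k)) (sym (Δ-def u k)))

    iter-periodic : ∀ {u} m → Periodic u → Periodic (iter Δ m u)
    iter-periodic zero    per = per
    iter-periodic (suc m) per = Δ-periodic (iter-periodic m per)

    Rel-Δ : ∀ B u k → Rel B (Δ u) k ≡ Rel B u (suc k) - Rel B u k
    Rel-Δ (B₀ , B₁ , B₂) u k = trans (cong₂ _+_ (cong₂ _+_ (cong (B₀ *_) (Δ-def u (2 ℕ.+ k)))
      (cong (B₁ *_) (Δ-def (iter Δ 2 u) (1 ℕ.+ k)))) (cong (B₂ *_) (Δ-def (iter Δ 4 u) k)))
      (ℤSolver.solve 9 (λ a b c x x′ y y′ z z′ →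
        a :* (x :- x′) :+ b :* (y :- y′) :+ c :* (z :- z′) := (a :* x :+ b :* y :+ c :* z) :-
          (a :* x′ :+ b :* y′ :+ c :* z′))
      refl B₀ B₁ B₂ (u (3 ℕ.+ k)) (u (2 ℕ.+ k)) (iter Δ 2 u (2 ℕ.+ k)) (iter Δ 2 u (1 ℕ.+ k))
        (iter Δ 4 u (1 ℕ.+ k)) (iter Δ 4 u k))

    Rel-iter : ∀ B u m → P ∣ˢ Rel B u → P ∣ˢ Rel B (iter Δ m u)
    Rel-iter B u zero    p∣ k = p∣ k
    Rel-iter B u (suc m) p∣ k = subst (P ∣_) (sym (Rel-Δ B (iter Δ m u) k))
      (∣m∣n⇒∣m-n (Rel-iter B u m p∣ (suc k)) (Rel-iter B u m p∣ k))

    -- `Rel` is multiplied by s² to keep indices natural; periodicity makes the shift invertible and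
    -- undoes this.
    unshift : ∀ {u} → Periodic u → (∀ k → P ∣ u (2 ℕ.+ k)) → P ∣ˢ u
    unshift {u} per p∣ k =
      subst (P ∣_) (trans (cong u lemma) (trans (per (n ℕ.+ k)) (per k))) (p∣ (n′ ℕ.+ (n′ ℕ.+ k)))
      where
      lemma : 2 ℕ.+ (n′ ℕ.+ (n′ ℕ.+ k)) ≡ n ℕ.+ (n ℕ.+ k)
      lemma = cong suc (sym (ℕ.+-suc n′ (n′ ℕ.+ k)))

    -- Let Bᵢ be the first coefficient not divisible by p, and apply the relation to Δ⁴u, Δ²u or u
    -- for i = 0, 1, 2. Up to a shift, the i-th term is then BᵢΔ⁴u; the terms before it have
    -- coefficients divisible by p, those after it contain Δ⁶u.
    descend : ∀ {B u} → Unit B → Periodic u → P ∣ˢ Rel B u → P ∣ˢ iter Δ 6 u → P ∣ˢ iter Δ 4 u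
    descend {B₀ , B₁ , B₂} {u} unit per rel p∣⁶ with P ∣? B₀ | P ∣? B₁
    ... | no p∤B₀ | _ = unshift (iter-periodic 4 per) λ k → euclid p-prime B₀ _ p∤B₀
      (∣m+n∣m⇒∣n (subst (P ∣_) (ℤSolver.solve 3 (λ x y z → x :+ y :+ z := y :+ z :+ x) refl
        (B₀ * iter Δ 4 u (2 ℕ.+ k)) (B₁ * iter Δ 6 u (1 ℕ.+ k)) (B₂ * iter Δ 8 u k))
          (Rel-iter (B₀ , B₁ , B₂) u 4 rel k))
        (∣m∣n⇒∣m+n (∣n⇒∣m*n B₁ (p∣⁶ (1 ℕ.+ k))) (∣n⇒∣m*n B₂ (∣ˢ-Δ (∣ˢ-Δ p∣⁶) k))))
    ... | yes p∣B₀ | no p∤B₁ = unshift (iter-periodic 4 per) λ k → euclid p-prime B₁ _ p∤B₁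
      (∣m+n∣m⇒∣n (subst (P ∣_) (ℤSolver.solve 3 (λ x y z → x :+ y :+ z := x :+ z :+ y) refl
        (B₀ * iter Δ 2 u (3 ℕ.+ k)) (B₁ * iter Δ 4 u (2 ℕ.+ k)) (B₂ * iter Δ 6 u (1 ℕ.+ k)))
          (Rel-iter (B₀ , B₁ , B₂) u 2 rel (suc k)))
        (∣m∣n⇒∣m+n (∣m⇒∣m*n (iter Δ 2 u (3 ℕ.+ k)) p∣B₀) (∣n⇒∣m*n B₂ (p∣⁶ (1 ℕ.+ k)))))
    ... | yes p∣B₀ | yes p∣B₁ = λ k → euclid p-prime B₂ _ (λ p∣B₂ → unit (p∣B₀ , p∣B₁ , p∣B₂))
      (∣m+n∣m⇒∣n (rel k) (∣m∣n⇒∣m+n (∣m⇒∣m*n (u (2 ℕ.+ k)) p∣B₀) (∣m⇒∣m*n (iter Δ 2 u (1 ℕ.+ k)) p∣B₁)))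

    descend-all : ∀ {B u} → Unit B → Periodic u → P ∣ˢ Rel B u → ∀ m → P ∣ˢ iter Δ 4 (iter Δ (m ℕ.* 2) u) →
      P ∣ˢ iter Δ 4 u
    descend-all         unit per rel zero    p∣ = p∣
    descend-all {B} {u} unit per rel (suc m) p∣ = descend-all unit per rel m
      (descend unit (iter-periodic (m ℕ.* 2) per) (Rel-iter B u (m ℕ.* 2) rel) p∣)

    -- Modulo p the operator `Ψ` is Δ to the power 6 + 2t, so that Ψu = 0 is where the descent of
    -- exponents starts.
    Δ⁴-divisible : ∀ {B u} → Unit B → Solution B u → P ∣ˢ iter Δ 4 u
    Δ⁴-divisible {B} {u} unit sol =
      descend-all unit periodic (λ k → subst (P ∣_) (sym (relation k)) (divides 0ℤ refl)) (suc t)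
      λ k → subst (P ∣_) (lemma k) (∣m∣n⇒∣m-n {m = Ψ u k} (subst (P ∣_) (sym (kernel k)) (divides 0ℤ refl))
        (Ψ-mod u k))
      where
      open Solution sol
      lemma : ∀ k → Ψ u k - (Ψ u k - iter Δ 6 (iter Δ (t ℕ.* 2) u) k) ≡ iter Δ 6 (iter Δ (t ℕ.* 2) u) k
      lemma k = ℤSolver.solve 2 (λ x y → x :- (x :- y) := y) refl (Ψ u k) (iter Δ 6 (iter Δ (t ℕ.* 2) u) k)

    Rel-cong : ∀ B {u v} → (∀ k → u k ≡ v k) → ∀ k → Rel B u k ≡ Rel B v k
    Rel-cong (B₀ , B₁ , B₂) eq k = cong₂ _+_ (cong₂ _+_ (cong (B₀ *_) (eq (2 ℕ.+ k)))
      (cong (B₁ *_) (Δ-cong eq 2 (1 ℕ.+ k)))) (cong (B₂ *_) (Δ-cong eq 4 k))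

    Δ-affine : ∀ c d g m k → iter Δ (suc m) (λ j → c + d * g j) k ≡ d * iter Δ (suc m) g k
    Δ-affine c d g zero    k = trans (Δ-def _ k) (trans
      (ℤSolver.solve 4 (λ c d x y → (c :+ d :* x) :- (c :+ d :* y) := d :* (x :- y)) refl c d (g (suc k))
        (g k))
      (cong (d *_) (sym (Δ-def g k))))
    Δ-affine c d g (suc m) k =
      trans (Δ-def _ k) (trans (cong₂ _-_ (Δ-affine c d g m (suc k)) (Δ-affine c d g m k)) (trans
      (ℤSolver.solve 3 (λ d x y → d :* x :- d :* y := d :* (x :- y)) refl d (iter Δ (suc m) g (suc k))
        (iter Δ (suc m) g k))
      (cong (d *_) (sym (Δ-def (iter Δ (suc m) g) k)))))

    Rel-scale : ∀ B d g k → Rel B (λ j → d * g j) k ≡ d * Rel B g k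
    Rel-scale (B₀ , B₁ , B₂) d g k = trans (cong₂ _+_
      (cong (_+_ (B₀ * (d * g (2 ℕ.+ k)))) (cong (B₁ *_) (scale 1 (1 ℕ.+ k)))) (cong (B₂ *_) (scale 3 k)))
      (ℤSolver.solve 7 (λ a b c d x y z → a :* (d :* x) :+ b :* (d :* y) :+ c :* (d :* z) := d :*
        (a :* x :+ b :* y :+ c :* z)) refl
        B₀ B₁ B₂ d (g (2 ℕ.+ k)) (iter Δ 2 g (1 ℕ.+ k)) (iter Δ 4 g k))
      where
      scale : ∀ m k → iter Δ (suc m) (λ j → d * g j) k ≡ d * iter Δ (suc m) g k
      scale m k = trans (Δ-cong (λ j → sym (ℤ.+-identityˡ (d * g j))) (suc m) k) (Δ-affine 0ℤ d g m k)

    p-cancel : ∀ {x y} → P * x ≡ P * y → x ≡ y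
    p-cancel = ℤ.*-cancelˡ-≡ P _ _

    p-zero : ∀ {x} → P * x ≡ 0ℤ → x ≡ 0ℤ
    p-zero eq = p-cancel (trans eq (sym (ℤ.*-zeroʳ P)))

    -- Δg satisfies the same relations as u = c + pg, so that Ψg is divisible by p,
    -- while 0 = Ψu = p(c + Ψg).
    constant-part-divisible : ∀ {B u} → Unit B → Solution B u → ∀ c g → (∀ k → u k ≡ c + P * g k) → P ∣ c
    constant-part-divisible {B} {u} unit sol c g u≡ =
      subst (P ∣_) (ℤSolver.solve 2 (λ c x → (c :+ x) :- x := c) refl c (Ψ g 0))
        (∣m∣n⇒∣m-n (subst (P ∣_) (sym (p-zero (Ψu 0))) (divides 0ℤ refl)) p∣Ψg)
      where
      open Solution sol
      Δu≡ : ∀ k → Δ u k ≡ P * Δ g k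
      Δu≡ k = trans (Δ-cong u≡ 1 k) (Δ-affine c P g 0 k)
      Ψu : ∀ k → P * (c + Ψ g k) ≡ 0ℤ
      Ψu k = trans (sym (Ψ-affine c g k)) (trans (sym (Ψ-cong u≡ k)) (kernel k))
      ΔΨ≡ : ∀ k → P * Ψ (Δ g) k ≡ 0ℤ
      ΔΨ≡ k = begin
        P * Ψ (Δ g) k                                     ≡⟨ cong (P *_) (Ψ-Δ g k) ⟩
        P * (Ψ g (suc k) - Ψ g k)
          ≡⟨ ℤSolver.solve 4 (λ p c x y → p :* (x :- y) := p :* (c :+ x) :- p :* (c :+ y)) refl P c
          (Ψ g (suc k)) (Ψ g k) ⟩
        P * (c + Ψ g (suc k)) - P * (c + Ψ g k)           ≡⟨ cong₂ _-_ (Ψu (suc k)) (Ψu k) ⟩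
        0ℤ                                                ∎
        where open ≡-Reasoning
      Δg-solution : Solution B (Δ g)
      Δg-solution = record
        { periodic = λ k → p-cancel (trans (sym (Δu≡ (n ℕ.+ k))) (trans (Δ-periodic periodic k) (Δu≡ k)))
        ; relation = λ k → p-zero (trans (sym (Rel-scale B P (Δ g) k)) (trans (sym (Rel-cong B Δu≡ k))
                       (trans (Rel-Δ B u k) (cong₂ _-_ (relation (suc k)) (relation k)))))
        ; kernel   = λ k → p-zero (ΔΨ≡ k)
        }
      Δ⁶ : ∀ m → P ∣ˢ iter Δ 6 (iter Δ m g)
      Δ⁶ zero    = ∣ˢ-Δ (Δ⁴-divisible unit Δg-solution)
      Δ⁶ (suc m) = ∣ˢ-Δ (Δ⁶ m)
      p∣Ψg : P ∣ Ψ g 0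
      p∣Ψg = subst (P ∣_) (ℤSolver.solve 2 (λ x y → (x :- y) :+ y := x) refl (Ψ g 0)
        (iter Δ 6 (iter Δ (t ℕ.* 2) g) 0))
        (∣m∣n⇒∣m+n (Ψ-mod g 0) (Δ⁶ (t ℕ.* 2) 0))

    -- If Δu vanishes modulo p, then u is constant modulo p, that is, of the form c + pg treated
    -- above.
    constant-divisible : ∀ {B u} → Unit B → Solution B u → P ∣ˢ Δ u → P ∣ˢ u
    constant-divisible {B} {u} unit sol p∣Δ k =
      subst (P ∣_) (ℤSolver.solve 2 (λ x c → (x :- c) :+ c := x) refl (u k) (u 0))
      (∣m∣n⇒∣m+n (difference k) (constant-part-divisible unit sol (u 0) (λ j → _∣_.quotient (difference j))
        λ j →
        trans (ℤSolver.solve 2 (λ x c → x := c :+ (x :- c)) refl (u j) (u 0))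
          (cong (_+_ (u 0)) (trans (_∣_.equality (difference j)) (ℤ.*-comm _ P)))))
      where
      difference : ∀ k → P ∣ u k - u 0
      difference zero    = divides 0ℤ (ℤ.+-inverseʳ (u 0))
      difference (suc k) =
        subst (P ∣_) (ℤSolver.solve 3 (λ x y c → (x :- y) :+ (y :- c) := x :- c) refl (u (suc k)) (u k) (u 0))
        (∣m∣n⇒∣m+n (subst (P ∣_) (Δ-def u k) (p∣Δ k)) (difference k))

    Δ-solution : ∀ {B u} → Solution B u → Solution B (Δ u)
    Δ-solution {B} {u} sol = record
      { periodic = Δ-periodic periodic
      ; relation = λ k → trans (Rel-Δ B u k) (cong₂ _-_ (relation (suc k)) (relation k))
      ; kernel   = λ k → trans (Ψ-Δ u k) (cong₂ _-_ (kernel (suc k)) (kernel k))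
      }
      where open Solution sol

    -- From Δ⁴u ≡ 0 the four differences are stripped one at a time; Δu, Δ²u and Δ³u are solutions
    -- as well.
    divisible : ∀ {B u} → Unit B → Solution B u → P ∣ˢ u
    divisible {B} {u} unit sol =
      step sol (step sol¹ (step sol² (step (Δ-solution sol²) (Δ⁴-divisible unit sol))))
      where
      step : ∀ {v} → Solution B v → P ∣ˢ Δ v → P ∣ˢ v
      step = constant-divisible unit
      sol¹ = Δ-solution sol
      sol² = Δ-solution sol¹

    abstract
      divide : ∀ {B u} → Unit B → Solution B u → Σ[ v ∈ Seq ] (∀ j → u j ≡ P * v j)
      divide unit sol = (λ j → _∣_.quotient (divisible unit sol j))
        , λ j → trans (_∣_.equality (divisible unit sol j)) (ℤ.*-comm (_∣_.quotient (divisible unit sol j)) P)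

    shrink : ∀ x → x ≢ 0ℤ → abs x ℕ.< abs (P * x)
    shrink x x≢0 = subst (abs x ℕ.<_) (sym (ℤ.abs-* P x)) (subst (ℕ._< p ℕ.* abs x) (ℕ.*-identityˡ (abs x))
      (ℕ.*-monoˡ-< (abs x) {{ℕ.≢-nonZero (x≢0 ∘ ℤ.∣i∣≡0⇒i≡0)}}
        (ℕ.nonTrivial⇒n>1 p {{prime⇒nonTrivial p-prime}})))

    -- Infinite descent: u/p is again a solution, and a nonzero entry would shrink in absolute value
    -- each time.
    vanishes-unit : ∀ {B u} → Unit B → Solution B u → ∀ k → u k ≡ 0ℤ
    vanishes-unit {B} {u} unit sol k = go u sol (<-wellFounded (abs (u k)))
      where
      go : ∀ u → Solution B u → Acc ℕ._<_ (abs (u k)) → u k ≡ 0ℤ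
      go u sol (acc smaller) = decidable-stable (u k ℤ.≟ 0ℤ) λ uk≢0 →
        let vk≢0 : v k ≢ 0ℤ
            vk≢0 vk≡0 = uk≢0 (trans (u≡ k) (trans (cong (P *_) vk≡0) (ℤ.*-zeroʳ P)))
        in vk≢0 (go v v-solution (smaller (subst (λ x → abs (v k) ℕ.< abs x) (sym (u≡ k))
          (shrink (v k) vk≢0))))
        where
        open Solution sol
        v : Seq
        v = proj₁ (divide unit sol)
        u≡ : ∀ j → u j ≡ P * v j
        u≡ = proj₂ (divide unit sol)
        Ψv : ∀ j → P * Ψ v j ≡ 0ℤ
        Ψv j = trans (cong (P *_) (sym (ℤ.+-identityˡ (Ψ v j)))) (trans (sym (Ψ-affine 0ℤ v j))
          (trans (Ψ-cong (λ i → trans (ℤ.+-identityˡ (P * v i)) (sym (u≡ i))) j) (kernel j)))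
        v-solution : Solution B v
        v-solution = record
          { periodic = λ j → p-cancel (trans (sym (u≡ (n ℕ.+ j))) (trans (periodic j) (u≡ j)))
          ; relation =
            λ j → p-zero (trans (sym (Rel-scale B P v j)) (trans (sym (Rel-cong B u≡ j)) (relation j)))
          ; kernel   = λ j → p-zero (Ψv j)
          }

    NonZeroᵀ : Triple → Set
    NonZeroᵀ (B₀ , B₁ , B₂) = ¬ (B₀ ≡ 0ℤ × B₁ ≡ 0ℤ × B₂ ≡ 0ℤ)

    size : Triple → ℕ
    size (B₀ , B₁ , B₂) = abs B₀ ℕ.+ abs B₁ ℕ.+ abs B₂

    shrink≤ : ∀ x → abs x ℕ.≤ abs (P * x)
    shrink≤ x with x ℤ.≟ 0ℤ
    ... | yes refl = ℕ.z≤n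
    ... | no  x≢0  = ℕ.<⇒≤ (shrink x x≢0)

    -- A factor p common to all three coefficients is divided out of the relation first; this
    -- terminates because some coefficient is nonzero.
    vanishes : ∀ {B u} → NonZeroᵀ B → Solution B u → ∀ k → u k ≡ 0ℤ
    vanishes {B} {u} B≢0 sol k = go B B≢0 sol (<-wellFounded (size B))
      where
      go : ∀ B → NonZeroᵀ B → Solution B u → Acc ℕ._<_ (size B) → u k ≡ 0ℤ
      go B@(B₀ , B₁ , B₂) B≢0 sol (acc smaller) with P ∣? B₀ | P ∣? B₁ | P ∣? B₂
      ... | no p∤B₀ | _ | _ = vanishes-unit (λ (p∣B₀ , _ , _) → p∤B₀ p∣B₀) sol k
      ... | yes _ | no p∤B₁ | _ = vanishes-unit (λ (_ , p∣B₁ , _) → p∤B₁ p∣B₁) sol k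
      ... | yes _ | yes _ | no p∤B₂ = vanishes-unit (λ (_ , _ , p∣B₂) → p∤B₂ p∣B₂) sol k
      ... | yes (divides q₀ refl) | yes (divides q₁ refl) | yes (divides q₂ refl) =
        go (q₀ , q₁ , q₂) (λ { (refl , refl , refl) → B≢0 (refl , refl , refl) }) smaller-solution
          (smaller size<)
        where
        open Solution sol
        smaller-solution : Solution (q₀ , q₁ , q₂) u
        smaller-solution = record
          { periodic = periodic
          ; relation = λ j → p-zero (trans (ℤSolver.solve 7
            (λ p a b c x y z → p :* (a :* x :+ b :* y :+ c :* z)
            := a :* p :* x :+ b :* p :* y :+ c :* p :* z) refl
                         P q₀ q₁ q₂ (u (2 ℕ.+ j)) (iter Δ 2 u (1 ℕ.+ j)) (iter Δ 4 u j)) (relation j))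
          ; kernel   = kernel
          }
        ≤-P : ∀ q → abs q ℕ.≤ abs (q * P)
        ≤-P q = subst (λ x → abs q ℕ.≤ abs x) (ℤ.*-comm P q) (shrink≤ q)
        <-P : ∀ q → q ≢ 0ℤ → abs q ℕ.< abs (q * P)
        <-P q q≢0 = subst (λ x → abs q ℕ.< abs x) (ℤ.*-comm P q) (shrink q q≢0)
        size< : size (q₀ , q₁ , q₂) ℕ.< size (q₀ * P , q₁ * P , q₂ * P)
        size< with q₀ ℤ.≟ 0ℤ | q₁ ℤ.≟ 0ℤ | q₂ ℤ.≟ 0ℤ
        ... | no q₀≢0 | _ | _ = ℕ.+-mono-<-≤ (ℕ.+-mono-<-≤ (<-P q₀ q₀≢0) (≤-P q₁)) (≤-P q₂)
        ... | yes _ | no q₁≢0 | _ = ℕ.+-mono-<-≤ (ℕ.+-mono-≤-< (≤-P q₀) (<-P q₁ q₁≢0)) (≤-P q₂)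
        ... | yes _ | yes _ | no q₂≢0 = ℕ.+-mono-≤-< (ℕ.+-mono-≤ (≤-P q₀) (≤-P q₁)) (<-P q₂ q₂≢0)
        ... | yes refl | yes refl | yes refl = contradiction (refl , refl , refl) B≢0

  -- Cyclotomic operators modulo p

  ∑< : ℕ → Seq → ℤ
  ∑< zero    f = 0ℤ
  ∑< (suc m) f = f 0 + ∑< m (f ∘ suc)

  ∑-cong : ∀ m {f g} → (∀ k → f k ≡ g k) → ∑< m f ≡ ∑< m g
  ∑-cong zero    eq = refl
  ∑-cong (suc m) eq = cong₂ _+_ (eq 0) (∑-cong m (eq ∘ suc))

  ∑-last : ∀ m f → ∑< (suc m) f ≡ ∑< m f + f m
  ∑-last zero    f = ℤ.+-comm (f 0) 0ℤ
  ∑-last (suc m) f = trans (cong (_+_ (f 0)) (∑-last m (f ∘ suc))) (sym (ℤ.+-assoc (f 0) _ _))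

  ∑-minus : ∀ m f g → ∑< m (λ k → f k - g k) ≡ ∑< m f - ∑< m g
  ∑-minus zero    f g = refl
  ∑-minus (suc m) f g = trans (cong (_+_ (f 0 - g 0)) (∑-minus m (f ∘ suc) (g ∘ suc)))
    (ℤSolver.solve 4 (λ a b x y → (a :- b) :+ (x :- y) := (a :+ x) :- (b :+ y)) refl (f 0) (g 0)
      (∑< m (f ∘ suc)) (∑< m (g ∘ suc)))

  ∑-affine : ∀ m c d g → ∑< m (λ k → c + d * g k) ≡ + m * c + d * ∑< m g
  ∑-affine zero    c d g = ℤSolver.solve 2 (λ c d → con 0ℤ := con 0ℤ :* c :+ d :* con 0ℤ) refl c d
  ∑-affine (suc m) c d g = trans (cong (_+_ (c + d * g 0)) (∑-affine m c d (g ∘ suc)))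
    (trans (ℤSolver.solve 5 (λ m c d x y → (c :+ d :* x) :+ (m :* c :+ d :* y) := (con 1ℤ :+ m)
      :* c :+ d :* (x :+ y)) refl (+ m) c d (g 0) (∑< m (g ∘ suc)))
      refl)

  ∑-divisible : ∀ {p} m f → (∀ k → k ℕ.< m → p ∣ f k) → p ∣ ∑< m f
  ∑-divisible zero    f p∣ = divides 0ℤ refl
  ∑-divisible (suc m) f p∣ =
    ∣m∣n⇒∣m+n (p∣ 0 (ℕ.s≤s ℕ.z≤n)) (∑-divisible m (f ∘ suc) λ k k<m → p∣ (suc k) (ℕ.s≤s k<m))

  -- The coefficients of (s − 1)ʳ.
  coeff : ℕ → ℕ → ℤ
  coeff zero    zero    = 1ℤ
  coeff zero    (suc j) = 0ℤ
  coeff (suc r) zero    = - coeff r zero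
  coeff (suc r) (suc j) = coeff r j - coeff r (suc j)

  coeff-top : ∀ r → coeff r (suc r) ≡ 0ℤ × coeff r r ≡ 1ℤ
  coeff-top r = beyond′ r , top r
    where
    beyond : ∀ r i → coeff r (suc (r ℕ.+ i)) ≡ 0ℤ
    beyond zero    i = refl
    beyond (suc r) i =
      cong₂ _-_ (beyond r i) (trans (cong (coeff r ∘ suc) (sym (ℕ.+-suc r i))) (beyond r (suc i)))
    beyond′ : ∀ r → coeff r (suc r) ≡ 0ℤ
    beyond′ r = trans (cong (coeff r ∘ suc) (sym (ℕ.+-identityʳ r))) (beyond r 0)
    top : ∀ r → coeff r r ≡ 1ℤ
    top zero    = refl
    top (suc r) = trans (cong₂ _-_ (top r) (beyond′ r)) refl

  Δ-expansion : ∀ r u k → iter Δ r u k ≡ ∑< (suc r) (λ j → coeff r j * u (j ℕ.+ k))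
  Δ-expansion zero    u k = ℤSolver.solve 1 (λ x → x := con 1ℤ :* x :+ con 0ℤ) refl (u k)
  Δ-expansion (suc r) u k = begin
    Δ (iter Δ r u) k                                              ≡⟨ Δ-def (iter Δ r u) k ⟩
    iter Δ r u (suc k) - iter Δ r u k
      ≡⟨ cong₂ _-_ (Δ-expansion r u (suc k)) (Δ-expansion r u k) ⟩
    ∑< (suc r) (λ j → c j * u (j ℕ.+ suc k)) - ∑< (suc r) f
      ≡⟨ cong₂ _-_ (∑-cong (suc r) λ j → cong (λ i → c j * u i) (ℕ.+-suc j k)) extend ⟩
    ∑< (suc r) f′ - (f 0 + ∑< (suc r) (f ∘ suc))
      ≡⟨ ℤSolver.solve 3 (λ x a y → x :- (a :+ y) := :- a :+ (x :- y)) refl (∑< (suc r) f′) (f 0)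
      (∑< (suc r) (f ∘ suc)) ⟩
    - f 0 + (∑< (suc r) f′ - ∑< (suc r) (f ∘ suc))
      ≡⟨ cong (_+_ (- f 0)) (∑-minus (suc r) f′ (f ∘ suc)) ⟨
    - f 0 + ∑< (suc r) (λ j → f′ j - f (suc j))
      ≡⟨ cong₂ _+_ (ℤ.neg-distribˡ-* (c 0) (u k)) (∑-cong (suc r) λ j →
        ℤSolver.solve 3 (λ a b x → a :* x :- b :* x := (a :- b) :* x) refl (c j) (c (suc j))
          (u (suc j ℕ.+ k))) ⟩
    ∑< (suc (suc r)) (λ j → coeff (suc r) j * u (j ℕ.+ k))        ∎
    where
    open ≡-Reasoning
    c : ℕ → ℤ
    c = coeff r
    f f′ : Seq
    f  j = c j * u (j ℕ.+ k)
    f′ j = c j * u (suc j ℕ.+ k)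
    extend : ∑< (suc r) f ≡ ∑< (suc (suc r)) f
    extend = sym (trans (∑-last (suc r) f) (trans
      (cong (λ x → ∑< (suc r) f + x * u (suc r ℕ.+ k)) (proj₁ (coeff-top r)))
      (ℤ.+-identityʳ _)))

  -- The absorption identity of binomial coefficients; the signs on the two sides agree.
  coeff-absorb : ∀ r j → + suc j * coeff (suc r) (suc j) ≡ + suc r * coeff r j
  coeff-absorb zero    zero    = refl
  coeff-absorb zero    (suc j) = ℤ.*-zeroʳ (+ suc (suc j))
  coeff-absorb (suc r) zero    = begin
    1ℤ * (- c 0 - coeff (suc r) 1)
      ≡⟨ ℤSolver.solve 2 (λ x y → con 1ℤ :* (:- x :- y) := :- x :- con 1ℤ :* y) refl (c 0) (coeff (suc r) 1) ⟩
    - c 0 - 1ℤ * coeff (suc r) 1                 ≡⟨ cong (_-_ (- c 0)) (coeff-absorb r zero) ⟩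
    - c 0 - + suc r * c 0
      ≡⟨ ℤSolver.solve 2 (λ m x → :- x :- m :* x := (con 1ℤ :+ m) :* (:- x)) refl (+ suc r) (c 0) ⟩
    + suc (suc r) * (- c 0)                      ∎
    where
    open ≡-Reasoning
    c = coeff r
  coeff-absorb (suc r) (suc j) = begin
    + suc (suc j) * (x - coeff (suc r) (suc (suc j)))            ≡⟨ ℤ.*-distribˡ-+ (+ suc (suc j)) x _ ⟩
    + suc (suc j) * x + + suc (suc j) * - coeff (suc r) (suc (suc j))
      ≡⟨ cong (_+_ (+ suc (suc j) * x)) (ℤ.neg-distribʳ-* (+ suc (suc j)) _) ⟨
    + suc (suc j) * x - + suc (suc j) * coeff (suc r) (suc (suc j))
      ≡⟨ cong (_-_ (+ suc (suc j) * x)) (coeff-absorb r (suc j)) ⟩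
    + suc (suc j) * x - + suc r * c (suc j)
      ≡⟨ ℤSolver.solve 4 (λ i m a b → (con 1ℤ :+ i) :* (a :- b) :- m :* b := (i :* (a :- b) :- m :* a) :+
      (con 1ℤ :+ m) :* (a :- b)) refl (+ suc j) (+ suc r) (c j) (c (suc j)) ⟩
    (+ suc j * x - + suc r * c j) + + suc (suc r) * x
      ≡⟨ cong (λ y → (y - + suc r * c j) + + suc (suc r) * x) (coeff-absorb r j) ⟩
    (+ suc r * c j - + suc r * c j) + + suc (suc r) * x
      ≡⟨ cong (_+ + suc (suc r) * x) (ℤ.+-inverseʳ (+ suc r * c j)) ⟩
    0ℤ + + suc (suc r) * x                                       ≡⟨ ℤ.+-identityˡ _ ⟩
    + suc (suc r) * x                                            ∎
    where
    open ≡-Reasoning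
    c = coeff r
    x = coeff (suc r) (suc j)

  module _ {r} (p-prime : Prime (suc r)) where

    private
      p : ℤ
      p = + suc r

    -- The difference is an inner coefficient of (s - 1)ᵖ, where p = r + 1, and by absorption its
    -- multiple by j + 1, which is prime to p, is divisible by p.
    coeff-step : ∀ {j} → j ℕ.< r → p ∣ coeff r j - coeff r (suc j)
    coeff-step {j} j<r =
      euclid p-prime (+ suc j) (coeff (suc r) (suc j)) (λ p∣j → ℕ.<⇒≱ (ℕ.s≤s j<r) (ℕ∣.∣⇒≤ (∣⇒∣ᵤ p∣j)))
      (divides (coeff r j) (trans (coeff-absorb r j) (ℤ.*-comm p (coeff r j))))

    -- By `coeff-step` all coefficients of (s - 1)^(p-1) agree modulo p with the leading one. In
    -- other words, 1 + s + ... + s^(p-1) ≡ (s - 1)^(p-1).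
    coeff-prime : ∀ {j} → j ℕ.≤ r → p ∣ coeff r j - 1ℤ
    coeff-prime {j} j≤r = subst (λ i → p ∣ coeff r i - 1ℤ) (ℕ.m∸[m∸n]≡n j≤r) (down (r ℕ.∸ j) (ℕ.m∸n≤m r j))
      where
      down : ∀ i → i ℕ.≤ r → p ∣ coeff r (r ℕ.∸ i) - 1ℤ
      down zero    _   = subst (λ x → p ∣ x - 1ℤ) (sym (proj₂ (coeff-top r))) (divides 0ℤ refl)
      down (suc i) i<r = subst (p ∣_) (ℤSolver.solve 3 (λ x y o → (x :- y) :+ (y :- o) := x :- o) refl
        (coeff r (r ℕ.∸ suc i)) (coeff r (r ℕ.∸ i)) 1ℤ)
        (∣m∣n⇒∣m+n (subst (λ k → p ∣ coeff r (r ℕ.∸ suc i) - coeff r k) (sym (ℕ.+-∸-assoc 1 i<r))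
            (coeff-step (subst (ℕ._≤ r) (ℕ.+-∸-assoc 1 i<r) (ℕ.m∸n≤m r i))))
          (down i (ℕ.<⇒≤ i<r)))

    ∑-mod-Δ : ∀ u k → p ∣ ∑< (suc r) (λ j → u (j ℕ.+ k)) - iter Δ r u k
    ∑-mod-Δ u k = subst (p ∣_) (trans (∑-minus (suc r) (λ j → u (j ℕ.+ k)) (λ j → coeff r j * u (j ℕ.+ k)))
      (cong (_-_ (∑< (suc r) (λ j → u (j ℕ.+ k)))) (sym (Δ-expansion r u k))))
      (∑-divisible (suc r) (λ j → u (j ℕ.+ k) - coeff r j * u (j ℕ.+ k)) λ j j≤r → subst (p ∣_)
        (ℤSolver.solve 2 (λ c x → (c :- con 1ℤ) :* (:- x) := x :- c :* x) refl (coeff r j) (u (j ℕ.+ k)))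
        (∣m⇒∣m*n (- u (j ℕ.+ k)) (coeff-prime (ℕ.s≤s⁻¹ j≤r))))

    cyclotomic-prime : ∀ t → r ≡ 6 ℕ.+ t ℕ.* 2 → Cyclotomic (suc r) (suc r)
    cyclotomic-prime t r≡ = record
      { p-prime  = p-prime
      ; Ψ        = λ u k → ∑< (suc r) (λ j → u (j ℕ.+ k))
      ; Ψ-cong   = λ eq k → ∑-cong (suc r) (λ j → eq (j ℕ.+ k))
      ; Ψ-affine = λ c g k → trans (∑-affine (suc r) c p (λ j → g (j ℕ.+ k))) (sym (ℤ.*-distribˡ-+ p c _))
      ; Ψ-Δ = λ u k → trans (∑-cong (suc r) (λ j → trans (Δ-def u (j ℕ.+ k))
        (cong (λ i → u i - u (j ℕ.+ k)) (sym (ℕ.+-suc j k)))))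
                     (∑-minus (suc r) (λ j → u (j ℕ.+ suc k)) (λ j → u (j ℕ.+ k)))
      ; t        = t
      ; Ψ-mod    = λ u k → subst (λ m → p ∣ ∑< (suc r) (λ j → u (j ℕ.+ k)) - iter Δ m u k) r≡ (∑-mod-Δ u k)
      }

  module _ where

    private
      d₅ : Seq → Seq
      d₅ u k = u (5 ℕ.+ k) - u k

      Ψ₂₅ : Seq → Seq
      Ψ₂₅ u k = u k + u (5 ℕ.+ k) + u (10 ℕ.+ k) + u (15 ℕ.+ k) + u (20 ℕ.+ k)

      5ℤ : ℤ
      5ℤ = + 5

      -- The quotient is s⁴ - 2s³ + 2s² - s, from (s⁵ - 1) - (s - 1)⁵ = 5s⁴ - 10s³ + 10s² - 5s.
      frobenius : ∀ u k → 5ℤ ∣ d₅ u k - iter Δ 5 u k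
      frobenius u k = divides (u (4 ℕ.+ k) - (1ℤ + 1ℤ) * u (3 ℕ.+ k) + (1ℤ + 1ℤ) * u (2 ℕ.+ k) - u (1 ℕ.+ k))
        (trans (cong (_-_ (d₅ u k)) (Δ-expansion 5 u k)) (ℤSolver.solve 6 (λ a b c d e f →
          (f :- a) :- (con (- 1ℤ) :* a :+ (con (+ 5) :* b :+
            (con (- + 10) :* c :+ (con (+ 10) :* d :+ (con (- + 5) :* e :+ (con (+ 1) :* f :+ con 0ℤ))))))
          := (e :- (con 1ℤ :+ con 1ℤ) :* d :+ (con 1ℤ :+ con 1ℤ) :* c :- b) :* con (+ 5)) refl
          (u k) (u (1 ℕ.+ k)) (u (2 ℕ.+ k)) (u (3 ℕ.+ k)) (u (4 ℕ.+ k)) (u (5 ℕ.+ k))))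

      infix 4 _≋_
      _≋_ : Seq → Seq → Set
      u ≋ v = ∀ k → 5ℤ ∣ u k - v k

      ≋-trans : ∀ u v w → u ≋ v → v ≋ w → u ≋ w
      ≋-trans u v w eq eq′ k = subst (5ℤ ∣_) (ℤSolver.solve 3 (λ x y z → (x :- y) :+ (y :- z) := x :- z)
        refl (u k) (v k) (w k)) (∣m∣n⇒∣m+n (eq k) (eq′ k))

      d₅-≋ : ∀ u v → u ≋ v → d₅ u ≋ d₅ v
      d₅-≋ u v eq k = subst (5ℤ ∣_) (ℤSolver.solve 4
        (λ x y x′ y′ → (x :- y) :- (x′ :- y′) := (x :- x′) :- (y :- y′)) refl (u (5 ℕ.+ k)) (v (5 ℕ.+ k))
        (u k) (v k))
        (∣m∣n⇒∣m-n (eq (5 ℕ.+ k)) (eq k))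

      d₅-iter : ∀ m u → iter d₅ m u ≋ iter Δ (m ℕ.* 5) u
      d₅-iter zero    u k = divides 0ℤ (ℤ.+-inverseʳ (u k))
      d₅-iter (suc m) u = ≋-trans (iter d₅ (suc m) u) (d₅ (iter Δ (m ℕ.* 5) u)) (iter Δ (suc m ℕ.* 5) u)
        (d₅-≋ (iter d₅ m u) (iter Δ (m ℕ.* 5) u) (d₅-iter m u)) (frobenius (iter Δ (m ℕ.* 5) u))

      -- With y = s⁵ this is (1 + y + y² + y³ + y⁴) - (y - 1)⁴ = 5(y³ - y² + y).
      Ψ-d₅ : ∀ u → Ψ₂₅ u ≋ iter d₅ 4 u
      Ψ-d₅ u k = divides (u (15 ℕ.+ k) - u (10 ℕ.+ k) + u (5 ℕ.+ k)) (ℤSolver.solve 5 (λ a b c d e →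
          (a :+ b :+ c :+ d :+ e) :- ((((e :- d) :- (d :- c)) :- ((d :- c) :- (c :- b))) :-
            (((d :- c) :- (c :- b)) :- ((c :- b) :- (b :- a))))
          := (d :- c :+ b) :* con (+ 5)) refl (u k) (u (5 ℕ.+ k)) (u (10 ℕ.+ k)) (u (15 ℕ.+ k)) (u
            (20 ℕ.+ k)))

    cyclotomic-25 : Cyclotomic 5 25
    cyclotomic-25 = record
      { p-prime  = from-yes (prime? 5)
      ; Ψ        = Ψ₂₅
      ; Ψ-cong = λ eq k → cong₂ _+_ (cong₂ _+_ (cong₂ _+_ (cong₂ _+_ (eq k) (eq (5 ℕ.+ k)))
        (eq (10 ℕ.+ k))) (eq (15 ℕ.+ k))) (eq (20 ℕ.+ k))
      ; Ψ-affine = λ c g k → ℤSolver.solve 6 (λ c v w x y z → (c :+ con (+ 5) :* v) :+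
        (c :+ con (+ 5) :* w) :+ (c :+ con (+ 5) :* x) :+ (c :+ con (+ 5) :* y) :+ (c :+ con (+ 5) :* z)
                     := con (+ 5) :* (c :+ (v :+ w :+ x :+ y :+ z))) refl c (g k) (g (5 ℕ.+ k)) (g
                       (10 ℕ.+ k)) (g (15 ℕ.+ k)) (g (20 ℕ.+ k))
      ; Ψ-Δ = λ u k → trans (cong₂ _+_ (cong₂ _+_
        (cong₂ _+_ (cong₂ _+_ (Δ-def u k) (Δ-def u (5 ℕ.+ k))) (Δ-def u (10 ℕ.+ k))) (Δ-def u (15 ℕ.+ k)))
        (Δ-def u (20 ℕ.+ k)))
                     (ℤSolver.solve 10 (λ a b c d e a′ b′ c′ d′ e′ → (a′ :- a) :+ (b′ :- b) :+ (c′ :- c) :+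
                       (d′ :- d) :+ (e′ :- e)
                       := (a′ :+ b′ :+ c′ :+ d′ :+ e′) :- (a :+ b :+ c :+ d :+ e)) refl
                       (u k) (u (5 ℕ.+ k)) (u (10 ℕ.+ k)) (u (15 ℕ.+ k)) (u (20 ℕ.+ k))
                       (u (1 ℕ.+ k)) (u (6 ℕ.+ k)) (u (11 ℕ.+ k)) (u (16 ℕ.+ k)) (u (21 ℕ.+ k)))
      -- Four powers of s⁵ - 1 give Δ to the power 20 = 6 + 7 · 2.
      ; t        = 7
      ; Ψ-mod    = λ u → ≋-trans (Ψ₂₅ u) (iter d₅ 4 u) (iter Δ 20 u) (Ψ-d₅ u) (d₅-iter 4 u)
      }

open IntegerSequences using
  (Seq; Δ; Δ-def; Δ-expansion; Triple; Rel; Cyclotomic; ∑<; ∑-cong; module Descent; cyclotomic-prime; cyclotomic-25)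

-- Clearing denominators

fromℤ : ℤ → ℚ
fromℤ z = ℚ.mkℚ z 0 (Coprime.sym (Coprime.1-coprimeTo _))

fromℤ-* : ∀ a b → fromℤ (a ℤ.* b) ≡ fromℤ a ℚ.* fromℤ b
fromℤ-* a b = ℚ.toℚᵘ-injective (ℚᵘ.≃-trans (ℚᵘ.*≡*
  (ℤSolver.solve 2 (λ a b → (a ℤSolver.:* b) ℤSolver.:* ℤSolver.con 1ℤ ℤSolver.:= (a ℤSolver.:* b)
  ℤSolver.:* ℤSolver.con 1ℤ) refl a b))
  (ℚᵘ.≃-sym (ℚ.toℚᵘ-homo-* (fromℤ a) (fromℤ b))))

fromℤ-+ : ∀ a b → fromℤ (a ℤ.+ b) ≡ fromℤ a ℚ.+ fromℤ b
fromℤ-+ a b = ℚ.toℚᵘ-injective (ℚᵘ.≃-trans (ℚᵘ.*≡*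
  (ℤSolver.solve 2 (λ a b → (a ℤSolver.:+ b) ℤSolver.:* ℤSolver.con 1ℤ ℤSolver.:=
  (a ℤSolver.:* ℤSolver.con 1ℤ ℤSolver.:+ b ℤSolver.:* ℤSolver.con 1ℤ) ℤSolver.:* ℤSolver.con 1ℤ) refl a b))
  (ℚᵘ.≃-sym (ℚ.toℚᵘ-homo-+ (fromℤ a) (fromℤ b))))

fromℤ-injective : ∀ {a b} → fromℤ a ≡ fromℤ b → a ≡ b
fromℤ-injective = cong ℚ.↥_

denominator-clears : ∀ q → fromℤ (ℚ.↧ q) ℚ.* q ≡ fromℤ (ℚ.↥ q)
denominator-clears q@(ℚ.mkℚ n d-1 _) = ℚ.toℚᵘ-injective (ℚᵘ.≃-trans (ℚ.toℚᵘ-homo-* (fromℤ (ℚ.↧ q)) q)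
  (ℚᵘ.*≡* (ℤSolver.solve 2 (λ d n → (d ℤSolver.:* n) ℤSolver.:* ℤSolver.con 1ℤ ℤSolver.:= n ℤSolver.:*
    (ℤSolver.con 1ℤ ℤSolver.:* d)) refl (ℤ.+ suc d-1) n)))

product≢0 : ∀ a b → a ≢ 0ℤ → b ≢ 0ℤ → a ℤ.* b ≢ 0ℤ
product≢0 a b a≢0 b≢0 ab≡0 with ℤ.i*j≡0⇒i≡0∨j≡0 a ab≡0
... | inj₁ a≡0 = a≢0 a≡0
... | inj₂ b≡0 = b≢0 b≡0

common-denominator : ∀ n (q : ℕ → ℚ) → Σ[ D ∈ ℤ ] D ≢ 0ℤ × (∀ k → k ℕ.< n → ∃[ z ] fromℤ D ℚ.* q k ≡ fromℤ z)
common-denominator zero    q = 1ℤ , (λ ()) , λ k ()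
common-denominator (suc n) q with common-denominator n q
... | D , D≢0 , clears = d ℤ.* D , product≢0 d D (λ ()) D≢0 , clears′
  where
  d : ℤ
  d = ℚ.↧ (q n)
  clears′ : ∀ k → k ℕ.< suc n → ∃[ z ] fromℤ (d ℤ.* D) ℚ.* q k ≡ fromℤ z
  clears′ k k<1+n with k ℕ.≟ n
  ... | yes refl = D ℤ.* ℚ.↥ (q n) , (begin
      fromℤ (d ℤ.* D) ℚ.* q n          ≡⟨ cong (ℚ._* q n) (trans (cong fromℤ (ℤ.*-comm d D)) (fromℤ-* D d)) ⟩
      fromℤ D ℚ.* fromℤ d ℚ.* q n      ≡⟨ ℚ.*-assoc (fromℤ D) (fromℤ d) (q n) ⟩
      fromℤ D ℚ.* (fromℤ d ℚ.* q n)    ≡⟨ cong (fromℤ D ℚ.*_) (denominator-clears (q n)) ⟩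
      fromℤ D ℚ.* fromℤ (ℚ.↥ (q n))    ≡⟨ fromℤ-* D _ ⟨
      fromℤ (D ℤ.* ℚ.↥ (q n))          ∎)
    where open ≡-Reasoning
  ... | no k≢n with clears k (ℕ.≤∧≢⇒< (ℕ.s≤s⁻¹ k<1+n) k≢n)
  ...   | z , eq = d ℤ.* z , (begin
      fromℤ (d ℤ.* D) ℚ.* q k          ≡⟨ cong (ℚ._* q k) (fromℤ-* d D) ⟩
      fromℤ d ℚ.* fromℤ D ℚ.* q k      ≡⟨ ℚ.*-assoc (fromℤ d) (fromℤ D) (q k) ⟩
      fromℤ d ℚ.* (fromℤ D ℚ.* q k)    ≡⟨ cong (fromℤ d ℚ.*_) eq ⟩
      fromℤ d ℚ.* fromℤ z              ≡⟨ fromℤ-* d z ⟨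
      fromℤ (d ℤ.* z)                  ∎)
    where open ≡-Reasoning

-- Formal integer combinations of the entries of a sequence. One such combination is evaluated in ℤ,
-- in ℚ and in the field, which is how relations between roots of unity are carried over to integer
-- sequences.
Combination : Set
Combination = List (ℤ × ℕ)

evalℤ : Combination → Seq → ℤ
evalℤ []            u = 0ℤ
evalℤ ((c , j) ∷ C) u = c ℤ.* u j ℤ.+ evalℤ C u

evalℚ : Combination → (ℕ → ℚ) → ℚ
evalℚ []            q = 0ℚ
evalℚ ((c , j) ∷ C) q = fromℤ c ℚ.* q j ℚ.+ evalℚ C q

evalℤ-scaled : ∀ C D q (z : Seq) → (∀ k → fromℤ D ℚ.* q k ≡ fromℤ (z k)) → fromℤ (evalℤ C z)
  ≡ fromℤ D ℚ.* evalℚ C q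
evalℤ-scaled []            D q z scaled = sym (ℚ.*-zeroʳ (fromℤ D))
evalℤ-scaled ((c , j) ∷ C) D q z scaled = begin
  fromℤ (c ℤ.* z j ℤ.+ evalℤ C z)
    ≡⟨ trans (fromℤ-+ (c ℤ.* z j) _) (cong (ℚ._+ fromℤ (evalℤ C z)) (fromℤ-* c (z j))) ⟩
  fromℤ c ℚ.* fromℤ (z j) ℚ.+ fromℤ (evalℤ C z)
    ≡⟨ cong₂ (λ x y → fromℤ c ℚ.* x ℚ.+ y) (sym (scaled j)) (evalℤ-scaled C D q z scaled) ⟩
  fromℤ c ℚ.* (fromℤ D ℚ.* q j) ℚ.+ fromℤ D ℚ.* evalℚ C q
    ≡⟨ ℚSolver.solve 4 (λ c d x y → c ℚSolver.:* (d ℚSolver.:* x)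
    ℚSolver.:+ d ℚSolver.:* y ℚSolver.:= d ℚSolver.:* (c ℚSolver.:* x ℚSolver.:+ y)) refl
      (fromℤ c) (fromℤ D) (q j) (evalℚ C q) ⟩
  fromℤ D ℚ.* (fromℤ c ℚ.* q j ℚ.+ evalℚ C q)      ∎
  where open ≡-Reasoning

-- `Rel` with Δ² and Δ⁴ expanded by their binomial coefficients 1, -2, 1 and 1, -4, 6, -4, 1.
relation-combination : Triple → ℕ → Combination
relation-combination (B₀ , B₁ , B₂) k =
  (B₀ , 2 ℕ.+ k) ∷ (B₁ , 3 ℕ.+ k) ∷ (ℤ.- ℤ.+ 2 ℤ.* B₁ , 2 ℕ.+ k) ∷ (B₁ , 1 ℕ.+ k) ∷
  (B₂ , 4 ℕ.+ k) ∷ (ℤ.- ℤ.+ 4 ℤ.* B₂ , 3 ℕ.+ k) ∷ (ℤ.+ 6 ℤ.* B₂ , 2 ℕ.+ k) ∷ (ℤ.- ℤ.+ 4 ℤ.* B₂ , 1 ℕ.+ k) ∷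
    (B₂ , k) ∷ []

relation-eval : ∀ B u k → Rel B u k ≡ evalℤ (relation-combination B k) u
relation-eval (B₀ , B₁ , B₂) u k = trans
  (cong₂ (λ x y → B₀ ℤ.* u (2 ℕ.+ k) ℤ.+ B₁ ℤ.* x ℤ.+ B₂ ℤ.* y) (Δ-expansion 2 u (1 ℕ.+ k))
    (Δ-expansion 4 u k))
  (ℤSolver.solve 8 (λ a b c x₀ x₁ x₂ x₃ x₄ →
    a ℤSolver.:* x₂ ℤSolver.:+ b ℤSolver.:* (ℤSolver.con 1ℤ ℤSolver.:* x₁ ℤSolver.:+
      (ℤSolver.con (ℤ.- ℤ.+ 2) ℤSolver.:* x₂ ℤSolver.:+
      (ℤSolver.con 1ℤ ℤSolver.:* x₃ ℤSolver.:+ ℤSolver.con 0ℤ)))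
      ℤSolver.:+ c ℤSolver.:* (ℤSolver.con 1ℤ ℤSolver.:* x₀ ℤSolver.:+
        (ℤSolver.con (ℤ.- ℤ.+ 4) ℤSolver.:* x₁ ℤSolver.:+
        (ℤSolver.con (ℤ.+ 6) ℤSolver.:* x₂ ℤSolver.:+
        (ℤSolver.con (ℤ.- ℤ.+ 4) ℤSolver.:* x₃ ℤSolver.:+
        (ℤSolver.con 1ℤ ℤSolver.:* x₄ ℤSolver.:+ ℤSolver.con 0ℤ)))))
    ℤSolver.:= a ℤSolver.:* x₂ ℤSolver.:+ (b ℤSolver.:* x₃ ℤSolver.:+
      (ℤSolver.con (ℤ.- ℤ.+ 2) ℤSolver.:* b ℤSolver.:* x₂ ℤSolver.:+
      (b ℤSolver.:* x₁ ℤSolver.:+ (c ℤSolver.:* x₄ ℤSolver.:+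
      (ℤSolver.con (ℤ.- ℤ.+ 4) ℤSolver.:* c ℤSolver.:* x₃ ℤSolver.:+
      (ℤSolver.con (ℤ.+ 6) ℤSolver.:* c ℤSolver.:* x₂ ℤSolver.:+
        (ℤSolver.con (ℤ.- ℤ.+ 4) ℤSolver.:* c ℤSolver.:* x₁ ℤSolver.:+
        (c ℤSolver.:* x₀ ℤSolver.:+ ℤSolver.con 0ℤ)))))))))
    refl B₀ B₁ B₂ (u k) (u (1 ℕ.+ k)) (u (2 ℕ.+ k)) (u (3 ℕ.+ k)) (u (4 ℕ.+ k)))

-- Sums ζ + ζ⁻¹ outside quadratic fields

module Obstruction {c ℓ₁ ℓ₂ : Level} (Ω : AlgebraicallyClosedField c ℓ₁ ℓ₂) where
  open Field Ω

  ιℤ : ℤ → K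
  ιℤ z = ι (fromℤ z)

  ιℤ-* : ∀ a b → ιℤ (a ℤ.* b) ≈ ιℤ a * ιℤ b
  ιℤ-* a b = ≈-trans (ι-cong (fromℤ-* a b)) (ι-* _ _)

  evalK : Combination → (ℕ → K) → K
  evalK []            θ = 0#
  evalK ((c , j) ∷ C) θ = ιℤ c * θ j + evalK C θ

  pow : K → ℕ → K
  pow z k = iter (z *_) k 1#

  module _ {ζ ζ′ : K} (ζζ′ : ζ * ζ′ ≈ 1#) where

    θ : ℕ → K
    θ k = pow ζ k + pow ζ′ k

    θ-recurrence : ∀ k → θ (2 ℕ.+ k) ≈ θ 1 * θ (1 ℕ.+ k) - θ k
    θ-recurrence k = begin
      ζ * (ζ * a) + ζ′ * (ζ′ * b)
        ≈⟨ solve 4 (λ z w a b → z :* (z :* a) :+ w :* (w :* b) := (z :* con 1ℚ :+ w :* con 1ℚ) :*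
        (z :* a :+ w :* b) :- (z :* w :* a :+ z :* w :* b)) ≈-refl ζ ζ′ a b ⟩
      θ 1 * (ζ * a + ζ′ * b) - (ζ * ζ′ * a + ζ * ζ′ * b)
        ≈⟨ +-congˡ (-‿cong (+-cong (≈-trans (*-congʳ ζζ′) (*-identityˡ a))
        (≈-trans (*-congʳ ζζ′) (*-identityˡ b)))) ⟩
      θ 1 * (ζ * a + ζ′ * b) - (a + b)                              ∎
      where
      open ≈-Reasoning
      a b : K
      a = pow ζ k
      b = pow ζ′ k

    module _ {p} {X : Pred K p} (deg : HasDegree Ω (Generated Ω X) 2) (θ₁∈ : Generated Ω X (ζ + ζ′)) where

      open HasDegree deg

      θ∈ : ∀ k → Generated Ω X (θ k) × Generated Ω X (θ (suc k))
      θ∈ zero    = +∈ 1∈ 1∈ , resp (+-cong (≈-sym (*-identityʳ ζ)) (≈-sym (*-identityʳ ζ′))) θ₁∈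
      θ∈ (suc k) = proj₂ (θ∈ k) , resp (≈-sym (θ-recurrence k))
        (+∈ (*∈ (proj₂ (θ∈ 0)) (proj₂ (θ∈ k))) (-∈ (proj₁ (θ∈ k))))

      q : Fin 2 → ℕ → ℚ
      q i k = proj₁ (spanning (proj₁ (θ∈ k))) i

      θ-coords : ∀ k → θ k ≈ ι (q zero k) * basis zero + (ι (q (suc zero) k) * basis (suc zero) + 0#)
      θ-coords k = proj₂ (spanning (proj₁ (θ∈ k)))

      evalK-coords : ∀ C → evalK C θ ≈ ι (evalℚ C (q zero)) * basis zero +
        (ι (evalℚ C (q (suc zero))) * basis (suc zero) + 0#)
      evalK-coords [] = ≈-trans (solve 2 (λ x y → con 0ℚ := con 0ℚ :* x :+ (con 0ℚ :* y :+ con 0ℚ)) ≈-refl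
        (basis zero) (basis (suc zero)))
        (≈-sym (+-cong (*-congʳ ι-0) (+-congʳ (*-congʳ ι-0))))
      evalK-coords ((c , j) ∷ C) = begin
        ιℤ c * θ j + evalK C θ   ≈⟨ +-cong (*-congˡ (θ-coords j)) (evalK-coords C) ⟩
        _
          ≈⟨ solve 7 (λ c x y x′ y′ b₀ b₁ → c :* (x :* b₀ :+ (y :* b₁ :+ con 0ℚ)) :+
          (x′ :* b₀ :+ (y′ :* b₁ :+ con 0ℚ))
            := (c :* x :+ x′) :* b₀ :+ ((c :* y :+ y′) :* b₁ :+ con 0ℚ)) ≈-refl
            (ιℤ c) (ι (q zero j)) (ι (q (suc zero) j)) (ι (evalℚ C (q zero))) (ι (evalℚ C (q (suc zero))))
              (basis zero) (basis (suc zero)) ⟩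
        _                        ≈⟨ +-cong (*-congʳ (collect zero)) (+-congʳ (*-congʳ (collect (suc zero)))) ⟩
        _                        ∎
        where
        open ≈-Reasoning
        collect : ∀ i → ιℤ c * ι (q i j) + ι (evalℚ C (q i)) ≈ ι (evalℚ ((c , j) ∷ C) (q i))
        collect i = ≈-sym (≈-trans (ι-+ _ _) (+-congʳ (ι-* (fromℤ c) (q i j))))

      -- A basis is independent over ℚ, so each coordinate sequence inherits every integral linear
      -- relation of the θₖ.
      evalℚ-zero : ∀ C → evalK C θ ≈ 0# → ∀ i → evalℚ C (q i) ≡ 0ℚ
      evalℚ-zero C eq = independent (λ i → evalℚ C (q i)) (≈-trans (≈-sym (evalK-coords C)) eq)

      -- θ₀ = 2 is nonzero. The coordinate found here is the one that the descent will show to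
      -- vanish.
      θ₀-coordinate : Σ[ i ∈ Fin 2 ] q i 0 ≢ 0ℚ
      θ₀-coordinate with q zero 0 ℚ.≟ 0ℚ | q (suc zero) 0 ℚ.≟ 0ℚ
      ... | no q≢0  | _       = zero , q≢0
      ... | yes _   | no q≢0  = suc zero , q≢0
      ... | yes q≡0 | yes q≡0′ = contradiction (begin
          ι 2ℚ             ≈⟨ ι-+ 1ℚ 1ℚ ⟩
          ι 1ℚ + ι 1ℚ      ≈⟨ +-cong ι-1 ι-1 ⟩
          θ 0              ≈⟨ θ-coords 0 ⟩
          _
            ≈⟨ +-cong (*-congʳ (≈-trans (ι-cong q≡0) ι-0)) (+-congʳ (*-congʳ (≈-trans (ι-cong q≡0′) ι-0))) ⟩
          _
            ≈⟨ solve 2 (λ x y → con 0ℚ :* x :+ (con 0ℚ :* y :+ con 0ℚ) := con 0ℚ) ≈-refl (basis zero)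
            (basis (suc zero)) ⟩
          0#               ∎) (#0⇒≉0 (ι-#0 λ ()))
        where open ≈-Reasoning

      abstract
        -- In a field of degree 2 the numbers 1, η and η² with η = ζ + ζ′ - 2 are dependent.
        integral-relation : Σ[ B ∈ Triple ] ¬ (proj₁ B ≡ 0ℤ × proj₁ (proj₂ B) ≡ 0ℤ × proj₂ (proj₂ B) ≡ 0ℤ)
          × ιℤ (proj₁ B) + ιℤ (proj₁ (proj₂ B)) * (ζ + ζ′ - ι 2ℚ) + ιℤ (proj₂ (proj₂ B)) *
            ((ζ + ζ′ - ι 2ℚ) * (ζ + ζ′ - ι 2ℚ)) ≈ 0#
        integral-relation with dependence deg 1∈ η∈ (*∈ η∈ η∈)
          where
          η∈ : Generated Ω X (ζ + ζ′ - ι 2ℚ)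
          η∈ = +∈ θ₁∈ (-∈ (resp (≈-sym (≈-trans (ι-+ 1ℚ 1ℚ) (+-cong ι-1 ι-1))) (+∈ 1∈ 1∈)))
        ... | dep = (proj₁ (z 0) , proj₁ (z 1) , proj₁ (z 2)) ,
          (λ (eq₀ , eq₁ , eq₂) → nonzero (unscale 0 0<3 eq₀ , unscale 1 1<3 eq₁ , unscale 2 2<3 eq₂)) , (begin
            ιℤ (proj₁ (z 0)) + ιℤ (proj₁ (z 1)) * η + ιℤ (proj₁ (z 2)) * (η * η)
              ≈⟨ +-cong (+-cong (scaled 0 0<3) (*-congʳ (scaled 1 1<3))) (*-congʳ (scaled 2 2<3)) ⟩
            ιℤ D * ι B₀ + ιℤ D * ι B₁ * η + ιℤ D * ι B₂ * (η * η)
              ≈⟨ solve 5 (λ d a b c x → d :* a :+ d :* b :* x :+ d :* c :* (x :* x) := d :*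
              (a :* con 1ℚ :+ b :* x :+ c :* (x :* x))) ≈-refl
                (ιℤ D) (ι B₀) (ι B₁) (ι B₂) η ⟩
            ιℤ D * (ι B₀ * 1# + ι B₁ * η + ι B₂ * (η * η))                             ≈⟨ *-congˡ relation ⟩
            ιℤ D * 0#                                                                  ≈⟨ zeroʳ _ ⟩
            0#                                                                         ∎)
          where
          open ≈-Reasoning
          open Dependence dep
          η : K
          η = ζ + ζ′ - ι 2ℚ
          coefficient : ℕ → ℚ
          coefficient 0 = B₀
          coefficient 1 = B₁
          coefficient _ = B₂
          cleared : Σ[ D ∈ ℤ ] D ≢ 0ℤ × (∀ k → k ℕ.< 3 → ∃[ z ] fromℤ D ℚ.* coefficient k ≡ fromℤ z)
          cleared = common-denominator 3 coefficient
          D : ℤ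
          D = proj₁ cleared
          z : ∀ k → ∃[ z ] (k ℕ.< 3 → fromℤ D ℚ.* coefficient k ≡ fromℤ z)
          z k with k ℕ.<? 3
          ... | yes k<3 = proj₁ (proj₂ (proj₂ cleared) k k<3) , λ _ → proj₂ (proj₂ (proj₂ cleared) k k<3)
          ... | no  k≮3 = 0ℤ , λ k<3 → contradiction k<3 k≮3
          scaled : ∀ k → k ℕ.< 3 → ιℤ (proj₁ (z k)) ≈ ιℤ D * ι (coefficient k)
          scaled k k<3 = ≈-trans (ι-cong (sym (proj₂ (z k) k<3))) (ι-* _ _)
          unscale : ∀ k → k ℕ.< 3 → proj₁ (z k) ≡ 0ℤ → coefficient k ≡ 0ℚ
          unscale k k<3 eq = ι-zero (*-cancel-# (ι-#0 λ D≡0 → proj₁ (proj₂ cleared) (fromℤ-injective D≡0))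
            (≈-trans (≈-sym (scaled k k<3)) (≈-trans (ι-cong (cong fromℤ eq)) ι-0)))
          0<3 : 0 ℕ.< 3
          0<3 = ℕ.s≤s ℕ.z≤n
          1<3 : 1 ℕ.< 3
          1<3 = ℕ.s≤s (ℕ.s≤s ℕ.z≤n)
          2<3 : 2 ℕ.< 3
          2<3 = ℕ.≤-refl

      -- The relation is symmetric in ζ and ζ′, so its operator annihilates k ↦ ζᵏ and k ↦ ζ′ᵏ
      -- separately. The factor `G x` is x² times the relation, because x² + 1 - 2x = xη when x is ζ
      -- or ζ′.
      relation-vanishes : ∀ B → ιℤ (proj₁ B) + ιℤ (proj₁ (proj₂ B)) * (ζ + ζ′ - ι 2ℚ)
          + ιℤ (proj₂ (proj₂ B)) * ((ζ + ζ′ - ι 2ℚ) * (ζ + ζ′ - ι 2ℚ)) ≈ 0# →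
        ∀ k → evalK (relation-combination B k) θ ≈ 0#
      relation-vanishes B@(B₀ , B₁ , B₂) eq k = begin
        evalK (relation-combination B k) θ
          ≈⟨ +-congˡ (+-congˡ (+-cong (*-congʳ (ιℤ-* _ B₁))
            (+-congˡ (+-congˡ (+-cong (*-congʳ (ιℤ-* _ B₂))
            (+-cong (*-congʳ (ιℤ-* _ B₂)) (+-congʳ (*-congʳ (ιℤ-* _ B₂))))))))) ⟩
        _ ≈⟨ solve 7 (λ z w a b p q r →
               let t₀ = a :+ b
                   t₁ = z :* a :+ w :* b
                   t₂ = z :* (z :* a) :+ w :* (w :* b)
                   t₃ = z :* (z :* (z :* a)) :+ w :* (w :* (w :* b))
                   t₄ = z :* (z :* (z :* (z :* a))) :+ w :* (w :* (w :* (w :* b)))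
                   g = λ x → p :* (x :* x) :+ q :* (x :* (x :* x :+ con 1ℚ :- con 2ℚ :* x)) :+ r :*
                     ((x :* x :+ con 1ℚ :- con 2ℚ :* x) :* (x :* x :+ con 1ℚ :- con 2ℚ :* x))
               in p :* t₂ :+ (q :* t₃ :+ (con (fromℤ (ℤ.- ℤ.+ 2)) :* q :* t₂ :+
                 (q :* t₁ :+ (r :* t₄ :+ (con (fromℤ (ℤ.- ℤ.+ 4)) :* r :* t₃ :+
                    (con (fromℤ (ℤ.+ 6)) :* r :* t₂ :+
                      (con (fromℤ (ℤ.- ℤ.+ 4)) :* r :* t₁ :+ (r :* t₀ :+ con 0ℚ))))))))
                  := a :* g z :+ b :* g w) ≈-refl ζ ζ′ (pow ζ k) (pow ζ′ k) (ιℤ B₀) (ιℤ B₁) (ιℤ B₂) ⟩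
        pow ζ k * G ζ + pow ζ′ k * G ζ′
          ≈⟨ +-cong (*-congˡ (G-zero ζ ζ′ ζζ′ eq)) (*-congˡ (G-zero ζ′ ζ (≈-trans (*-comm ζ′ ζ) ζζ′)
             (≈-trans (+-cong (+-congˡ (*-congˡ swap)) (*-congˡ (*-cong swap swap))) eq))) ⟩
        pow ζ k * 0# + pow ζ′ k * 0#
          ≈⟨ solve 2 (λ x y → x :* con 0ℚ :+ y :* con 0ℚ := con 0ℚ) ≈-refl (pow ζ k) (pow ζ′ k) ⟩
        0#                              ∎
        where
        open ≈-Reasoning
        swap : ζ′ + ζ - ι 2ℚ ≈ ζ + ζ′ - ι 2ℚ
        swap = +-congʳ (+-comm ζ′ ζ)
        G : K → K
        G x = ιℤ B₀ * (x * x) + ιℤ B₁ * (x * (x * x + 1# - ι 2ℚ * x)) + ιℤ B₂ *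
          ((x * x + 1# - ι 2ℚ * x) * (x * x + 1# - ι 2ℚ * x))
        G-zero : ∀ x y → x * y ≈ 1# → ιℤ B₀ + ιℤ B₁ * (x + y - ι 2ℚ) + ιℤ B₂ *
          ((x + y - ι 2ℚ) * (x + y - ι 2ℚ)) ≈ 0# → G x ≈ 0#
        G-zero x y xy eq = begin
          G x                       ≈⟨ +-cong (+-congˡ (*-congˡ (*-congˡ η))) (*-congˡ (*-cong η η)) ⟩
          _
            ≈⟨ solve 5 (λ x y p q r → p :* (x :* x) :+ q :* (x :* (x :* (x :+ y :- con 2ℚ))) :+ r :*
            ((x :* (x :+ y :- con 2ℚ)) :* (x :* (x :+ y :- con 2ℚ)))
              := x :* x :* (p :+ q :* (x :+ y :- con 2ℚ) :+ r :*
                ((x :+ y :- con 2ℚ) :* (x :+ y :- con 2ℚ)))) ≈-refl x y (ιℤ B₀) (ιℤ B₁) (ιℤ B₂) ⟩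
          _                         ≈⟨ *-congˡ eq ⟩
          x * x * 0#                ≈⟨ zeroʳ _ ⟩
          0#                        ∎
          where
          η : x * x + 1# - ι 2ℚ * x ≈ x * (x + y - ι 2ℚ)
          η = ≈-trans (+-congʳ (+-congˡ (≈-sym xy)))
            (solve 2 (λ x y → x :* x :+ x :* y :- con 2ℚ :* x := x :* (x :+ y :- con 2ℚ)) ≈-refl x y)

      -- A coordinate sequence is periodic, so one denominator makes all of it integral. It
      -- satisfies the relation and is annihilated by `Ψ`; by the descent it is zero, although its
      -- initial term is not.
      degree≢2 : ∀ {p n′} (cyclotomic : Cyclotomic p (suc n′)) → pow ζ (suc n′) ≈ 1# → pow ζ′ (suc n′) ≈ 1# →
        (C : ℕ → Combination) → (∀ u k → Cyclotomic.Ψ cyclotomic u k ≡ evalℤ (C k) u) →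
          (∀ k → evalK (C k) θ ≈ 0#) → Data.Empty.⊥
      degree≢2 {p} {n′} cyclotomic ζⁿ ζ′ⁿ C Ψ-eval Ψθ≈0 = contradiction z₀≡0 z₀≢0
        where
        open Descent cyclotomic using (n; Solution; vanishes)
        i : Fin 2
        i = proj₁ θ₀-coordinate
        pow-periodic : ∀ z → pow z n ≈ 1# → ∀ k → pow z (k ℕ.+ n) ≈ pow z k
        pow-periodic z zⁿ zero    = zⁿ
        pow-periodic z zⁿ (suc k) = *-congˡ (pow-periodic z zⁿ k)
        q-periodic : ∀ k → q i (k ℕ.+ n) ≡ q i k
        q-periodic k = begin
          q i (k ℕ.+ n)
            ≡⟨ ℚSolver.solve 2 (λ x y → x ℚSolver.:= ℚSolver.con 1ℚ ℚSolver.:* x ℚSolver.:+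
            (ℚSolver.con (fromℤ (ℤ.- 1ℤ)) ℚSolver.:* y ℚSolver.:+ ℚSolver.con 0ℚ) ℚSolver.:+ y) refl (q i
            (k ℕ.+ n)) (q i k) ⟩
          evalℚ ((1ℤ , k ℕ.+ n) ∷ (ℤ.- 1ℤ , k) ∷ []) (q i) ℚ.+ q i k
            ≡⟨ cong (ℚ._+ q i k) (evalℚ-zero ((1ℤ , k ℕ.+ n) ∷ (ℤ.- 1ℤ , k) ∷ []) θ-periodic i) ⟩
          0ℚ ℚ.+ q i k                                                 ≡⟨ ℚ.+-identityˡ _ ⟩
          q i k                                                        ∎
          where
          open ≡-Reasoning
          θ-periodic : evalK ((1ℤ , k ℕ.+ n) ∷ (ℤ.- 1ℤ , k) ∷ []) θ ≈ 0#
          θ-periodic = ≈-trans (+-congʳ (*-cong ι-1 (+-cong (pow-periodic ζ ζⁿ k) (pow-periodic ζ′ ζ′ⁿ k))))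
            (solve 1 (λ x → con 1ℚ :* x :+ (con (fromℤ (ℤ.- 1ℤ)) :* x :+ con 0ℚ) := con 0ℚ) ≈-refl (θ k))
        q-periodic-* : ∀ m k → q i (k ℕ.+ m ℕ.* n) ≡ q i k
        q-periodic-* zero    k = cong (q i) (ℕ.+-identityʳ k)
        q-periodic-* (suc m) k =
          trans (cong (q i) (sym (ℕ.+-assoc k n (m ℕ.* n)))) (trans (q-periodic-* m (k ℕ.+ n)) (q-periodic k))
        cleared = common-denominator n (q i)
        D : ℤ
        D = proj₁ cleared
        reduced : ∀ k → ∃[ z ] fromℤ D ℚ.* q i (k % n) ≡ fromℤ z
        reduced k = proj₂ (proj₂ cleared) (k % n) (m%n<n k n)
        z : Seq
        z k = proj₁ (reduced k)
        scaled : ∀ k → fromℤ D ℚ.* q i k ≡ fromℤ (z k)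
        scaled k = trans (cong (fromℤ D ℚ.*_) (trans (cong (q i) (m≡m%n+[m/n]*n k n))
          (q-periodic-* (k / n) (k % n)))) (proj₂ (reduced k))
        transfer : ∀ C → evalK C θ ≈ 0# → evalℤ C z ≡ 0ℤ
        transfer C eq = fromℤ-injective (trans (evalℤ-scaled C D (q i) z scaled)
          (trans (cong (fromℤ D ℚ.*_) (evalℚ-zero C eq i)) (ℚ.*-zeroʳ (fromℤ D))))
        B : Triple
        B = proj₁ integral-relation
        solution : Solution B z
        solution = record
          { periodic = λ k → fromℤ-injective (trans (sym (scaled (n ℕ.+ k))) (trans (cong (fromℤ D ℚ.*_)
                         (trans (cong (q i) (ℕ.+-comm n k)) (q-periodic k))) (scaled k)))
          ; relation = λ k → trans (relation-eval B z k)
            (transfer (relation-combination B k) (relation-vanishes B (proj₂ (proj₂ integral-relation)) k))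
          ; kernel   = λ k → trans (Ψ-eval z k) (transfer (C k) (Ψθ≈0 k))
          }
        z₀≡0 : z 0 ≡ 0ℤ
        z₀≡0 = vanishes (proj₁ (proj₂ integral-relation)) solution 0
        z₀≢0 : z 0 ≢ 0ℤ
        z₀≢0 z₀≡0 = proj₂ θ₀-coordinate (ι-zero (*-cancel-#
          (ι-#0 {fromℤ D} λ D≡0 → proj₁ (proj₂ cleared) (fromℤ-injective D≡0))
          (≈-trans (≈-sym (ι-* _ _)) (≈-trans (ι-cong (trans (scaled 0) (cong fromℤ z₀≡0))) ι-0))))

  -- The geometric sum 1 + z + ... + z^(m-1) in Horner form.
  T : K → ℕ → K
  T z zero    = 0#
  T z (suc m) = 1# + z * T z m

  T-cong : ∀ {y z} → y ≈ z → ∀ m → T y m ≈ T z m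
  T-cong eq zero    = ≈-refl
  T-cong eq (suc m) = +-congˡ (*-cong eq (T-cong eq m))

  T-telescope : ∀ z m → (z - 1#) * T z m ≈ pow z m - 1#
  T-telescope z zero    = solve 1 (λ z → (z :- con 1ℚ) :* con 0ℚ := con 1ℚ :- con 1ℚ) ≈-refl z
  T-telescope z (suc m) = begin
    (z - 1#) * (1# + z * T z m)
      ≈⟨ solve 2 (λ z t → (z :- con 1ℚ) :* (con 1ℚ :+ z :* t) := z :- con 1ℚ :+ z :* ((z :- con 1ℚ) :* t))
      ≈-refl z (T z m) ⟩
    z - 1# + z * ((z - 1#) * T z m)       ≈⟨ +-congˡ (*-congˡ (T-telescope z m)) ⟩
    z - 1# + z * (pow z m - 1#)
      ≈⟨ solve 2 (λ z a → z :- con 1ℚ :+ z :* (a :- con 1ℚ) := z :* a :- con 1ℚ) ≈-refl z (pow z m) ⟩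
    z * pow z m - 1#                      ∎
    where open ≈-Reasoning

  pow-inverse : ∀ {y z} → y * z ≈ 1# → ∀ m → pow y m * pow z m ≈ 1#
  pow-inverse         eq zero    = *-identityˡ 1#
  pow-inverse {y} {z} eq (suc m) =
    ≈-trans (solve 4 (λ y z a b → y :* a :* (z :* b) := (y :* z) :* (a :* b)) ≈-refl y z (pow y m) (pow z m))
    (≈-trans (*-cong eq (pow-inverse eq m)) (*-identityˡ 1#))

  T-last : ∀ z m → T z (suc m) ≈ T z m + pow z m
  T-last z zero    = solve 1 (λ z → con 1ℚ :+ z :* con 0ℚ := con 0ℚ :+ con 1ℚ) ≈-refl z
  T-last z (suc m) = ≈-trans (+-congˡ (*-congˡ (T-last z m)))
    (solve 3 (λ z t a → con 1ℚ :+ z :* (t :+ a) := con 1ℚ :+ z :* t :+ z :* a) ≈-refl z (T z m) (pow z m))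

  -- Multiplication by the top power of the inverse reverses the order of the geometric sum. Thus
  -- the inverse of a root is a root.
  T-inverse : ∀ {y z} → y * z ≈ 1# → ∀ m → pow y m * T z (suc m) ≈ T y (suc m)
  T-inverse {y} {z} eq zero =
    solve 2 (λ y z → con 1ℚ :* (con 1ℚ :+ z :* con 0ℚ) := con 1ℚ :+ y :* con 0ℚ) ≈-refl y z
  T-inverse {y} {z} eq (suc m) = begin
    y * pow y m * T z (suc (suc m))                               ≈⟨ *-congˡ (T-last z (suc m)) ⟩
    y * pow y m * (T z (suc m) + z * pow z m)
      ≈⟨ solve 5 (λ y z a b t → y :* a :* (t :+ z :* b) := y :* (a :* t) :+ y :* z :* (a :* b)) ≈-refl y z
      (pow y m) (pow z m) (T z (suc m)) ⟩
    y * (pow y m * T z (suc m)) + y * z * (pow y m * pow z m)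
      ≈⟨ +-cong (*-congˡ (T-inverse eq m)) (*-cong eq (pow-inverse eq m)) ⟩
    y * T y (suc m) + 1# * 1#
      ≈⟨ solve 1 (λ x → x :+ con 1ℚ :* con 1ℚ := con 1ℚ :+ x) ≈-refl (y * T y (suc m)) ⟩
    T y (suc (suc m))                                             ∎
    where open ≈-Reasoning

  T-inverse-zero : ∀ {y z} → y * z ≈ 1# → ∀ m → T y (suc m) ≈ 0# → T z (suc m) ≈ 0#
  T-inverse-zero eq m Ty = *-cancel-# (invertible⇒#0 (pow-inverse eq m)) (≈-trans (T-inverse eq m) Ty)

  pow-^ : ∀ z m → z ^ᴷ m ≈ pow z m
  pow-^ z zero    = ≈-refl
  pow-^ z (suc m) = *-congˡ (pow-^ z m)

  -- A root of the geometric sum itself, and not just of z^(m+2) - 1, since it is the sum that the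
  -- operator `Ψ` encodes.
  geometric-root : ∀ m → ∃[ z ] T z (suc (suc m)) ≈ 0#
  geometric-root m with hasRoot m (λ _ → 1#)
  ... | z , eq = z , (begin
      T z (suc (suc m))                                                 ≈⟨ T-last z (suc m) ⟩
      T z (suc m) + pow z (suc m)
        ≈⟨ +-cong (≈-sym (sum-T 0 (suc m))) (≈-sym (pow-^ z (suc m))) ⟩
      _                                                                 ≈⟨ +-comm _ _ ⟩
      z ^ᴷ suc m + sumK (λ (i : Fin (suc m)) → 1# * z ^ᴷ Fin.toℕ i)     ≈⟨ eq ⟩
      0#                                                                ∎)
    where
    open ≈-Reasoning
    sum-pow : ∀ k m → sumK (λ (i : Fin m) → 1# * z ^ᴷ (k ℕ.+ Fin.toℕ i)) ≈ pow z k * T z m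
    sum-pow k zero    = ≈-sym (zeroʳ (pow z k))
    sum-pow k (suc m) = begin
      1# * z ^ᴷ (k ℕ.+ 0) + sumK (λ (i : Fin m) → 1# * z ^ᴷ (k ℕ.+ suc (Fin.toℕ i)))
        ≈⟨ +-cong (*-congˡ (≈-trans (reflexive (cong (z ^ᴷ_) (ℕ.+-identityʳ k))) (pow-^ z k)))
          (sum-cong m λ i → *-congˡ (reflexive (cong (z ^ᴷ_) (ℕ.+-suc k (Fin.toℕ i))))) ⟩
      1# * pow z k + sumK (λ (i : Fin m) → 1# * z ^ᴷ (suc k ℕ.+ Fin.toℕ i)) ≈⟨ +-congˡ (sum-pow (suc k) m) ⟩
      1# * pow z k + z * pow z k * T z m
        ≈⟨ solve 3 (λ z a t → con 1ℚ :* a :+ z :* a :* t := a :* (con 1ℚ :+ z :* t)) ≈-refl z (pow z k)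
        (T z m) ⟩
      pow z k * (1# + z * T z m)                                             ∎
      where
      sum-cong : ∀ m {f g : Fin m → K} → (∀ i → f i ≈ g i) → sumK f ≈ sumK g
      sum-cong zero    eq = ≈-refl
      sum-cong (suc m) eq = +-cong (eq zero) (sum-cong m (eq ∘ suc))
    sum-T : ∀ k m → sumK (λ (i : Fin m) → 1# * z ^ᴷ Fin.toℕ i) ≈ T z m
    sum-T _ m = ≈-trans (sum-pow 0 m) (*-identityˡ _)

  pow-of-geometric : ∀ {z} m → T z m ≈ 0# → pow z m ≈ 1#
  pow-of-geometric {z} m eq = -≈0⇒≈ (≈-trans (≈-sym (T-telescope z m)) (≈-trans (*-congˡ eq) (zeroʳ _)))

  run : ℕ → ℕ → Combination
  run zero    k = []
  run (suc m) k = (1ℤ , k) ∷ run m (suc k)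

  run-eval : ∀ m u k → ∑< m (λ j → u (j ℕ.+ k)) ≡ evalℤ (run m k) u
  run-eval zero    u k = refl
  run-eval (suc m) u k = cong₂ ℤ._+_ (sym (ℤ.*-identityˡ (u k)))
    (trans (∑-cong m λ j → cong u (sym (ℕ.+-suc j k))) (run-eval m u (suc k)))

  run-θ : ∀ {ζ ζ′} (ζζ′ : ζ * ζ′ ≈ 1#) m k → evalK (run m k) (θ ζζ′) ≈ pow ζ k * T ζ m + pow ζ′ k * T ζ′ m
  run-θ {ζ} {ζ′} ζζ′ zero k =
    solve 2 (λ x y → con 0ℚ := x :* con 0ℚ :+ y :* con 0ℚ) ≈-refl (pow ζ k) (pow ζ′ k)
  run-θ {ζ} {ζ′} ζζ′ (suc m) k = ≈-trans (+-cong (*-congʳ ι-1) (run-θ ζζ′ m (suc k)))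
    (solve 6 (λ z w a b s t → con 1ℚ :* (a :+ b) :+ (z :* a :* s :+ w :* b :* t) := a :* (con 1ℚ :+ z :* s)
      :+ b :* (con 1ℚ :+ w :* t)) ≈-refl
      ζ ζ′ (pow ζ k) (pow ζ′ k) (T ζ m) (T ζ′ m))

  record NonquadraticRoot (n : ℕ) : Set (Level.suc (c ⊔ ℓ₁ ⊔ ℓ₂)) where
    field
      ζ ζ′ : K
      ζζ′  : ζ * ζ′ ≈ 1#
      ζ′ⁿ  : pow ζ′ n ≈ 1#
      nonquadratic : ∀ {X : Pred K (c ⊔ ℓ₁ ⊔ ℓ₂)} → HasDegree Ω (Generated Ω X) 2 → ¬ Generated Ω X (ζ + ζ′)

  pow-+ : ∀ z m k → pow z (m ℕ.+ k) ≈ pow z m * pow z k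
  pow-+ z zero    k = ≈-sym (*-identityˡ _)
  pow-+ z (suc m) k = ≈-trans (*-congˡ (pow-+ z m k)) (≈-sym (*-assoc z _ _))

  nonquadratic-prime : ∀ t → Prime (7 ℕ.+ t ℕ.* 2) → NonquadraticRoot (7 ℕ.+ t ℕ.* 2)
  nonquadratic-prime t p-prime = record
    { ζ = ζ ; ζ′ = ζ′ ; ζζ′ = ζⁿ ; ζ′ⁿ = ζ′ⁿ
    ; nonquadratic =
      λ deg θ∈ → degree≢2 ζⁿ deg θ∈ (cyclotomic-prime p-prime t refl) ζⁿ ζ′ⁿ (run n) (run-eval n)
        λ k → ≈-trans (run-θ ζⁿ n k) (≈-trans (+-cong (*-congˡ Tζ) (*-congˡ Tζ′))
          (solve 2 (λ x y → x :* con 0ℚ :+ y :* con 0ℚ := con 0ℚ) ≈-refl (pow ζ k) (pow ζ′ k)))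
    }
    where
    n : ℕ
    n = 7 ℕ.+ t ℕ.* 2
    ζ ζ′ : K
    ζ  = proj₁ (geometric-root (5 ℕ.+ t ℕ.* 2))
    -- The inverse is taken as the power n - 1, so that ζ * ζ′ unfolds to `pow ζ n`.
    ζ′ = pow ζ (6 ℕ.+ t ℕ.* 2)
    Tζ : T ζ n ≈ 0#
    Tζ = proj₂ (geometric-root (5 ℕ.+ t ℕ.* 2))
    ζⁿ : pow ζ n ≈ 1#
    ζⁿ = pow-of-geometric n Tζ
    Tζ′ : T ζ′ n ≈ 0#
    Tζ′ = T-inverse-zero ζⁿ (6 ℕ.+ t ℕ.* 2) Tζ
    ζ′ⁿ : pow ζ′ n ≈ 1#
    ζ′ⁿ = pow-of-geometric n Tζ′

  pow-* : ∀ z m k → pow z (m ℕ.* k) ≈ pow (pow z k) m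
  pow-* z zero    k = ≈-refl
  pow-* z (suc m) k = ≈-trans (pow-+ z k (m ℕ.* k)) (*-congˡ (pow-* z m k))

  -- The 25th cyclotomic polynomial is 1 + y + y² + y³ + y⁴ at y = z⁵, so ζ is found as a fifth root
  -- of a root η of 1 + y + y² + y³ + y⁴.
  nonquadratic-25 : NonquadraticRoot 25
  nonquadratic-25 = record
    { ζ = ζ ; ζ′ = ζ′ ; ζζ′ = ζ²⁵ ; ζ′ⁿ = ζ′²⁵
    ; nonquadratic = λ deg θ∈ → degree≢2 ζ²⁵ deg θ∈ cyclotomic-25 ζ²⁵ ζ′²⁵ C C-eval C-θ
    }
    where
    η : K
    η = proj₁ (geometric-root 3)
    coefficients-of : Fin 5 → K
    coefficients-of zero    = - η
    coefficients-of (suc _) = 0#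
    ζ ζ′ : K
    ζ  = proj₁ (hasRoot 4 coefficients-of)
    ζ′ = pow ζ 24
    ζ⁵ : pow ζ 5 ≈ η
    ζ⁵ = -≈0⇒≈ (≈-trans (solve 2 (λ z e →
        let p = λ m → iter (z :*_) m (con 1ℚ) in
        p 5 :- e := p 5 :+ (:- e :* con 1ℚ :+ (con 0ℚ :* p 1 :+
          (con 0ℚ :* p 2 :+ (con 0ℚ :* p 3 :+ (con 0ℚ :* p 4 :+ con 0ℚ))))))
      ≈-refl ζ η) (proj₂ (hasRoot 4 coefficients-of)))
    Tζ⁵ : T (pow ζ 5) 5 ≈ 0#
    Tζ⁵ = ≈-trans (T-cong ζ⁵ 5) (proj₂ (geometric-root 3))
    ζ²⁵ : pow ζ 25 ≈ 1#
    ζ²⁵ = ≈-trans (pow-* ζ 5 5) (pow-of-geometric 5 Tζ⁵)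
    Tζ′⁵ : T (pow ζ′ 5) 5 ≈ 0#
    Tζ′⁵ = T-inverse-zero (pow-inverse ζ²⁵ 5) 4 Tζ⁵
    ζ′²⁵ : pow ζ′ 25 ≈ 1#
    ζ′²⁵ = ≈-trans (pow-* ζ′ 5 5) (pow-of-geometric 5 Tζ′⁵)
    C : ℕ → Combination
    C k = (1ℤ , k) ∷ (1ℤ , 5 ℕ.+ k) ∷ (1ℤ , 10 ℕ.+ k) ∷ (1ℤ , 15 ℕ.+ k) ∷ (1ℤ , 20 ℕ.+ k) ∷ []
    C-eval : ∀ u k → Cyclotomic.Ψ cyclotomic-25 u k ≡ evalℤ (C k) u
    C-eval u k = ℤSolver.solve 5
      (λ a b c d e →
      a ℤSolver.:+ b ℤSolver.:+ c ℤSolver.:+ d ℤSolver.:+ e ℤSolver.:= one ℤSolver.:* a ℤSolver.:+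
      (one ℤSolver.:* b ℤSolver.:+ (one ℤSolver.:* c ℤSolver.:+
      (one ℤSolver.:* d ℤSolver.:+ (one ℤSolver.:* e ℤSolver.:+ ℤSolver.con 0ℤ)))))
      refl (u k) (u (5 ℕ.+ k)) (u (10 ℕ.+ k)) (u (15 ℕ.+ k)) (u (20 ℕ.+ k))
      where
      one : ∀ {n} → ℤSolver.Polynomial n
      one = ℤSolver.con 1ℤ
    split : ∀ z k j → pow z (j ℕ.* 5 ℕ.+ k) ≈ pow (pow z 5) j * pow z k
    split z k j = ≈-trans (pow-+ z (j ℕ.* 5) k) (*-congʳ (pow-* z j 5))
    C-θ : ∀ k → evalK (C k) (θ ζ²⁵) ≈ 0#
    C-θ k = begin
      evalK (C k) (θ ζ²⁵)
        ≈⟨ +-congˡ (+-cong (*-congˡ (term 1)) (+-cong (*-congˡ (term 2))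
          (+-cong (*-congˡ (term 3)) (+-congʳ (*-congˡ (term 4)))))) ⟩
      _
        ≈⟨ +-cong (*-congʳ ι-1) (+-cong (*-congʳ ι-1)
        (+-cong (*-congʳ ι-1) (+-cong (*-congʳ ι-1) (+-congʳ (*-congʳ ι-1))))) ⟩
      _ ≈⟨ solve 4 (λ y z a b →
             let p = λ m → iter (y :*_) m (con 1ℚ)
                 q = λ m → iter (z :*_) m (con 1ℚ)
             in con 1ℚ :* (a :+ b) :+ (con 1ℚ :* (p 1 :* a :+ q 1 :* b) :+
               (con 1ℚ :* (p 2 :* a :+ q 2 :* b) :+
               (con 1ℚ :* (p 3 :* a :+ q 3 :* b) :+ (con 1ℚ :* (p 4 :* a :+ q 4 :* b) :+ con 0ℚ))))
                := a :* (con 1ℚ :+ y :* (con 1ℚ :+ y :*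
                  (con 1ℚ :+ y :* (con 1ℚ :+ y :* (con 1ℚ :+ y :* con 0ℚ)))))
                :+ b :* (con 1ℚ :+ z :* (con 1ℚ :+ z :*
                  (con 1ℚ :+ z :* (con 1ℚ :+ z :* (con 1ℚ :+ z :* con 0ℚ))))))
             ≈-refl (pow ζ 5) (pow ζ′ 5) (pow ζ k) (pow ζ′ k) ⟩
      pow ζ k * T (pow ζ 5) 5 + pow ζ′ k * T (pow ζ′ 5) 5 ≈⟨ +-cong (*-congˡ Tζ⁵) (*-congˡ Tζ′⁵) ⟩
      pow ζ k * 0# + pow ζ′ k * 0#
        ≈⟨ solve 2 (λ x y → x :* con 0ℚ :+ y :* con 0ℚ := con 0ℚ) ≈-refl (pow ζ k) (pow ζ′ k) ⟩
      0#                                                  ∎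
      where
      open ≈-Reasoning
      term : ∀ j → pow ζ (j ℕ.* 5 ℕ.+ k) + pow ζ′ (j ℕ.* 5 ℕ.+ k) ≈ pow (pow ζ 5) j * pow ζ k + pow
        (pow ζ′ 5) j * pow ζ′ k
      term j = +-cong (split ζ k j) (split ζ′ k j)

-- Powers and subgroups of order five

module Powers (G : FinGroup) where
  open FinGroup G
  open GroupLemmas G

  **-+ : ∀ x m n → x ** (m ℕ.+ n) ≡ x ** m ∙ x ** n
  **-+ x zero    n = sym (identityˡ _)
  **-+ x (suc m) n = trans (cong (x ∙_) (**-+ x m n)) (sym (assoc x _ _))

  **-* : ∀ x m n → x ** (m ℕ.* n) ≡ (x ** n) ** m
  **-* x zero    n = refl
  **-* x (suc m) n = trans (**-+ x n (m ℕ.* n)) (cong (x ** n ∙_) (**-* x m n))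

  **-swap : ∀ x m n → (x ** m) ** n ≡ (x ** n) ** m
  **-swap x m n = trans (sym (**-* x n m)) (trans (cong (x **_) (ℕ.*-comm n m)) (**-* x m n))

  ε** : ∀ n → ε ** n ≡ ε
  ε** zero    = refl
  ε** (suc n) = trans (identityˡ _) (ε** n)

  **-1 : ∀ {x} → x ** 1 ≡ ε → x ≡ ε
  **-1 {x} eq = trans (sym (identityʳ x)) eq

  **-coprime : ∀ {x p k} → Prime p → 0 ℕ.< k → k ℕ.< p → x ** k ≡ ε → x ** p ≡ ε → x ≡ ε
  **-coprime {x} p-prime 0<k k<p xᵏ xᵖ = trans (sym (identityʳ x))
    (iter-coprime (prime⇒coprime p-prime {{ℕ.>-nonZero 0<k}} k<p) xᵖ xᵏ)

  **-% : ∀ {x n} k → x ** suc n ≡ ε → x ** k ≡ x ** (k % suc n)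
  **-% {x} {n} k xⁿ = begin
    x ** k                                               ≡⟨ cong (x **_) (m≡m%n+[m/n]*n k (suc n)) ⟩
    x ** (k % suc n ℕ.+ k / suc n ℕ.* suc n)             ≡⟨ **-+ x (k % suc n) _ ⟩
    x ** (k % suc n) ∙ x ** (k / suc n ℕ.* suc n)
      ≡⟨ cong (x ** (k % suc n) ∙_) (trans (**-* x (k / suc n) (suc n))
      (trans (cong (_** (k / suc n)) xⁿ) (ε** (k / suc n)))) ⟩
    x ** (k % suc n) ∙ ε                                 ≡⟨ identityʳ _ ⟩
    x ** (k % suc n)                                     ∎
    where open ≡-Reasoning

  torsion : ∀ x → ∃[ n ] x ** suc n ≡ ε
  torsion x with Fin.pigeonhole (ℕ.n<1+n order) (λ (i : Fin (suc order)) → x ** toℕ i)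
  ... | i , j , i<j , eq = toℕ j ℕ.∸ suc (toℕ i) , ∙-cancelˡ (x ** toℕ i) _ ε (begin
      x ** toℕ i ∙ x ** suc (toℕ j ℕ.∸ suc (toℕ i))     ≡⟨ **-+ x (toℕ i) _ ⟨
      x ** (toℕ i ℕ.+ suc (toℕ j ℕ.∸ suc (toℕ i)))
        ≡⟨ cong (x **_) (trans (ℕ.+-suc (toℕ i) _) (ℕ.m+[n∸m]≡n i<j)) ⟩
      x ** toℕ j                                        ≡⟨ eq ⟨
      x ** toℕ i                                        ≡⟨ identityʳ _ ⟨
      x ** toℕ i ∙ ε                                    ∎)
    where open ≡-Reasoning

  module Cyclic5 {x} (x⁵ : x ** 5 ≡ ε) where

    Multiple : El → Set
    Multiple z = Σ[ i ∈ Fin 5 ] z ≡ x ** toℕ i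

    multiple : ∀ k → Multiple (x ** k)
    multiple k = fromℕ< (m%n<n k 5) , trans (**-% k x⁵) (cong (x **_) (sym (Fin.toℕ-fromℕ< (m%n<n k 5))))

    multiple-∙ : ∀ {y z} → Multiple y → Multiple z → Multiple (y ∙ z)
    multiple-∙ (i , refl) (j , refl) = subst Multiple (**-+ x (toℕ i) (toℕ j)) (multiple (toℕ i ℕ.+ toℕ j))

    multiple-⁻¹ : ∀ {y} → Multiple y → Multiple (y ⁻¹)
    multiple-⁻¹ (i , refl) = subst Multiple (inverseˡ-unique _ _ (trans (sym (**-+ x (4 ℕ.* toℕ i) (toℕ i)))
        (trans (cong (x **_) (trans (ℕ.+-comm (4 ℕ.* toℕ i) (toℕ i)) (ℕ.*-comm 5 (toℕ i))))
          (trans (**-* x (toℕ i) 5) (trans (cong (_** toℕ i) x⁵) (ε** (toℕ i)))))))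
      (multiple (4 ℕ.* toℕ i))

    -- y = y⁶ = (y²)³.
    multiple-root : ∀ {y} → y ** 5 ≡ ε → Multiple (y ∙ y) → Multiple y
    multiple-root {y} y⁵ y²∈ = subst Multiple (begin
        y ∙ y ∙ (y ∙ y) ∙ (y ∙ y)
          ≡⟨ free (♯₀ ⊙ ♯₀ ⊙ (♯₀ ⊙ ♯₀) ⊙ (♯₀ ⊙ ♯₀)) (𝟏 ⊙ ♯₀ **ʷ 5 ⊙ inv 𝟏 ⊙ ♯₀) (y ∷ []) refl ⟩
        ε ∙ y ** 5 ∙ ε ⁻¹ ∙ y       ≡⟨ insert ε y y⁵ ⟩
        y                           ∎) (multiple-∙ (multiple-∙ y²∈ y²∈) y²∈)
      where open ≡-Reasoning

-- Eigenfunctions on the group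

module Eigen {c ℓ₁ ℓ₂ : Level} (Ω : AlgebraicallyClosedField c ℓ₁ ℓ₂) (G : FinGroup) where
  open Field Ω
  open FinGroup G
  open GroupLemmas G
  open Powers G

  Function : Set c
  Function = El → K

  -- The adjacency operator A of the Cayley graph. Neighbours of g are the elements sg, hence
  -- translations from the left.
  Act : List El → Function → Function
  Act []      w g = 0#
  Act (s ∷ L) w g = w (s ∙ g) + Act L w g

  IsEigenfunction : List El → K → Function → Set ℓ₁
  IsEigenfunction L μ w = ∀ g → Act L w g ≈ μ * w g

  Nonzero : Function → Set ℓ₂
  Nonzero w = ∃[ g ] w g # 0#

  Eigenvalue : List El → Pred K (c ⊔ ℓ₁ ⊔ ℓ₂)
  Eigenvalue L μ = Σ[ w ∈ Function ] Nonzero w × IsEigenfunction L μ w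

  Act-cong : ∀ L {v w} → (∀ g → v g ≈ w g) → ∀ g → Act L v g ≈ Act L w g
  Act-cong []      eq g = ≈-refl
  Act-cong (s ∷ L) eq g = +-cong (eq (s ∙ g)) (Act-cong L eq g)

  Act-linear : ∀ L a b v w g → Act L (λ h → a * v h + b * w h) g ≈ a * Act L v g + b * Act L w g
  Act-linear []      a b v w g = solve 2 (λ a b → con 0ℚ := a :* con 0ℚ :+ b :* con 0ℚ) ≈-refl a b
  Act-linear (s ∷ L) a b v w g = ≈-trans (+-congˡ (Act-linear L a b v w g))
    (solve 6 (λ a b x y x′ y′ → a :* x :+ b :* y :+ (a :* x′ :+ b :* y′) := a :* (x :+ x′) :+ b :*
      (y :+ y′)) ≈-refl
      a b (v (s ∙ g)) (w (s ∙ g)) (Act L v g) (Act L w g))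

  Act-scale : ∀ L a w g → Act L (λ h → a * w h) g ≈ a * Act L w g
  Act-scale []      a w g = ≈-sym (zeroʳ a)
  Act-scale (s ∷ L) a w g = ≈-trans (+-congˡ (Act-scale L a w g)) (≈-sym (distribˡ a _ _))

  Act² : ∀ L {μ w} → IsEigenfunction L μ w → ∀ g → Act L (Act L w) g ≈ μ * (μ * w g)
  Act² L {μ} {w} eig g = ≈-trans (Act-cong L eig g) (≈-trans (Act-scale L μ w g) (*-congˡ (eig g)))

  -- (A − p)(A − q) w = 0, with the products expanded.
  Quadratic : List El → K → K → Function → Set ℓ₁
  Quadratic L p q w = ∀ g → Act L (Act L w) g ≈ (p + q) * Act L w g - p * q * w g

  quadratic⇒root : ∀ L {p q μ w} → p # q → Nonzero w → IsEigenfunction L μ w → Quadratic L p q w → μ ≈ p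
    ⊎ μ ≈ q
  quadratic⇒root L {p} {q} {μ} {w} p#q (g , w#0) eig quad = roots p#q (*-cancel-# w#0 (begin
    w g * ((μ - p) * (μ - q))
      ≈⟨ solve 4 (λ x m p q → x :* ((m :- p) :* (m :- q)) := m :* (m :* x) :-
      ((p :+ q) :* (m :* x) :- p :* q :* x)) ≈-refl (w g) μ p q ⟩
    μ * (μ * w g) - ((p + q) * (μ * w g) - p * q * w g)
      ≈⟨ ≈⇒-≈0 (≈-trans (≈-sym (Act² L eig g)) (≈-trans (quad g) (+-congʳ (*-congˡ (eig g))))) ⟩
    0#                                                     ∎))
    where open ≈-Reasoning

  -- The functions (A - q)w and -(A - p)w add up to (p - q)w, so where w is apart from zero one of
  -- them is too. The quadratic equation makes the first an eigenfunction for p, the second one for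
  -- q.
  quadratic⇒eigenvalue : ∀ L {p q w} → p # q → Nonzero w → Quadratic L p q w → Eigenvalue L p ⊎ Eigenvalue L q
  quadratic⇒eigenvalue L {p} {q} {w} p#q (g , w#0) quad = choose (+-split-#
      (#-congʳ (solve 4 (λ p q x y → (p :- q) :* x := y :- q :* x :+ :- (y :- p :* x)) ≈-refl p q (w g)
        (Act L w g)) (x#0y#0→xy#0 (#⇒-#0 p#q) w#0)))
    where
    open ≈-Reasoning
    choose : Act L w g - q * w g # 0# ⊎ - (Act L w g - p * w g) # 0# → Eigenvalue L p ⊎ Eigenvalue L q
    choose (inj₁ nz) = inj₁ (_ , (g , nz) , λ h → begin
      Act L (λ h → Act L w h - q * w h) h
        ≈⟨ Act-cong L (λ h → solve 3 (λ a q x → a :- q :* x := con 1ℚ :* a :+ (:- q) :* x) ≈-refl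
        (Act L w h) q (w h)) h ⟩
      Act L (λ h → 1# * Act L w h + (- q) * w h) h         ≈⟨ Act-linear L 1# (- q) (Act L w) w h ⟩
      1# * Act L (Act L w) h + (- q) * Act L w h           ≈⟨ +-congʳ (*-congˡ (quad h)) ⟩
      1# * ((p + q) * Act L w h - p * q * w h) + (- q) * Act L w h
        ≈⟨ solve 4 (λ p q a x → con 1ℚ :* ((p :+ q) :* a :- p :* q :* x) :+ (:- q) :* a := p :*
        (a :- q :* x)) ≈-refl p q (Act L w h) (w h) ⟩
      p * (Act L w h - q * w h)                            ∎)
    choose (inj₂ nz) = inj₂ (_ , (g , nz) , λ h → begin
      Act L (λ h → - (Act L w h - p * w h)) h
        ≈⟨ Act-cong L (λ h → solve 3 (λ a q x → :- (a :- q :* x) := (:- con 1ℚ) :* a :+ q :* x) ≈-refl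
        (Act L w h) p (w h)) h ⟩
      Act L (λ h → (- 1#) * Act L w h + p * w h) h         ≈⟨ Act-linear L (- 1#) p (Act L w) w h ⟩
      (- 1#) * Act L (Act L w) h + p * Act L w h           ≈⟨ +-congʳ (*-congˡ (quad h)) ⟩
      (- 1#) * ((p + q) * Act L w h - p * q * w h) + p * Act L w h
        ≈⟨ solve 4 (λ p q a x → (:- con 1ℚ) :* ((p :+ q) :* a :- p :* q :* x) :+ p :* a := q :*
        (:- (a :- p :* x))) ≈-refl p q (Act L w h) (w h) ⟩
      q * (- (Act L w h - p * w h))                        ∎)

  δ : Function
  δ g = if does (g Fin.≟ ε) then 1# else 0#

  δ-one : ∀ {g} → g ≡ ε → δ g ≈ 1#
  δ-one {g} g≡ε rewrite dec-true (g Fin.≟ ε) g≡ε = ≈-refl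

  δ-zero : ∀ {g} → g ≢ ε → δ g ≈ 0#
  δ-zero {g} g≢ε rewrite dec-false (g Fin.≟ ε) g≢ε = ≈-refl

  open Obstruction Ω using (pow; NonquadraticRoot; nonquadratic-prime; nonquadratic-25)

  -- The eigenvector is a character of ⟨x⟩, extended by zero.
  cyclic-eigenvalue : ∀ {x n ζ ζ′} → x ** suc n ≡ ε → (∀ k → 0 ℕ.< k → k ℕ.< suc n → x ** k ≢ ε) →
    ζ * ζ′ ≈ 1# → pow ζ′ (suc n) ≈ 1# → Eigenvalue (x ∷ x ⁻¹ ∷ []) (ζ + ζ′)
  cyclic-eigenvalue {x} {n} {ζ} {ζ′} xⁿ faithful ζζ′ ζ′ⁿ =
    f (suc n) , (ε , #-congʳ (≈-sym (f-one n ℕ.≤-refl)) 1#0) , λ g → begin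
      f (suc n) (x ∙ g) + (f (suc n) (x ⁻¹ ∙ g) + 0#)  ≈⟨ +-cong (forward g) (+-congʳ (backward g)) ⟩
      ζ * f (suc n) g + (ζ′ * f (suc n) g + 0#)
        ≈⟨ solve 3 (λ z w x → z :* x :+ (w :* x :+ con 0ℚ) := (z :+ w) :* x) ≈-refl ζ ζ′ (f (suc n) g) ⟩
      (ζ + ζ′) * f (suc n) g                           ∎
    where
    open ≈-Reasoning
    f : ℕ → Function
    f zero    g = 0#
    f (suc m) g = f m g + pow ζ′ m * δ (x ** m ∙ g)
    shift : ∀ m g → x ** m ∙ (x ∙ g) ≡ x ** suc m ∙ g
    shift m g = trans (sym (assoc _ x g)) (cong (_∙ g) (trans (cong (x ** m ∙_) (sym (identityʳ x)))
      (trans (sym (**-+ x m 1)) (cong (x **_) (ℕ.+-comm m 1)))))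
    telescope : ∀ m g → ζ′ * f m (x ∙ g) + δ g ≈ f m g + pow ζ′ m * δ (x ** m ∙ g)
    telescope zero    g = ≈-trans (+-congˡ (reflexive (cong δ (sym (identityˡ g)))))
      (solve 2 (λ z d → z :* con 0ℚ :+ d := con 0ℚ :+ con 1ℚ :* d) ≈-refl ζ′ (δ (ε ∙ g)))
    telescope (suc m) g = begin
      ζ′ * (f m (x ∙ g) + pow ζ′ m * δ (x ** m ∙ (x ∙ g))) + δ g
        ≈⟨ solve 5 (λ z a p d e → z :* (a :+ p :* d) :+ e := (z :* a :+ e) :+ z :* p :* d) ≈-refl ζ′
        (f m (x ∙ g)) (pow ζ′ m) (δ (x ** m ∙ (x ∙ g))) (δ g) ⟩
      (ζ′ * f m (x ∙ g) + δ g) + ζ′ * pow ζ′ m * δ (x ** m ∙ (x ∙ g))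
        ≈⟨ +-cong (telescope m g) (*-congˡ (reflexive (cong δ (shift m g)))) ⟩
      f (suc m) g + pow ζ′ (suc m) * δ (x ** suc m ∙ g)             ∎
    descend : ∀ g → ζ′ * f (suc n) (x ∙ g) ≈ f (suc n) g
    descend g = begin
      ζ′ * f (suc n) (x ∙ g)
        ≈⟨ solve 2 (λ a d → a := (a :+ d) :- d) ≈-refl (ζ′ * f (suc n) (x ∙ g)) (δ g) ⟩
      (ζ′ * f (suc n) (x ∙ g) + δ g) - δ g                     ≈⟨ +-congʳ (telescope (suc n) g) ⟩
      f (suc n) g + pow ζ′ (suc n) * δ (x ** suc n ∙ g) - δ g
        ≈⟨ +-congʳ (+-congˡ (*-cong ζ′ⁿ (reflexive (cong δ (trans (cong (_∙ g) xⁿ) (identityˡ g)))))) ⟩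
      f (suc n) g + 1# * δ g - δ g
        ≈⟨ solve 2 (λ a d → a :+ con 1ℚ :* d :- d := a) ≈-refl (f (suc n) g) (δ g) ⟩
      f (suc n) g                                              ∎
    forward : ∀ g → f (suc n) (x ∙ g) ≈ ζ * f (suc n) g
    forward g = begin
      f (suc n) (x ∙ g)                 ≈⟨ *-identityˡ _ ⟨
      1# * f (suc n) (x ∙ g)            ≈⟨ *-congʳ ζζ′ ⟨
      ζ * ζ′ * f (suc n) (x ∙ g)        ≈⟨ *-assoc ζ ζ′ _ ⟩
      ζ * (ζ′ * f (suc n) (x ∙ g))      ≈⟨ *-congˡ (descend g) ⟩
      ζ * f (suc n) g                   ∎
    backward : ∀ g → f (suc n) (x ⁻¹ ∙ g) ≈ ζ′ * f (suc n) g
    backward g = ≈-trans (≈-sym (descend (x ⁻¹ ∙ g)))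
      (*-congˡ (reflexive (cong (f (suc n)) (free (♯₀ ⊙ (inv ♯₀ ⊙ ♯₁)) ♯₁ (x ∷ g ∷ []) refl))))
    f-one : ∀ m → m ℕ.< suc n → f (suc m) ε ≈ 1#
    f-one zero _ = ≈-trans (+-congˡ (*-congˡ (δ-one (identityˡ ε))))
      (solve 0 (con 0ℚ :+ con 1ℚ :* con 1ℚ := con 1ℚ) ≈-refl)
    f-one (suc m) m<n   = begin
      f (suc m) ε + pow ζ′ (suc m) * δ (x ** suc m ∙ ε)   ≈⟨ +-cong (f-one m (ℕ.<-trans (ℕ.n<1+n m) m<n))
          (*-congˡ (δ-zero λ eq → faithful (suc m) (ℕ.s≤s ℕ.z≤n) m<n (trans (sym (identityʳ _)) eq))) ⟩
      1# + pow ζ′ (suc m) * 0#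
        ≈⟨ solve 1 (λ x → con 1ℚ :+ x :* con 0ℚ := con 1ℚ) ≈-refl (pow ζ′ (suc m)) ⟩
      1#                                                  ∎

  fifth-power-shift : ∀ {y} → y ** 5 ≡ ε → ∀ g → y ∙ (y ∙ (y ∙ g)) ≡ y ⁻¹ ∙ (y ⁻¹ ∙ g)
  fifth-power-shift {y} y⁵ g = trans
    (free (♯₀ ⊙ (♯₀ ⊙ (♯₀ ⊙ ♯₁))) (𝟏 ⊙ ♯₀ **ʷ 5 ⊙ inv 𝟏 ⊙ (inv ♯₀ ⊙ (inv ♯₀ ⊙ ♯₁))) (y ∷ g ∷ []) refl)
    (insert ε _ y⁵)

  fifth-power-shift⁻¹ : ∀ {y} → y ** 5 ≡ ε → ∀ g → y ⁻¹ ∙ (y ⁻¹ ∙ (y ⁻¹ ∙ g)) ≡ y ∙ (y ∙ g)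
  fifth-power-shift⁻¹ {y} y⁵ g = sym (trans
    (free (♯₀ ⊙ (♯₀ ⊙ ♯₁)) (𝟏 ⊙ ♯₀ **ʷ 5 ⊙ inv 𝟏 ⊙ (inv ♯₀ ⊙ (inv ♯₀ ⊙ (inv ♯₀ ⊙ ♯₁)))) (y ∷ g ∷ []) refl)
    (insert ε _ y⁵))

  cancelˡ : ∀ y g → y ∙ (y ⁻¹ ∙ g) ≡ g
  cancelˡ y g = free (♯₀ ⊙ (inv ♯₀ ⊙ ♯₁)) ♯₁ (y ∷ g ∷ []) refl

  cancelʳ : ∀ y g → y ⁻¹ ∙ (y ∙ g) ≡ g
  cancelʳ y g = free (inv ♯₀ ⊙ (♯₀ ⊙ ♯₁)) ♯₁ (y ∷ g ∷ []) refl

  C : El → Function → Function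
  C y w g = w (y ∙ g) + w (y ⁻¹ ∙ g)

  -- (C − 2)(C − φ′) w, where φ′ = −1 − φ.
  project : K → El → Function → Function
  project φ y w g = (w (y ∙ (y ∙ g)) + w (y ⁻¹ ∙ (y ⁻¹ ∙ g))) - (1# - φ) * C y w g - (φ + φ) * w g

  -- If y⁵ = 1, then (C - 2)(C - φ)(C - φ′) = 0. In coordinates, y³ = y⁻² folds all translates back
  -- to the five values u₀, ..., u₄.
  project-C : ∀ {φ y} → Golden φ → y ** 5 ≡ ε → ∀ w g → C y (project φ y w) g ≈ φ * project φ y w g
  project-C {φ} {y} golden y⁵ w g = begin
    C y (project φ y w) g
      ≈⟨ reflexive (cong₂ _+_
           (cong₂ (λ s t → s - (1# - φ) * t - (φ + φ) * w (y ∙ g))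
             (cong₂ (λ h k → w h + w k) (fifth-power-shift y⁵ g) (cong (y ⁻¹ ∙_) (cancelʳ y g)))
             (cong (λ h → w (y ∙ (y ∙ g)) + w h) (cancelʳ y g)))
           (cong₂ (λ s t → s - (1# - φ) * t - (φ + φ) * w (y ⁻¹ ∙ g))
             (cong₂ (λ h k → w h + w k) (cong (y ∙_) (cancelˡ y g)) (fifth-power-shift⁻¹ y⁵ g))
             (cong (λ h → w h + w (y ⁻¹ ∙ (y ⁻¹ ∙ g))) (cancelˡ y g)))) ⟩
    ((u₃ + u₄) - (1# - φ) * (u₂ + u₀) - (φ + φ) * u₁) + ((u₁ + u₂) - (1# - φ) * (u₀ + u₃) - (φ + φ) * u₄)
      ≈⟨ solve 6 (λ f a b c d e → ((d :+ e) :- (con 1ℚ :- f) :* (c :+ a) :- (f :+ f) :* b) :+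
        ((b :+ c) :- (con 1ℚ :- f) :* (a :+ d) :- (f :+ f) :* e)
           := f :* (c :+ d) :- (f :- (con 1ℚ :- f)) :* (b :+ e) :- ((con 1ℚ :- f) :+ (con 1ℚ :- f)) :* a)
             ≈-refl φ u₀ u₁ u₂ u₃ u₄ ⟩
    φ * (u₂ + u₃) - (φ - (1# - φ)) * (u₁ + u₄) - ((1# - φ) + (1# - φ)) * u₀
      ≈⟨ +-cong (+-congˡ (-‿cong (*-congʳ (+-congˡ (-‿cong φ²))))) (-‿cong (*-congʳ (+-cong φ² φ²))) ⟨
    φ * (u₂ + u₃) - (φ - φ * φ) * (u₁ + u₄) - (φ * φ + φ * φ) * u₀
      ≈⟨ solve 6 (λ f a b c d e → f :* (c :+ d) :- (f :- f :* f) :* (b :+ e) :- (f :* f :+ f :* f) :* a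
           := f :* ((c :+ d) :- (con 1ℚ :- f) :* (b :+ e) :- (f :+ f) :* a)) ≈-refl φ u₀ u₁ u₂ u₃ u₄ ⟩
    φ * project φ y w g ∎
    where
    open ≈-Reasoning
    φ² : φ * φ ≈ 1# - φ
    φ² = golden² golden
    u₀ u₁ u₂ u₃ u₄ : K
    u₀ = w g
    u₁ = w (y ∙ g)
    u₂ = w (y ∙ (y ∙ g))
    u₃ = w (y ⁻¹ ∙ (y ⁻¹ ∙ g))
    u₄ = w (y ⁻¹ ∙ g)

  ι-double : ι 2ℚ ≈ 1# + 1#
  ι-double = ≈-trans (ι-+ 1ℚ 1ℚ) (+-cong ι-1 ι-1)

  golden-#0 : ∀ {φ} → Golden φ → φ # 0#
  golden-#0 {φ} golden =
    invertible⇒#0 (≈-trans (solve 1 (λ x → x :* (x :+ con 1ℚ) := x :* x :+ x) ≈-refl φ) golden)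

  two-# : ∀ {x} → x # 0# → x + x # 0#
  two-# {x} x#0 =
    #-congʳ (≈-trans (*-congʳ ι-double) (solve 1 (λ x → (con 1ℚ :+ con 1ℚ) :* x := x :+ x) ≈-refl x))
    (x#0y#0→xy#0 (ι-#0 {2ℚ} λ ()) x#0)

  record PlaneVector (φ : K) (x y : El) : Set (c ⊔ ℓ₁ ⊔ ℓ₂) where
    field
      f       : Function
      nonzero : Nonzero f
      f-x     : ∀ g → f (x ∙ g) ≈ f g
      f-y     : ∀ g → C y f g ≈ φ * f g

    f-x⁻¹ : ∀ g → f (x ⁻¹ ∙ g) ≈ f g
    f-x⁻¹ g = ≈-trans (≈-sym (f-x (x ⁻¹ ∙ g))) (reflexive (cong f (cancelˡ x g)))

  -- The delta function is projected to the φ-eigenspace of C for y and then summed over translates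
  -- by ⟨x⟩. As y lies outside ⟨x⟩, the only term of all these that survives at the identity is -2φ,
  -- which is apart from zero.
  plane-vector : ∀ {φ x y} → Golden φ → x ≢ ε → x ** 5 ≡ ε → y ** 5 ≡ ε → x ∙ y ≡ y ∙ x →
    (∀ (i : Fin 5) → y ≢ x ** toℕ i) → PlaneVector φ x y
  plane-vector {φ} {x} {y} golden x≢ε x⁵ y⁵ xy outside = record
    { f = f ; nonzero = ε , #-congʳ (≈-sym f-ε) -2φ#0 ; f-x = f-x ; f-y = f-y }
    where
    open Cyclic5 x⁵
    open ≈-Reasoning
    h : Function
    h = project φ y δ
    X : ℕ → El → El
    X = iter (x ∙_)
    f : Function
    f g = h (X 0 g) + (h (X 1 g) + (h (X 2 g) + (h (X 3 g) + h (X 4 g))))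
    f-x : ∀ g → f (x ∙ g) ≈ f g
    f-x g = ≈-trans (+-congˡ (+-congˡ (+-congˡ (+-congˡ (reflexive (cong h
          (trans (free (♯₀ ⊙ (♯₀ ⊙ (♯₀ ⊙ (♯₀ ⊙ (♯₀ ⊙ ♯₁))))) (𝟏 ⊙ ♯₀ **ʷ 5 ⊙ inv 𝟏 ⊙ ♯₁) (x ∷ g ∷ []) refl)
            (insert ε g x⁵))))))))
      (solve 5 (λ a b c d e → b :+ (c :+ (d :+ (e :+ a))) := a :+ (b :+ (c :+ (d :+ e)))) ≈-refl
        (h (X 0 g)) (h (X 1 g)) (h (X 2 g)) (h (X 3 g)) (h (X 4 g)))
    commute : ∀ {z} → x ∙ z ≡ z ∙ x → ∀ k g → X k (z ∙ g) ≡ z ∙ X k g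
    commute xz zero    g = refl
    commute {z} xz (suc k) g = trans (cong (x ∙_) (commute xz k g))
      (trans (sym (assoc x z _)) (trans (cong (_∙ X k g) xz) (assoc z x _)))
    xy⁻¹ : x ∙ y ⁻¹ ≡ y ⁻¹ ∙ x
    xy⁻¹ = trans (free (♯₀ ⊙ inv ♯₁) (inv ♯₁ ⊙ (♯₁ ⊙ ♯₀) ⊙ inv ♯₁) (x ∷ y ∷ []) refl)
      (trans (cong (λ z → y ⁻¹ ∙ z ∙ y ⁻¹) (sym xy))
        (free (inv ♯₁ ⊙ (♯₀ ⊙ ♯₁) ⊙ inv ♯₁) (inv ♯₁ ⊙ ♯₀) (x ∷ y ∷ []) refl))
    f-y : ∀ g → C y f g ≈ φ * f g
    f-y g = begin
      f (y ∙ g) + f (y ⁻¹ ∙ g)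
        ≈⟨ +-cong (move xy) (move xy⁻¹) ⟩
      (h (y ∙ X 0 g) + (h (y ∙ X 1 g) + (h (y ∙ X 2 g) + (h (y ∙ X 3 g) + h (y ∙ X 4 g)))))
        + (h (y ⁻¹ ∙ X 0 g) + (h (y ⁻¹ ∙ X 1 g) + (h (y ⁻¹ ∙ X 2 g) + (h (y ⁻¹ ∙ X 3 g) + h (y ⁻¹ ∙ X 4 g)))))
        ≈⟨ solve 10 (λ a b c d e a′ b′ c′ d′ e′ → (a :+ (b :+ (c :+ (d :+ e)))) :+
          (a′ :+ (b′ :+ (c′ :+ (d′ :+ e′))))
             := (a :+ a′) :+ ((b :+ b′) :+ ((c :+ c′) :+ ((d :+ d′) :+ (e :+ e′))))) ≈-refl
             (h (y ∙ X 0 g)) (h (y ∙ X 1 g)) (h (y ∙ X 2 g)) (h (y ∙ X 3 g)) (h (y ∙ X 4 g))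
             (h (y ⁻¹ ∙ X 0 g)) (h (y ⁻¹ ∙ X 1 g)) (h (y ⁻¹ ∙ X 2 g)) (h (y ⁻¹ ∙ X 3 g)) (h (y ⁻¹ ∙ X 4 g)) ⟩
      C y h (X 0 g) + (C y h (X 1 g) + (C y h (X 2 g) + (C y h (X 3 g) + C y h (X 4 g))))
        ≈⟨ +-cong (eig 0) (+-cong (eig 1) (+-cong (eig 2) (+-cong (eig 3) (eig 4)))) ⟩
      φ * h (X 0 g) + (φ * h (X 1 g) + (φ * h (X 2 g) + (φ * h (X 3 g) + φ * h (X 4 g))))
        ≈⟨ solve 6 (λ p a b c d e → p :* a :+ (p :* b :+ (p :* c :+ (p :* d :+ p :* e))) := p :*
          (a :+ (b :+ (c :+ (d :+ e))))) ≈-refl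
             φ (h (X 0 g)) (h (X 1 g)) (h (X 2 g)) (h (X 3 g)) (h (X 4 g)) ⟩
      φ * f g ∎
      where
      eig : ∀ k → C y h (X k g) ≈ φ * h (X k g)
      eig k = project-C golden y⁵ δ (X k g)
      move : ∀ {z} → x ∙ z ≡ z ∙ x → f (z ∙ g) ≈ h (z ∙ X 0 g) +
        (h (z ∙ X 1 g) + (h (z ∙ X 2 g) + (h (z ∙ X 3 g) + h (z ∙ X 4 g))))
      move xz = reflexive (cong₂ _+_ (at 0) (cong₂ _+_ (at 1) (cong₂ _+_ (at 2) (cong₂ _+_ (at 3) (at 4)))))
        where
        at : ∀ k → h (X k (_ ∙ g)) ≡ h (_ ∙ X k g)
        at k = cong h (commute xz k g)
    y∉ : ¬ Multiple y
    y∉ (i , eq) = outside i eq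
    avoid₁ : ∀ {z} → Multiple z → y ∙ z ≢ ε
    avoid₁ z∈ eq = y∉ (subst Multiple (sym (inverseˡ-unique _ _ eq)) (multiple-⁻¹ z∈))
    avoid₄ : ∀ {z} → Multiple z → y ⁻¹ ∙ z ≢ ε
    avoid₄ {z} z∈ eq =
      y∉ (subst Multiple (trans (sym (cancelˡ y z)) (trans (cong (y ∙_) eq) (identityʳ y))) z∈)
    avoid₂ : ∀ {z} → Multiple z → y ∙ (y ∙ z) ≢ ε
    avoid₂ {z} z∈ eq = y∉ (multiple-root y⁵ (subst Multiple
      (sym (inverseˡ-unique _ _ (trans (assoc y y z) eq))) (multiple-⁻¹ z∈)))
    avoid₃ : ∀ {z} → Multiple z → y ⁻¹ ∙ (y ⁻¹ ∙ z) ≢ ε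
    avoid₃ {z} z∈ eq = y∉ (multiple-root y⁵ (subst Multiple
      (trans (free ♯₁ (♯₀ ⊙ (♯₀ ⊙ (inv ♯₀ ⊙ (inv ♯₀ ⊙ ♯₁)))) (y ∷ z ∷ []) refl)
      (trans (cong (λ t → y ∙ (y ∙ t)) eq) (cong (y ∙_) (identityʳ y)))) z∈))
    h-on-x : ∀ {z} → Multiple z → h z ≈ - ((φ + φ) * δ z)
    h-on-x {z} z∈ = ≈-trans (+-congʳ (+-cong (+-cong (δ-zero (avoid₂ z∈)) (δ-zero (avoid₃ z∈)))
      (-‿cong (*-congˡ (+-cong (δ-zero (avoid₁ z∈)) (δ-zero (avoid₄ z∈)))))))
      (solve 2 (λ p d → (con 0ℚ :+ con 0ℚ) :- (con 1ℚ :- p) :* (con 0ℚ :+ con 0ℚ) :- (p :+ p) :* d := :-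
        ((p :+ p) :* d)) ≈-refl φ (δ z))
    -2φ#0 : - (φ + φ) # 0#
    -2φ#0 = *-factorˡ-# {y = - 1#} (#-congʳ (solve 1 (λ x → x :+ x := :- (x :+ x) :* :- con 1ℚ) ≈-refl φ)
      (two-# (golden-#0 golden)))
    h-zero : ∀ k → 0 ℕ.< k → k ℕ.< 5 → h (X k ε) ≈ 0#
    h-zero k 0<k k<5 = ≈-trans (h-on-x (multiple k))
      (≈-trans (-‿cong (*-congˡ (δ-zero λ eq → x≢ε (**-coprime (from-yes (prime? 5)) 0<k k<5 eq x⁵))))
      (solve 1 (λ p → :- ((p :+ p) :* con 0ℚ) := con 0ℚ) ≈-refl φ))
    f-ε : f ε ≈ - (φ + φ)
    f-ε = ≈-trans (+-cong (≈-trans (h-on-x (multiple 0)) (-‿cong (*-congˡ (δ-one refl))))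
        (+-cong (h-zero 1 (ℕ.s≤s ℕ.z≤n) (from-yes (1 ℕ.<? 5)))
          (+-cong (h-zero 2 (ℕ.s≤s ℕ.z≤n) (from-yes (2 ℕ.<? 5)))
          (+-cong (h-zero 3 (ℕ.s≤s ℕ.z≤n) (from-yes (3 ℕ.<? 5)))
            (h-zero 4 (ℕ.s≤s ℕ.z≤n) (from-yes (4 ℕ.<? 5)))))))
      (solve 1 (λ p → :- ((p :+ p) :* con 1ℚ) :+ (con 0ℚ :+ (con 0ℚ :+ (con 0ℚ :+ con 0ℚ))) := :- (p :+ p))
        ≈-refl φ)

  -- Connection sets as lists

  record ConnectionList (L : List El) : Set where
    field
      unique : Unique L
      ε∉     : ε ∉ L
      closed : ∀ {s} → s ∈ L → s ⁻¹ ∈ L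
      2≤     : 2 ℕ.≤ length L
      ≤3     : length L ℕ.≤ 3

  pair-list : ∀ {x} → x ≢ ε → x ∙ x ≢ ε → ConnectionList (x ∷ x ⁻¹ ∷ [])
  pair-list {x} x≢ε x²≢ε = record
    { unique = ((λ eq → x²≢ε (trans (cong (x ∙_) eq) (inverseʳ x))) ∷ []) ∷ [] ∷ []
    ; ε∉ = λ { (here eq) → x≢ε (sym eq) ; (there (here eq)) → x≢ε
      (trans (sym (⁻¹-involutive x)) (trans (cong _⁻¹ (sym eq)) ε⁻¹≈ε)) }
    ; closed = λ { (here refl) → there (here refl) ; (there (here refl)) → here (⁻¹-involutive x) }
    ; 2≤     = ℕ.≤-refl
    ; ≤3     = ℕ.n≤1+n 2
    }

  pair-involution-list : ∀ {x a} → x ≢ ε → x ∙ x ≢ ε → Involution a → ConnectionList (x ∷ x ⁻¹ ∷ a ∷ [])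
  pair-involution-list {x} {a} x≢ε x²≢ε (a≢ε , a²) = record
    { unique = ((λ eq → x²≢ε (trans (cong (x ∙_) eq) (inverseʳ x))) ∷ x≢a ∷ []) ∷ (x⁻¹≢a ∷ []) ∷ [] ∷ []
    ; ε∉ = λ { (here eq) → x≢ε (sym eq) ; (there (here eq)) → x≢ε
      (trans (sym (⁻¹-involutive x)) (trans (cong _⁻¹ (sym eq)) ε⁻¹≈ε))
                 ; (there (there (here eq))) → a≢ε (sym eq) }
    ; closed = λ { (here refl) → there (here refl) ; (there (here refl)) → here (⁻¹-involutive x)
                 ; (there (there (here refl))) → there (there (here (involution-⁻¹ a²))) }
    ; 2≤     = ℕ.n≤1+n 2
    ; ≤3     = ℕ.≤-refl
    }
    where
    x≢a : x ≢ a
    x≢a refl = x²≢ε a²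
    x⁻¹≢a : x ⁻¹ ≢ a
    x⁻¹≢a eq = x≢a (trans (sym (⁻¹-involutive x)) (trans (cong _⁻¹ eq) (involution-⁻¹ a²)))

  involutions-list : ∀ {a b} → Involution a → Involution b → a ≢ b → ConnectionList (a ∷ b ∷ [])
  involutions-list (a≢ε , a²) (b≢ε , b²) a≢b = record
    { unique = (a≢b ∷ []) ∷ [] ∷ []
    ; ε∉     = λ { (here eq) → a≢ε (sym eq) ; (there (here eq)) → b≢ε (sym eq) }
    ; closed = λ { (here refl) → here (involution-⁻¹ a²) ; (there (here refl)) → there
      (here (involution-⁻¹ b²)) }
    ; 2≤     = ℕ.≤-refl
    ; ≤3     = ℕ.n≤1+n 2
    }

  three-involutions-list : ∀ {a b c} → Involution a → Involution b → Involution c → a ≢ b → a ≢ c → b ≢ c →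
    ConnectionList (a ∷ b ∷ c ∷ [])
  three-involutions-list (a≢ε , a²) (b≢ε , b²) (c≢ε , c²) a≢b a≢c b≢c = record
    { unique = (a≢b ∷ a≢c ∷ []) ∷ (b≢c ∷ []) ∷ [] ∷ []
    ; ε∉ = λ { (here eq) → a≢ε (sym eq) ; (there (here eq)) → b≢ε (sym eq) ; (there (there (here eq))) →
      c≢ε (sym eq) }
    ; closed = λ { (here refl) → here (involution-⁻¹ a²) ; (there (here refl)) → there
      (here (involution-⁻¹ b²))
                 ; (there (there (here refl))) → there (there (here (involution-⁻¹ c²))) }
    ; 2≤     = ℕ.n≤1+n 2
    ; ≤3     = ℕ.≤-refl
    }

-- Restrictions forced by 2-integrality

-5ℚ -2ℚ ¼ ½ 9ℚ 11ℚ 14ℚ 15ℚ 25ℚ 101ℚ 126ℚ : ℚ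
-5ℚ  = ℚ.- 5ℚ
¼    = ℤ.+ 1 ℚ./ 4
½    = ℤ.+ 1 ℚ./ 2
9ℚ   = ℤ.+ 9 ℚ./ 1
11ℚ  = ℤ.+ 11 ℚ./ 1
14ℚ  = ℤ.+ 14 ℚ./ 1
15ℚ  = ℤ.+ 15 ℚ./ 1
25ℚ  = ℤ.+ 25 ℚ./ 1
101ℚ = ℤ.+ 101 ℚ./ 1
126ℚ = ℤ.+ 126 ℚ./ 1
-2ℚ  = ℚ.- 2ℚ

module Forward {c ℓ₁ ℓ₂ : Level} (Ω : AlgebraicallyClosedField c ℓ₁ ℓ₂) (G : FinGroup)
  (degree-2 : ∀ {L} → Eigen.ConnectionList Ω G L → HasDegree Ω (Generated Ω (Eigen.Eigenvalue Ω G L)) 2) where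
  open Field Ω
  open FinGroup G
  open GroupLemmas G
  open Powers G
  open Eigen Ω G
  open Obstruction Ω using (NonquadraticRoot; nonquadratic-prime; nonquadratic-25)

  generated-rational : ∀ {p} {X : Pred K p} → (∀ {x} → X x → ∃[ q ] x ≈ ι q) → ∀ {x} → Generated Ω X x →
    ∃[ q ] x ≈ ι q
  generated-rational gens (gen x∈) = gens x∈
  generated-rational gens (resp x≈y x∈) = let q , eq = generated-rational gens x∈ in q , ≈-trans (≈-sym x≈y) eq
  generated-rational gens 0∈ = 0ℚ , ≈-sym ι-0
  generated-rational gens 1∈ = 1ℚ , ≈-sym ι-1
  generated-rational gens (+∈ x∈ y∈) =
    let p , eq = generated-rational gens x∈ ; q , eq′ = generated-rational gens y∈ in p ℚ.+ q , ≈-trans (+-cong eq eq′) (≈-sym (ι-+ p q))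
  generated-rational gens (-∈ x∈) = let q , eq = generated-rational gens x∈ in ℚ.- q , ≈-trans (-‿cong eq) (≈-sym (ι-- q))
  generated-rational gens (*∈ x∈ y∈) =
    let p , eq = generated-rational gens x∈ ; q , eq′ = generated-rational gens y∈ in p ℚ.* q , ≈-trans (*-cong eq eq′) (≈-sym (ι-* p q))
  generated-rational gens (⁻¹∈ {x} {y} xy≈1 x∈) = invert (generated-rational gens x∈)
    where
    invert : ∃[ q ] x ≈ ι q → ∃[ q ] y ≈ ι q
    invert (q , eq) = ℚ.1/ q , (begin
      y                     ≈⟨ *-identityˡ y ⟨
      1# * y
        ≈⟨ *-congʳ (≈-trans (≈-sym ι-1) (≈-trans (ι-cong (sym (ℚ.*-inverseˡ q))) (ι-* (ℚ.1/ q) q))) ⟩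
      ι (ℚ.1/ q) * ι q * y  ≈⟨ *-assoc _ _ y ⟩
      ι (ℚ.1/ q) * (ι q * y) ≈⟨ *-congˡ (≈-trans (*-congʳ (≈-sym eq)) xy≈1) ⟩
      ι (ℚ.1/ q) * 1#       ≈⟨ *-identityʳ _ ⟩
      ι (ℚ.1/ q)            ∎)
      where
      open ≈-Reasoning
      instance
        q-nonZero : ℚ.NonZero q
        q-nonZero = ℚ.≢-nonZero λ q≡0 → #0⇒≉0 (invertible⇒#0 xy≈1) (≈-trans eq (≈-trans (ι-cong q≡0) ι-0))

  rational-spectrum-impossible : ∀ {L} → ConnectionList L → ¬ (∀ {μ} → Eigenvalue L μ → ∃[ q ] μ ≈ ι q)
  rational-spectrum-impossible list rational = rational-degree≢2 (generated-rational rational) (degree-2 list)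

  ι-# : ∀ {p q} → p ≢ q → ι p # ι q
  ι-# {p} {q} p≢q = -#0⇒# (#-congʳ (≈-trans (ι-+ p _) (+-congˡ (ι-- q)))
    (ι-#0 λ eq → p≢q (ι-injective (-≈0⇒≈ (≈-trans (+-congˡ (≈-sym (ι-- q)))
      (≈-trans (≈-sym (ι-+ p _)) (≈-trans (ι-cong eq) ι-0)))))))

  -- From x² = x⁻¹ follows A² = A + 2 for A = x + x⁻¹, with roots 2 and -1.
  no-order-3 : ∀ {x} → x ** 3 ≡ ε → x ≡ ε
  no-order-3 {x} x³ =
    decidable-stable (x Fin.≟ ε) λ x≢ε → rational-spectrum-impossible (pair-list x≢ε (x²≢ε x≢ε)) rational
    where
    x²≢ε : x ≢ ε → x ∙ x ≢ ε
    x²≢ε x≢ε x² = x≢ε (trans (free ♯₀ (𝟏 ⊙ inv (♯₀ ⊙ ♯₀) ⊙ inv 𝟏 ⊙ ♯₀ **ʷ 3) (x ∷ []) refl)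
      (trans (insert ε _ (trans (cong _⁻¹ x²) ε⁻¹≈ε)) x³))
    x∙x≡x⁻¹ : ∀ g → x ∙ (x ∙ g) ≡ x ⁻¹ ∙ g
    x∙x≡x⁻¹ g = trans (free (♯₀ ⊙ (♯₀ ⊙ ♯₁)) (𝟏 ⊙ ♯₀ **ʷ 3 ⊙ inv 𝟏 ⊙ (inv ♯₀ ⊙ ♯₁)) (x ∷ g ∷ []) refl)
      (insert ε _ x³)
    x⁻¹∙x⁻¹≡x : ∀ g → x ⁻¹ ∙ (x ⁻¹ ∙ g) ≡ x ∙ g
    x⁻¹∙x⁻¹≡x g = sym (trans (free (♯₀ ⊙ ♯₁) (𝟏 ⊙ ♯₀ **ʷ 3 ⊙ inv 𝟏 ⊙ (inv ♯₀ ⊙ (inv ♯₀ ⊙ ♯₁))) (x ∷ g ∷ [])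
      refl) (insert ε _ x³))
    L = x ∷ x ⁻¹ ∷ []
    quadratic : ∀ w → Quadratic L (ι 2ℚ) (ι -1ℚ) w
    quadratic w g = begin
      Act L (Act L w) g
        ≈⟨ reflexive (cong₂ (λ s t → s + (t + 0#))
          (cong₂ (λ h k → w h + (w k + 0#)) (x∙x≡x⁻¹ g) (cancelʳ x g))
             (cong₂ (λ h k → w h + (w k + 0#)) (cancelˡ x g) (x⁻¹∙x⁻¹≡x g))) ⟩
      (w (x ⁻¹ ∙ g) + (w g + 0#)) + ((w g + (w (x ∙ g) + 0#)) + 0#)
        ≈⟨ solve 3 (λ a b c → (c :+ (a :+ con 0ℚ)) :+ ((a :+ (b :+ con 0ℚ)) :+ con 0ℚ)
             := (con 2ℚ :+ con -1ℚ) :* (b :+ (c :+ con 0ℚ)) :- con 2ℚ :* con -1ℚ :* a) ≈-refl (w g) (w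
               (x ∙ g)) (w (x ⁻¹ ∙ g)) ⟩
      (ι 2ℚ + ι -1ℚ) * Act L w g - ι 2ℚ * ι -1ℚ * w g ∎
      where open ≈-Reasoning
    rational : ∀ {μ} → Eigenvalue L μ → ∃[ q ] μ ≈ ι q
    rational (w , nz , eig) = [ (λ eq → _ , eq) , (λ eq → _ , eq) ]′
      (quadratic⇒root L (ι-# {2ℚ} { -1ℚ} λ ()) nz eig (quadratic w))

  -- The roots of A³ = 4A are 0, 2 and -2. Both elements of order 4 and pairs of commuting
  -- involutions lead to this equation, since there A² is 2(1 + z) with zA = A, for z = x² or z =
  -- ab.
  cubic⇒rational : ∀ L → (∀ w g → Act L (Act L (Act L w)) g ≈ ι 4ℚ * Act L w g) → ∀ {μ} → Eigenvalue L μ →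
    ∃[ q ] μ ≈ ι q
  cubic⇒rational L cubic {μ} (w , (g , w#0) , eig) = choose (#-cotrans (ι-# {0ℚ} {2ℚ} λ ()) μ)
    where
    open ≈-Reasoning
    vanish : (μ - ι 0ℚ) * ((μ - ι 2ℚ) * (μ - ι -2ℚ)) ≈ 0#
    vanish = *-cancel-# w#0 (begin
      w g * ((μ - ι 0ℚ) * ((μ - ι 2ℚ) * (μ - ι -2ℚ)))  ≈⟨ *-congˡ (*-congʳ (+-congˡ (-‿cong ι-0))) ⟩
      w g * ((μ - 0#) * ((μ - ι 2ℚ) * (μ - ι -2ℚ)))
        ≈⟨ solve 2 (λ x m → x :* ((m :- con 0ℚ) :* ((m :- con 2ℚ) :* (m :- con -2ℚ))) := m :*
        (m :* (m :* x)) :- con 4ℚ :* (m :* x)) ≈-refl (w g) μ ⟩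
      μ * (μ * (μ * w g)) - ι 4ℚ * (μ * w g)
        ≈⟨ ≈⇒-≈0 (≈-trans (≈-sym cube) (≈-trans (cubic w g) (*-congˡ (eig g)))) ⟩
      0#                                               ∎)
      where
      cube : Act L (Act L (Act L w)) g ≈ μ * (μ * (μ * w g))
      cube = ≈-trans (Act-cong L (Act² L eig) g) (≈-trans (Act-scale L μ _ g)
        (*-congˡ (≈-trans (Act-scale L μ w g) (*-congˡ (eig g)))))
    choose : ι 0ℚ # μ ⊎ μ # ι 2ℚ → ∃[ q ] μ ≈ ι q
    choose (inj₁ 0#μ) = [ (λ eq → _ , eq) , (λ eq → _ , eq) ]′
      (roots (ι-# {2ℚ} { -2ℚ} λ ()) (*-cancel-# (#⇒-#0 (#-sym 0#μ)) vanish))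
    choose (inj₂ μ#2) = [ (λ eq → _ , eq) , (λ eq → _ , eq) ]′
      (roots (ι-# {0ℚ} { -2ℚ} λ ()) (*-cancel-# (#⇒-#0 μ#2)
        (≈-trans (solve 3 (λ a b c → b :* (a :* c) := a :* (b :* c)) ≈-refl (μ - ι 0ℚ) (μ - ι 2ℚ)
          (μ - ι -2ℚ)) vanish)))

  order-4-trivial : ∀ {x} → x ** 4 ≡ ε → x ** 2 ≡ ε
  order-4-trivial {x} x⁴ = decidable-stable (x ** 2 Fin.≟ ε) λ x²≢ε →
    rational-spectrum-impossible (pair-list (λ x≡ε → x²≢ε (trans (cong (_** 2) x≡ε) (ε** 2)))
      (λ x² → x²≢ε (trans (free (♯₀ **ʷ 2) (♯₀ ⊙ ♯₀) (x ∷ []) refl) x²)))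
      (cubic⇒rational L cubic)
    where
    open ≈-Reasoning
    L = x ∷ x ⁻¹ ∷ []
    square : ∀ w g → Act L (Act L w) g ≈ ι 2ℚ * (w g + w (x ∙ (x ∙ g)))
    square w g = begin
      Act L (Act L w) g
        ≈⟨ reflexive (cong₂ (λ s t → s + (t + 0#)) (cong (λ k → w (x ∙ (x ∙ g)) + (w k + 0#)) (cancelʳ x g))
             (cong₂ (λ h k → w h + (w k + 0#)) (cancelˡ x g) (sym (trans
               (free (♯₀ ⊙ (♯₀ ⊙ ♯₁)) (𝟏 ⊙ ♯₀ **ʷ 4 ⊙ inv 𝟏 ⊙ (inv ♯₀ ⊙ (inv ♯₀ ⊙ ♯₁))) (x ∷ g ∷ []) refl)
                 (insert ε _ x⁴))))) ⟩
      (w (x ∙ (x ∙ g)) + (w g + 0#)) + ((w g + (w (x ∙ (x ∙ g)) + 0#)) + 0#)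
        ≈⟨ solve 2 (λ a b → (b :+ (a :+ con 0ℚ)) :+ ((a :+ (b :+ con 0ℚ)) :+ con 0ℚ) := con 2ℚ :* (a :+ b))
          ≈-refl (w g) (w (x ∙ (x ∙ g))) ⟩
      ι 2ℚ * (w g + w (x ∙ (x ∙ g))) ∎
    cubic : ∀ w g → Act L (Act L (Act L w)) g ≈ ι 4ℚ * Act L w g
    cubic w g = begin
      Act L (Act L (Act L w)) g ≈⟨ +-cong (square w (x ∙ g)) (+-congʳ (square w (x ⁻¹ ∙ g))) ⟩
      ι 2ℚ * (w (x ∙ g) + w (x ∙ (x ∙ (x ∙ g)))) + (ι 2ℚ * (w (x ⁻¹ ∙ g) + w (x ∙ (x ∙ (x ⁻¹ ∙ g)))) + 0#)
        ≈⟨ reflexive (cong₂ (λ h k → ι 2ℚ * (w (x ∙ g) + w h) + (ι 2ℚ * (w (x ⁻¹ ∙ g) + w k) + 0#))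
             (trans (free (♯₀ ⊙ (♯₀ ⊙ (♯₀ ⊙ ♯₁))) (𝟏 ⊙ ♯₀ **ʷ 4 ⊙ inv 𝟏 ⊙ (inv ♯₀ ⊙ ♯₁)) (x ∷ g ∷ []) refl)
               (insert ε _ x⁴))
             (cong (x ∙_) (cancelˡ x g))) ⟩
      ι 2ℚ * (w (x ∙ g) + w (x ⁻¹ ∙ g)) + (ι 2ℚ * (w (x ⁻¹ ∙ g) + w (x ∙ g)) + 0#)
        ≈⟨ solve 2 (λ a b → con 2ℚ :* (a :+ b) :+ (con 2ℚ :* (b :+ a) :+ con 0ℚ) := con 4ℚ :*
          (a :+ (b :+ con 0ℚ))) ≈-refl (w (x ∙ g)) (w (x ⁻¹ ∙ g)) ⟩
      ι 4ℚ * Act L w g ∎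

  commuting-involutions : ∀ {a b} → Involution a → Involution b → a ∙ b ≡ b ∙ a → a ≡ b
  commuting-involutions {a} {b} a-inv@(_ , a²) b-inv@(_ , b²) ab = decidable-stable (a Fin.≟ b) λ a≢b →
    rational-spectrum-impossible (involutions-list a-inv b-inv a≢b) (cubic⇒rational L cubic)
    where
    open ≈-Reasoning
    L = a ∷ b ∷ []
    twice : ∀ {z} → z ∙ z ≡ ε → ∀ g → z ∙ (z ∙ g) ≡ g
    twice {z} z² g = trans (sym (assoc z z g)) (trans (cong (_∙ g) z²) (identityˡ g))
    swap : ∀ g → b ∙ (a ∙ g) ≡ a ∙ (b ∙ g)
    swap g = trans (sym (assoc b a g)) (trans (cong (_∙ g) (sym ab)) (assoc a b g))
    square : ∀ w g → Act L (Act L w) g ≈ ι 2ℚ * (w g + w (a ∙ (b ∙ g)))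
    square w g = begin
      Act L (Act L w) g
        ≈⟨ reflexive (cong₂ (λ s t → s + (t + 0#)) (cong₂ (λ h k → w h + (w k + 0#)) (twice a² g) (swap g))
             (cong (λ k → w (a ∙ (b ∙ g)) + (w k + 0#)) (twice b² g))) ⟩
      (w g + (w (a ∙ (b ∙ g)) + 0#)) + ((w (a ∙ (b ∙ g)) + (w g + 0#)) + 0#)
        ≈⟨ solve 2 (λ a b → (a :+ (b :+ con 0ℚ)) :+ ((b :+ (a :+ con 0ℚ)) :+ con 0ℚ) := con 2ℚ :* (a :+ b))
          ≈-refl (w g) (w (a ∙ (b ∙ g))) ⟩
      ι 2ℚ * (w g + w (a ∙ (b ∙ g))) ∎
    cubic : ∀ w g → Act L (Act L (Act L w)) g ≈ ι 4ℚ * Act L w g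
    cubic w g = begin
      Act L (Act L (Act L w)) g ≈⟨ +-cong (square w (a ∙ g)) (+-congʳ (square w (b ∙ g))) ⟩
      ι 2ℚ * (w (a ∙ g) + w (a ∙ (b ∙ (a ∙ g)))) + (ι 2ℚ * (w (b ∙ g) + w (a ∙ (b ∙ (b ∙ g)))) + 0#)
        ≈⟨ reflexive (cong₂ (λ h k → ι 2ℚ * (w (a ∙ g) + w h) + (ι 2ℚ * (w (b ∙ g) + w k) + 0#))
             (trans (cong (a ∙_) (swap g)) (twice a² (b ∙ g))) (cong (a ∙_) (twice b² g))) ⟩
      ι 2ℚ * (w (a ∙ g) + w (b ∙ g)) + (ι 2ℚ * (w (b ∙ g) + w (a ∙ g)) + 0#)
        ≈⟨ solve 2 (λ a b → con 2ℚ :* (a :+ b) :+ (con 2ℚ :* (b :+ a) :+ con 0ℚ) := con 4ℚ :*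
          (a :+ (b :+ con 0ℚ))) ≈-refl (w (a ∙ g)) (w (b ∙ g)) ⟩
      ι 4ℚ * Act L w g ∎

  root-impossible : ∀ {x n} → NonquadraticRoot (suc n) → x ** suc n ≡ ε → x ≢ ε → x ∙ x ≢ ε → ¬
    (∀ k → 0 ℕ.< k → k ℕ.< suc n → x ** k ≢ ε)
  root-impossible root xⁿ x≢ε x²≢ε faithful =
    nonquadratic (degree-2 (pair-list x≢ε x²≢ε)) (gen (cyclic-eigenvalue xⁿ faithful ζζ′ ζ′ⁿ))
    where open NonquadraticRoot root

  no-large-prime-order : ∀ {x} t → Prime (7 ℕ.+ t ℕ.* 2) → x ** (7 ℕ.+ t ℕ.* 2) ≡ ε → x ≡ ε
  no-large-prime-order {x} t p-prime xᵖ = decidable-stable (x Fin.≟ ε) λ x≢ε →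
    root-impossible (nonquadratic-prime t p-prime) xᵖ x≢ε
      (λ x² → x≢ε (**-coprime p-prime (ℕ.s≤s ℕ.z≤n) (ℕ.s≤s (ℕ.s≤s (ℕ.s≤s ℕ.z≤n)))
        (trans (free (♯₀ **ʷ 2) (♯₀ ⊙ ♯₀) (x ∷ []) refl) x²) xᵖ))
      (λ k 0<k k<p xᵏ → x≢ε (**-coprime p-prime 0<k k<p xᵏ xᵖ))

  order-25-trivial : ∀ {x} → x ** 25 ≡ ε → x ** 5 ≡ ε
  order-25-trivial {x} x²⁵ = decidable-stable (x ** 5 Fin.≟ ε) λ x⁵≢ε →
    root-impossible nonquadratic-25 x²⁵ (λ x≡ε → x⁵≢ε (trans (cong (_** 5) x≡ε) (ε** 5)))
      (λ x² → x⁵≢ε (from-multiple 2 15 refl (trans (free (♯₀ **ʷ 2) (♯₀ ⊙ ♯₀) (x ∷ []) refl) x²)))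
      (λ k 0<k k<25 xᵏ → x⁵≢ε (from-order k 0<k k<25 xᵏ))
    where
    from-multiple : ∀ k m → (m ℕ.* k) % 25 ≡ 5 → x ** k ≡ ε → x ** 5 ≡ ε
    from-multiple k m eq xᵏ = trans (cong (x **_) (sym eq)) (trans (sym (**-% (m ℕ.* k) x²⁵))
      (trans (**-* x m k) (trans (cong (_** m) xᵏ) (ε** m))))
    -- If 0 < k < 25, the greatest common divisor of k and 25 divides 5, so 5 is a multiple of k
    -- modulo 25; this is checked by enumeration.
    multiplier : ∀ (i : Fin 25) → i ≡ zero ⊎ (∃[ m ] (toℕ {25} m ℕ.* toℕ i) % 25 ≡ 5)
    multiplier = from-yes (Fin.all? λ (i : Fin 25) → (i Fin.≟ zero) ⊎-dec Fin.any? λ (m : Fin 25) →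
      (toℕ m ℕ.* toℕ i) % 25 ℕ.≟ 5)
    from-order : ∀ k → 0 ℕ.< k → k ℕ.< 25 → x ** k ≡ ε → x ** 5 ≡ ε
    from-order k 0<k k<25 xᵏ = choose (multiplier (fromℕ< k<25))
      where
      i≡k : toℕ (fromℕ< k<25) ≡ k
      i≡k = Fin.toℕ-fromℕ< k<25
      choose : fromℕ< k<25 ≡ zero ⊎ (∃[ m ] (toℕ {25} m ℕ.* toℕ (fromℕ< k<25)) % 25 ≡ 5) → x ** 5 ≡ ε
      choose (inj₁ i≡0)      = contradiction (trans (sym (cong toℕ i≡0)) i≡k) (ℕ.<⇒≢ 0<k)
      choose (inj₂ (m , eq)) =
        from-multiple k (toℕ m) (trans (cong (λ j → (toℕ m ℕ.* j) % 25) (sym i≡k)) eq) xᵏ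

  even-or-odd : ∀ j → (∃[ t ] j ≡ t ℕ.* 2) ⊎ (∃[ t ] j ≡ suc (t ℕ.* 2))
  even-or-odd zero    = inj₁ (0 , refl)
  even-or-odd (suc j) with even-or-odd j
  ... | inj₁ (t , refl) = inj₂ (t , refl)
  ... | inj₂ (t , refl) = inj₁ (suc t , refl)

  -- A prime p is removed from the exponent 10p. For p = 2 this concerns the element x⁵ with fourth
  -- power x²⁰, for p = 5 the element x² with 25th power x⁵⁰; any other prime would be the order of
  -- x¹⁰.
  prime-step : ∀ {p} → Prime p → ∀ x → (x ** 10) ** p ≡ ε → x ** 10 ≡ ε
  prime-step {0} p-prime x eq = contradiction p-prime ¬prime[0]
  prime-step {1} p-prime x eq = contradiction p-prime ¬prime[1]
  prime-step {2} p-prime x eq =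
    trans (**-* x 2 5) (order-4-trivial (trans (sym (**-* x 4 5)) (trans (**-* x 2 10) eq)))
  prime-step {3} p-prime x eq = no-order-3 eq
  prime-step {4} p-prime x eq = contradiction p-prime (from-no (prime? 4))
  prime-step {5} p-prime x eq =
    trans (**-* x 5 2) (order-25-trivial (trans (sym (**-* x 25 2)) (trans (**-* x 5 10) eq)))
  prime-step {6} p-prime x eq = contradiction p-prime (from-no (prime? 6))
  prime-step {suc (suc (suc (suc (suc (suc (suc j))))))} p-prime x eq with even-or-odd j
  ... | inj₁ (t , refl) = no-large-prime-order t p-prime eq
  ... | inj₂ (t , refl) with prime⇒irreducible p-prime {2} (ℕ∣.divides (4 ℕ.+ t) refl)
  ...   | inj₁ ()
  ...   | inj₂ ()

  exponent-10 : ∀ x → x ** 10 ≡ ε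
  exponent-10 x =
    by-factors factors factorsPrime x (subst (λ n → x ** n ≡ ε) isFactorisation (proj₂ (torsion x)))
    where
    open PrimeFactorisation (factorise (suc (proj₁ (torsion x))))
    by-factors : ∀ ps → All Prime ps → ∀ x → x ** product ps ≡ ε → x ** 10 ≡ ε
    by-factors []       []         x eq = trans (cong (_** 10) (**-1 eq)) (ε** 10)
    by-factors (p ∷ ps) (pp ∷ pps) x eq = prime-step pp x (trans (**-swap x 10 p) (by-factors ps pps (x ** p)
      (trans (sym (**-* x (product ps) p)) (trans (cong (x **_) (ℕ.*-comm (product ps) p)) eq))))

  order-5-square : ∀ {x} → x ≢ ε → x ** 5 ≡ ε → x ∙ x ≢ ε
  order-5-square x≢ε x⁵ x² = x≢ε (order-2-and-5 x² x⁵)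

  5+2φ-nonsquare : ∀ {φ x} → Golden φ → InSpan φ x → ¬ x * x ≈ ι 5ℚ + ι 2ℚ * φ
  5+2φ-nonsquare golden = nonsquare golden 5ℚ 2ℚ (ℤ.+ 11 ℚ./ 1) (from-yes (prime? 11)) refl refl refl

  9-5φ-nonsquare : ∀ {φ x} → Golden φ → InSpan φ x → ¬ x * x ≈ ι 9ℚ + ι -5ℚ * φ
  9-5φ-nonsquare golden = nonsquare golden 9ℚ -5ℚ (ℤ.+ 101 ℚ./ 1) (from-yes (prime? 101)) refl refl refl

  square-root : ∀ d → ∃[ s ] s * s ≈ d
  square-root d = s , -≈0⇒≈ (≈-trans (solve 2 (λ s d → s :* s :- d := s :* (s :* con 1ℚ) :+
    (:- d :* con 1ℚ :+ (con 0ℚ :* (s :* con 1ℚ) :+ con 0ℚ))) ≈-refl s d)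
      (proj₂ (hasRoot 1 coefficients-of)))
    where
    coefficients-of : Fin 2 → K
    coefficients-of zero    = - d
    coefficients-of (suc _) = 0#
    s : K
    s = proj₁ (hasRoot 1 coefficients-of)

  square-#0 : ∀ {s d} → s * s ≈ d → d # 0# → s # 0#
  square-#0 eq d#0 = *-factorˡ-# (#-congʳ (≈-sym eq) d#0)

  s#-s : ∀ {s} → s # 0# → s # - s
  s#-s {s} s#0 = -#0⇒# (#-congʳ (solve 1 (λ s → s :+ s := s :- :- s) ≈-refl s) (two-# s#0))

  -- A² is 3 plus the six products of two different involutions from the list, which are x, y, x⁻¹y
  -- and their inverses. On a function fixed by x on which y + y⁻¹ acts as φ they contribute 2 + φ +
  -- φ, so that A² = 5 + 2φ.
  no-inverted-plane : ∀ {a x y} → Involution a → x ≢ ε → x ** 5 ≡ ε → y ** 5 ≡ ε →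
    (∀ (i : Fin 5) → y ≢ x ** toℕ i) → a ∙ x ∙ a ≡ x ⁻¹ → a ∙ y ∙ a ≡ y ⁻¹ → ¬ x ∙ y ≡ y ∙ x
  no-inverted-plane {a} {x} {y} a-inv@(a≢ε , a²) x≢ε x⁵ y⁵ outside axa aya xy =
      [ impossible μ² , impossible (≈-trans (solve 1 (λ s → :- s :* :- s := s :* s) ≈-refl μ) μ²) ]′
        (quadratic⇒eigenvalue L (s#-s μ#0) nonzero quadratic)
    where
    open ≈-Reasoning
    L = a ∷ a ∙ x ∷ a ∙ y ∷ []
    φ : K
    φ = proj₁ golden-exists
    golden : Golden φ
    golden = proj₂ golden-exists
    open PlaneVector (plane-vector golden x≢ε x⁵ y⁵ xy outside)
    y≢ε : y ≢ ε
    y≢ε = outside zero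
    flip : ∀ {z} → a ∙ z ∙ a ≡ z ⁻¹ → z ≢ ε → z ** 5 ≡ ε → Involution (a ∙ z)
    flip {z} aza z≢ε z⁵ = (λ az≡ε → order-5-square z≢ε z⁵
      (subst (λ t → t ∙ t ≡ ε) (sym (trans (inverseʳ-unique a z az≡ε) (involution-⁻¹ a²))) a²))
      , trans (sym (assoc (a ∙ z) a z)) (trans (cong (_∙ z) aza) (inverseˡ z))
    list : ConnectionList L
    list = three-involutions-list a-inv (flip axa x≢ε x⁵) (flip aya y≢ε y⁵)
      (λ eq → x≢ε (∙-cancelˡ a x ε (trans (sym eq) (sym (identityʳ a)))))
      (λ eq → y≢ε (∙-cancelˡ a y ε (trans (sym eq) (sym (identityʳ a)))))
      (λ eq → outside (suc zero) (trans (sym (∙-cancelˡ a x y eq)) (sym (identityʳ x))))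
    μ : K
    μ = proj₁ (square-root (ι 5ℚ + ι 2ℚ * φ))
    μ² : μ * μ ≈ ι 5ℚ + ι 2ℚ * φ
    μ² = proj₂ (square-root (ι 5ℚ + ι 2ℚ * φ))
    μ#0 : μ # 0#
    -- 3 - 2φ is the conjugate of 5 + 2φ, and the product is the norm 11.
    μ#0 = square-#0 μ² (*-factorˡ-# {y = ι 3ℚ - ι 2ℚ * φ} (#-congʳ (begin
      ι 11ℚ
        ≈⟨ solve 1 (λ f → con 11ℚ := con 15ℚ :- con 4ℚ :* (con 1ℚ :- f) :- con 4ℚ :* f) ≈-refl φ ⟩
      ι 15ℚ - ι 4ℚ * (1# - φ) - ι 4ℚ * φ
        ≈⟨ +-congʳ (+-congˡ (-‿cong (*-congˡ (golden² golden)))) ⟨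
      ι 15ℚ - ι 4ℚ * (φ * φ) - ι 4ℚ * φ
        ≈⟨ solve 1 (λ f → con 15ℚ :- con 4ℚ :* (f :* f) :- con 4ℚ :* f := (con 5ℚ :+ con 2ℚ :* f) :*
        (con 3ℚ :- con 2ℚ :* f)) ≈-refl φ ⟩
      (ι 5ℚ + ι 2ℚ * φ) * (ι 3ℚ - ι 2ℚ * φ)                                ∎) (ι-#0 {11ℚ} λ ())))
    impossible : ∀ {ν} → ν * ν ≈ ι 5ℚ + ι 2ℚ * φ → ¬ Eigenvalue L ν
    impossible {ν} ν² ν∈ = 5+2φ-nonsquare golden (degree-2-span golden (degree-2 list) φ∈ (gen ν∈)) ν²
      where
      ιq∈ : Generated Ω (Eigenvalue L) (ι 5ℚ)
      ιq∈ = resp (solve 0 (con 1ℚ :+ con 1ℚ :+ con 1ℚ :+ con 1ℚ :+ con 1ℚ := con 5ℚ) ≈-refl)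
        (+∈ (+∈ (+∈ (+∈ 1∈ 1∈) 1∈) 1∈) 1∈)
      2∈ : Generated Ω (Eigenvalue L) (ι 2ℚ)
      2∈ = resp (≈-sym ι-double) (+∈ 1∈ 1∈)
      -- φ = (ν² - 5)/2 must be in the generated field before `degree-2-span` can confine ν to ℚ +
      -- ℚφ.
      φ∈ : Generated Ω (Eigenvalue L) φ
      φ∈ = resp (begin
        ι ½ * (ν * ν - ι 5ℚ)                  ≈⟨ *-congˡ (+-congʳ ν²) ⟩
        ι ½ * (ι 5ℚ + ι 2ℚ * φ - ι 5ℚ)
          ≈⟨ solve 1 (λ f → con ½ :* (con 5ℚ :+ con 2ℚ :* f :- con 5ℚ) := f) ≈-refl φ ⟩
        φ                                     ∎)
        (*∈ (⁻¹∈ (solve 0 (con 2ℚ :* con ½ := con 1ℚ) ≈-refl) 2∈) (+∈ (*∈ (gen ν∈) (gen ν∈)) (-∈ ιq∈)))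
    twice : ∀ g → a ∙ (a ∙ g) ≡ g
    twice g = trans (sym (assoc a a g)) (trans (cong (_∙ g) a²) (identityˡ g))
    invert : ∀ {z} → a ∙ z ∙ a ≡ z ⁻¹ → ∀ g → a ∙ (z ∙ (a ∙ g)) ≡ z ⁻¹ ∙ g
    invert {z} aza g =
      trans (free (♯₀ ⊙ (♯₁ ⊙ (♯₀ ⊙ ♯₂))) (♯₀ ⊙ ♯₁ ⊙ ♯₀ ⊙ ♯₂) (a ∷ z ∷ g ∷ []) refl) (cong (_∙ g) aza)
    w₀ w₁ w₂ : El → K
    w₀ g = f g
    w₁ g = f (y ∙ g)
    w₂ g = f (y ⁻¹ ∙ g)
    term₂ : ∀ z g → a ∙ ((a ∙ z) ∙ g) ≡ z ∙ g
    term₂ z g = trans (cong (a ∙_) (assoc a z g)) (twice (z ∙ g))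
    term₃ : ∀ {z} → a ∙ z ∙ a ≡ z ⁻¹ → ∀ g → (a ∙ z) ∙ (a ∙ g) ≡ z ⁻¹ ∙ g
    term₃ {z} aza g = trans (assoc a z (a ∙ g)) (invert aza g)
    term₄ : ∀ {z} → a ∙ z ∙ a ≡ z ⁻¹ → ∀ u g → (a ∙ z) ∙ ((a ∙ u) ∙ g) ≡ z ⁻¹ ∙ (u ∙ g)
    term₄ {z} aza u g = trans (cong ((a ∙ z) ∙_) (assoc a u g)) (term₃ aza (u ∙ g))
    y⁻¹x : ∀ g → y ⁻¹ ∙ (x ∙ g) ≡ x ∙ (y ⁻¹ ∙ g)
    y⁻¹x g = trans (free (inv ♯₁ ⊙ (♯₀ ⊙ ♯₂)) (inv ♯₁ ⊙ (♯₀ ⊙ ♯₁) ⊙ inv ♯₁ ⊙ ♯₂) (x ∷ y ∷ g ∷ []) refl)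
      (trans (cong (λ z → y ⁻¹ ∙ z ∙ y ⁻¹ ∙ g) xy)
        (free (inv ♯₁ ⊙ (♯₁ ⊙ ♯₀) ⊙ inv ♯₁ ⊙ ♯₂) (♯₀ ⊙ (inv ♯₁ ⊙ ♯₂)) (x ∷ y ∷ g ∷ []) refl))
    quadratic : Quadratic L μ (- μ) f
    quadratic g = begin
      Act L (Act L f) g
        ≈⟨ +-cong
             (+-cong (reflexive (cong f (twice g)))
               (+-cong (≈-trans (reflexive (cong f (term₃ axa g))) (f-x⁻¹ g))
               (+-congʳ (reflexive (cong f (term₃ aya g))))))
             (+-cong
               (+-cong (≈-trans (reflexive (cong f (term₂ x g))) (f-x g))
                 (+-cong (reflexive (cong f (trans (term₄ axa x g) (cancelʳ x g))))
                 (+-congʳ (≈-trans (reflexive (cong f (trans (term₄ aya x g) (y⁻¹x g)))) (f-x _)))))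
               (+-congʳ (+-cong (reflexive (cong f (term₂ y g)))
                 (+-cong (≈-trans (reflexive (cong f (term₄ axa y g))) (f-x⁻¹ _))
                 (+-congʳ (reflexive (cong f (trans (term₄ aya y g) (cancelʳ y g))))))))) ⟩
      (f g + (f g + (w₂ g + 0#))) + ((f g + (f g + (w₂ g + 0#))) + ((w₁ g + (w₁ g + (f g + 0#))) + 0#))
        ≈⟨ solve 3 (λ a b c → (a :+ (a :+ (c :+ con 0ℚ))) :+
          ((a :+ (a :+ (c :+ con 0ℚ))) :+ ((b :+ (b :+ (a :+ con 0ℚ))) :+ con 0ℚ))
             := con 5ℚ :* a :+ con 2ℚ :* (b :+ c)) ≈-refl (f g) (w₁ g) (w₂ g) ⟩
      ι 5ℚ * f g + ι 2ℚ * (w₁ g + w₂ g)          ≈⟨ +-congˡ (*-congˡ (f-y g)) ⟩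
      ι 5ℚ * f g + ι 2ℚ * (φ * f g)
        ≈⟨ solve 2 (λ f a → con 5ℚ :* a :+ con 2ℚ :* (f :* a) := (con 5ℚ :+ con 2ℚ :* f) :* a) ≈-refl φ
        (f g) ⟩
      (ι 5ℚ + ι 2ℚ * φ) * f g                    ≈⟨ *-congʳ μ² ⟨
      μ * μ * f g
        ≈⟨ solve 3 (λ m a b → m :* m :* a := (m :+ :- m) :* b :- m :* :- m :* a) ≈-refl μ (f g) (Act L f g) ⟩
      (μ + - μ) * Act L f g - μ * - μ * f g      ∎

  -- Conjugation by a takes u = xy to u′ = x⁻¹y, and the two span a plane. Let f be fixed by u, with
  -- u′ + u′⁻¹ acting as φ, and let f∘a be g ↦ f(ag). Then A takes f to 2f + f∘a and f∘a to f + φ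
  -- f∘a. The characteristic equation of this 2 × 2 matrix is (μ - 2)(μ - φ) = 1.
  no-mixed-plane : ∀ {a x y} → Involution a → x ≢ ε → x ** 5 ≡ ε → y ≢ ε → y ** 5 ≡ ε →
    a ∙ x ∙ a ≡ x ⁻¹ → a ∙ y ≡ y ∙ a → ¬ x ∙ y ≡ y ∙ x
  no-mixed-plane {a} {x} {y} a-inv@(a≢ε , a²) x≢ε x⁵ y≢ε y⁵ axa ay xy =
      [ impossible (solve 2 (λ f s → (con 2ℚ :+ f :+ s) :- (con 2ℚ :+ f) := s) ≈-refl φ s) s²
      , impossible (solve 2 (λ f s → (con 2ℚ :+ f :- s) :- (con 2ℚ :+ f) := :- s) ≈-refl φ s)
        (≈-trans (solve 1 (λ s → :- s :* :- s := s :* s) ≈-refl s) s²) ]′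
        (quadratic⇒eigenvalue L p#q nonzero quadratic)
    where
    u u′ : El
    u  = x ∙ y
    u′ = a ∙ u ∙ a
    aya : a ∙ y ∙ a ≡ y
    aya = trans (cong (_∙ a) ay) (trans (assoc y a a) (trans (cong (y ∙_) a²) (identityʳ y)))
    u′≡ : u′ ≡ x ⁻¹ ∙ y
    u′≡ = begin
      a ∙ (x ∙ y) ∙ a
        ≡⟨ free (♯₀ ⊙ (♯₁ ⊙ ♯₂) ⊙ ♯₀) (♯₀ ⊙ ♯₁ ⊙ inv ♯₀ ⊙ (♯₀ ⊙ ♯₂ ⊙ ♯₀)) (a ∷ x ∷ y ∷ []) refl ⟩
      a ∙ x ∙ a ⁻¹ ∙ (a ∙ y ∙ a)      ≡⟨ cong₂ (λ s t → a ∙ x ∙ s ∙ t) (involution-⁻¹ a²) aya ⟩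
      a ∙ x ∙ a ∙ y                   ≡⟨ cong (_∙ y) axa ⟩
      x ⁻¹ ∙ y                        ∎
      where open ≡-Reasoning
    power : ∀ {z w} → z ∙ w ≡ w ∙ z → z ** 5 ≡ ε → w ** 5 ≡ ε → (z ∙ w) ** 5 ≡ ε
    power {z} {w} zw z⁵ w⁵ = trans (expand 5) (trans (cong₂ _∙_ z⁵ w⁵) (identityˡ ε))
      where
      open ≡-Reasoning
      move : ∀ k → w ∙ z ** k ≡ z ** k ∙ w
      move zero    = trans (identityʳ w) (sym (identityˡ w))
      move (suc k) = trans (sym (assoc w z _)) (trans (cong (_∙ z ** k) (sym zw))
        (trans (assoc z w _) (trans (cong (z ∙_) (move k)) (sym (assoc z _ w)))))
      expand : ∀ k → (z ∙ w) ** k ≡ z ** k ∙ w ** k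
      expand zero    = sym (identityˡ ε)
      expand (suc k) = begin
        z ∙ w ∙ (z ∙ w) ** k          ≡⟨ cong (z ∙ w ∙_) (expand k) ⟩
        z ∙ w ∙ (z ** k ∙ w ** k)     ≡⟨ trans (assoc z w _) (cong (z ∙_) (sym (assoc w _ _))) ⟩
        z ∙ (w ∙ z ** k ∙ w ** k)     ≡⟨ cong (λ t → z ∙ (t ∙ w ** k)) (move k) ⟩
        z ∙ (z ** k ∙ w ∙ w ** k)     ≡⟨ trans (cong (z ∙_) (assoc _ w _)) (sym (assoc z _ _)) ⟩
        z ∙ z ** k ∙ (w ∙ w ** k)     ∎
    x⁻¹y : x ⁻¹ ∙ y ≡ y ∙ x ⁻¹
    x⁻¹y = trans (free (inv ♯₀ ⊙ ♯₁) (inv ♯₀ ⊙ (♯₁ ⊙ ♯₀) ⊙ inv ♯₀) (x ∷ y ∷ []) refl)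
      (trans (cong (λ z → x ⁻¹ ∙ z ∙ x ⁻¹) (sym xy))
        (free (inv ♯₀ ⊙ (♯₀ ⊙ ♯₁) ⊙ inv ♯₀) (♯₁ ⊙ inv ♯₀) (x ∷ y ∷ []) refl))
    u⁵ : u ** 5 ≡ ε
    u⁵ = power xy x⁵ y⁵
    u′⁵ : u′ ** 5 ≡ ε
    u′⁵ = trans (cong (_** 5) u′≡) (power x⁻¹y (trans (free (inv ♯₀ **ʷ 5) (inv (♯₀ **ʷ 5)) (x ∷ []) refl)
      (trans (cong _⁻¹ x⁵) ε⁻¹≈ε)) y⁵)
    x²≢ε : x ∙ x ≢ ε
    x²≢ε = order-5-square x≢ε x⁵
    u≢ε : u ≢ ε
    u≢ε u≡ε = x²≢ε (trans (cong (x ∙_) x≡x⁻¹) (inverseʳ x))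
      where
      y≡x⁻¹ : y ≡ x ⁻¹
      y≡x⁻¹ = inverseʳ-unique x y u≡ε
      y≡x : y ≡ x
      y≡x = trans (sym aya) (trans (cong (λ z → a ∙ z ∙ a) y≡x⁻¹)
        (trans (cong (λ b → b ∙ x ⁻¹ ∙ b) (sym (involution-⁻¹ a²)))
        (trans (free (inv ♯₀ ⊙ inv ♯₁ ⊙ inv ♯₀) (inv (♯₀ ⊙ ♯₁ ⊙ ♯₀)) (a ∷ x ∷ []) refl)
          (trans (cong _⁻¹ axa) (⁻¹-involutive x)))))
      x≡x⁻¹ : x ≡ x ⁻¹
      x≡x⁻¹ = trans (sym y≡x) y≡x⁻¹
    au′a : a ∙ u′ ∙ a ≡ u
    au′a = trans (free (♯₀ ⊙ (♯₀ ⊙ ♯₁ ⊙ ♯₀) ⊙ ♯₀) ((♯₀ ⊙ ♯₀) ⊙ ♯₁ ⊙ (♯₀ ⊙ ♯₀)) (a ∷ u ∷ []) refl)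
      (trans (cong₂ (λ s t → s ∙ u ∙ t) a² a²) (trans (identityʳ _) (identityˡ u)))
    conj-power : ∀ z k → a ∙ z ** k ∙ a ≡ (a ∙ z ∙ a) ** k
    conj-power z zero    = trans (cong (_∙ a) (identityʳ a)) a²
    conj-power z (suc k) =
      trans (free (♯₀ ⊙ (♯₁ ⊙ ♯₂) ⊙ ♯₀) (♯₀ ⊙ ♯₁ ⊙ inv ♯₀ ⊙ (♯₀ ⊙ ♯₂ ⊙ ♯₀)) (a ∷ z ∷ z ** k ∷ []) refl)
      (cong₂ _∙_ (cong (a ∙ z ∙_) (involution-⁻¹ a²)) (conj-power z k))
    -- If u′ = uᵐ, conjugating twice by a yields u to the power m² equal to u, which excludes m = 0,
    -- 2 and 3. The cases m = 1 and m = 4 would give x² = 1 and y² = 1.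
    u-power : ∀ m → u′ ≡ u ** m → u ** (m ℕ.* m) ≡ u
    u-power m eq = trans (**-* u m m) (trans (cong (_** m) (sym eq))
      (trans (sym (conj-power u m)) (trans (cong (λ z → a ∙ z ∙ a) (sym eq)) au′a)))
    reduce : ∀ k → 0 ℕ.< k → k ℕ.< 5 → u ** suc k ≡ u → u ≡ ε
    reduce k 0<k k<5 eq =
      **-coprime (from-yes (prime? 5)) 0<k k<5 (∙-cancelˡ u _ ε (trans eq (sym (identityʳ u)))) u⁵
    uu′ : u ∙ u′ ≡ u′ ∙ u
    uu′ = begin
      x ∙ y ∙ u′                  ≡⟨ cong (x ∙ y ∙_) u′≡ ⟩
      x ∙ y ∙ (x ⁻¹ ∙ y)          ≡⟨ cong (_∙ (x ⁻¹ ∙ y)) xy ⟩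
      y ∙ x ∙ (x ⁻¹ ∙ y)
        ≡⟨ free (♯₁ ⊙ ♯₀ ⊙ (inv ♯₀ ⊙ ♯₁)) (♯₁ ⊙ inv ♯₀ ⊙ (♯₀ ⊙ ♯₁)) (x ∷ y ∷ []) refl ⟩
      y ∙ x ⁻¹ ∙ (x ∙ y)          ≡⟨ cong (_∙ (x ∙ y)) x⁻¹y ⟨
      x ⁻¹ ∙ y ∙ (x ∙ y)          ≡⟨ cong (_∙ (x ∙ y)) u′≡ ⟨
      u′ ∙ (x ∙ y)                ∎
      where open ≡-Reasoning
    outside : ∀ (i : Fin 5) → u′ ≢ u ** toℕ i
    outside zero eq = u≢ε (sym (u-power 0 eq))
    outside (suc zero) eq = x²≢ε (trans (free (♯₀ ⊙ ♯₀) (♯₀ ⊙ ♯₁ ⊙ inv (inv ♯₀ ⊙ ♯₁)) (x ∷ y ∷ []) refl)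
      (trans (cong (λ z → u ∙ z ⁻¹) (trans (sym u′≡) (trans eq (identityʳ u)))) (inverseʳ u)))
    outside (suc (suc zero)) eq = u≢ε (reduce 3 (ℕ.s≤s ℕ.z≤n) (from-yes (3 ℕ.<? 5)) (u-power 2 eq))
    outside (suc (suc (suc zero))) eq = u≢ε (reduce 3 (ℕ.s≤s ℕ.z≤n) (from-yes (3 ℕ.<? 5))
      (trans (sym (**-% {n = 4} 9 u⁵)) (u-power 3 eq)))
    outside (suc (suc (suc (suc zero)))) eq = order-5-square y≢ε y⁵ (begin
      y ∙ y                       ≡⟨ free (♯₁ ⊙ ♯₁) (♯₁ ⊙ inv ♯₀ ⊙ (♯₀ ⊙ ♯₁)) (x ∷ y ∷ []) refl ⟩
      y ∙ x ⁻¹ ∙ u                ≡⟨ cong (_∙ u) (trans (sym x⁻¹y) (trans (sym u′≡) eq)) ⟩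
      u ** 4 ∙ u                  ≡⟨ free (♯₀ **ʷ 4 ⊙ ♯₀) (♯₀ **ʷ 5) (u ∷ []) refl ⟩
      u ** 5                      ≡⟨ u⁵ ⟩
      ε                           ∎)
      where open ≡-Reasoning
    L = u ∷ u ⁻¹ ∷ a ∷ []
    list : ConnectionList L
    list = pair-involution-list u≢ε (order-5-square u≢ε u⁵) a-inv
    φ s p q : K
    φ = proj₁ golden-exists
    golden : Golden φ
    golden = proj₂ golden-exists
    open PlaneVector (plane-vector golden u≢ε u⁵ u′⁵ uu′ outside)
    s = proj₁ (square-root (ι 9ℚ + ι -5ℚ * φ))
    s² : s * s ≈ ι 9ℚ + ι -5ℚ * φ
    s² = proj₂ (square-root (ι 9ℚ + ι -5ℚ * φ))
    -- The roots of μ² - (2 + φ)μ + (2φ - 1), whose discriminant is (2 + φ)² - 4(2φ - 1) = 9 - 5φ.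
    p = ι ½ * (ι 2ℚ + φ + s)
    q = ι ½ * (ι 2ℚ + φ - s)
    open ≈-Reasoning
    s#0 : s # 0#
    -- 14 + 5φ is the conjugate of 9 - 5φ, and the product is the norm 101.
    s#0 = square-#0 s² (*-factorˡ-# {y = ι 14ℚ + ι 5ℚ * φ} (#-congʳ (begin
      ι 101ℚ
        ≈⟨ solve 1 (λ f → con 101ℚ := con 126ℚ :- con 25ℚ :* f :- con 25ℚ :* (con 1ℚ :- f)) ≈-refl φ ⟩
      ι 126ℚ - ι 25ℚ * φ - ι 25ℚ * (1# - φ)
        ≈⟨ +-congˡ (-‿cong (*-congˡ (golden² golden))) ⟨
      ι 126ℚ - ι 25ℚ * φ - ι 25ℚ * (φ * φ)
        ≈⟨ solve 1 (λ f → con 126ℚ :- con 25ℚ :* f :- con 25ℚ :* (f :* f) := (con 9ℚ :+ con -5ℚ :* f) :*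
        (con 14ℚ :+ con 5ℚ :* f)) ≈-refl φ ⟩
      (ι 9ℚ + ι -5ℚ * φ) * (ι 14ℚ + ι 5ℚ * φ)                              ∎) (ι-#0 {101ℚ} λ ())))
    p#q : p # q
    p#q = -#0⇒# (#-congʳ (solve 2 (λ f s → s := con ½ :* (con 2ℚ :+ f :+ s) :- con ½ :* (con 2ℚ :+ f :- s))
      ≈-refl φ s) s#0)
    pq : p * q ≈ ι 2ℚ * φ - 1#
    pq = begin
      p * q
        ≈⟨ solve 2 (λ f s → (con ½ :* (con 2ℚ :+ f :+ s)) :* (con ½ :* (con 2ℚ :+ f :- s)) := con ¼ :*
        (con 4ℚ :+ con 4ℚ :* f :+ f :* f :- s :* s)) ≈-refl φ s ⟩
      ι ¼ * (ι 4ℚ + ι 4ℚ * φ + φ * φ - s * s)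
        ≈⟨ *-congˡ (+-cong (+-congˡ (golden² golden)) (-‿cong s²)) ⟩
      ι ¼ * (ι 4ℚ + ι 4ℚ * φ + (1# - φ) - (ι 9ℚ + ι -5ℚ * φ))
        ≈⟨ solve 1 (λ f → con ¼ :* (con 4ℚ :+ con 4ℚ :* f :+ (con 1ℚ :- f) :- (con 9ℚ :+ con -5ℚ :* f))
        := con 2ℚ :* f :- con 1ℚ) ≈-refl φ ⟩
      ι 2ℚ * φ - 1#                                            ∎
    -- φ is recovered from an eigenvalue μ through (μ − 2)(μ − φ) = 1.
    impossible : ∀ {r t} → r - (ι 2ℚ + φ) ≈ t → t * t ≈ ι 9ℚ + ι -5ℚ * φ → ¬ Eigenvalue L (ι ½ * r)
    impossible {r} {t} r≈ t² μ∈ = 9-5φ-nonsquare golden (degree-2-span golden (degree-2 list) φ∈ t∈) t²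
      where
      μ : K
      μ = ι ½ * r
      2∈ : Generated Ω (Eigenvalue L) (ι 2ℚ)
      2∈ = resp (≈-sym ι-double) (+∈ 1∈ 1∈)
      key : (μ - ι 2ℚ) * (μ - φ) ≈ 1#
      key = begin
        (μ - ι 2ℚ) * (μ - φ)
          ≈⟨ solve 2 (λ f r → (con ½ :* r :- con 2ℚ) :* (con ½ :* r :- f) := con ¼ :*
          ((r :- (con 2ℚ :+ f)) :* (r :- (con 2ℚ :+ f)) :- (con 4ℚ :- con 4ℚ :* f :+ f :* f))) ≈-refl φ r ⟩
        ι ¼ * ((r - (ι 2ℚ + φ)) * (r - (ι 2ℚ + φ)) - (ι 4ℚ - ι 4ℚ * φ + φ * φ))
          ≈⟨ *-congˡ (+-cong (≈-trans (*-cong r≈ r≈) t²) (-‿cong (+-congˡ (golden² golden)))) ⟩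
        ι ¼ * ((ι 9ℚ + ι -5ℚ * φ) - (ι 4ℚ - ι 4ℚ * φ + (1# - φ)))
          ≈⟨ solve 1 (λ f → con ¼ :* ((con 9ℚ :+ con -5ℚ :* f) :- (con 4ℚ :- con 4ℚ :* f :+ (con 1ℚ :- f)))
          := con 1ℚ) ≈-refl φ ⟩
        1#                                                     ∎
      φ∈ : Generated Ω (Eigenvalue L) φ
      φ∈ = resp (solve 2 (λ m f → m :+ :- (m :- f) := f) ≈-refl μ φ)
        (+∈ (gen μ∈) (-∈ (⁻¹∈ key (+∈ (gen μ∈) (-∈ 2∈)))))
      t∈ : Generated Ω (Eigenvalue L) t
      t∈ = resp (≈-trans (solve 2 (λ f r → con 2ℚ :* (con ½ :* r) :+ :- (con 2ℚ :+ f) := r :-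
        (con 2ℚ :+ f)) ≈-refl φ r) r≈)
        (+∈ (*∈ 2∈ (gen μ∈)) (-∈ (+∈ 2∈ φ∈)))
    move : ∀ g → a ∙ (u ∙ g) ≡ u′ ∙ (a ∙ g)
    move g = sym (trans (free (♯₀ ⊙ ♯₁ ⊙ ♯₀ ⊙ (♯₀ ⊙ ♯₂)) (♯₀ ⊙ ♯₁ ⊙ (♯₀ ⊙ ♯₀) ⊙ ♯₂) (a ∷ u ∷ g ∷ []) refl)
      (trans (cong (λ z → a ∙ u ∙ z ∙ g) a²) (trans (cong (_∙ g) (identityʳ _)) (assoc a u g))))
    move⁻¹ : ∀ g → a ∙ (u ⁻¹ ∙ g) ≡ u′ ⁻¹ ∙ (a ∙ g)
    move⁻¹ g = ∙-cancelˡ u′ _ _ (trans (sym (move (u ⁻¹ ∙ g)))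
      (trans (cong (a ∙_) (cancelˡ u g)) (sym (cancelˡ u′ (a ∙ g)))))
    Af : ∀ g → Act L f g ≈ ι 2ℚ * f g + f (a ∙ g)
    Af g = ≈-trans (+-cong (f-x g) (+-congʳ (f-x⁻¹ g)))
      (solve 2 (λ x y → x :+ (x :+ (y :+ con 0ℚ)) := con 2ℚ :* x :+ y) ≈-refl (f g) (f (a ∙ g)))
    quadratic : Quadratic L p q f
    quadratic g = begin
      Act L (Act L f) g
        ≈⟨ +-cong (Af (u ∙ g)) (+-cong (Af (u ⁻¹ ∙ g)) (+-congʳ (Af (a ∙ g)))) ⟩
      (ι 2ℚ * f (u ∙ g) + f (a ∙ (u ∙ g))) + ((ι 2ℚ * f (u ⁻¹ ∙ g) + f (a ∙ (u ⁻¹ ∙ g))) +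
        ((ι 2ℚ * f (a ∙ g) + f (a ∙ (a ∙ g))) + 0#))
        ≈⟨ +-cong (+-cong (*-congˡ (f-x g)) (reflexive (cong f (move g))))
          (+-cong (+-cong (*-congˡ (f-x⁻¹ g)) (reflexive (cong f (move⁻¹ g))))
             (+-congʳ (+-congˡ (reflexive (cong f
               (trans (sym (assoc a a g)) (trans (cong (_∙ g) a²) (identityˡ g)))))))) ⟩
      (ι 2ℚ * f g + f (u′ ∙ (a ∙ g))) + ((ι 2ℚ * f g + f (u′ ⁻¹ ∙ (a ∙ g))) + ((ι 2ℚ * f (a ∙ g) + f g) + 0#))
        ≈⟨ solve 4 (λ x y z w → (con 2ℚ :* x :+ z) :+
          ((con 2ℚ :* x :+ w) :+ ((con 2ℚ :* y :+ x) :+ con 0ℚ)) := con 5ℚ :* x :+ con 2ℚ :* y :+ (z :+ w))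
          ≈-refl (f g) (f (a ∙ g)) (f (u′ ∙ (a ∙ g))) (f (u′ ⁻¹ ∙ (a ∙ g))) ⟩
      ι 5ℚ * f g + ι 2ℚ * f (a ∙ g) + (f (u′ ∙ (a ∙ g)) + f (u′ ⁻¹ ∙ (a ∙ g)))
        ≈⟨ +-congˡ (f-y (a ∙ g)) ⟩
      ι 5ℚ * f g + ι 2ℚ * f (a ∙ g) + φ * f (a ∙ g)
        ≈⟨ solve 3 (λ f x y → con 5ℚ :* x :+ con 2ℚ :* y :+ f :* y := (con 2ℚ :+ f) :* (con 2ℚ :* x :+ y)
          :- (con 2ℚ :* f :- con 1ℚ) :* x) ≈-refl φ (f g) (f (a ∙ g)) ⟩
      (ι 2ℚ + φ) * (ι 2ℚ * f g + f (a ∙ g)) - (ι 2ℚ * φ - 1#) * f g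
        ≈⟨ +-cong (*-cong (solve 2 (λ f s → con ½ :* (con 2ℚ :+ f :+ s) :+ con ½ :* (con 2ℚ :+ f :- s)
          := con 2ℚ :+ f) ≈-refl φ s) (Af g)) (-‿cong (*-congʳ pq)) ⟨
      (p + q) * Act L f g - p * q * f g ∎

  restricted : Restricted G
  restricted = record
    { exponent-10       = exponent-10
    ; involution-unique = commuting-involutions
    ; no-mixed-plane    = no-mixed-plane
    ; no-inverted-plane = no-inverted-plane
    }

-- An eigenvalue of a Cayley graph in terms of an eigenvalue c of y + y⁻¹:
-- c + k or −(c + k).
data Form : Set where
  plus minus : ℚ → Form

-- Spectra by means of y + y⁻¹

module Backward {c ℓ₁ ℓ₂ : Level} (Ω : AlgebraicallyClosedField c ℓ₁ ℓ₂) (G : FinGroup) where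
  open Field Ω
  open FinGroup G
  open GroupLemmas G
  open Powers G
  open Eigen Ω G

  degree-transport : ∀ {p q} {X : Pred K p} {Y : Pred K q} → (∀ {x} → X x → Y x) → (∀ {x} → Y x → X x) →
    HasDegree Ω (Generated Ω X) 2 → HasDegree Ω (Generated Ω Y) 2
  degree-transport {X = X} {Y} X⊆Y Y⊆X deg = record
    { basis       = basis
    ; basis∈F     = λ i → monotone X⊆Y (basis∈F i)
    ; spanning    = λ y∈ → spanning (monotone Y⊆X y∈)
    ; independent = independent
    }
    where
    open HasDegree deg
    monotone : ∀ {p q} {X : Pred K p} {Y : Pred K q} → (∀ {x} → X x → Y x) → ∀ {x} → Generated Ω X x →
      Generated Ω Y x
    monotone X⊆Y (gen x∈)      = gen (X⊆Y x∈)
    monotone X⊆Y (resp eq x∈)  = resp eq (monotone X⊆Y x∈)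
    monotone X⊆Y 0∈            = 0∈
    monotone X⊆Y 1∈            = 1∈
    monotone X⊆Y (+∈ x∈ y∈)    = +∈ (monotone X⊆Y x∈) (monotone X⊆Y y∈)
    monotone X⊆Y (-∈ x∈)       = -∈ (monotone X⊆Y x∈)
    monotone X⊆Y (*∈ x∈ y∈)    = *∈ (monotone X⊆Y x∈) (monotone X⊆Y y∈)
    monotone X⊆Y (⁻¹∈ xy≈1 x∈) = ⁻¹∈ xy≈1 (monotone X⊆Y x∈)

  value : Form → K → K
  value (plus k)  x = x + ι k
  value (minus k) x = - (x + ι k)

  -- To recover φ from an eigenvalue, k has to lie in every generated field. These three values do
  -- so visibly and cover all forms that occur.
  Small : Form → Set
  Small (plus k)  = k ≡ 0ℚ ⊎ k ≡ 1ℚ ⊎ k ≡ -1ℚ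
  Small (minus k) = k ≡ 0ℚ ⊎ k ≡ 1ℚ ⊎ k ≡ -1ℚ

  value-span : ∀ {φ} f → InSpan φ (value f φ)
  value-span {φ} (plus k) =
    span k 1ℚ (≈-trans (+-comm φ (ι k)) (+-congˡ (≈-trans (≈-sym (*-identityˡ φ)) (*-congʳ (≈-sym ι-1)))))
  value-span {φ} (minus k) =
    span (ℚ.- k) -1ℚ (≈-trans (solve 2 (λ x k → :- (x :+ k) := :- k :+ :- con 1ℚ :* x) ≈-refl φ (ι k))
    (≈-sym (+-cong (ι-- k) (*-congʳ (≈-trans (ι-- 1ℚ) (-‿cong ι-1))))))

  value-conjugate : ∀ {φ} f → InSpan φ (value f (conjugate φ))
  value-conjugate {φ} (plus k) = span (k ℚ.- 1ℚ) -1ℚ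
    (≈-trans (solve 2 (λ x k → (:- con 1ℚ :- x) :+ k := k :- con 1ℚ :+ :- con 1ℚ :* x) ≈-refl φ (ι k))
    (≈-sym (+-cong (≈-trans (ι-+ k _) (+-congˡ (≈-trans (ι-- 1ℚ) (-‿cong ι-1))))
      (*-congʳ (≈-trans (ι-- 1ℚ) (-‿cong ι-1))))))
  value-conjugate {φ} (minus k) = span (1ℚ ℚ.- k) 1ℚ
    (≈-trans (solve 2 (λ x k → :- ((:- con 1ℚ :- x) :+ k) := con 1ℚ :- k :+ con 1ℚ :* x) ≈-refl φ (ι k))
    (≈-sym (+-cong (≈-trans (ι-+ 1ℚ _) (+-cong ι-1 (ι-- k))) (*-congʳ ι-1))))

  small-∈ : ∀ {p} {X : Pred K p} {k} → k ≡ 0ℚ ⊎ k ≡ 1ℚ ⊎ k ≡ -1ℚ → Generated Ω X (ι k)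
  small-∈ (inj₁ refl)        = resp (≈-sym ι-0) 0∈
  small-∈ (inj₂ (inj₁ refl)) = resp (≈-sym ι-1) 1∈
  small-∈ (inj₂ (inj₂ refl)) = resp (≈-sym (≈-trans (ι-- 1ℚ) (-‿cong ι-1))) (-∈ 1∈)

  recover : ∀ {p} {X : Pred K p} {φ} f → Small f → Generated Ω X (value f φ) → Generated Ω X φ
  recover {φ = φ} (plus k) small v∈ =
    resp (solve 2 (λ x k → x :+ k :+ :- k := x) ≈-refl φ (ι k)) (+∈ v∈ (-∈ (small-∈ small)))
  recover {φ = φ} (minus k) small v∈ =
    resp (solve 2 (λ x k → :- :- (x :+ k) :+ :- k := x) ≈-refl φ (ι k)) (+∈ (-∈ v∈) (-∈ (small-∈ small)))

  -- An s that centralizes or inverts y need not commute with y, but does commute with y + y⁻¹.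
  -- Hence so does A.
  Compatible : El → List El → Set
  Compatible y L = All (λ s → y ∙ s ≡ s ∙ y ⊎ y ∙ s ≡ s ∙ y ⁻¹) L

  CEigen : El → K → Function → Set ℓ₁
  CEigen y x w = ∀ g → C y w g ≈ x * w g

  -- A certificate of 2-integrality. Uniformity of `quadratic` in the root x serves φ and its
  -- conjugate at once; `p₂` and `q₂` take care of the eigenvalue 2 of C, where the eigenvalues of A
  -- are rational.
  record Spectral (L : List El) (y : El) : Set (c ⊔ ℓ₁ ⊔ ℓ₂) where
    field
      y≢ε        : y ≢ ε
      y⁵         : y ** 5 ≡ ε
      compatible : Compatible y L
      p q        : Form
      p-small    : Small p
      q-small    : Small q
      p#q        : ∀ {x} → Golden x → value p x # value q x
      quadratic  : ∀ {x w} → Golden x → CEigen y x w → Quadratic L (value p x) (value q x) w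
      p₂ q₂      : ℚ
      p₂≢q₂      : p₂ ≢ q₂
      quadratic₂ : ∀ {w} → CEigen y (ι 2ℚ) w → Quadratic L (ι p₂) (ι q₂) w

  commute-⁻¹ : ∀ {y s} → y ∙ s ≡ s ∙ y → y ⁻¹ ∙ s ≡ s ∙ y ⁻¹
  commute-⁻¹ {y} {s} ys = trans (free (inv ♯₀ ⊙ ♯₁) (inv ♯₀ ⊙ (♯₁ ⊙ ♯₀) ⊙ inv ♯₀) (y ∷ s ∷ []) refl)
    (trans (cong (λ z → y ⁻¹ ∙ z ∙ y ⁻¹) (sym ys))
      (free (inv ♯₀ ⊙ (♯₀ ⊙ ♯₁) ⊙ inv ♯₀) (♯₁ ⊙ inv ♯₀) (y ∷ s ∷ []) refl))

  invert-⁻¹ : ∀ {y s} → y ∙ s ≡ s ∙ y ⁻¹ → y ⁻¹ ∙ s ≡ s ∙ y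
  invert-⁻¹ {y} {s} ys = trans (free (inv ♯₀ ⊙ ♯₁) (inv ♯₀ ⊙ (♯₁ ⊙ inv ♯₀) ⊙ ♯₀) (y ∷ s ∷ []) refl)
    (trans (cong (λ z → y ⁻¹ ∙ z ∙ y) (sym ys)) (free (inv ♯₀ ⊙ (♯₀ ⊙ ♯₁) ⊙ ♯₀) (♯₁ ⊙ ♯₀) (y ∷ s ∷ []) refl))

  Act-C : ∀ {y} L → Compatible y L → ∀ w g → Act L (C y w) g ≈ C y (Act L w) g
  Act-C     []      []           w g = ≈-sym (+-identityˡ 0#)
  Act-C {y} (s ∷ L) (ys ∷ compat) w g = ≈-trans (+-cong (here-case ys) (Act-C L compat w g))
    (solve 4 (λ a b c d → (a :+ b) :+ (c :+ d) := (a :+ c) :+ (b :+ d)) ≈-refl (w (s ∙ (y ∙ g)))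
      (w (s ∙ (y ⁻¹ ∙ g))) (Act L w (y ∙ g)) (Act L w (y ⁻¹ ∙ g)))
    where
    slide : ∀ {u v} → u ∙ s ≡ s ∙ v → u ∙ (s ∙ g) ≡ s ∙ (v ∙ g)
    slide {u} {v} eq = trans (sym (assoc u s g)) (trans (cong (_∙ g) eq) (assoc s v g))
    here-case : y ∙ s ≡ s ∙ y ⊎ y ∙ s ≡ s ∙ y ⁻¹ → C y w (s ∙ g) ≈ w (s ∙ (y ∙ g)) + w (s ∙ (y ⁻¹ ∙ g))
    here-case (inj₁ eq) = reflexive (cong₂ (λ h k → w h + w k) (slide eq) (slide (commute-⁻¹ eq)))
    here-case (inj₂ eq) =
      ≈-trans (reflexive (cong₂ (λ h k → w h + w k) (slide eq) (slide (invert-⁻¹ eq)))) (+-comm _ _)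

  C-cong : ∀ y {v w} → (∀ g → v g ≈ w g) → ∀ g → C y v g ≈ C y w g
  C-cong y eq g = +-cong (eq (y ∙ g)) (eq (y ⁻¹ ∙ g))

  C² : ∀ y w g → C y (C y w) g ≈ (w (y ∙ (y ∙ g)) + w (y ⁻¹ ∙ (y ⁻¹ ∙ g))) + (w g + w g)
  C² y w g = ≈-trans (reflexive (cong₂ (λ h k → (w (y ∙ (y ∙ g)) + w h) + (w k + w (y ⁻¹ ∙ (y ⁻¹ ∙ g))))
    (cancelʳ y g) (cancelˡ y g)))
    (solve 3 (λ a b c → (a :+ c) :+ (c :+ b) := (a :+ b) :+ (c :+ c)) ≈-refl (w (y ∙ (y ∙ g)))
      (w (y ⁻¹ ∙ (y ⁻¹ ∙ g))) (w g))

  -- Quadratic polynomials in C map eigenfunctions to eigenfunctions.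
  polynomial : K → K → K → El → Function → Function
  polynomial α β γ y w g = α * C y (C y w) g + (β * C y w g + γ * w g)

  polynomial-eigen : ∀ {α β γ y μ w} L → Compatible y L → IsEigenfunction L μ w → IsEigenfunction L μ
    (polynomial α β γ y w)
  polynomial-eigen {α} {β} {γ} {y} {μ} {w} L compat eig g = begin
    Act L (polynomial α β γ y w) g
      ≈⟨ Act-cong L (λ h → +-congˡ (≈-sym (*-identityˡ _))) g ⟩
    Act L (λ h → α * C y (C y w) h + 1# * (β * C y w h + γ * w h)) g
      ≈⟨ ≈-trans (Act-linear L α 1# (C y (C y w)) (λ h → β * C y w h + γ * w h) g)
        (+-congˡ (*-congˡ (Act-linear L β γ (C y w) w g))) ⟩
    α * Act L (C y (C y w)) g + 1# * (β * Act L (C y w) g + γ * Act L w g)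
      ≈⟨ +-cong (*-congˡ (≈-trans (Act-C L compat (C y w) g) (C-cong y (λ h → eigC h) g)))
        (*-congˡ (+-cong (*-congˡ (eigC g)) (*-congˡ (eig g)))) ⟩
    α * C y (λ h → μ * C y w h) g + 1# * (β * (μ * C y w g) + γ * (μ * w g))
      ≈⟨ solve 8 (λ a b c m x₁ x₂ y z → a :* (m :* x₁ :+ m :* x₂) :+ con 1ℚ :*
        (b :* (m :* y) :+ c :* (m :* z)) := m :* (a :* (x₁ :+ x₂) :+ (b :* y :+ c :* z))) ≈-refl
           α β γ μ (C y w (y ∙ g)) (C y w (y ⁻¹ ∙ g)) (C y w g) (w g) ⟩
    μ * polynomial α β γ y w g ∎
    where
    open ≈-Reasoning
    eigC : ∀ h → Act L (C y w) h ≈ μ * C y w h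
    eigC h = ≈-trans (Act-C L compat w h) (≈-trans (+-cong (eig (y ∙ h)) (eig (y ⁻¹ ∙ h)))
      (≈-sym (distribˡ μ _ _)))

  -- The sum over ⟨y⟩, and as a polynomial in C the product (C - φ)(C - φ′) = C² + C - 1.
  average : El → Function → Function
  average y w g = (w (y ∙ (y ∙ g)) + w (y ⁻¹ ∙ (y ⁻¹ ∙ g))) + C y w g + w g

  average-C : ∀ {y} → y ** 5 ≡ ε → ∀ w → CEigen y (ι 2ℚ) (average y w)
  average-C {y} y⁵ w g = ≈-trans
    (reflexive (cong₂ _+_
      (cong₂ (λ s t → s + t + w (y ∙ g)) (cong₂ (λ h k → w h + w k) (fifth-power-shift y⁵ g)
        (cong (y ⁻¹ ∙_) (cancelʳ y g))) (cong (λ h → w (y ∙ (y ∙ g)) + w h) (cancelʳ y g)))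
      (cong₂ (λ s t → s + t + w (y ⁻¹ ∙ g)) (cong₂ (λ h k → w h + w k) (cong (y ∙_) (cancelˡ y g))
        (fifth-power-shift⁻¹ y⁵ g)) (cong (λ h → w h + w (y ⁻¹ ∙ (y ⁻¹ ∙ g))) (cancelˡ y g)))))
    (solve 5 (λ a b c d e → ((d :+ e) :+ (c :+ a) :+ b) :+ ((b :+ c) :+ (a :+ d) :+ e) := con 2ℚ :*
      ((c :+ d) :+ (b :+ e) :+ a)) ≈-refl
      (w g) (w (y ∙ g)) (w (y ∙ (y ∙ g))) (w (y ⁻¹ ∙ (y ⁻¹ ∙ g))) (w (y ⁻¹ ∙ g)))

  average-eigen : ∀ {y μ w} L → Compatible y L → IsEigenfunction L μ w → IsEigenfunction L μ (average y w)
  average-eigen {y} {μ} {w} L compat eig g =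
    ≈-trans (Act-cong L same g) (≈-trans (polynomial-eigen L compat eig g) (*-congˡ (≈-sym (same g))))
    where
    same : ∀ h → average y w h ≈ polynomial 1# 1# (- 1#) y w h
    same h = ≈-trans (solve 3 (λ s t a → s :+ t :+ a := con 1ℚ :* (s :+ (a :+ a)) :+
      (con 1ℚ :* t :+ :- con 1ℚ :* a)) ≈-refl
        (w (y ∙ (y ∙ h)) + w (y ⁻¹ ∙ (y ⁻¹ ∙ h))) (C y w h) (w h)) (+-congʳ (*-congˡ (≈-sym (C² y w h))))

  project-eigen : ∀ {φ y μ w} L → Compatible y L → IsEigenfunction L μ w → IsEigenfunction L μ (project φ y w)
  project-eigen {φ} {y} {μ} {w} L compat eig g =
    ≈-trans (Act-cong L same g) (≈-trans (polynomial-eigen L compat eig g) (*-congˡ (≈-sym (same g))))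
    where
    same : ∀ h → project φ y w h ≈ polynomial 1# (- (1# - φ)) (- (φ + φ) - (1# + 1#)) y w h
    same h = ≈-trans (solve 4 (λ f s t a → s :- (con 1ℚ :- f) :* t :- (f :+ f) :* a := con 1ℚ :*
      (s :+ (a :+ a)) :+ (:- (con 1ℚ :- f) :* t :+ (:- (f :+ f) :- (con 1ℚ :+ con 1ℚ)) :* a)) ≈-refl
        φ (w (y ∙ (y ∙ h)) + w (y ⁻¹ ∙ (y ⁻¹ ∙ h))) (C y w h) (w h)) (+-congʳ (*-congˡ (≈-sym (C² y w h))))

  -- Lagrange interpolation at 2, φ and φ′, multiplied by 5: the weights are 5/((2 - φ)(2 - φ′)) = 1
  -- and 5/((φ - 2)(φ - φ′)) = -1/φ = φ′, together with the conjugate of the latter.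
  decomposition : ∀ {φ} → Golden φ → ∀ y w g →
    ι 5ℚ * w g ≈ average y w g + (conjugate φ * project φ y w g + φ * project (conjugate φ) y w g)
  decomposition {φ} golden y w g = ≈-sym (begin
    average y w g + (conjugate φ * project φ y w g + φ * project (conjugate φ) y w g)
      ≈⟨ solve 4 (λ f s t a → let f′ = :- con 1ℚ :- f in
           s :+ t :+ a :+ (f′ :* (s :- (con 1ℚ :- f) :* t :- (f :+ f) :* a) :+ f :*
             (s :- (con 1ℚ :- f′) :* t :- (f′ :+ f′) :* a))
           := (con 2ℚ :- con 2ℚ :* (f :* f :+ f)) :* t :+ (con 1ℚ :+ con 4ℚ :* (f :* f :+ f)) :* a)
             ≈-refl φ (w (y ∙ (y ∙ g)) + w (y ⁻¹ ∙ (y ⁻¹ ∙ g))) (C y w g) (w g) ⟩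
    (ι 2ℚ - ι 2ℚ * (φ * φ + φ)) * C y w g + (1# + ι 4ℚ * (φ * φ + φ)) * w g
      ≈⟨ +-cong (*-congʳ (+-congˡ (-‿cong (*-congˡ golden)))) (*-congʳ (+-congˡ (*-congˡ golden))) ⟩
    (ι 2ℚ - ι 2ℚ * 1#) * C y w g + (1# + ι 4ℚ * 1#) * w g
      ≈⟨ solve 2 (λ t a → (con 2ℚ :- con 2ℚ :* con 1ℚ) :* t :+ (con 1ℚ :+ con 4ℚ :* con 1ℚ) :* a
        := con 5ℚ :* a) ≈-refl (C y w g) (w g) ⟩
    ι 5ℚ * w g ∎)
    where open ≈-Reasoning

  -- An eigenfunction has a nonzero component in some eigenspace of C, where the quadratic equation
  -- puts its eigenvalue into ℚ + ℚφ. That φ is attained follows from the projection of the delta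
  -- function, whose value at the identity is -2φ: one of the two forms at φ is an eigenvalue.
  spectral⇒degree-2 : ∀ {L y} → Spectral L y → HasDegree Ω (Generated Ω (Eigenvalue L)) 2
  spectral⇒degree-2 {L} {y} spectral = golden-degree golden (λ μ∈ → spans μ∈) φ∈
    where
    open Spectral spectral
    φ : K
    φ = proj₁ golden-exists
    golden : Golden φ
    golden = proj₂ golden-exists
    φ̄ : K
    φ̄ = conjugate φ
    golden̄ : Golden φ̄
    golden̄ = golden-conjugate golden
    rational-span : ∀ k → InSpan φ (ι k)
    rational-span k = span k 0ℚ (≈-trans (solve 2 (λ k x → k := k :+ con 0ℚ :* x) ≈-refl (ι k) φ)
      (+-congˡ (*-congʳ (≈-sym ι-0))))
    spans : ∀ {μ} → Eigenvalue L μ → InSpan φ μ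
    spans {μ} (w , (g , w#0) , eig) =
      split (+-split-# (#-congʳ (decomposition golden y w g) (x#0y#0→xy#0 (ι-#0 {5ℚ} λ ()) w#0)))
      where
      split : average y w g # 0# ⊎ conjugate φ * project φ y w g + φ * project (conjugate φ) y w g # 0# →
        InSpan φ μ
      split (inj₁ nz) = [ (λ eq → span-resp (≈-sym eq) (rational-span p₂)) ,
        (λ eq → span-resp (≈-sym eq) (rational-span q₂)) ]′
        (quadratic⇒root L ι-p#q (g , nz) (average-eigen L compatible eig) (quadratic₂ (average-C y⁵ w)))
        where
        ι-p#q : ι p₂ # ι q₂
        ι-p#q = -#0⇒# (#-congʳ (≈-trans (ι-+ p₂ _) (+-congˡ (ι-- q₂))) (ι-#0 λ eq → p₂≢q₂ (ι-injective (-≈0⇒≈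
          (≈-trans (+-congˡ (≈-sym (ι-- q₂))) (≈-trans (≈-sym (ι-+ p₂ _)) (≈-trans (ι-cong eq) ι-0)))))))
      split (inj₂ nz) = split′ (+-split-# nz)
        where
        split′ : conjugate φ * project φ y w g # 0# ⊎ φ * project (conjugate φ) y w g # 0# → InSpan φ μ
        split′ (inj₁ nz) =
          [ (λ eq → span-resp (≈-sym eq) (value-span p)) , (λ eq → span-resp (≈-sym eq) (value-span q)) ]′
          (quadratic⇒root L (p#q golden) (g , *-factorʳ-# nz) (project-eigen L compatible eig)
            (quadratic golden (project-C golden y⁵ w)))
        split′ (inj₂ nz) = [ (λ eq → span-resp (≈-sym eq) (value-conjugate p)) ,
          (λ eq → span-resp (≈-sym eq) (value-conjugate q)) ]′
          (quadratic⇒root L (p#q golden̄) (g , *-factorʳ-# nz) (project-eigen L compatible eig)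
            (quadratic golden̄ (project-C golden̄ y⁵ w)))
    y²≢ε : y ∙ y ≢ ε
    y²≢ε y² = y≢ε (order-2-and-5 y² y⁵)
    y⁻¹≢ε : y ⁻¹ ≢ ε
    y⁻¹≢ε eq = y≢ε (trans (sym (⁻¹-involutive y)) (trans (cong _⁻¹ eq) ε⁻¹≈ε))
    seed : Nonzero (project φ y δ)
    seed = ε , #-congʳ (≈-sym (≈-trans (+-cong (+-cong
          (+-cong (δ-zero λ eq → y²≢ε (trans (cong (y ∙_) (sym (identityʳ y))) eq))
                  (δ-zero λ eq → y²≢ε (trans (sym (⁻¹-involutive (y ∙ y)))
                    (trans (cong _⁻¹ (trans (free (inv (♯₀ ⊙ ♯₀)) (inv ♯₀ ⊙ (inv ♯₀ ⊙ 𝟏)) (y ∷ []) refl)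
                    eq)) ε⁻¹≈ε))))
          (-‿cong (*-congˡ (+-cong (δ-zero λ eq → y≢ε (trans (sym (identityʳ y)) eq))
            (δ-zero λ eq → y⁻¹≢ε (trans (sym (identityʳ _)) eq))))))
          (-‿cong (*-congˡ (δ-one refl))))
        (solve 1 (λ f → (con 0ℚ :+ con 0ℚ) :- (con 1ℚ :- f) :* (con 0ℚ :+ con 0ℚ) :- (f :+ f) :* con 1ℚ
          := :- con 1ℚ :* (f :+ f)) ≈-refl φ)))
      (x#0y#0→xy#0 (invertible⇒#0 (solve 0 (:- con 1ℚ :* :- con 1ℚ := con 1ℚ) ≈-refl))
        (two-# (golden-#0 golden)))
    φ∈ : Generated Ω (Eigenvalue L) φ
    φ∈ = [ (λ ev → recover p p-small (gen ev)) , (λ ev → recover q q-small (gen ev)) ]′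
      (quadratic⇒eigenvalue L (p#q golden) seed (quadratic golden (project-C golden y⁵ δ)))

  quadratic-from : ∀ L {p q w} σ π → (∀ g → Act L (Act L w) g ≈ σ * Act L w g - π * w g) → p + q ≈ σ →
    p * q ≈ π → Quadratic L p q w
  quadratic-from L σ π eq p+q pq g = ≈-trans (eq g) (≈-sym (+-cong (*-congʳ p+q) (-‿cong (*-congʳ pq))))

  apart : ∀ {x y d} → x - y ≈ d → d # 0# → x # y
  apart eq d#0 = -#0⇒# (#-congʳ (≈-sym eq) d#0)

  golden+1-#0 : ∀ {x} → Golden x → x + 1# # 0#
  golden+1-#0 {x} golden = *-factorʳ-# (#-congʳ (≈-sym
    (≈-trans (solve 1 (λ x → x :* (x :+ con 1ℚ) := x :* x :+ x) ≈-refl x) golden)) 1#0)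

  value-plus-0 : ∀ x → value (plus 0ℚ) x ≈ x
  value-plus-0 x = ≈-trans (+-congˡ ι-0) (+-identityʳ x)

  value-plus-1 : ∀ x → value (plus 1ℚ) x ≈ x + 1#
  value-plus-1 x = +-congˡ ι-1

  value-plus--1 : ∀ x → value (plus -1ℚ) x ≈ x - 1#
  value-plus--1 x = +-congˡ (≈-trans (ι-- 1ℚ) (-‿cong ι-1))

  ±-apart : ∀ {a b x} → a ≈ x → b ≈ - x → x # 0# → a # b
  ±-apart {x = x} a≈x b≈-x x#0 =
    apart (≈-trans (+-cong a≈x (-‿cong b≈-x)) (solve 1 (λ x → x :- :- x := x :+ x) ≈-refl x)) (two-# x#0)

  ±-quadratic : ∀ L {w a b x d} → a ≈ x → b ≈ - x → x * x ≈ d → (∀ g → Act L (Act L w) g ≈ d * w g) →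
    Quadratic L a b w
  ±-quadratic L {w} {a} {b} {x} {d} a≈x b≈-x x² A² = quadratic-from L 0# (- d)
    (λ g → ≈-trans (A² g) (solve 3 (λ d y z → d :* y := con 0ℚ :* z :- :- d :* y) ≈-refl d (w g) (Act L w g)))
    (≈-trans (+-cong a≈x b≈-x) (-‿inverseʳ x)) (≈-trans (*-cong a≈x b≈-x)
      (≈-trans (solve 1 (λ x → x :* :- x := :- (x :* x)) ≈-refl x) (-‿cong x²)))

  golden+1² : ∀ {x} → Golden x → (x + 1#) * (x + 1#) ≈ ι 2ℚ + x
  golden+1² {x} golden =
    ≈-trans (solve 1 (λ x → (x :+ con 1ℚ) :* (x :+ con 1ℚ) := (x :* x :+ x) :+ con 1ℚ :+ x) ≈-refl x)
    (≈-trans (+-congʳ (+-congʳ golden)) (solve 1 (λ x → con 1ℚ :+ con 1ℚ :+ x := con 2ℚ :+ x) ≈-refl x))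

  pair-spectral : ∀ {x} → x ≢ ε → x ** 5 ≡ ε → Spectral (x ∷ x ⁻¹ ∷ []) x
  pair-spectral {x} x≢ε x⁵ = record
    { y≢ε = x≢ε ; y⁵ = x⁵ ; compatible = inj₁ refl ∷ inj₁ (trans (inverseʳ x) (sym (inverseˡ x))) ∷ []
    -- Here A is C itself and p alone is a root of its equation; q is a placeholder apart from p,
    -- and likewise 3 next to 2 below.
    ; p = plus 0ℚ ; q = plus 1ℚ ; p-small = inj₁ refl ; q-small = inj₂ (inj₁ refl)
    ; p#q = λ {c} _ → apart (≈-trans (+-cong (value-plus-0 c) (-‿cong (value-plus-1 c)))
      (solve 1 (λ c → c :- (c :+ con 1ℚ) := :- con 1ℚ) ≈-refl c)) -1#0
    ; quadratic = λ {c} {w} _ eig → linear {c} {w} (value-plus-0 c) eig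
    ; p₂ = 2ℚ ; q₂ = 3ℚ ; p₂≢q₂ = λ ()
    ; quadratic₂ = λ {w} eig → linear {ι 2ℚ} {w} ≈-refl eig
    }
    where
    -1#0 : - 1# # 0#
    -1#0 = invertible⇒#0 (solve 0 (:- con 1ℚ :* :- con 1ℚ := con 1ℚ) ≈-refl)
    L = x ∷ x ⁻¹ ∷ []
    linear : ∀ {c w p q} → p ≈ c → CEigen x c w → Quadratic L p q w
    linear {c} {w} {p} {q} p≈c eig = quadratic-from L (c + q) (c * q) (λ g → begin
        Act L (Act L w) g                       ≈⟨ Act² L {c} {w} A g ⟩
        c * (c * w g)
          ≈⟨ solve 3 (λ c q x → c :* (c :* x) := (c :+ q) :* (c :* x) :- c :* q :* x) ≈-refl c q (w g) ⟩
        (c + q) * (c * w g) - c * q * w g       ≈⟨ +-congʳ (*-congˡ (A g)) ⟨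
        (c + q) * Act L w g - c * q * w g       ∎) (+-congʳ p≈c) (*-congʳ p≈c)
      where
      open ≈-Reasoning
      A : ∀ g → Act L w g ≈ c * w g
      A g = ≈-trans (+-congˡ (+-identityʳ _)) (eig g)

  -- A = Ce with e central and e² = 1, so that A² = c² where C acts as c.
  twisted-pair-spectral : ∀ {y e} → y ≢ ε → y ** 5 ≡ ε → e ∙ e ≡ ε → (∀ g → e ∙ g ≡ g ∙ e) → Spectral
    (y ∙ e ∷ (y ∙ e) ⁻¹ ∷ []) y
  twisted-pair-spectral {y} {e} y≢ε y⁵ e² central = record
    { y≢ε = y≢ε ; y⁵ = y⁵ ; compatible = inj₁ ye ∷ inj₁ (sym (commute-⁻¹ (sym ye))) ∷ []
    ; p = plus 0ℚ ; q = minus 0ℚ ; p-small = inj₁ refl ; q-small = inj₁ refl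
    ; p#q = λ {c} golden → ±-apart (value-plus-0 c) (-‿cong (value-plus-0 c)) (golden-#0 golden)
    ; quadratic = λ {c} _ eig → ±-quadratic L (value-plus-0 c) (-‿cong (value-plus-0 c)) ≈-refl (square eig)
    ; p₂ = 2ℚ ; q₂ = -2ℚ ; p₂≢q₂ = λ ()
    ; quadratic₂ = λ eig → ±-quadratic L ≈-refl (ι-- 2ℚ) ≈-refl (square eig)
    }
    where
    L = y ∙ e ∷ (y ∙ e) ⁻¹ ∷ []
    ye : y ∙ (y ∙ e) ≡ y ∙ e ∙ y
    ye = trans (cong (y ∙_) (sym (central y))) (sym (assoc y e y))
    A : ∀ {c w} → CEigen y c w → ∀ g → Act L w g ≈ c * w (e ∙ g)
    A {c} {w} eig g = ≈-trans (reflexive (cong₂ (λ h k → w h + (w k + 0#)) (assoc y e g)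
        (trans (cong (_∙ g) (trans (⁻¹-anti-homo-∙ y e)
          (trans (cong (_∙ y ⁻¹) (involution-⁻¹ e²)) (central (y ⁻¹))))) (assoc (y ⁻¹) e g))))
      (≈-trans (+-congˡ (+-identityʳ _)) (eig (e ∙ g)))
    square : ∀ {c w} → CEigen y c w → ∀ g → Act L (Act L w) g ≈ c * c * w g
    square {c} {w} eig g = begin
      Act L (Act L w) g                ≈⟨ Act-cong L (A eig) g ⟩
      Act L (λ h → c * w (e ∙ h)) g    ≈⟨ Act-scale L c (λ h → w (e ∙ h)) g ⟩
      c * Act L (λ h → w (e ∙ h)) g
        ≈⟨ *-congˡ (A (λ h → ≈-trans (reflexive (cong₂ (λ s t → w s + w t) (slide y h) (slide (y ⁻¹) h)))
        (eig (e ∙ h))) g) ⟩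
      c * (c * w (e ∙ (e ∙ g)))
        ≈⟨ *-congˡ (*-congˡ (reflexive (cong w (trans (sym (assoc e e g))
        (trans (cong (_∙ g) e²) (identityˡ g)))))) ⟩
      c * (c * w g)                    ≈⟨ *-assoc c c (w g) ⟨
      c * c * w g                      ∎
      where
      open ≈-Reasoning
      slide : ∀ z h → e ∙ (z ∙ h) ≡ z ∙ (e ∙ h)
      slide z h = trans (sym (assoc e z h)) (trans (cong (_∙ h) (central z)) (assoc z e h))

  -- A = (C + 1)e, hence A² = (c + 1)².
  twisted-triple-spectral : ∀ {y e} → y ≢ ε → y ** 5 ≡ ε → e ∙ e ≡ ε → (∀ g → e ∙ g ≡ g ∙ e) → Spectral
    (y ∙ e ∷ (y ∙ e) ⁻¹ ∷ e ∷ []) y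
  twisted-triple-spectral {y} {e} y≢ε y⁵ e² central = record
    { y≢ε = y≢ε ; y⁵ = y⁵ ; compatible = inj₁ ye ∷ inj₁ (sym (commute-⁻¹ (sym ye))) ∷ inj₁
      (sym (central y)) ∷ []
    ; p = plus 1ℚ ; q = minus 1ℚ ; p-small = inj₂ (inj₁ refl) ; q-small = inj₂ (inj₁ refl)
    ; p#q = λ {c} golden → ±-apart (value-plus-1 c) (-‿cong (value-plus-1 c)) (golden+1-#0 golden)
    ; quadratic = λ {c} _ eig → ±-quadratic L (value-plus-1 c) (-‿cong (value-plus-1 c)) ≈-refl (square eig)
    ; p₂ = 3ℚ ; q₂ = ℚ.- 3ℚ ; p₂≢q₂ = λ ()
    ; quadratic₂ = λ eig → ±-quadratic L ≈-refl (ι-- 3ℚ)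
      (solve 0 (con 3ℚ :* con 3ℚ := (con 2ℚ :+ con 1ℚ) :* (con 2ℚ :+ con 1ℚ)) ≈-refl) (square eig)
    }
    where
    L = y ∙ e ∷ (y ∙ e) ⁻¹ ∷ e ∷ []
    ye : y ∙ (y ∙ e) ≡ y ∙ e ∙ y
    ye = trans (cong (y ∙_) (sym (central y))) (sym (assoc y e y))
    A : ∀ {c w} → CEigen y c w → ∀ g → Act L w g ≈ (c + 1#) * w (e ∙ g)
    A {c} {w} eig g = ≈-trans (reflexive (cong₂ (λ h k → w h + (w k + (w (e ∙ g) + 0#))) (assoc y e g)
        (trans (cong (_∙ g) (trans (⁻¹-anti-homo-∙ y e)
          (trans (cong (_∙ y ⁻¹) (involution-⁻¹ e²)) (central (y ⁻¹))))) (assoc (y ⁻¹) e g))))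
      (≈-trans (solve 3 (λ a b c → a :+ (b :+ (c :+ con 0ℚ)) := (a :+ b) :+ c) ≈-refl (w (y ∙ (e ∙ g)))
        (w (y ⁻¹ ∙ (e ∙ g))) (w (e ∙ g)))
        (≈-trans (+-congʳ (eig (e ∙ g))) (solve 2 (λ c x → c :* x :+ x := (c :+ con 1ℚ) :* x) ≈-refl c
          (w (e ∙ g)))))
    square : ∀ {c w} → CEigen y c w → ∀ g → Act L (Act L w) g ≈ (c + 1#) * (c + 1#) * w g
    square {c} {w} eig g = begin
      Act L (Act L w) g                       ≈⟨ Act-cong L (A eig) g ⟩
      Act L (λ h → (c + 1#) * w (e ∙ h)) g    ≈⟨ Act-scale L (c + 1#) (λ h → w (e ∙ h)) g ⟩
      (c + 1#) * Act L (λ h → w (e ∙ h)) g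
        ≈⟨ *-congˡ (A (λ h → ≈-trans (reflexive (cong₂ (λ s t → w s + w t) (slide y h) (slide (y ⁻¹) h)))
        (eig (e ∙ h))) g) ⟩
      (c + 1#) * ((c + 1#) * w (e ∙ (e ∙ g)))
        ≈⟨ *-congˡ (*-congˡ (reflexive (cong w (trans (sym (assoc e e g))
        (trans (cong (_∙ g) e²) (identityˡ g)))))) ⟩
      (c + 1#) * ((c + 1#) * w g)             ≈⟨ *-assoc (c + 1#) (c + 1#) (w g) ⟨
      (c + 1#) * (c + 1#) * w g               ∎
      where
      open ≈-Reasoning
      slide : ∀ z h → e ∙ (z ∙ h) ≡ z ∙ (e ∙ h)
      slide z h = trans (sym (assoc e z h)) (trans (cong (_∙ h) (central z)) (assoc z e h))

  -- A = C + t, where t commutes with C and t² = 1. Therefore (A - c)² = 1.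
  triple-spectral : ∀ {y t} → y ≢ ε → y ** 5 ≡ ε → t ∙ t ≡ ε → y ∙ t ≡ t ∙ y ⊎ y ∙ t ≡ t ∙ y ⁻¹ → Spectral
    (y ∷ y ⁻¹ ∷ t ∷ []) y
  triple-spectral {y} {t} y≢ε y⁵ t² compat = record
    { y≢ε = y≢ε ; y⁵ = y⁵ ; compatible = inj₁ refl ∷ inj₁ (trans (inverseʳ y) (sym (inverseˡ y)))
      ∷ compat ∷ []
    ; p = plus 1ℚ ; q = plus -1ℚ ; p-small = inj₂ (inj₁ refl) ; q-small = inj₂ (inj₂ refl)
    ; p#q = λ {c} _ → apart (≈-trans (+-cong (value-plus-1 c) (-‿cong (value-plus--1 c)))
      (solve 1 (λ c → (c :+ con 1ℚ) :- (c :- con 1ℚ) := con 2ℚ) ≈-refl c)) (ι-#0 {2ℚ} λ ())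
    ; quadratic = λ {c} _ eig → quadratic-from L (c + c) (c * c - 1#) (square eig)
        (≈-trans (+-cong (value-plus-1 c) (value-plus--1 c))
          (solve 1 (λ c → (c :+ con 1ℚ) :+ (c :- con 1ℚ) := c :+ c) ≈-refl c))
        (≈-trans (*-cong (value-plus-1 c) (value-plus--1 c))
          (solve 1 (λ c → (c :+ con 1ℚ) :* (c :- con 1ℚ) := c :* c :- con 1ℚ) ≈-refl c))
    ; p₂ = 3ℚ ; q₂ = 1ℚ ; p₂≢q₂ = λ ()
    ; quadratic₂ = λ eig → quadratic-from L (ι 2ℚ + ι 2ℚ) (ι 2ℚ * ι 2ℚ - 1#) (square eig)
        (≈-trans (+-congˡ ι-1) (solve 0 (con 3ℚ :+ con 1ℚ := con 2ℚ :+ con 2ℚ) ≈-refl))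
        (≈-trans (*-congˡ ι-1) (solve 0 (con 3ℚ :* con 1ℚ := con 2ℚ :* con 2ℚ :- con 1ℚ) ≈-refl))
    }
    where
    L = y ∷ y ⁻¹ ∷ t ∷ []
    A : ∀ {c w} → CEigen y c w → ∀ g → Act L w g ≈ c * w g + w (t ∙ g)
    A {c} {w} eig g = ≈-trans (solve 3 (λ a b c → a :+ (b :+ (c :+ con 0ℚ)) := (a :+ b) :+ c) ≈-refl
      (w (y ∙ g)) (w (y ⁻¹ ∙ g)) (w (t ∙ g))) (+-congʳ (eig g))
    square : ∀ {c w} → CEigen y c w → ∀ g → Act L (Act L w) g ≈ (c + c) * Act L w g - (c * c - 1#) * w g
    square {c} {w} eig g = begin
      Act L (Act L w) g
        ≈⟨ A (λ h → ≈-trans (≈-sym (Act-C L (inj₁ refl ∷ inj₁ (trans (inverseʳ y) (sym (inverseˡ y)))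
          ∷ compat ∷ []) w h))
             (≈-trans (Act-cong L eig h) (Act-scale L c w h))) g ⟩
      c * Act L w g + Act L w (t ∙ g)
        ≈⟨ +-congˡ (≈-trans (A eig (t ∙ g)) (+-congˡ
          (reflexive (cong w (trans (sym (assoc t t g)) (trans (cong (_∙ g) t²) (identityˡ g))))))) ⟩
      c * Act L w g + (c * w (t ∙ g) + w g)
        ≈⟨ solve 4 (λ c a x z → c :* a :+ (c :* z :+ x) := c :* a :+ c :* (c :* x :+ z) :-
          (c :* c :- con 1ℚ) :* x) ≈-refl c (Act L w g) (w g) (w (t ∙ g)) ⟩
      c * Act L w g + c * (c * w g + w (t ∙ g)) - (c * c - 1#) * w g
        ≈⟨ +-congʳ (+-congˡ (*-congˡ (A eig g))) ⟨
      c * Act L w g + c * Act L w g - (c * c - 1#) * w g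
        ≈⟨ +-congʳ (distribʳ (Act L w g) c c) ⟨
      (c + c) * Act L w g - (c * c - 1#) * w g ∎
      where open ≈-Reasoning

  twice : ∀ {s} → s ∙ s ≡ ε → ∀ g → s ∙ (s ∙ g) ≡ g
  twice {s} s² g = trans (sym (assoc s s g)) (trans (cong (_∙ g) s²) (identityˡ g))

  product-⁻¹ : ∀ {s t} → s ∙ s ≡ ε → t ∙ t ≡ ε → ∀ g → (s ∙ t) ⁻¹ ∙ g ≡ t ∙ (s ∙ g)
  product-⁻¹ {s} {t} s² t² g = trans (cong (_∙ g)
    (trans (⁻¹-anti-homo-∙ s t) (cong₂ _∙_ (involution-⁻¹ t²) (involution-⁻¹ s²)))) (assoc t s g)

  -- A² = 2 + c, which is (c + 1)² when c² + c = 1 and 2² when c = 2.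
  involutions-spectral : ∀ {s t} → s ∙ s ≡ ε → t ∙ t ≡ ε → s ∙ t ≢ ε → (s ∙ t) ** 5 ≡ ε → Spectral
    (s ∷ t ∷ []) (s ∙ t)
  involutions-spectral {s} {t} s² t² y≢ε y⁵ = record
    { y≢ε = y≢ε ; y⁵ = y⁵
    ; compatible = inj₂ (trans (assoc s t s) (cong (s ∙_)
      (trans (sym (trans (product-⁻¹ s² t² ε) (cong (t ∙_) (identityʳ s)))) (identityʳ _))))
                 ∷ inj₂ (trans (assoc s t t) (trans (trans (cong (s ∙_) t²) (identityʳ s))
                   (sym (trans (cong (t ∙_) (trans (sym (identityʳ _)) (product-⁻¹ s² t² ε)))
                   (trans (twice t² (s ∙ ε)) (identityʳ s))))))
                 ∷ []
    ; p = plus 1ℚ ; q = minus 1ℚ ; p-small = inj₂ (inj₁ refl) ; q-small = inj₂ (inj₁ refl)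
    ; p#q = λ {c} golden → ±-apart (value-plus-1 c) (-‿cong (value-plus-1 c)) (golden+1-#0 golden)
    ; quadratic = λ {c} golden eig → ±-quadratic L (value-plus-1 c) (-‿cong (value-plus-1 c))
      (golden+1² golden) (square eig)
    ; p₂ = 2ℚ ; q₂ = -2ℚ ; p₂≢q₂ = λ ()
    ; quadratic₂ = λ eig → ±-quadratic L ≈-refl (ι-- 2ℚ)
      (solve 0 (con 2ℚ :* con 2ℚ := con 2ℚ :+ con 2ℚ) ≈-refl) (square eig)
    }
    where
    L = s ∷ t ∷ []
    square : ∀ {c w} → CEigen (s ∙ t) c w → ∀ g → Act L (Act L w) g ≈ (ι 2ℚ + c) * w g
    square {c} {w} eig g = begin
      Act L (Act L w) g
        ≈⟨ reflexive (cong₂ (λ x y → x + (y + 0#))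
          (cong₂ (λ h k → w h + (w k + 0#)) (twice s² g) (sym (product-⁻¹ s² t² g)))
             (cong₂ (λ h k → w h + (w k + 0#)) (sym (assoc s t g)) (twice t² g))) ⟩
      (w g + (w ((s ∙ t) ⁻¹ ∙ g) + 0#)) + ((w (s ∙ t ∙ g) + (w g + 0#)) + 0#)
        ≈⟨ solve 3 (λ a b c → (a :+ (c :+ con 0ℚ)) :+ ((b :+ (a :+ con 0ℚ)) :+ con 0ℚ) := con 2ℚ :* a :+
          (b :+ c)) ≈-refl (w g) (w (s ∙ t ∙ g)) (w ((s ∙ t) ⁻¹ ∙ g)) ⟩
      ι 2ℚ * w g + C (s ∙ t) w g      ≈⟨ +-congˡ (eig g) ⟩
      ι 2ℚ * w g + c * w g            ≈⟨ distribʳ (w g) (ι 2ℚ) c ⟨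
      (ι 2ℚ + c) * w g                ∎
      where open ≈-Reasoning

  -- The hypothesis on products evaluates the six mixed terms of A². As z² + z⁻² acts as c² - 2, it
  -- gives A² = 3 + 2c + (c² - 2) = (c + 1)², also for c = 2.
  three-involutions-spectral : ∀ {s t r z} → s ∙ s ≡ ε → t ∙ t ≡ ε → r ∙ r ≡ ε → z ≢ ε → z ** 5 ≡ ε →
    Compatible z (s ∷ t ∷ r ∷ []) →
    (∀ w g → C (s ∙ t) w g + C (s ∙ r) w g + C (t ∙ r) w g ≈ C z w g + C z w g + C (z ∙ z) w g) → Spectral
      (s ∷ t ∷ r ∷ []) z
  three-involutions-spectral {s} {t} {r} {z} s² t² r² z≢ε z⁵ compat products = record
    { y≢ε = z≢ε ; y⁵ = z⁵ ; compatible = compat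
    ; p = plus 1ℚ ; q = minus 1ℚ ; p-small = inj₂ (inj₁ refl) ; q-small = inj₂ (inj₁ refl)
    ; p#q = λ {c} golden → ±-apart (value-plus-1 c) (-‿cong (value-plus-1 c)) (golden+1-#0 golden)
    ; quadratic = λ {c} _ eig → ±-quadratic L (value-plus-1 c) (-‿cong (value-plus-1 c)) ≈-refl (square eig)
    ; p₂ = 3ℚ ; q₂ = ℚ.- 3ℚ ; p₂≢q₂ = λ ()
    ; quadratic₂ = λ eig → ±-quadratic L ≈-refl (ι-- 3ℚ)
      (solve 0 (con 3ℚ :* con 3ℚ := (con 2ℚ :+ con 1ℚ) :* (con 2ℚ :+ con 1ℚ)) ≈-refl) (square eig)
    }
    where
    L = s ∷ t ∷ r ∷ []
    square : ∀ {c w} → CEigen z c w → ∀ g → Act L (Act L w) g ≈ (c + 1#) * (c + 1#) * w g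
    square {c} {w} eig g = begin
      Act L (Act L w) g
        ≈⟨ reflexive (cong₂ _+_ (cong₂ _+_ (cong w (twice s² g))
          (cong₂ (λ h k → w h + (w k + 0#)) (sym (product-⁻¹ s² t² g)) (sym (product-⁻¹ s² r² g))))
             (cong₂ (λ x y → x + (y + 0#)) (cong₂ _+_ (cong w (sym (assoc s t g)))
               (cong₂ (λ h k → w h + (w k + 0#)) (twice t² g) (sym (product-⁻¹ t² r² g))))
               (cong₂ _+_ (cong w (sym (assoc s r g)))
                 (cong₂ (λ h k → w h + (w k + 0#)) (sym (assoc t r g)) (twice r² g))))) ⟩
      (w g + (w ((s ∙ t) ⁻¹ ∙ g) + (w ((s ∙ r) ⁻¹ ∙ g) + 0#))) +
        ((w (s ∙ t ∙ g) + (w g + (w ((t ∙ r) ⁻¹ ∙ g) + 0#))) +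
        ((w (s ∙ r ∙ g) + (w (t ∙ r ∙ g) + (w g + 0#))) + 0#))
        ≈⟨ solve 7 (λ a b b′ c c′ d d′ → (a :+ (b′ :+ (c′ :+ con 0ℚ))) :+
          ((b :+ (a :+ (d′ :+ con 0ℚ))) :+ ((c :+ (d :+ (a :+ con 0ℚ))) :+ con 0ℚ))
             := con 3ℚ :* a :+ ((b :+ b′) :+ (c :+ c′) :+ (d :+ d′))) ≈-refl
             (w g) (w (s ∙ t ∙ g)) (w ((s ∙ t) ⁻¹ ∙ g)) (w (s ∙ r ∙ g)) (w ((s ∙ r) ⁻¹ ∙ g))
               (w (t ∙ r ∙ g)) (w ((t ∙ r) ⁻¹ ∙ g)) ⟩
      ι 3ℚ * w g + (C (s ∙ t) w g + C (s ∙ r) w g + C (t ∙ r) w g)   ≈⟨ +-congˡ (products w g) ⟩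
      ι 3ℚ * w g + (C z w g + C z w g + C (z ∙ z) w g)
        ≈⟨ +-congˡ (+-cong (+-cong (eig g) (eig g)) double) ⟩
      ι 3ℚ * w g + (c * w g + c * w g + (c * (c * w g) - (w g + w g)))
        ≈⟨ solve 2 (λ c x → con 3ℚ :* x :+ (c :* x :+ c :* x :+ (c :* (c :* x) :- (x :+ x))) :=
        (c :+ con 1ℚ) :* (c :+ con 1ℚ) :* x) ≈-refl c (w g) ⟩
      (c + 1#) * (c + 1#) * w g                                      ∎
      where
      open ≈-Reasoning
      double : C (z ∙ z) w g ≈ c * (c * w g) - (w g + w g)
      double = begin
        C (z ∙ z) w g
          ≈⟨ reflexive (cong₂ (λ h k → w h + w k) (assoc z z g)
          (trans (cong (_∙ g) (⁻¹-anti-homo-∙ z z)) (assoc (z ⁻¹) (z ⁻¹) g))) ⟩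
        w (z ∙ (z ∙ g)) + w (z ⁻¹ ∙ (z ⁻¹ ∙ g))
          ≈⟨ solve 2 (λ s a → s := s :+ (a :+ a) :- (a :+ a)) ≈-refl
          (w (z ∙ (z ∙ g)) + w (z ⁻¹ ∙ (z ⁻¹ ∙ g))) (w g) ⟩
        _                                                            ≈⟨ +-congʳ (C² z w g) ⟨
        C z (C z w) g - (w g + w g)
          ≈⟨ +-congʳ (≈-trans (C-cong z eig g) (≈-sym (distribˡ c _ _))) ⟩
        c * C z w g - (w g + w g)                                    ≈⟨ +-congʳ (*-congˡ (eig g)) ⟩
        c * (c * w g) - (w g + w g)                                  ∎

-- Degree two for each shape of connection set

module Degree {c ℓ₁ ℓ₂ : Level} (Ω : AlgebraicallyClosedField c ℓ₁ ℓ₂) (G : FinGroup) where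
  open Field Ω
  open FinGroup G
  open GroupLemmas G
  open Powers G
  open Eigen Ω G
  open Backward Ω G

  Act-↭ : ∀ {L L′} → L ↭ L′ → ∀ w g → Act L w g ≈ Act L′ w g
  Act-↭ ↭.refl          w g = ≈-refl
  Act-↭ (↭.prep s p)      w g = +-congˡ (Act-↭ p w g)
  Act-↭ (↭.swap s t p)  w g = ≈-trans (+-congˡ (+-congˡ (Act-↭ p w g)))
    (solve 3 (λ a b c → a :+ (b :+ c) := b :+ (a :+ c)) ≈-refl (w (s ∙ g)) (w (t ∙ g)) _)
  Act-↭ (↭.trans p q)   w g = ≈-trans (Act-↭ p w g) (Act-↭ q w g)

  degree-↭ : ∀ {L L′} → L ↭ L′ → HasDegree Ω (Generated Ω (Eigenvalue L)) 2 → HasDegree Ω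
    (Generated Ω (Eigenvalue L′)) 2
  degree-↭ {L} {L′} p = degree-transport (transport p) (transport (↭-sym p))
    where
    transport : ∀ {L L′} → L ↭ L′ → ∀ {μ} → Eigenvalue L μ → Eigenvalue L′ μ
    transport p (w , nz , eig) = w , nz , λ g → ≈-trans (≈-sym (Act-↭ p w g)) (eig g)

  data Shape : List El → Set where
    pair    : ∀ x → x ∙ x ≢ ε → Shape (x ∷ x ⁻¹ ∷ [])
    triple  : ∀ x t → x ∙ x ≢ ε → Involution t → Shape (x ∷ x ⁻¹ ∷ t ∷ [])
    double  : ∀ s t → Involution s → Involution t → s ≢ t → Shape (s ∷ t ∷ [])
    three : ∀ s t r → Involution s → Involution t → Involution r → s ≢ t → s ≢ r → t ≢ r → Shape
      (s ∷ t ∷ r ∷ [])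

  Shaped : List El → Set
  Shaped L = Σ[ L′ ∈ List El ] L′ ↭ L × Shape L′

  self-inverse : ∀ {s} → s ⁻¹ ≡ s → s ∙ s ≡ ε
  self-inverse {s} eq = trans (cong (s ∙_) (sym eq)) (inverseʳ s)

  ⁻¹-swap : ∀ {s t} → s ⁻¹ ≡ t → t ⁻¹ ≡ s
  ⁻¹-swap {s} refl = ⁻¹-involutive s

  -- Inversion permutes the list. An entry that is not self-inverse is paired with another one, and
  -- with three entries the remaining one is then its own inverse.
  classify : ∀ {L} → ConnectionList L → Shaped L
  classify {[]} list = contradiction (ConnectionList.2≤ list) λ ()
  classify {_ ∷ []} list = contradiction (ConnectionList.2≤ list) λ { (ℕ.s≤s ()) }
  classify {s ∷ t ∷ []} list = decide (s ∙ s Fin.≟ ε)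
    where
    open ConnectionList list
    s≢t : s ≢ t
    s≢t with unique
    ... | (s≢t ∷ []) ∷ _ = s≢t
    decide : Dec (s ∙ s ≡ ε) → Shaped (s ∷ t ∷ [])
    decide (yes s²) = second (closed (there (here refl)))
      where
      second : t ⁻¹ ∈ s ∷ t ∷ [] → Shaped (s ∷ t ∷ [])
      second (here eq)         = contradiction (trans (sym (involution-⁻¹ s²)) (⁻¹-swap eq)) s≢t
      second (there (here eq)) = _ , ↭-refl , double s t ((λ eq → ε∉ (here (sym eq))) , s²)
        ((λ eq → ε∉ (there (here (sym eq)))) , self-inverse eq) s≢t
    decide (no ¬s²) = first (closed (here refl))
      where
      first : s ⁻¹ ∈ s ∷ t ∷ [] → Shaped (s ∷ t ∷ [])
      first (here eq)            = contradiction (self-inverse eq) ¬s²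
      first (there (here refl))  = _ , ↭-refl , pair s ¬s²
  classify {s ∷ t ∷ r ∷ []} list = decide (s ∙ s Fin.≟ ε) (t ∙ t Fin.≟ ε)
    where
    open ConnectionList list
    distinct : s ≢ t × s ≢ r × t ≢ r
    distinct with unique
    ... | (s≢t ∷ s≢r ∷ []) ∷ (t≢r ∷ []) ∷ _ = s≢t , s≢r , t≢r
    s≢t : s ≢ t
    s≢t = proj₁ distinct
    s≢r : s ≢ r
    s≢r = proj₁ (proj₂ distinct)
    t≢r : t ≢ r
    t≢r = proj₂ (proj₂ distinct)
    s≢ε : s ≢ ε
    s≢ε eq = ε∉ (here (sym eq))
    t≢ε : t ≢ ε
    t≢ε eq = ε∉ (there (here (sym eq)))
    r≢ε : r ≢ ε
    r≢ε eq = ε∉ (there (there (here (sym eq))))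
    r-involution-ˢᵗ : s ⁻¹ ≡ t → Involution r
    r-involution-ˢᵗ s⁻¹≡t = r≢ε , go (closed (there (there (here refl))))
      where
      go : r ⁻¹ ∈ s ∷ t ∷ r ∷ [] → r ∙ r ≡ ε
      go (here eq)                 = contradiction (trans (sym s⁻¹≡t) (⁻¹-swap eq)) t≢r
      go (there (here eq))         = contradiction (trans (sym (⁻¹-swap s⁻¹≡t)) (⁻¹-swap eq)) s≢r
      go (there (there (here eq))) = self-inverse eq
    t-involution-ˢʳ : s ⁻¹ ≡ r → Involution t
    t-involution-ˢʳ s⁻¹≡r = t≢ε , go (closed (there (here refl)))
      where
      go : t ⁻¹ ∈ s ∷ t ∷ r ∷ [] → t ∙ t ≡ ε
      go (here eq)                 = contradiction (trans (sym (⁻¹-swap eq)) s⁻¹≡r) t≢r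
      go (there (here eq))         = self-inverse eq
      go (there (there (here eq))) = contradiction (trans (sym (⁻¹-swap s⁻¹≡r)) (⁻¹-swap eq)) s≢t
    decide : Dec (s ∙ s ≡ ε) → Dec (t ∙ t ≡ ε) → Shaped (s ∷ t ∷ r ∷ [])
    decide (no ¬s²) _ = first (closed (here refl))
      where
      first : s ⁻¹ ∈ s ∷ t ∷ r ∷ [] → Shaped (s ∷ t ∷ r ∷ [])
      first (here eq)                   = contradiction (self-inverse eq) ¬s²
      first (there (here refl))         = _ , ↭-refl , triple s r ¬s² (r-involution-ˢᵗ refl)
      first (there (there (here refl))) =
        _ , ↭.prep s (↭.swap (s ⁻¹) t ↭-refl) , triple s t ¬s² (t-involution-ˢʳ refl)
    decide (yes s²) (no ¬t²) = second (closed (there (here refl)))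
      where
      second : t ⁻¹ ∈ s ∷ t ∷ r ∷ [] → Shaped (s ∷ t ∷ r ∷ [])
      second (here eq)                   = contradiction (trans (sym (involution-⁻¹ s²)) (⁻¹-swap eq)) s≢t
      second (there (here eq))           = contradiction (self-inverse eq) ¬t²
      second (there (there (here refl))) =
        _ , ↭.trans (↭.prep t (↭.swap (t ⁻¹) s ↭-refl)) (↭.swap t s ↭-refl) , triple t s ¬t² (s≢ε , s²)
    decide (yes s²) (yes t²) = third (closed (there (there (here refl))))
      where
      third : r ⁻¹ ∈ s ∷ t ∷ r ∷ [] → Shaped (s ∷ t ∷ r ∷ [])
      third (here eq)                 = contradiction (trans (sym (involution-⁻¹ s²)) (⁻¹-swap eq)) s≢r
      third (there (here eq))         = contradiction (trans (sym (involution-⁻¹ t²)) (⁻¹-swap eq)) t≢r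
      third (there (there (here eq))) =
        _ , ↭-refl , three s t r (s≢ε , s²) (t≢ε , t²) (r≢ε , self-inverse eq) s≢t s≢r t≢r
  classify {_ ∷ _ ∷ _ ∷ _ ∷ _} list = contradiction (ConnectionList.≤3 list) λ { (ℕ.s≤s (ℕ.s≤s (ℕ.s≤s ()))) }

  degree-by-shape : (∀ {L} → Shape L → HasDegree Ω (Generated Ω (Eigenvalue L)) 2) →
    ∀ {L} → ConnectionList L → HasDegree Ω (Generated Ω (Eigenvalue L)) 2
  degree-by-shape by-shape list = let L′ , p , shape = classify list in degree-↭ p (by-shape shape)

  square≢ε⇒≢ε : ∀ {x} → x ∙ x ≢ ε → x ≢ ε
  square≢ε⇒≢ε x² refl = x² (identityˡ ε)

  -- The case e = 1 is included and covers the groups of exponent 5 themselves. An involution can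
  -- only be e, which rules out lists with two of them.
  central-degree-2 : ∀ {e} → e ∙ e ≡ ε → (∀ g → e ∙ g ≡ g ∙ e) →
    (∀ g → ∃[ y ] y ** 5 ≡ ε × (g ≡ y ⊎ g ≡ y ∙ e)) →
    ∀ {L} → ConnectionList L → HasDegree Ω (Generated Ω (Eigenvalue L)) 2
  central-degree-2 {e} e² central cover = degree-by-shape by-shape
    where
    square : ∀ y → y ∙ e ∙ (y ∙ e) ≡ y ∙ y
    square y = trans (trans (assoc y e (y ∙ e)) (cong (y ∙_)
      (trans (sym (assoc e y e)) (trans (cong (_∙ e) (central y))
      (trans (assoc y e e) (trans (cong (y ∙_) e²) (identityʳ y))))))) refl
    unique : ∀ {t} → Involution t → t ≡ e
    unique {t} (t≢ε , t²) = go (cover t)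
      where
      go : ∃[ y ] y ** 5 ≡ ε × (t ≡ y ⊎ t ≡ y ∙ e) → t ≡ e
      go (y , y⁵ , inj₁ refl) = contradiction (order-2-and-5 t² y⁵) t≢ε
      go (y , y⁵ , inj₂ refl) =
        trans (cong (_∙ e) (order-2-and-5 (trans (sym (square y)) t²) y⁵)) (identityˡ e)
    by-shape : ∀ {L} → Shape L → HasDegree Ω (Generated Ω (Eigenvalue L)) 2
    by-shape (pair x x²≢ε) = go (cover x)
      where
      go : ∃[ y ] y ** 5 ≡ ε × (x ≡ y ⊎ x ≡ y ∙ e) → HasDegree Ω (Generated Ω (Eigenvalue (x ∷ x ⁻¹ ∷ []))) 2
      go (y , y⁵ , inj₁ refl) = spectral⇒degree-2 (pair-spectral (square≢ε⇒≢ε x²≢ε) y⁵)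
      go (y , y⁵ , inj₂ refl) = spectral⇒degree-2
        (twisted-pair-spectral (square≢ε⇒≢ε (λ y² → x²≢ε (trans (square y) y²))) y⁵ e² central)
    by-shape (triple x t x²≢ε t-inv) with unique t-inv
    ... | refl = go (cover x)
      where
      go : ∃[ y ] y ** 5 ≡ ε × (x ≡ y ⊎ x ≡ y ∙ e) → HasDegree Ω
        (Generated Ω (Eigenvalue (x ∷ x ⁻¹ ∷ t ∷ []))) 2
      go (y , y⁵ , inj₁ refl) =
        spectral⇒degree-2 (triple-spectral (square≢ε⇒≢ε x²≢ε) y⁵ e² (inj₁ (sym (central y))))
      go (y , y⁵ , inj₂ refl) = spectral⇒degree-2
        (twisted-triple-spectral (square≢ε⇒≢ε (λ y² → x²≢ε (trans (square y) y²))) y⁵ e² central)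
    by-shape (double s t s-inv t-inv s≢t) = contradiction (trans (unique s-inv) (sym (unique t-inv))) s≢t
    by-shape (three s t r s-inv t-inv r-inv s≢t _ _) =
      contradiction (trans (unique s-inv) (sym (unique t-inv))) s≢t

  -- Among the classes {ρ, ρ⁻¹} and {ρ², ρ⁻²} of i, j and i + j, not all are equal.
  class : Fin 5 → Bool
  class i = does ((toℕ i ℕ.* toℕ i) % 5 ℕ.≟ 1)

  classes-differ : ∀ (i j : Fin 5) → i ≡ zero ⊎ j ≡ zero ⊎ (toℕ i ℕ.+ toℕ j) % 5 ≡ 0
    ⊎ ∃[ k ] toℕ {5} k ≡ (toℕ i ℕ.+ toℕ j) % 5 × k ≢ zero × ¬ (class i ≡ class j × class i ≡ class k)
  classes-differ = from-yes (Fin.all? λ i → Fin.all? λ j → (i Fin.≟ zero) ⊎-dec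
    ((j Fin.≟ zero) ⊎-dec (((toℕ i ℕ.+ toℕ j) % 5 ℕ.≟ 0)
    ⊎-dec Fin.any? λ k → (toℕ k ℕ.≟ (toℕ i ℕ.+ toℕ j) % 5) ×-dec
      (¬? (k Fin.≟ zero) ×-dec ¬? ((class i Bool.≟ class j) ×-dec (class i Bool.≟ class k))))))

  dihedral-degree-2 : Dihedral G → ∀ {L} → ConnectionList L → HasDegree Ω (Generated Ω (Eigenvalue L)) 2
  dihedral-degree-2 dihedral = degree-by-shape by-shape
    where
    open Dihedral dihedral renaming (r to ρ; f to τ; r≢ε to ρ≢ε; r⁵ to ρ⁵; f² to τ²; frf to τρτ)
    open Cyclic5 ρ⁵
    multiple-fifth : ∀ {x} → Multiple x → x ** 5 ≡ ε
    multiple-fifth (i , refl) = trans (**-swap ρ (toℕ i) 5) (trans (cong (_** toℕ i) ρ⁵) (ε** (toℕ i)))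
    τ-invert : ∀ k → τ ∙ ρ ** k ≡ (ρ ** k) ⁻¹ ∙ τ
    τ-invert k = trans (sym (trans (assoc (τ ∙ ρ ** k) τ τ)
      (trans (cong (τ ∙ ρ ** k ∙_) τ²) (identityʳ _)))) (cong (_∙ τ) (invert-power k τ² τρτ))
    Reflection : El → Set
    Reflection s = Σ[ i ∈ Fin 5 ] s ≡ ρ ** toℕ i ∙ τ
    reflection-square : ∀ {s} → Reflection s → s ∙ s ≡ ε
    reflection-square (i , refl) = trans (assoc (ρ ** toℕ i) τ _)
      (trans (cong (ρ ** toℕ i ∙_) (trans (sym (assoc τ _ τ)) (trans (cong (_∙ τ) (τ-invert (toℕ i)))
      (trans (assoc _ τ τ) (trans (cong ((ρ ** toℕ i) ⁻¹ ∙_) τ²) (identityʳ _)))))) (inverseʳ _))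
    rotation-or-reflection : ∀ g → Multiple g ⊎ Reflection g
    rotation-or-reflection g with covered g
    ... | i , 0ℙ , eq = inj₁ (i , trans eq (identityʳ _))
    ... | i , 1ℙ , eq = inj₂ (i , trans eq (cong (ρ ** toℕ i ∙_) (identityʳ τ)))
    nonsquare-multiple : ∀ {x} → x ∙ x ≢ ε → Multiple x
    nonsquare-multiple {x} x² =
      [ (λ m → m) , (λ refl′ → contradiction (reflection-square refl′) x²) ]′ (rotation-or-reflection x)
    involution-reflection : ∀ {s} → Involution s → Reflection s
    involution-reflection {s} (s≢ε , s²) = [ (λ m → contradiction (order-2-and-5 s² (multiple-fifth m))
      s≢ε) , (λ refl′ → refl′) ]′ (rotation-or-reflection s)
    power-comm : ∀ i j → ρ ** i ∙ ρ ** j ≡ ρ ** j ∙ ρ ** i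
    power-comm i j = trans (sym (**-+ ρ i j)) (trans (cong (ρ **_) (ℕ.+-comm i j)) (**-+ ρ j i))
    inverted : ∀ {x s} → Multiple x → Reflection s → x ∙ s ≡ s ∙ x ⁻¹
    inverted (j , refl) (i , refl) = begin
      ρʲ ∙ (ρⁱ ∙ τ)               ≡⟨ trans (sym (assoc ρʲ ρⁱ τ)) (cong (_∙ τ) (power-comm (toℕ j) (toℕ i))) ⟩
      ρⁱ ∙ ρʲ ∙ τ
        ≡⟨ free (♯₀ ⊙ ♯₁ ⊙ ♯₂) (♯₀ ⊙ (♯₁ ⊙ ♯₂ ⊙ ♯₁ ⊙ inv ♯₁)) (ρⁱ ∷ ρʲ ∷ τ ∷ []) refl ⟩
      ρⁱ ∙ (ρʲ ∙ τ ∙ ρʲ ∙ ρʲ ⁻¹)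
        ≡⟨ cong (λ z → ρⁱ ∙ (z ∙ ρʲ ⁻¹)) (trans (assoc ρʲ τ ρʲ)
        (trans (cong (ρʲ ∙_) (τ-invert (toℕ j))) (cancelˡ ρʲ τ))) ⟩
      ρⁱ ∙ (τ ∙ ρʲ ⁻¹)            ≡⟨ assoc ρⁱ τ (ρʲ ⁻¹) ⟨
      ρⁱ ∙ τ ∙ ρʲ ⁻¹              ∎
      where
      open ≡-Reasoning
      ρⁱ ρʲ : El
      ρⁱ = ρ ** toℕ i
      ρʲ = ρ ** toℕ j
    rotation : ∀ {s t} → Reflection s → Reflection t → Multiple (s ∙ t)
    rotation (i , refl) (j , refl) = subst Multiple (begin
        ρⁱ ∙ ρʲ ⁻¹              ≡⟨ cong (ρⁱ ∙_) (trans (cong (ρʲ ⁻¹ ∙_) τ²) (identityʳ _)) ⟨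
        ρⁱ ∙ (ρʲ ⁻¹ ∙ (τ ∙ τ))
          ≡⟨ cong (ρⁱ ∙_) (trans (sym (assoc (ρʲ ⁻¹) τ τ))
          (trans (cong (_∙ τ) (sym (τ-invert (toℕ j)))) (assoc τ ρʲ τ))) ⟩
        ρⁱ ∙ (τ ∙ (ρʲ ∙ τ))     ≡⟨ assoc ρⁱ τ (ρʲ ∙ τ) ⟨
        ρⁱ ∙ τ ∙ (ρʲ ∙ τ)       ∎) (multiple-∙ (i , refl) (multiple-⁻¹ (j , refl)))
      where
      open ≡-Reasoning
      ρⁱ ρʲ : El
      ρⁱ = ρ ** toℕ i
      ρʲ = ρ ** toℕ j
    distinct-product : ∀ {s t} → s ∙ s ≡ ε → s ≢ t → s ∙ t ≢ ε
    distinct-product {s} {t} s² s≢t st = s≢t (∙-cancelˡ s s t (trans s² (sym st)))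
    ρ²≢ε : ρ ∙ ρ ≢ ε
    ρ²≢ε ρ² = ρ≢ε (order-2-and-5 ρ² ρ⁵)

    U V : Function → Function
    U = C ρ
    V = C (ρ ∙ ρ)
    by-class : Bool → Function → El → K
    by-class true  w g = U w g
    by-class false w g = V w g
    C-⁻¹ : ∀ {x y} → x ≡ y ⁻¹ → ∀ w g → C x w g ≈ C y w g
    C-⁻¹ {y = y} refl w g =
      ≈-trans (+-congˡ (reflexive (cong (λ z → w (z ∙ g)) (⁻¹-involutive y)))) (+-comm _ _)
    C-≡ : ∀ {x y} → x ≡ y → ∀ w g → C x w g ≈ C y w g
    C-≡ refl w g = ≈-refl
    ρ⁴ : ρ ** 4 ≡ ρ ⁻¹
    ρ⁴ = inverseˡ-unique _ _ (trans (free (♯₀ **ʷ 4 ⊙ ♯₀) (♯₀ **ʷ 5) (ρ ∷ []) refl) ρ⁵)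
    ρ³ : ρ ** 3 ≡ (ρ ∙ ρ) ⁻¹
    ρ³ = inverseˡ-unique _ _ (trans (free (♯₀ **ʷ 3 ⊙ (♯₀ ⊙ ♯₀)) (♯₀ **ʷ 5) (ρ ∷ []) refl) ρ⁵)
    C-class : ∀ (i : Fin 5) → i ≢ zero → ∀ w g → C (ρ ** toℕ i) w g ≈ by-class (class i) w g
    C-class zero i≢0 w g = contradiction refl i≢0
    C-class (suc zero) _ w g = C-≡ (identityʳ ρ) w g
    C-class (suc (suc zero)) _ w g = C-≡ (cong (ρ ∙_) (identityʳ ρ)) w g
    C-class (suc (suc (suc zero))) _ w g = C-⁻¹ ρ³ w g
    C-class (suc (suc (suc (suc zero)))) _ w g = C-⁻¹ ρ⁴ w g

    by-shape : ∀ {L} → Shape L → HasDegree Ω (Generated Ω (Eigenvalue L)) 2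
    by-shape (pair x x²≢ε) =
      spectral⇒degree-2 (pair-spectral (square≢ε⇒≢ε x²≢ε) (multiple-fifth (nonsquare-multiple x²≢ε)))
    by-shape (triple x t x²≢ε t-inv) =
      spectral⇒degree-2 (triple-spectral (square≢ε⇒≢ε x²≢ε) (multiple-fifth (nonsquare-multiple x²≢ε))
      (proj₂ t-inv) (inj₂ (inverted (nonsquare-multiple x²≢ε) (involution-reflection t-inv))))
    by-shape (double s t s-inv t-inv s≢t) =
      spectral⇒degree-2 (involutions-spectral (proj₂ s-inv) (proj₂ t-inv)
      (distinct-product (proj₂ s-inv) s≢t) (multiple-fifth
        (rotation (involution-reflection s-inv) (involution-reflection t-inv))))
    by-shape (three s t r s-inv t-inv r-inv s≢t s≢r t≢r) = go (classes-differ i j)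
      where
      s-refl = involution-reflection s-inv
      t-refl = involution-reflection t-inv
      r-refl = involution-reflection r-inv
      st-multiple : Multiple (s ∙ t)
      st-multiple = rotation s-refl t-refl
      tr-multiple : Multiple (t ∙ r)
      tr-multiple = rotation t-refl r-refl
      i j : Fin 5
      i = proj₁ st-multiple
      j = proj₁ tr-multiple
      st≡ : s ∙ t ≡ ρ ** toℕ i
      st≡ = proj₂ st-multiple
      tr≡ : t ∙ r ≡ ρ ** toℕ j
      tr≡ = proj₂ tr-multiple
      sr≡ : s ∙ r ≡ ρ ** ((toℕ i ℕ.+ toℕ j) % 5)
      sr≡ = begin
        s ∙ r                           ≡⟨ cong (s ∙_) (twice (proj₂ t-inv) r) ⟨
        s ∙ (t ∙ (t ∙ r))               ≡⟨ assoc s t (t ∙ r) ⟨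
        s ∙ t ∙ (t ∙ r)                 ≡⟨ cong₂ _∙_ st≡ tr≡ ⟩
        ρ ** toℕ i ∙ ρ ** toℕ j         ≡⟨ **-+ ρ (toℕ i) (toℕ j) ⟨
        ρ ** (toℕ i ℕ.+ toℕ j)          ≡⟨ **-% (toℕ i ℕ.+ toℕ j) ρ⁵ ⟩
        ρ ** ((toℕ i ℕ.+ toℕ j) % 5)    ∎
        where open ≡-Reasoning
      compat : ∀ {z} → Multiple z → Compatible z (s ∷ t ∷ r ∷ [])
      compat z∈ = inj₂ (inverted z∈ s-refl) ∷ inj₂ (inverted z∈ t-refl) ∷ inj₂ (inverted z∈ r-refl) ∷ []
      Goal : Set _
      Goal = HasDegree Ω (Generated Ω (Eigenvalue (s ∷ t ∷ r ∷ []))) 2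
      with-ρ : (∀ w g → C (s ∙ t) w g + C (s ∙ r) w g + C (t ∙ r) w g ≈ U w g + U w g + V w g) → Goal
      with-ρ products =
        spectral⇒degree-2 (three-involutions-spectral (proj₂ s-inv) (proj₂ t-inv) (proj₂ r-inv) ρ≢ε ρ⁵
        (compat (subst Multiple (identityʳ ρ) (multiple 1))) products)
      with-ρ² : (∀ w g → C (s ∙ t) w g + C (s ∙ r) w g + C (t ∙ r) w g ≈ V w g + V w g + U w g) → Goal
      with-ρ² products = spectral⇒degree-2 (three-involutions-spectral (proj₂ s-inv) (proj₂ t-inv)
        (proj₂ r-inv) ρ²≢ε (multiple-fifth ρ²∈)
        -- For z = ρ² the term C (z²) belongs to ρ⁴ = ρ⁻¹, and C is the same for an element and its
        -- inverse.
        (compat ρ²∈) λ w g → ≈-trans (products w g)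
          (+-congˡ (≈-sym (C-⁻¹ (trans (free (♯₀ ⊙ ♯₀ ⊙ (♯₀ ⊙ ♯₀)) (♯₀ **ʷ 4) (ρ ∷ []) refl) ρ⁴) w g))))
        where
        ρ²∈ : Multiple (ρ ∙ ρ)
        ρ²∈ = subst Multiple (cong (ρ ∙_) (identityʳ ρ)) (multiple 2)
      go : i ≡ zero ⊎ j ≡ zero ⊎ (toℕ i ℕ.+ toℕ j) % 5 ≡ 0
        ⊎ ∃[ k ] toℕ {5} k ≡ (toℕ i ℕ.+ toℕ j) % 5 × k ≢ zero × ¬ (class i ≡ class j × class i ≡ class k) →
          Goal
      go (inj₁ i≡0) =
        contradiction (trans st≡ (cong (λ i → ρ ** toℕ i) i≡0)) (distinct-product (proj₂ s-inv) s≢t)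
      go (inj₂ (inj₁ j≡0)) =
        contradiction (trans tr≡ (cong (λ j → ρ ** toℕ j) j≡0)) (distinct-product (proj₂ t-inv) t≢r)
      go (inj₂ (inj₂ (inj₁ k≡0))) =
        contradiction (trans sr≡ (cong (ρ **_) k≡0)) (distinct-product (proj₂ s-inv) s≢r)
      go (inj₂ (inj₂ (inj₂ (k , k≡ , k≢0 , differ)))) = choose (class i) (class k) (class j) refl refl refl
        where
        i≢0 : i ≢ zero
        i≢0 i≡0 = distinct-product (proj₂ s-inv) s≢t (trans st≡ (cong (λ i → ρ ** toℕ i) i≡0))
        j≢0 : j ≢ zero
        j≢0 j≡0 = distinct-product (proj₂ t-inv) t≢r (trans tr≡ (cong (λ j → ρ ** toℕ j) j≡0))
        sum : ∀ {a b d} → class i ≡ a → class k ≡ b → class j ≡ d → ∀ w g →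
          C (s ∙ t) w g + C (s ∙ r) w g + C (t ∙ r) w g ≈ by-class a w g + by-class b w g + by-class d w g
        sum refl refl refl w g = +-cong (+-cong (≈-trans (C-≡ st≡ w g) (C-class i i≢0 w g))
          (≈-trans (C-≡ (trans sr≡ (cong (ρ **_) (sym k≡))) w g) (C-class k k≢0 w g))) (≈-trans
            (C-≡ tr≡ w g) (C-class j j≢0 w g))
        rotate₁ : ∀ x y → x + y + x ≈ x + x + y
        rotate₁ = solve 2 (λ x y → x :+ y :+ x := x :+ x :+ y) ≈-refl
        rotate₂ : ∀ x y → y + x + x ≈ x + x + y
        rotate₂ = solve 2 (λ x y → y :+ x :+ x := x :+ x :+ y) ≈-refl
        -- The class that occurs twice among the three products decides whether z is ρ or ρ²; the
        -- remaining product then has the class of z².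
        choose : ∀ a b d → class i ≡ a → class k ≡ b → class j ≡ d → Goal
        choose true true true eq₁ eq₂ eq₃ = contradiction (trans eq₁ (sym eq₃) , trans eq₁ (sym eq₂)) differ
        choose true  true  false eq₁ eq₂ eq₃ = with-ρ λ w g → sum eq₁ eq₂ eq₃ w g
        choose true false true eq₁ eq₂ eq₃ =
          with-ρ λ w g → ≈-trans (sum eq₁ eq₂ eq₃ w g) (rotate₁ (U w g) (V w g))
        choose false true true eq₁ eq₂ eq₃ =
          with-ρ λ w g → ≈-trans (sum eq₁ eq₂ eq₃ w g) (rotate₂ (U w g) (V w g))
        choose true false false eq₁ eq₂ eq₃ =
          with-ρ² λ w g → ≈-trans (sum eq₁ eq₂ eq₃ w g) (rotate₂ (V w g) (U w g))
        choose false true false eq₁ eq₂ eq₃ =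
          with-ρ² λ w g → ≈-trans (sum eq₁ eq₂ eq₃ w g) (rotate₁ (V w g) (U w g))
        choose false false true  eq₁ eq₂ eq₃ = with-ρ² λ w g → sum eq₁ eq₂ eq₃ w g
        choose false false false eq₁ eq₂ eq₃ =
          contradiction (trans eq₁ (sym eq₃) , trans eq₁ (sym eq₂)) differ

-- Passage between groups, indices, subsets and lists

module _ {a ℓ} (G : FiniteGroup a ℓ) where
  private module G = FiniteGroup G
  open G using (index; element; index-cong)

  element-index : ∀ g → element (index g) G.≈ g
  element-index = Inverse.strictlyInverseʳ G.enumeration

  index-element : ∀ i → index (element i) ≡ i
  index-element = Inverse.strictlyInverseˡ G.enumeration

  -- Elements are replaced by their indices. Equality becomes propositional and decidable, as the
  -- counting arguments and case distinctions require.
  toFin : FinGroup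
  toFin = record
    { order   = G.order
    ; _∙_     = λ i j → index (element i G.∙ element j)
    ; ε       = index G.ε
    ; _⁻¹     = λ i → index (element i G.⁻¹)
    ; isGroup = record
      { isMonoid = record
        { isSemigroup = record
          { isMagma = record { isEquivalence = ≡.isEquivalence ; ∙-cong = λ { refl refl → refl } }
          ; assoc = λ i j k → index-cong (G.trans (G.∙-congʳ (element-index _))
            (G.trans (G.assoc _ _ _) (G.∙-congˡ (G.sym (element-index _)))))
          }
        ; identity =
          (λ i → trans (index-cong (G.trans (G.∙-congʳ (element-index _)) (G.identityˡ _))) (index-element i))
                   , (λ i → trans (index-cong (G.trans (G.∙-congˡ (element-index _)) (G.identityʳ _)))
                     (index-element i))
        }
      ; inverse = (λ i → index-cong (G.trans (G.∙-congʳ (element-index _)) (G.inverseˡ _)))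
                , (λ i → index-cong (G.trans (G.∙-congˡ (element-index _)) (G.inverseʳ _)))
      ; ⁻¹-cong = cong (λ i → index (element i G.⁻¹))
      }
    }

  index-∙ : ∀ g h → index (g G.∙ h) ≡ FinGroup._∙_ toFin (index g) (index h)
  index-∙ g h = index-cong (G.∙-cong (G.sym (element-index g)) (G.sym (element-index h)))

ofFin : FinGroup → FiniteGroup 0ℓ 0ℓ
ofFin G = record { group = group ; finite = record { size = order ; enumeration = identity } }
  where
  open FinGroup G
  identity : Inverse (Group.setoid group) (≡.setoid (Fin order))
  identity = record { to = λ i → i ; from = λ i → i ; to-cong = λ eq → eq ; from-cong = λ eq → eq
    ; inverse = (λ eq → eq) , (λ eq → eq) }

members : ∀ {n} → Subset n → List (Fin n)
members Vec.[]            = []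
members (true  Vec.∷ S) = zero ∷ map suc (members S)
members (false Vec.∷ S) = map suc (members S)

length-members : ∀ {n} (S : Subset n) → length (members S) ≡ Subset.∣ S ∣
length-members Vec.[]          = refl
length-members (true  Vec.∷ S) = cong suc (trans (List.length-map suc (members S)) (length-members S))
length-members (false Vec.∷ S) = trans (List.length-map suc (members S)) (length-members S)

∈-members : ∀ {n} {S : Subset n} {i} → i Subset.∈ S → i ∈ members S
∈-members {S = true  Vec.∷ S} {zero}  Vec.here        = here refl
∈-members {S = true  Vec.∷ S} {suc i} (Vec.there i∈S) = there (∈-map⁺ suc (∈-members i∈S))
∈-members {S = false Vec.∷ S} {suc i} (Vec.there i∈S) = ∈-map⁺ suc (∈-members i∈S)

members-∈ : ∀ {n} {S : Subset n} {i} → i ∈ members S → i Subset.∈ S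
members-∈ {S = true  Vec.∷ S} (here refl) = Vec.here
members-∈ {S = true  Vec.∷ S} (there i∈) with ∈-map⁻ suc i∈
... | j , j∈ , refl = Vec.there (members-∈ j∈)
members-∈ {S = false Vec.∷ S} i∈ with ∈-map⁻ suc i∈
... | j , j∈ , refl = Vec.there (members-∈ j∈)

members-unique : ∀ {n} (S : Subset n) → Unique (members S)
members-unique Vec.[]          = []
members-unique (true Vec.∷ S) =
  All.map⁺ (All.universal (λ _ ()) (members S)) ∷ Unique.map⁺ Fin.suc-injective (members-unique S)
members-unique (false Vec.∷ S) = Unique.map⁺ Fin.suc-injective (members-unique S)

_∈ᴸ?_ : ∀ {n} (i : Fin n) L → Dec (i ∈ L)
i ∈ᴸ? L = Any.any? (i Fin.≟_) L

fromList : ∀ {n} → List (Fin n) → Subset n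
fromList L = Vec.tabulate λ i → does (i ∈ᴸ? L)

∈-fromList : ∀ {n} {L : List (Fin n)} {i} → i ∈ L → i Subset.∈ fromList L
∈-fromList {L = L} {i} i∈L = Vec.lookup⇒[]= i (fromList L)
  (trans (Vec.lookup∘tabulate (λ j → does (j ∈ᴸ? L)) i) (dec-true (i ∈ᴸ? L) i∈L))

fromList-∈ : ∀ {n} {L : List (Fin n)} {i} → i Subset.∈ fromList L → i ∈ L
fromList-∈ {L = L} {i} i∈S = decidable-stable (i ∈ᴸ? L) λ i∉L → contradiction
  (trans (sym (dec-false (i ∈ᴸ? L) i∉L)) (trans (sym (Vec.lookup∘tabulate (λ j → does (j ∈ᴸ? L)) i))
    (Vec.[]=⇒lookup i∈S))) λ ()

members-fromList : ∀ {n} {L : List (Fin n)} → Unique L → members (fromList L) ↭ L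
members-fromList {L = L} unique = ∼bag⇒↭ (unique∧set⇒bag (members-unique (fromList L)) unique
  (mk⇔ (λ i∈ → fromList-∈ (members-∈ i∈)) (λ i∈ → ∈-members (∈-fromList i∈))))

module Transport {c ℓ₁ ℓ₂ a ℓ : Level} (Ω : AlgebraicallyClosedField c ℓ₁ ℓ₂) (G : FiniteGroup a ℓ) where
  open Field Ω
  private module G = FiniteGroup G
  open G using (index; element; index-cong)
  open FinGroup (toFin G) using (El; _∙_; ε; _⁻¹; order; group; identityʳ)
  open Eigen Ω (toFin G) using (Function; Act; Eigenvalue; ConnectionList)
  open GroupLemmas (toFin G)
  open Degree Ω (toFin G) using (degree-↭)
  open Backward Ω (toFin G) using (degree-transport)
  open MonoidSum (CommutativeRing.+-commutativeMonoid ringK) using (sum; sum-permute; sum-cong-≋)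

  indicator : Subset order → El → K
  indicator S i = if does (i Subset.∈? S) then 1# else 0#

  list-sum : ∀ {n} → (Fin n → K) → List (Fin n) → K
  list-sum y []      = 0#
  list-sum y (i ∷ L) = y i + list-sum y L

  list-sum-map : ∀ {n} (y : Fin (suc n) → K) L → list-sum y (map suc L) ≡ list-sum (y ∘ suc) L
  list-sum-map y []      = refl
  list-sum-map y (i ∷ L) = cong (y (suc i) +_) (list-sum-map y L)

  sum-members : ∀ {n} (S : Subset n) (y : Fin n → K) →
    sum (λ i → (if does (i Subset.∈? S) then 1# else 0#) * y i) ≈ list-sum y (members S)
  sum-members Vec.[]          y = ≈-refl
  sum-members (true Vec.∷ S) y = +-cong (*-identityˡ (y zero))
    (≈-trans (sum-members S (y ∘ suc)) (reflexive (sym (list-sum-map y (members S)))))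
  sum-members (false Vec.∷ S) y = ≈-trans (+-cong (zeroˡ (y zero)) (sum-members S (y ∘ suc)))
    (≈-trans (+-identityˡ _) (reflexive (sym (list-sum-map y (members S)))))

  list-sum-Act : ∀ L w g → list-sum (λ s → w (s ∙ g)) L ≈ Act L w g
  list-sum-Act []      w g = ≈-refl
  list-sum-Act (s ∷ L) w g = +-congˡ (list-sum-Act L w g)

  module _ (S : Subset order) (conn : IsConnectionSet G S) where
    private
      Γ = Cay G S conn
      A = adjacencyMatrix Ω Γ

    -- Substituting j = s ∙ i in row i of the matrix, the condition that j ∙ i⁻¹ lie in S becomes
    -- that s lie in S.
    adjacency-Act : ∀ w i → sum (λ j → A i j * w j) ≈ Act (members S) w i
    adjacency-Act w i = begin
      sum (λ j → A i j * w j)                                  ≈⟨ sum-permute (λ j → A i j * w j) shift ⟩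
      sum (λ s → A i (s ∙ i) * w (s ∙ i))
        ≈⟨ sum-cong-≋ (λ s → *-congʳ (reflexive (cong (indicator S)
        (trans (index-cong (cancel s)) (index-element G s))))) ⟩
      sum (λ s → indicator S s * w (s ∙ i))                    ≈⟨ sum-members S (λ s → w (s ∙ i)) ⟩
      list-sum (λ s → w (s ∙ i)) (members S)                   ≈⟨ list-sum-Act (members S) w i ⟩
      Act (members S) w i                                      ∎
      where
      open ≈-Reasoning
      shift : Permutation order order
      shift = permutation (_∙ i) (_∙ i ⁻¹) (λ s → free (♯₀ ⊙ inv ♯₁ ⊙ ♯₁) ♯₀ (s ∷ i ∷ []) refl)
        (λ s → free (♯₀ ⊙ ♯₁ ⊙ inv ♯₁) ♯₀ (s ∷ i ∷ []) refl)
      cancel : ∀ s → element (s ∙ i) G.∙ element i G.⁻¹ G.≈ element s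
      cancel s = G.trans (G.∙-congʳ (element-index G _))
        (G.trans (G.assoc _ _ _) (G.trans (G.∙-congˡ (G.inverseʳ _)) (G.identityʳ _)))

    to-eigenvalue : ∀ {μ} → IsEigenvalue Ω Γ μ → Eigenvalue (members S) μ
    to-eigenvalue (x , nz , eig) = x , nz , λ i → ≈-trans (≈-sym (adjacency-Act x i)) (eig i)

    from-eigenvalue : ∀ {μ} → Eigenvalue (members S) μ → IsEigenvalue Ω Γ μ
    from-eigenvalue (x , nz , eig) = x , nz , λ i → ≈-trans (adjacency-Act x i) (eig i)

  connection-list : ∀ S → IsConnectionSet G S → 2 ℕ.≤ Subset.∣ S ∣ → Subset.∣ S ∣ ℕ.≤ 3 → ConnectionList
    (members S)
  connection-list S conn 2≤ ≤3 = record
    { unique = members-unique S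
    ; ε∉     = λ ε∈ → ε∉S (members-∈ ε∈)
    ; closed = λ {s} s∈ → ∈-members (Equivalence.to (S≡S⁻¹ (element s))
      (subst (Subset._∈ S) (sym (index-element G s)) (members-∈ s∈)))
    ; 2≤     = subst (2 ℕ.≤_) (sym (length-members S)) 2≤
    ; ≤3     = subst (ℕ._≤ 3) (sym (length-members S)) ≤3
    }
    where open IsConnectionSet conn

  is-connection-set : ∀ {L} → ConnectionList L → IsConnectionSet G (fromList L)
  is-connection-set {L} list = record
    { ε∉S   = λ ε∈ → ε∉ (fromList-∈ ε∈)
    ; S≡S⁻¹ = λ g → mk⇔ (λ g∈ → ∈-fromList (subst (_∈ L) (index-⁻¹ g) (closed (fromList-∈ g∈))))
        (λ g⁻¹∈ → ∈-fromList (subst (_∈ L) (trans (index-⁻¹ (g G.⁻¹)) (index-cong (⁻¹-involutive g)))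
          (closed (fromList-∈ g⁻¹∈))))
    }
    where
    open ConnectionList list
    open GroupProperties G.group using (⁻¹-involutive)
    index-⁻¹ : ∀ g → index g ⁻¹ ≡ index (g G.⁻¹)
    index-⁻¹ g = index-cong (G.⁻¹-cong (element-index G g))

  𝓑⇒lists : 𝓑 Ω 3 G → ∀ {L} → ConnectionList L → HasDegree Ω (Generated Ω (Eigenvalue L)) 2
  𝓑⇒lists B {L} list = degree-↭ perm (degree-transport (to-eigenvalue S conn) (from-eigenvalue S conn)
      (B S conn (subst (2 ℕ.≤_) size 2≤) (subst (ℕ._≤ 3) size ≤3)))
    where
    open ConnectionList list
    S : Subset order
    S = fromList L
    conn : IsConnectionSet G S
    conn = is-connection-set list
    perm : members S ↭ L
    perm = members-fromList unique
    size : length L ≡ Subset.∣ S ∣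
    size = trans (sym (↭-length perm)) (length-members S)

  lists⇒𝓑 : (∀ {L} → ConnectionList L → HasDegree Ω (Generated Ω (Eigenvalue L)) 2) → 𝓑 Ω 3 G
  lists⇒𝓑 degree-2 S conn 2≤ ≤3 =
    degree-transport (from-eigenvalue S conn) (to-eigenvalue S conn) (degree-2 (connection-list S conn 2≤ ≤3))

-- Isomorphisms of groups

record Iso {a b ℓ₁ ℓ₂} (G : Group a ℓ₁) (H : Group b ℓ₂) : Set (a ⊔ b ⊔ ℓ₁ ⊔ ℓ₂) where
  private
    module G = Group G
    module H = Group H
  field
    f          : G.Carrier → H.Carrier
    f-cong     : ∀ {x y} → x G.≈ y → f x H.≈ f y
    f-∙        : ∀ x y → f (x G.∙ y) H.≈ f x H.∙ f y
    injective  : ∀ {x y} → f x H.≈ f y → x G.≈ y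
    surjective : ∀ y → ∃[ x ] f x H.≈ y

  f-ε : f G.ε H.≈ H.ε
  f-ε = GroupProperties.identityˡ-unique H (f G.ε) (f G.ε)
    (H.trans (H.sym (f-∙ G.ε G.ε)) (f-cong (G.identityˡ G.ε)))

  f-⁻¹ : ∀ x → f (x G.⁻¹) H.≈ f x H.⁻¹
  f-⁻¹ x = GroupProperties.inverseˡ-unique H (f (x G.⁻¹)) (f x)
    (H.trans (H.sym (f-∙ (x G.⁻¹) x)) (H.trans (f-cong (G.inverseˡ x)) f-ε))

  iso : G ≅ H
  iso = f , record
    { isGroupMonomorphism = record
      { isGroupHomomorphism = record
        { isMonoidHomomorphism = record
          { isMagmaHomomorphism = record { isRelHomomorphism = record { cong = f-cong } ; homo = f-∙ }
          ; ε-homo = f-ε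
          }
        ; ⁻¹-homo = f-⁻¹
        }
      ; injective = injective
      }
    ; surjective = λ y → let x , fx≈y = surjective y in x , λ z≈x → H.trans (f-cong z≈x) fx≈y
    }

fromIso : ∀ {a b ℓ₁ ℓ₂} {G : Group a ℓ₁} {H : Group b ℓ₂} → G ≅ H → Iso G H
fromIso {G = G} {H} (f , isIso) = record
  { f = f ; f-cong = ⟦⟧-cong ; f-∙ = ∙-homo ; injective = injective ; surjective = λ y → let x , eq = surjective y in x , eq (Group.refl G) }
  where
  open GroupMorphisms (Group.rawGroup G) (Group.rawGroup H)
  open IsGroupIsomorphism isIso

index-iso : ∀ {a ℓ} (G : FiniteGroup a ℓ) → Iso (FiniteGroup.group G) (FinGroup.group (toFin G))
index-iso G = record
  { f = index ; f-cong = index-cong ; f-∙ = index-∙ G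
  ; injective = λ {x} {y} eq → trans′ (sym′ (element-index G x))
    (trans′ (Inverse.from-cong enumeration eq) (element-index G y))
  ; surjective = λ i → element i , index-element G i
  }
  where open FiniteGroup G using (index; element; index-cong; enumeration) renaming (trans to trans′; sym to sym′)

iso-∘ : ∀ {a b c ℓ₁ ℓ₂ ℓ₃} {G : Group a ℓ₁} {H : Group b ℓ₂} {J : Group c ℓ₃} → Iso G H → Iso H J → Iso G J
iso-∘ {J = J} φ ψ = record
  { f = Ψ.f ∘ Φ.f ; f-cong = Ψ.f-cong ∘ Φ.f-cong ; f-∙ = λ x y → J.trans (Ψ.f-cong (Φ.f-∙ x y)) (Ψ.f-∙ _ _)
  ; injective = Φ.injective ∘ Ψ.injective
  ; surjective = λ z → let y , eq = Ψ.surjective z ; x , eq′ = Φ.surjective y in x , J.trans (Ψ.f-cong eq′) eq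
  }
  where
  module Φ = Iso φ
  module Ψ = Iso ψ
  module J = Group J

iso-⁻¹ : ∀ {a b ℓ₁ ℓ₂} {G : Group a ℓ₁} {H : Group b ℓ₂} → Iso G H → Iso H G
iso-⁻¹ {G = G} {H} φ = record
  { f = g
  ; f-cong = λ {x} {y} eq → injective (H.trans (fg x) (H.trans eq (H.sym (fg y))))
  ; f-∙ = λ x y → injective (H.trans (fg _) (H.trans (H.∙-cong (H.sym (fg x)) (H.sym (fg y)))
    (H.sym (f-∙ _ _))))
  ; injective = λ {x} {y} eq → H.trans (H.sym (fg x)) (H.trans (f-cong eq) (fg y))
  ; surjective = λ x → f x , injective (fg (f x))
  }
  where
  open Iso φ
  module H = Group H
  g : Group.Carrier H → Group.Carrier G
  g y = proj₁ (surjective y)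
  fg : ∀ y → f (g y) H.≈ y
  fg y = proj₂ (surjective y)

module IsoPowers {a ℓ} (G : FinGroup) {H : Group a ℓ} (φ : Iso (FinGroup.group G) H) where
  open FinGroup G
  open Iso φ
  private module H = Group H
  open import Algebra.Definitions.RawMonoid H.rawMonoid using () renaming (_×_ to power)

  f-** : ∀ x k → f (x ** k) H.≈ power k (f x)
  f-** x zero    = f-ε
  f-** x (suc k) = H.trans (f-∙ x (x ** k)) (H.∙-congˡ (f-** x k))

-- Groups of exponent 5 are 5-groups

exponent-toFin : ∀ {a ℓ} (P : FiniteGroup a ℓ) → HasExponent 5 P → ∀ x → FinGroup._**_ (toFin P)
  x 5 ≡ FinGroup.ε (toFin P)
exponent-toFin P exp x = trans (sym (index-element P _))
  (FiniteGroup.index-cong P (FiniteGroup.trans P (f-** x 5) (exp (FiniteGroup.element P x))))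
  where open IsoPowers (toFin P) (iso-⁻¹ (index-iso P))

-- For a prime q ≠ 5 an element with x^q = 1 also has x⁵ = 1 and is trivial, so by McKay's count q
-- does not divide the order.
exponent⇒5-group : ∀ {a ℓ} (P : FiniteGroup a ℓ) → HasExponent 5 P → IsPGroup 5 P
exponent⇒5-group P exp =
  power-of-prime order {{order≢0}} λ q-prime q≢5 → prime-∤-order q-prime (torsion-free q-prime q≢5)
  where
  open FinGroup (toFin P) using (order; _**_; ε; _∙_; identityʳ)
  open McKay (toFin P)
  open Powers (toFin P)
  order≢0 : ℕ.NonZero order
  order≢0 with order | ε
  ... | suc _ | _ = _
  torsion-free : ∀ {q} → Prime q → q ≢ 5 → ∀ x → x ** q ≡ ε → x ≡ ε
  torsion-free {q} q-prime q≢5 x xq with ℕ.<-cmp q 5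
  ... | tri< q<5 _ _ = **-coprime (from-yes (prime? 5)) (ℕ.>-nonZero⁻¹ q {{prime⇒nonZero q-prime}}) q<5 xq
    (exponent-toFin P exp x)
  ... | tri≈ _ q≡5 _ = contradiction q≡5 q≢5
  ... | tri> _ _ 5<q = **-coprime q-prime (ℕ.s≤s ℕ.z≤n) 5<q (exponent-toFin P exp x) xq

lookup-injective : ∀ {a} {A : Set a} {L : List A} → Unique L → ∀ i j → lookup L i ≡ lookup L j → i ≡ j
lookup-injective (x∉ ∷ u) zero    zero    eq = refl
lookup-injective (x∉ ∷ u) zero    (suc j) eq = contradiction eq (All.lookup x∉ (∈-lookup j))
lookup-injective (x∉ ∷ u) (suc i) zero    eq = contradiction (sym eq) (All.lookup x∉ (∈-lookup i))
lookup-injective (x∉ ∷ u) (suc i) (suc j) eq = cong suc (lookup-injective u i j eq)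

-- Splitting off the central involution

module Kernel (G : FinGroup) (central : CentralInvolution G) where
  open FinGroup G
  open CentralInvolution central
  open GroupLemmas G

  sgn-ε : sgn ε ≡ 0ℙ
  sgn-ε = cancel (sgn ε) (trans (sym (sgn-∙ ε ε)) (cong sgn (identityˡ ε)))
    where
    cancel : ∀ p → p +ℙ p ≡ p → p ≡ 0ℙ
    cancel 0ℙ _ = refl

  sgn-⁻¹ : ∀ x → sgn (x ⁻¹) ≡ sgn x
  sgn-⁻¹ x = cancel (sgn (x ⁻¹)) (sgn x) (trans (sym (sgn-∙ (x ⁻¹) x)) (trans (cong sgn (inverseˡ x)) sgn-ε))
    where
    cancel : ∀ p q → p +ℙ q ≡ 0ℙ → p ≡ q
    cancel 0ℙ 0ℙ _ = refl
    cancel 1ℙ 1ℙ _ = refl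

  Even : Set
  Even = Σ[ x ∈ El ] sgn x ≡ 0ℙ

  even-group : Group 0ℓ 0ℓ
  even-group = record
    { Carrier = Even
    ; _≈_     = λ x y → proj₁ x ≡ proj₁ y
    ; _∙_     = λ (x , p) (y , q) → x ∙ y , trans (sgn-∙ x y) (cong₂ _+ℙ_ p q)
    ; ε       = ε , sgn-ε
    ; _⁻¹     = λ (x , p) → x ⁻¹ , trans (sgn-⁻¹ x) p
    ; isGroup = record
      { isMonoid = record
        { isSemigroup = record
          { isMagma = record { isEquivalence = record { refl = refl ; sym = sym ; trans = trans }
            ; ∙-cong = cong₂ _∙_ }
          ; assoc   = λ (x , _) (y , _) (z , _) → assoc x y z
          }
        ; identity = (λ (x , _) → identityˡ x) , (λ (x , _) → identityʳ x)
        }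
      ; inverse = (λ (x , _) → inverseˡ x) , (λ (x , _) → inverseʳ x)
      ; ⁻¹-cong = cong _⁻¹
      }
    }

  even-subset : Subset order
  even-subset = Vec.tabulate λ x → does (sgn x Parity.≟ 0ℙ)

  evens : List El
  evens = members even-subset

  ∈-evens : ∀ {x} → sgn x ≡ 0ℙ → x ∈ evens
  ∈-evens {x} p = ∈-members (Vec.lookup⇒[]= x even-subset
    (trans (Vec.lookup∘tabulate (λ x → does (sgn x Parity.≟ 0ℙ)) x) (dec-true (sgn x Parity.≟ 0ℙ) p)))

  evens-∈ : ∀ {x} → x ∈ evens → sgn x ≡ 0ℙ
  evens-∈ {x} x∈ = decidable-stable (sgn x Parity.≟ 0ℙ) λ p≢ → contradiction
    (trans (sym (dec-false (sgn x Parity.≟ 0ℙ) p≢))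
      (trans (sym (Vec.lookup∘tabulate (λ x → does (sgn x Parity.≟ 0ℙ)) x))
      (Vec.[]=⇒lookup (members-∈ {S = even-subset} x∈)))) λ ()

  position : Even → Fin (length evens)
  position (x , p) = Any.index (∈-evens p)

  lookup-position : ∀ x → lookup evens (position x) ≡ proj₁ x
  lookup-position (x , p) = sym (lookup-index (∈-evens p))

  kernel : FiniteGroup 0ℓ 0ℓ
  kernel = record
    { group  = even-group
    ; finite = record { size = length evens ; enumeration = record
      { to        = position
      ; from      = at
      ; to-cong = λ {x} {y} eq → injective _ _ (trans (lookup-position x)
        (trans eq (sym (lookup-position y))))
      ; from-cong = cong (lookup evens)
      ; inverse = (λ {i} {x} eq → injective _ _ (trans (lookup-position x) eq)) ,
        (λ {x} {i} eq → trans (cong (lookup evens) eq) (lookup-position x))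
      } }
    }
    where
    injective : ∀ i j → lookup evens i ≡ lookup evens j → i ≡ j
    injective = lookup-injective (members-unique even-subset)
    at : Fin (length evens) → Even
    at i = lookup evens i , evens-∈ (∈-lookup i)

  kernel-exponent : HasExponent 5 kernel
  kernel-exponent (x , p) = trans (proj₁-power 5) (exponent-5 x p)
    where
    open import Algebra.Definitions.RawMonoid (Group.rawMonoid even-group) using () renaming (_×_ to power)
    proj₁-power : ∀ k → proj₁ (power k (x , p)) ≡ x ** k
    proj₁-power zero    = refl
    proj₁-power (suc k) = cong (x ∙_) (proj₁-power k)

  twist : Parity → El
  twist 0ℙ = ε
  twist 1ℙ = e

  sgn-twist : ∀ s → sgn (twist s) ≡ s
  sgn-twist 0ℙ = sgn-ε
  sgn-twist 1ℙ = sgn-e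

  p+p : ∀ p → p +ℙ p ≡ 0ℙ
  p+p 0ℙ = refl
  p+p 1ℙ = refl

  twist-∙ : ∀ s t → twist (s +ℙ t) ≡ twist s ∙ twist t
  twist-∙ 0ℙ t  = sym (identityˡ _)
  twist-∙ 1ℙ 0ℙ = sym (identityʳ e)
  twist-∙ 1ℙ 1ℙ = sym e²

  twist-central : ∀ s g → twist s ∙ g ≡ g ∙ twist s
  twist-central 0ℙ g = trans (identityˡ g) (sym (identityʳ g))
  twist-central 1ℙ g = e-central g

  twist² : ∀ s → twist s ∙ twist s ≡ ε
  twist² s = trans (sym (twist-∙ s s)) (cong twist (p+p s))

  untwist : ∀ x s → x ∙ twist s ∙ twist s ≡ x
  untwist x s = trans (assoc x _ _) (trans (cong (x ∙_) (twist² s)) (identityʳ x))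

  -- Multiplying by e exactly the elements of sign 1 moves all of G into the kernel, and centrality
  -- of e makes this multiplicative. The sign remembers what was done.
  splitting : Iso group (even-group ×ᴳ ℤ₂)
  splitting = record
    { f          = λ x → (x ∙ twist (sgn x) , even x) , sgn x
    ; f-cong     = λ { refl → refl , refl }
    ; f-∙        = λ x y → (begin
        x ∙ y ∙ twist (sgn (x ∙ y))
          ≡⟨ cong (x ∙ y ∙_) (trans (cong twist (sgn-∙ x y)) (twist-∙ (sgn x) (sgn y))) ⟩
        x ∙ y ∙ (twist (sgn x) ∙ twist (sgn y))
          ≡⟨ free (♯₀ ⊙ ♯₁ ⊙ (♯₂ ⊙ ♯₃)) (♯₀ ⊙ (♯₁ ⊙ ♯₂) ⊙ ♯₃) (x ∷ y ∷ twist (sgn x) ∷ twist (sgn y) ∷ [])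
          refl ⟩
        x ∙ (y ∙ twist (sgn x)) ∙ twist (sgn y)
          ≡⟨ cong (λ z → x ∙ z ∙ twist (sgn y)) (twist-central (sgn x) y) ⟨
        x ∙ (twist (sgn x) ∙ y) ∙ twist (sgn y)
          ≡⟨ free (♯₀ ⊙ (♯₂ ⊙ ♯₁) ⊙ ♯₃) (♯₀ ⊙ ♯₂ ⊙ (♯₁ ⊙ ♯₃)) (x ∷ y ∷ twist (sgn x) ∷ twist (sgn y) ∷ [])
          refl ⟩
        x ∙ twist (sgn x) ∙ (y ∙ twist (sgn y))       ∎) , sgn-∙ x y
    ; injective = λ {x} {y} (eq , s≡) → trans (sym (untwist x (sgn x)))
      (trans (cong₂ (λ z s → z ∙ twist s) eq s≡) (untwist y (sgn y)))
    ; surjective = λ ((x , p) , s) → x ∙ twist s ,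
      (trans (cong (λ t → x ∙ twist s ∙ twist t) (sgn-lift x p s)) (untwist x s) , sgn-lift x p s)
    }
    where
    open ≡-Reasoning
    even : ∀ x → sgn (x ∙ twist (sgn x)) ≡ 0ℙ
    even x = trans (sgn-∙ x _) (trans (cong (sgn x +ℙ_) (sgn-twist (sgn x))) (p+p (sgn x)))
    sgn-lift : ∀ x → sgn x ≡ 0ℙ → ∀ s → sgn (x ∙ twist s) ≡ s
    sgn-lift x p s = trans (sgn-∙ x (twist s)) (cong₂ _+ℙ_ p (sgn-twist s))

-- Recognition of the dihedral group

module DihedralIso (G : FinGroup) (dihedral : Dihedral G) where
  open FinGroup G
  open Dihedral dihedral renaming (f to τ; r to ρ)
  open GroupLemmas G
  open Powers G
  open D₁₀ using (_+₅_; -₅_; act) renaming (_∙_ to _∙₁₀_)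

  rot : Fin 5 → El
  rot i = ρ ** toℕ i

  ref : Parity → El
  ref s = τ ** [ s ]ᴾ

  embed : D₁₀.Carrier → El
  embed (i , s) = rot i ∙ ref s

  rot-+ : ∀ i j → rot (i +₅ j) ≡ rot i ∙ rot j
  rot-+ i j = trans (cong (ρ **_) (Fin.toℕ-fromℕ< (m%n<n (toℕ i ℕ.+ toℕ j) 5)))
    (trans (sym (**-% (toℕ i ℕ.+ toℕ j) r⁵)) (**-+ ρ (toℕ i) (toℕ j)))

  rot-⁻¹ : ∀ i → rot (-₅ i) ≡ rot i ⁻¹
  rot-⁻¹ i = trans (cong (ρ **_) (Fin.toℕ-fromℕ< (m%n<n (5 ℕ.∸ toℕ i) 5)))
    (trans (sym (**-% (5 ℕ.∸ toℕ i) r⁵))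
    (inverseˡ-unique _ _ (trans (sym (**-+ ρ (5 ℕ.∸ toℕ i) (toℕ i)))
      (trans (cong (ρ **_) (ℕ.m∸n+n≡m (ℕ.<⇒≤ (Fin.toℕ<n i)))) r⁵))))

  ref-rot : ∀ s j → ref s ∙ rot j ≡ rot (act s j) ∙ ref s
  ref-rot 0ℙ j = trans (identityˡ _) (sym (identityʳ _))
  ref-rot 1ℙ j = begin
    τ ∙ ε ∙ rot j              ≡⟨ cong (_∙ rot j) (identityʳ τ) ⟩
    τ ∙ rot j                  ≡⟨ trans (cong (τ ∙ rot j ∙_) f²) (identityʳ _) ⟨
    τ ∙ rot j ∙ (τ ∙ τ)        ≡⟨ assoc (τ ∙ rot j) τ τ ⟨
    τ ∙ rot j ∙ τ ∙ τ          ≡⟨ cong₂ _∙_ (invert-power (toℕ j) f² frf) (sym (identityʳ τ)) ⟩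
    rot j ⁻¹ ∙ (τ ∙ ε)         ≡⟨ cong (_∙ (τ ∙ ε)) (rot-⁻¹ j) ⟨
    rot (-₅ j) ∙ (τ ∙ ε)       ∎
    where open ≡-Reasoning

  ref-+ : ∀ s t → ref (s +ℙ t) ≡ ref s ∙ ref t
  ref-+ 0ℙ t  = sym (identityˡ _)
  ref-+ 1ℙ 0ℙ = sym (identityʳ _)
  ref-+ 1ℙ 1ℙ = trans (sym f²) (sym (cong₂ _∙_ (identityʳ τ) (identityʳ τ)))

  embed-∙ : ∀ x y → embed (x ∙₁₀ y) ≡ embed x ∙ embed y
  embed-∙ (i , s) (j , t) = begin
    rot (i +₅ act s j) ∙ ref (s +ℙ t)               ≡⟨ cong₂ _∙_ (rot-+ i (act s j)) (ref-+ s t) ⟩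
    rot i ∙ rot (act s j) ∙ (ref s ∙ ref t)
      ≡⟨ trans (assoc _ _ _) (cong (rot i ∙_) (sym (assoc _ _ _))) ⟩
    rot i ∙ (rot (act s j) ∙ ref s ∙ ref t)         ≡⟨ cong (λ z → rot i ∙ (z ∙ ref t)) (ref-rot s j) ⟨
    rot i ∙ (ref s ∙ rot j ∙ ref t)
      ≡⟨ trans (cong (rot i ∙_) (assoc _ _ _)) (sym (assoc _ _ _)) ⟩
    rot i ∙ ref s ∙ (rot j ∙ ref t)                 ∎
    where open ≡-Reasoning

  rot-injective : ∀ i j → rot i ≡ rot j → i ≡ j
  rot-injective = Orbits.iter-injective (from-yes (prime? 5)) (ρ ∙_)
    (λ g → trans (free (♯₀ ⊙ (♯₀ ⊙ (♯₀ ⊙ (♯₀ ⊙ (♯₀ ⊙ ♯₁))))) (♯₀ **ʷ 5 ⊙ ♯₁) (ρ ∷ g ∷ []) refl)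
      (trans (cong (_∙ g) r⁵) (identityˡ g)))
    (λ ρε → r≢ε (trans (sym (identityʳ ρ)) ρε))

  open Cyclic5 r⁵

  τ-not-rotation : ¬ Multiple τ
  τ-not-rotation (i , eq) = f≢ε (order-2-and-5 f²
    (trans (cong (_** 5) eq) (trans (**-swap ρ (toℕ i) 5) (trans (cong (_** toℕ i) r⁵) (ε** (toℕ i))))))

  embed-injective : ∀ x y → embed x ≡ embed y → x ≡ y
  embed-injective (i , 0ℙ) (j , 0ℙ) eq = cong (_, 0ℙ) (rot-injective i j (∙-cancelʳ ε _ _ eq))
  embed-injective (i , 1ℙ) (j , 1ℙ) eq = cong (_, 1ℙ) (rot-injective i j (∙-cancelʳ (τ ∙ ε) _ _ eq))
  embed-injective (i , 0ℙ) (j , 1ℙ) eq = contradiction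
    (subst Multiple (trans (cong (rot j ⁻¹ ∙_) (trans (sym (identityʳ _))
    (trans eq (cong (rot j ∙_) (identityʳ τ)))))
    (free (inv ♯₀ ⊙ (♯₀ ⊙ ♯₁)) ♯₁ (rot j ∷ τ ∷ []) refl)) (multiple-∙ (multiple-⁻¹ (j , refl)) (i , refl)))
      τ-not-rotation
  embed-injective (i , 1ℙ) (j , 0ℙ) eq = contradiction
    (subst Multiple (trans (cong (rot i ⁻¹ ∙_) (trans (sym (identityʳ _))
    (trans (sym eq) (cong (rot i ∙_) (identityʳ τ)))))
    (free (inv ♯₀ ⊙ (♯₀ ⊙ ♯₁)) ♯₁ (rot i ∷ τ ∷ []) refl)) (multiple-∙ (multiple-⁻¹ (i , refl)) (j , refl)))
      τ-not-rotation

  embedding : Iso D₁₀ group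
  embedding = record
    { f = embed ; f-cong = cong embed ; f-∙ = embed-∙ ; injective = λ {x} {y} → embed-injective x y
    ; surjective = λ g → let i , s , eq = covered g in (i , s) , sym eq
    }

-- The classified groups are 2-integral

module PullBack {a ℓ} (G : FinGroup) {H : Group a ℓ} (φ : Iso (FinGroup.group G) H) where
  open FinGroup G
  open Iso φ
  open IsoPowers G φ
  private module H = Group H
  open import Algebra.Definitions.RawMonoid H.rawMonoid using () renaming (_×_ to power)

  pull-ε : ∀ {x} → f x H.≈ H.ε → x ≡ ε
  pull-ε eq = injective (H.trans eq (H.sym f-ε))

  pull-power : ∀ {x} → power 5 (f x) H.≈ H.ε → x ** 5 ≡ ε
  pull-power {x} eq = pull-ε (H.trans (f-** x 5) eq)

module Converse {c ℓ₁ ℓ₂} (Ω : AlgebraicallyClosedField c ℓ₁ ℓ₂) (G : FinGroup) where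
  open FinGroup G
  open Eigen Ω G using (ConnectionList; Eigenvalue)
  open Degree Ω G using (central-degree-2; dihedral-degree-2)

  Goal : Set _
  Goal = ∀ {L} → ConnectionList L → HasDegree Ω (Generated Ω (Eigenvalue L)) 2

  from-exponent-5 : (P : FiniteGroup 0ℓ 0ℓ) → HasExponent 5 P → Iso group (FiniteGroup.group P) → Goal
  from-exponent-5 P exp φ = central-degree-2 (identityˡ ε) (λ g → trans (identityˡ g) (sym (identityʳ g)))
    λ g → g , PullBack.pull-power G φ (exp (Iso.f φ g)) , inj₁ refl

  from-product : (P : FiniteGroup 0ℓ 0ℓ) → HasExponent 5 P → Iso group (FiniteGroup.group P ×ᴳ ℤ₂) → Goal
  from-product P exp φ = central-degree-2 e² central cover
    where
    open Iso φ
    module P = FiniteGroup P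
    open import Algebra.Definitions.RawMonoid (Group.rawMonoid (P.group ×ᴳ ℤ₂)) using () renaming
      (_×_ to power)
    open import Algebra.Definitions.RawMonoid P.rawMonoid using () renaming (_×_ to powerᴾ)
    e : El
    e = proj₁ (surjective (P.ε , 1ℙ))
    fe₁ : proj₁ (f e) P.≈ P.ε
    fe₁ = proj₁ (proj₂ (surjective (P.ε , 1ℙ)))
    fe₂ : proj₂ (f e) ≡ 1ℙ
    fe₂ = proj₂ (proj₂ (surjective (P.ε , 1ℙ)))
    e² : e ∙ e ≡ ε
    e² = PullBack.pull-ε G φ (P.trans (proj₁ (f-∙ e e)) (P.trans (P.∙-cong fe₁ fe₁) (P.identityˡ P.ε))
      , trans (proj₂ (f-∙ e e)) (cong₂ _+ℙ_ fe₂ fe₂))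
    central : ∀ g → e ∙ g ≡ g ∙ e
    central g = injective (P.trans (proj₁ (f-∙ e g))
      (P.trans (P.∙-congʳ fe₁) (P.trans (P.identityˡ _)
      (P.sym (P.trans (proj₁ (f-∙ g e)) (P.trans (P.∙-congˡ fe₁) (P.identityʳ _))))))
      , trans (proj₂ (f-∙ e g)) (trans (Parity.+-comm (proj₂ (f e)) (proj₂ (f g))) (sym (proj₂ (f-∙ g e)))))
    power₁ : ∀ k x → proj₁ (power k x) P.≈ powerᴾ k (proj₁ x)
    power₁ zero    x = P.refl
    power₁ (suc k) x = P.∙-congˡ (power₁ k x)
    power₂ : ∀ k x → proj₂ x ≡ 0ℙ → proj₂ (power k x) ≡ 0ℙ
    power₂ zero    x eq = refl
    power₂ (suc k) x eq = cong₂ _+ℙ_ eq (power₂ k x eq)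
    fifth : ∀ g → proj₂ (f g) ≡ 0ℙ → g ** 5 ≡ ε
    fifth g eq = PullBack.pull-power G φ (P.trans (power₁ 5 (f g)) (exp (proj₁ (f g))) , power₂ 5 (f g) eq)
    cover : ∀ g → ∃[ y ] y ** 5 ≡ ε × (g ≡ y ⊎ g ≡ y ∙ e)
    cover g = split (proj₂ (f g)) refl
      where
      split : ∀ s → proj₂ (f g) ≡ s → ∃[ y ] y ** 5 ≡ ε × (g ≡ y ⊎ g ≡ y ∙ e)
      split 0ℙ eq = g , fifth g eq , inj₁ refl
      split 1ℙ eq = g ∙ e , fifth (g ∙ e) (trans (proj₂ (f-∙ g e)) (cong₂ _+ℙ_ eq fe₂))
        , inj₂ (sym (trans (assoc g e e) (trans (cong (g ∙_) e²) (identityʳ g))))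

  from-dihedral : Iso group D₁₀ → Goal
  from-dihedral φ = dihedral-degree-2 record
    { r = r ; f = τ
    ; r≢ε = λ r≡ε → case trans (sym fr) (trans (cong f r≡ε) f-ε) of λ ()
    ; r⁵ = pull-power (cong (power 5) fr)
    ; f≢ε = λ τ≡ε → case trans (sym fτ) (trans (cong f τ≡ε) f-ε) of λ ()
    ; f² = pull-ε (trans (f-∙ τ τ) (cong₂ D₁₀._∙_ fτ fτ))
    ; frf = injective (trans (trans (f-∙ (τ ∙ r) τ)
      (cong₂ D₁₀._∙_ (trans (f-∙ τ r) (cong₂ D₁₀._∙_ fτ fr)) fτ)) (sym (trans (f-⁻¹ r) (cong D₁₀._⁻¹ fr))))
    ; covered = λ g → proj₁ (f g) , proj₂ (f g) , injective (sym (trans (f-∙ (r ** toℕ (proj₁ (f g))) _)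
        (trans (cong₂ D₁₀._∙_ (trans (f-** r (toℕ (proj₁ (f g)))) (cong (power (toℕ (proj₁ (f g)))) fr))
          (trans (f-** τ [ proj₂ (f g) ]ᴾ) (cong (power [ proj₂ (f g) ]ᴾ) fτ)))
          (normal-form (proj₁ (f g)) (proj₂ (f g))))))
    }
    where
    open Iso φ
    open IsoPowers G φ
    open PullBack G φ
    open import Algebra.Definitions.RawMonoid (Group.rawMonoid D₁₀) using () renaming (_×_ to power)
    r τ : El
    r = proj₁ (surjective (suc zero , 0ℙ))
    τ = proj₁ (surjective (zero , 1ℙ))
    fr : f r ≡ (suc zero , 0ℙ)
    fr = proj₂ (surjective (suc zero , 0ℙ))
    fτ : f τ ≡ (zero , 1ℙ)
    fτ = proj₂ (surjective (zero , 1ℙ))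
    normal-form : ∀ i s → power (toℕ i) (suc zero , 0ℙ) D₁₀.∙ power [ s ]ᴾ (zero , 1ℙ) ≡ (i , s)
    normal-form zero 0ℙ = refl
    normal-form zero 1ℙ = refl
    normal-form (suc zero) 0ℙ = refl
    normal-form (suc zero) 1ℙ = refl
    normal-form (suc (suc zero)) 0ℙ = refl
    normal-form (suc (suc zero)) 1ℙ = refl
    normal-form (suc (suc (suc zero))) 0ℙ = refl
    normal-form (suc (suc (suc zero))) 1ℙ = refl
    normal-form (suc (suc (suc (suc zero)))) 0ℙ = refl
    normal-form (suc (suc (suc (suc zero)))) 1ℙ = refl

-- The classification

open FiniteGroup using (group)

theorem6p11 : ∀ {c ℓ₁ ℓ₂ a ℓ : Level} (Ω : AlgebraicallyClosedField c ℓ₁ ℓ₂) (G : FiniteGroup a ℓ) →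
  𝓑 Ω 3 G ⇔
    ( (Σ[ P ∈ FiniteGroup 0ℓ 0ℓ ] IsPGroup 5 P × HasExponent 5 P × group G ≅ group P)
    ⊎ (Σ[ P ∈ FiniteGroup 0ℓ 0ℓ ] IsPGroup 5 P × HasExponent 5 P × group G ≅ (group P ×ᴳ ℤ₂))
    ⊎ group G ≅ D₁₀ )
theorem6p11 Ω G = mk⇔ forward backward
  where
  open Transport Ω G
  Classified : Set _
  Classified = (Σ[ P ∈ FiniteGroup 0ℓ 0ℓ ] IsPGroup 5 P × HasExponent 5 P × group G ≅ group P)
    ⊎ (Σ[ P ∈ FiniteGroup 0ℓ 0ℓ ] IsPGroup 5 P × HasExponent 5 P × group G ≅ (group P ×ᴳ ℤ₂))
    ⊎ group G ≅ D₁₀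
  forward : 𝓑 Ω 3 G → Classified
  forward B = split (trichotomy (toFin G) (Forward.restricted Ω (toFin G) (𝓑⇒lists B)))
    where
    split : (∀ x → FinGroup._**_ (toFin G) x 5 ≡ FinGroup.ε (toFin G)) ⊎ CentralInvolution (toFin G)
      ⊎ Dihedral (toFin G) → Classified
    -- P is the copy of G on indices, because P has to live at level zero whereas G may not.
    split (inj₁ exp) =
      inj₁ (ofFin (toFin G) , exponent⇒5-group (ofFin (toFin G)) exp , exp , Iso.iso (index-iso G))
    split (inj₂ (inj₁ central)) = inj₂ (inj₁ (kernel , exponent⇒5-group kernel kernel-exponent
      , kernel-exponent , Iso.iso (iso-∘ (index-iso G) splitting)))
      where open Kernel (toFin G) central
    split (inj₂ (inj₂ dihedral)) =
      inj₂ (inj₂ (Iso.iso (iso-∘ (index-iso G) (iso-⁻¹ (DihedralIso.embedding (toFin G) dihedral)))))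
  backward : Classified → 𝓑 Ω 3 G
  backward (inj₁ (P , _ , exp , φ)) =
    lists⇒𝓑 (from-exponent-5 P exp (iso-∘ (iso-⁻¹ (index-iso G)) (fromIso φ)))
    where open Converse Ω (toFin G)
  backward (inj₂ (inj₁ (P , _ , exp , φ))) =
    lists⇒𝓑 (from-product P exp (iso-∘ (iso-⁻¹ (index-iso G)) (fromIso φ)))
    where open Converse Ω (toFin G)
  backward (inj₂ (inj₂ φ)) = lists⇒𝓑 (from-dihedral (iso-∘ (iso-⁻¹ (index-iso G)) (fromIso φ)))
    where open Converse Ω (toFin G)
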